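{- For every $\alpha>0$ there is a $\Delta>0$ such that the following holds for every $I\ge1$, every integer $C\geq 1$, every Boolean function $f:\mathcal X\times\mathcal Y\to\{0,1\}$ on finite sets and every protocol distribution $p(xym)$ with $m=(m_0,m_1,\dots,m_C)$. If $\mathsf M_I(p,f)\le\alpha I$, $\mu(xy)=p(xy)$, and $m_2,\dots,m_C\in\{0,1\}$, then $$\mathsf{adv}_\mu\big(\Delta(I+\sqrt{CI}\log(CI)),\,f\big)\ \ge\ 1/\Delta.$$
   Context: All sets are finite, $xy$ means $(x,y)$, logs are base 2. For joint distributions we write e.g. $q(xy|m)$, $q(x|ym)$ for conditionals, $p(xy)$ for marginals. Protocol distribution: a distribution $p(xym)$ on inputs $xy$ and $m=(m_0,m_1,\dots,m_C)$, where $m_0$ is the public randomness and $m_1,\dots,m_C$ are the messages (odd ones sent by Alice, even ones by Bob), such that $$p(xym)=p(xy)\cdot p(m_0)\cdot\prod_{i=1,3,5,\dots}p(m_i|xm_{<i})\cdot p(m_{i+1}|ym_{\le i}).$$ A distribution $q(xym)$ is rectangular with respect to $\mu(xy)$ if $q(xym)=\mu(xy)\cdot A(xm)\cdot B(ym)$ for some functions $A,B$. Marginal information: for $I\ge1$, $\delta=1/15$, $$\mathsf M_I(p,f)=\inf_q\sup_{xym}\log\Big(\frac{q(x|ym)}{p(x|y)}\cdot\frac{q(y|xm)}{p(y|x)}\cdot\Big(\frac{q(xym)}{p(xym)}\Big)^I\cdot\Big|\mathbb E_{q(xy|m)}[(-1)^{f(xy)}]\Big|^{ -12I/\delta}\Big),$$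 infimum over distributions $q$ rectangular with respect to $p(xy)$, supremum over $xym$ in the support of $q$ (division by $0$, or a negative power of $0$, is read as $+\infty$). A randomized two-party communication protocol $\pi$: Alice receives $x$, Bob receives $y$, they have public and private randomness and exchange bits; the output $\pi(xy)$ is determined by the transcript and the public randomness; $\|\pi\|$ is the maximum number of bits exchanged (public randomness not counted). For a distribution $\mu(xy)$ on inputs, $$\mathsf{adv}_\mu(T,f)=\sup_{\|\pi\|\le T}\mathbb E\big[(-1)^{\pi(xy)+f(xy)}\big],$$ the expectation being over $xy\sim\mu$ and the randomness of $\pi$. -}

module Defs where

open import Algebra.Bundles using (CommutativeRing; Semiring)
open import Algebra.Structures using (IsCommutativeRing)
import Algebra.Definitions.RawSemiring as RawSemiringDefinitions
import Algebra.Properties.Semiring.Sum as SemiringSum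
open import Axiom.ExcludedMiddle using (ExcludedMiddle)
open import Data.Bool.Base using (Bool; true; false; if_then_else_; _∧_; _xor_)
open import Data.Fin.Base as Fin using (Fin; toℕ)
open import Data.Fin.Properties using (_≟_)
open import Data.Nat.Base as ℕ using (ℕ; zero; suc; _≡ᵇ_; _%_)
open import Data.Product.Base using (Σ; ∃; _×_; _,_; proj₁)
open import Data.Sum.Base using (_⊎_; inj₁; inj₂)
open import Data.Vec.Base using (Vec; []; _∷_)
import Data.Vec.Functional as Vector
open import Data.Vec.Relation.Unary.All using (All; []; _∷_)
open import Function.Base using (_∘_)
open import Level using (0ℓ)
import Relation.Binary.Construct.Add.Extrema.NonStrict as ExtremaOrder
import Relation.Binary.Construct.NonStrictToStrict as NonStrictToStrict
open import Relation.Binary.Core using (Rel)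
open import Relation.Binary.PropositionalEquality.Core using (_≡_; _≢_)
open import Relation.Binary.Structures using (IsTotalOrder)
open import Relation.Nullary.Construct.Add.Extrema using (_±; ⊥±; [_]; ⊤±)
open import Relation.Nullary.Decidable.Core using (yes; no; ⌊_⌋)
open import Relation.Unary using (Pred; Satisfiable)

UpperBound LowerBound : {A : Set} → Rel A 0ℓ → Pred A 0ℓ → Pred A 0ℓ
UpperBound _≤_ S b = ∀ x → S x → x ≤ b
LowerBound _≤_ S b = ∀ x → S x → b ≤ x

IsSupremum : {A : Set} → Rel A 0ℓ → Pred A 0ℓ → Pred A 0ℓ
IsSupremum _≤_ S s = UpperBound _≤_ S s × LowerBound _≤_ (UpperBound _≤_ S) s

-- The real numbers, characterised up to isomorphism as the
-- Dedekind-complete ordered field.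
record RealNumbers : Set₁ where
  infix  8 -_
  infix  9 _⁻¹
  infixl 7 _*_ _/_
  infixl 6 _+_
  infix  4 _≤_
  field
    ℝ                 : Set
    _+_ _*_           : ℝ → ℝ → ℝ
    -_                : ℝ → ℝ
    0ℝ 1ℝ             : ℝ
    isCommutativeRing : IsCommutativeRing _≡_ _+_ _*_ -_ 0ℝ 1ℝ
    1≢0               : 1ℝ ≢ 0ℝ
    _⁻¹               : ℝ → ℝ
    *-inverseʳ        : ∀ x → x ≢ 0ℝ → x * x ⁻¹ ≡ 1ℝ
    0⁻¹≡0             : 0ℝ ⁻¹ ≡ 0ℝ
    _≤_               : Rel ℝ 0ℓ
    isTotalOrder      : IsTotalOrder _≡_ _≤_
    +-monoˡ-≤         : ∀ z {x y} → x ≤ y → x + z ≤ y + z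
    *-nonNegative     : ∀ {x y} → 0ℝ ≤ x → 0ℝ ≤ y → 0ℝ ≤ x * y
    complete          : ∀ (S : Pred ℝ 0ℓ) → Satisfiable S →
                        Satisfiable (UpperBound _≤_ S) →
                        ∃ (IsSupremum _≤_ S)

  commutativeRing : CommutativeRing 0ℓ 0ℓ
  commutativeRing = record { isCommutativeRing = isCommutativeRing }

  open NonStrictToStrict _≡_ _≤_ public using (_<_)

  _/_ : ℝ → ℝ → ℝ
  x / y = x * y ⁻¹

module RealAnalysis (lem : ExcludedMiddle 0ℓ) (R : RealNumbers) where

  open RealNumbers R public
  open CommutativeRing commutativeRing public using (semiring; _-_)
  open RawSemiringDefinitions (Semiring.rawSemiring semiring) public
    using (product; _^_) renaming (_×_ to _·_)
  open SemiringSum semiring public using (sum; sum-syntax)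
  open ExtremaOrder _≤_ public using (_≤±_)

  fromℕ : ℕ → ℝ
  fromℕ n = n · 1ℝ

  ∣_∣ : ℝ → ℝ
  ∣ x ∣ with IsTotalOrder.total isTotalOrder 0ℝ x
  ... | inj₁ _ = x
  ... | inj₂ _ = - x

  -- Sets that are empty or unbounded above are sent to 0.
  sup : Pred ℝ 0ℓ → ℝ
  sup S with lem {Satisfiable S × Satisfiable (UpperBound _≤_ S)}
  ... | yes (nonempty , bounded) = proj₁ (complete S nonempty bounded)
  ... | no  _                    = 0ℝ

  -- Suprema and infima in the extended reals ℝ ± = ℝ ∪ {⊥±, ⊤±}, where ⊥± is
  -- -∞ and ⊤± is +∞.
  sup± : Pred (ℝ ±) 0ℓ → ℝ ±
  sup± S with lem {∃ λ b → UpperBound _≤±_ S [ b ]}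
  ... | no  _ = ⊤±
  ... | yes _ with lem {∃ λ x → S [ x ]}
  ...   | no  _ = ⊥±
  ...   | yes _ = [ sup (λ x → S [ x ]) ]

  inf± : Pred (ℝ ±) 0ℓ → ℝ ±
  inf± S = sup± (LowerBound _≤±_ S)

  √_ : ℝ → ℝ
  √ x = sup λ t → t * t ≤ x

  -- For x > 0: the supremum of the rationals (a - b) / d such that
  -- 2 ^ ((a - b) / d) ≤ x.
  log₂ : ℝ → ℝ
  log₂ x = sup λ r → Σ ℕ λ a → Σ ℕ λ b → Σ ℕ λ c →
    fromℕ 2 ^ a ≤ fromℕ 2 ^ b * x ^ suc c ×
    r ≡ (fromℕ a - fromℕ b) / fromℕ (suc c)

  exp₂ : ℝ → ℝ
  exp₂ x = sup λ t → 0ℝ < t × log₂ t ≤ x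

  -- Real powers of a positive base.
  pow : ℝ → ℝ → ℝ
  pow x y = exp₂ (y * log₂ x)

module Communication (lem : ExcludedMiddle 0ℓ) (R : RealNumbers) where

  open RealAnalysis lem R public

  -- All Fin ks is the set of tuples (m₀, …, mₙ₋₁) with mᵢ ∈ Fin kᵢ.
  Joint : ℕ → ℕ → ∀ {n} → Vec ℕ n → Set
  Joint X Y ks = Fin X → Fin Y → All Fin ks → ℝ

  sumAll : ∀ {n} (ks : Vec ℕ n) → (All Fin ks → ℝ) → ℝ
  sumAll []       g = g []
  sumAll (k ∷ ks) g = sum {k} λ a → sumAll ks λ m → g (a ∷ m)

  -- (-1)ᵇ
  sign : Bool → ℝ
  sign false = 1ℝ
  sign true  = - 1ℝ

  IsProbability : ∀ {n} → (Fin n → ℝ) → Set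
  IsProbability ρ = (∀ i → 0ℝ ≤ ρ i) × sum ρ ≡ 1ℝ

  -- A conditional probability given a null event has value 0, as x / 0 = 0.
  module Probabilities {X Y n : ℕ} {ks : Vec ℕ n} (p : Joint X Y ks) where

    IsDistribution : Set
    IsDistribution =
      (∀ x y m → 0ℝ ≤ p x y m) ×
      (∑[ x < X ] ∑[ y < Y ] sumAll ks (p x y)) ≡ 1ℝ

    p[xy] : Fin X → Fin Y → ℝ
    p[xy] x y = sumAll ks (p x y)

    p[x|y] p[y|x] : Fin X → Fin Y → ℝ
    p[x|y] x y = p[xy] x y / (∑[ x′ < X ] p[xy] x′ y)
    p[y|x] x y = p[xy] x y / (∑[ y′ < Y ] p[xy] x y′)

    p[x|ym] p[y|xm] p[xy|m] : Fin X → Fin Y → All Fin ks → ℝ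
    p[x|ym] x y m = p x y m / (∑[ x′ < X ] p x′ y m)
    p[y|xm] x y m = p x y m / (∑[ y′ < Y ] p x y′ m)
    p[xy|m] x y m = p x y m / (∑[ x′ < X ] ∑[ y′ < Y ] p x′ y′ m)

    -- E_{p(xy|m)} [ (-1)^f(xy) ]
    bias : (Fin X → Fin Y → Bool) → All Fin ks → ℝ
    bias f m = ∑[ x < X ] ∑[ y < Y ] (p[xy|m] x y m * sign (f x y))

  -- Whether m and m′ agree in their first i coordinates.
  agree : ∀ {n} {ks : Vec ℕ n} → ℕ → All Fin ks → All Fin ks → Bool
  agree zero    _       _         = true
  agree (suc i) []      []        = true
  agree (suc i) (a ∷ m) (a′ ∷ m′) = ⌊ a ≟ a′ ⌋ ∧ agree i m m′

  module Prefixes {X Y n : ℕ} {ks : Vec ℕ n} (p : Joint X Y ks) where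

    p[xym<_] : ℕ → Fin X → Fin Y → All Fin ks → ℝ
    p[xym< i ] x y m = sumAll ks λ m′ → if agree i m m′ then p x y m′ else 0ℝ

    p[xm<_] : ℕ → Fin X → All Fin ks → ℝ
    p[xm< i ] x m = ∑[ y < Y ] p[xym< i ] x y m

    p[ym<_] : ℕ → Fin Y → All Fin ks → ℝ
    p[ym< i ] y m = ∑[ x < X ] p[xym< i ] x y m

    p[m₀] : All Fin ks → ℝ
    p[m₀] m = ∑[ x < X ] ∑[ y < Y ] p[xym< 1 ] x y m

    -- p(mᵢ | x m_{<i}) and p(mᵢ | y m_{<i})
    p[m_|x] : ℕ → Fin X → All Fin ks → ℝ
    p[m i |x] x m = p[xm< suc i ] x m / p[xm< i ] x m

    p[m_|y] : ℕ → Fin Y → All Fin ks → ℝ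
    p[m i |y] y m = p[ym< suc i ] y m / p[ym< i ] y m

  -- Messages with odd index are sent by Alice. The value of the conditionals
  -- given null events is immaterial: the factorisation below holds exactly
  -- when it holds for some choice of genuine probability distributions there.
  -- Indeed any such choice makes the right-hand side a distribution that
  -- agrees with p wherever all conditionals are defined, while p = 0 elsewhere.
  record IsProtocolDistribution {X Y C : ℕ} {ks : Vec ℕ (suc C)}
                                (p : Joint X Y ks) : Set where
    open Probabilities p
    open Prefixes p
    field
      isDistribution : IsDistribution
      factorisation  : ∀ x y m →
        p x y m ≡ p[xy] x y * p[m₀] m * product {C} λ j →
          let i = suc (toℕ j) in
          if i % 2 ≡ᵇ 1 then p[m i |x] x m else p[m i |y] y m

  Rectangular : ∀ {X Y n} {ks : Vec ℕ n} →
                Joint X Y ks → (Fin X → Fin Y → ℝ) → Set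
  Rectangular {X} {Y} {ks = ks} q μ =
    Σ (Fin X → All Fin ks → ℝ) λ A → Σ (Fin Y → All Fin ks → ℝ) λ B →
    ∀ x y m → q x y m ≡ μ x y * A x m * B y m

  module MarginalInformation
    {X Y n : ℕ} {ks : Vec ℕ n} (I : ℝ) (p : Joint X Y ks)
    (f : Fin X → Fin Y → Bool) where

    open Probabilities

    δ : ℝ
    δ = 1ℝ / fromℕ 15

    -- The first case collects the divisions by 0 and the negative power of 0.
    logRatio : Joint X Y ks → Fin X → Fin Y → All Fin ks → ℝ ±
    logRatio q x y m
      with lem { p[x|y] p x y ≡ 0ℝ ⊎ p[y|x] p x y ≡ 0ℝ ⊎
                 p x y m ≡ 0ℝ ⊎ bias q f m ≡ 0ℝ }
    ... | yes _ = ⊤±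
    ... | no  _ = [ log₂ ( p[x|ym] q x y m / p[x|y] p x y
                         * (p[y|xm] q x y m / p[y|x] p x y)
                         * pow (q x y m / p x y m) I
                         * pow ∣ bias q f m ∣ (- (fromℕ 12 * I / δ)) ) ]

    cost : Joint X Y ks → ℝ ±
    cost q = sup± λ v → Σ (Fin X) λ x → Σ (Fin Y) λ y → Σ (All Fin ks) λ m →
      0ℝ < q x y m × v ≡ logRatio q x y m

    marginalInformation : ℝ ±
    marginalInformation = inf± λ v → Σ (Joint X Y ks) λ q →
      IsDistribution q × Rectangular q (p[xy] p) × v ≡ cost q

  open MarginalInformation public using () renaming (marginalInformation to M)

  -- Deterministic protocol trees on Alice's data A and Bob's data B; an inner
  -- node is labelled by the player who sends the next bit.
  data Tree (A B : Set) : Set where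
    output : Bool → Tree A B
    alice  : (A → Bool) → (Bool → Tree A B) → Tree A B
    bob    : (B → Bool) → (Bool → Tree A B) → Tree A B

  run : ∀ {A B} → Tree A B → A → B → Bool
  run (output b)  _ _ = b
  run (alice s t) a b = run (t (s a)) a b
  run (bob s t)   a b = run (t (s b)) a b

  depth : ∀ {A B} → Tree A B → ℕ
  depth (output _)  = 0
  depth (alice _ t) = suc (depth (t false) ℕ.⊔ depth (t true))
  depth (bob _ t)   = suc (depth (t false) ℕ.⊔ depth (t true))

  -- The public string selects a tree, which may depend on the inputs and on
  -- the players' independent private strings only through the bits sent.
  record Protocol (X Y : ℕ) : Set where
    field
      {publics privatesA privatesB} : ℕ
      public-pr       : Fin publics → ℝ
      privateA-pr     : Fin privatesA → ℝ
      privateB-pr     : Fin privatesB → ℝ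
      isProb-public   : IsProbability public-pr
      isProb-privateA : IsProbability privateA-pr
      isProb-privateB : IsProbability privateB-pr
      tree : Fin publics → Tree (Fin X × Fin privatesA) (Fin Y × Fin privatesB)

    ‖_‖ : ℕ
    ‖_‖ = Vector.foldr ℕ._⊔_ 0 (depth ∘ tree)

    -- E [ (-1)^(π(xy) + f(xy)) ]
    advantage : (Fin X → Fin Y → ℝ) → (Fin X → Fin Y → Bool) → ℝ
    advantage μ f =
      ∑[ x < X ] ∑[ y < Y ] ∑[ r < publics ] ∑[ a < privatesA ] ∑[ b < privatesB ]
        (μ x y * public-pr r * privateA-pr a * privateB-pr b
          * sign (run (tree r) (x , a) (y , b) xor f x y))

  open Protocol public using (‖_‖; advantage)

  adv : ∀ {X Y} → (Fin X → Fin Y → ℝ) → ℝ → (Fin X → Fin Y → Bool) → ℝ ±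
  adv {X} {Y} μ T f = sup± λ v → Σ (Protocol X Y) λ π →
    fromℕ ‖ π ‖ ≤ T × v ≡ [ advantage π μ f ]

-- Let q be nearly optimal for M I p f. If the players exchange a transcript m of
-- p and accept it with probability proportional to q / p, a product of a part
-- known to Alice and one known to Bob, then accepted transcripts follow q, and
-- guessing the sign of the bias of f under q given m gives an advantage. No
-- transcript is exchanged: the bits are drawn from shared thresholds, each
-- player predicting the bits of the other from q. The information terms of M
-- and Pinsker's inequality bound the expected number of wrong predictions by
-- O(√(C I)), and a binary search with noisy one-bit hash comparisons finds each
-- of them with O(log C) bits. The unbounded message m₁ is named by a hash of
-- O(I) bits. The remaining failures cost nothing in expectation: the players
-- xor random signs of their views into the output, which cancel wherever the
-- views differ. Finally the public randomness is fixed.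

module Submission where

open import Algebra.Bundles using (CommutativeRing)
import Algebra.Properties.Ring as RingProperties
import Algebra.Properties.Semiring.Exp as SemiringExp
import Algebra.Properties.Semiring.Mult as SemiringMult
import Algebra.Solver.Ring as RingSolver
open import Algebra.Solver.Ring.AlmostCommutativeRing using (AlmostCommutativeRing; _-Raw-AlmostCommutative⟶_; fromCommutativeRing)
open import Data.Bool.Base using (Bool; _xor_; _∧_; false; if_then_else_; not; true)
open import Data.Bool.Properties using (xor-comm; xor-same)
open import Data.Empty using (⊥-elim)
open import Data.Fin.Base as Fin using (Fin; fromℕ<; suc; toℕ; zero)
import Data.Fin.Properties as Fin
open import Data.Integer.Base as ℤ using (-[1+_]; ℤ) renaming (+_ to pos)
import Data.Integer.Properties as ℤ
open import Data.List.Base as List using (List; []; _++_; _∷_; allFin; concatMap; length)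
open import Data.List.Membership.Propositional using (_∈_; lose)
open import Data.List.Membership.Propositional.Properties using (∈-++⁺ʳ; ∈-++⁺ˡ; ∈-allFin; ∈-concatMap⁺; ∈-map⁺)
open import Data.List.Relation.Unary.Any using (here; there)
open import Data.Maybe.Base using (Maybe; just; maybe′; nothing)
open import Data.Maybe.Properties using (just-injective)
open import Data.Nat.Base as ℕ using (_%_; _≡ᵇ_; suc; s≤s; zero; z≤n; ℕ)
open import Data.Nat.Logarithm using (⌈log₂2^n⌉≡n; ⌈log₂_⌉; ⌈log₂⌉-mono-≤)
import Data.Nat.Properties as ℕ
open import Data.Product.Base using (_,_; _×_; proj₁; proj₂; Σ; ∃)
open import Data.Sum.Base using (_⊎_; inj₁; inj₂)
open import Data.Vec.Base as Vec using (Vec; []; _∷_; lookup; replicate)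
open import Data.Vec.Relation.Unary.All as All using (All; []; _∷_)
open import Function.Base using (_∘_; case_of_; id)
open import Relation.Binary.Bundles using (Poset)
import Relation.Binary.Construct.Add.Extrema.NonStrict as ExtremaOrder
open import Relation.Binary.PropositionalEquality using (_≡_; _≢_; cong; cong₂; module ≡-Reasoning; refl; subst; subst₂; sym; trans)
import Relation.Binary.Reasoning.PartialOrder as PosetReasoning
open import Relation.Binary.Structures using (IsTotalOrder)
open import Relation.Nullary using (Dec; contradiction; no; yes; ¬_)
open import Relation.Nullary.Construct.Add.Extrema using ([_]; _±; ⊤±; ⊥±)
open import Relation.Nullary.Decidable using (⌊_⌋)
open import Relation.Unary using (Pred; Satisfiable)
open import Axiom.ExcludedMiddle using (ExcludedMiddle)
open import Defs
open import Level using (0ℓ)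

-- A transcript is produced only with a probability of order `c`, a constant depending on α, so
-- errors of constant probability must not count against the advantage. They do not, because runs in
-- which the two views coincide are never wrong: the history is then the one that the speakers' own
-- bits form. Hence each transcript appears with probability at most `c` times its probability under
-- q, and only the shortfall has to be bounded, in the mean under q rather than under p (`payoff≥`).
-- There every factor of M has a nonnegative mean logarithm, hence a budget of α₂ I; the factors
-- whose exponent is at least I, those of q/p and of the bias, even have a constant budget. Mistakes
-- are deviations of bit probabilities. Pinsker enters in the linear form `deviation≤` with one
-- parameter k for all nodes, so that the chain rule can sum it along the history; k = √(I/C) then
-- gives O(√(C I)) mistakes. A constant bound on the mean of -ln |bias| yields a constant mean bias
-- by Jensen, and the accuracy θ is a fixed fraction of that.

-- Combinatorics of the search for wrong predictions

module Search where

  open import Data.Bool.Base using (Bool; true; false; if_then_else_; not; _∧_; _xor_)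
  open import Data.Bool.Properties using (∧-zeroʳ; xor-identityʳ; xor-same)
  open import Data.List.Base using (List; []; _∷_)
  open import Data.Nat.Base
  open import Data.Nat.Logarithm using (⌈log₂_⌉; ⌈log₂⌉-mono-≤; ⌈log₂⌈n/2⌉⌉≡⌈log₂n⌉∸1)
  open import Data.Nat.Properties
  open import Data.Product.Base using (_×_; _,_; proj₁; proj₂)
  open import Data.Vec.Base as Vec using (Vec; []; _∷_)
  open import Function.Base using (_∘_)
  open import Relation.Binary.PropositionalEquality using (_≡_; _≢_; refl; sym; trans; cong; cong₂; subst)
  open import Relation.Nullary using (¬_; yes; no; contradiction)

  private variable
    n : ℕ

  -- What a player does after each history: her next bit where she speaks, and
  -- her guess of the next bit where the other player speaks.
  data Strategy : ℕ → Set where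
    end  : Strategy 0
    node : Bool → (Bool → Strategy n) → Strategy (suc n)

  -- The history a player imagines; the flags mark the positions at which her
  -- guesses have to be reversed.
  path : Vec Bool n → Strategy n → Vec Bool n → Vec Bool n
  path []       end        []       = []
  path (o ∷ os) (node g s) (f ∷ fs) = let b = g xor (not o ∧ f) in b ∷ path os (s b) fs

  pathᴬ pathᴮ : Vec Bool n → Strategy n → Vec Bool n → Vec Bool n
  pathᴬ = path
  pathᴮ = path ∘ Vec.map not

  truth : Vec Bool n → Strategy n → Strategy n → Vec Bool n
  truth []       end        end          = []
  truth (o ∷ os) (node g s) (node g′ s′) = let b = if o then g else g′ in b ∷ truth os (s b) (s′ b)

  mistakes : Vec Bool n → Strategy n → Strategy n → ℕ
  mistakes []       end        end          = 0
  mistakes (o ∷ os) (node g s) (node g′ s′) = let b = if o then g else g′ in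
    (if g xor g′ then 1 else 0) + mistakes os (s b) (s′ b)

  agreement : Vec Bool n → Vec Bool n → ℕ
  agreement []       []       = 0
  agreement (a ∷ as) (b ∷ bs) = if a xor b then 0 else suc (agreement as bs)

  xor≡false⇒≡ : ∀ a b → a xor b ≡ false → a ≡ b
  xor≡false⇒≡ true  true  _ = refl
  xor≡false⇒≡ false false _ = refl

  agreement≤n : ∀ (as bs : Vec Bool n) → agreement as bs ≤ n
  agreement≤n []       []       = z≤n
  agreement≤n (a ∷ as) (b ∷ bs) with a xor b
  ... | true  = z≤n
  ... | false = s≤s (agreement≤n as bs)

  agreement-full : ∀ (as bs : Vec Bool n) → n ≤ agreement as bs → as ≡ bs
  agreement-full []       []       _ = refl
  agreement-full (a ∷ as) (b ∷ bs) p with a xor b in eq | p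
  ... | false | s≤s p = cong₂ _∷_ (xor≡false⇒≡ a b eq) (agreement-full as bs p)

  -- Prefixes are padded with `false` rather than cut off, so that prefixes of all lengths lie in
  -- one type and can be hashed with one kind of key.
  mask : ℕ → Vec Bool n → Vec Bool n
  mask zero    _        = Vec.replicate _ false
  mask (suc k) []       = []
  mask (suc k) (a ∷ as) = a ∷ mask k as

  mask-agree : ∀ k (as bs : Vec Bool n) → k ≤ agreement as bs → mask k as ≡ mask k bs
  mask-agree zero    as       bs       _ = refl
  mask-agree (suc k) []       []       _ = refl
  mask-agree (suc k) (a ∷ as) (b ∷ bs) p with a xor b in eq | p
  ... | false | s≤s p = cong₂ _∷_ (xor≡false⇒≡ a b eq) (mask-agree k as bs p)

  mask-differ : ∀ k (as bs : Vec Bool n) → agreement as bs < n → agreement as bs < k → mask k as ≢ mask k bs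
  mask-differ (suc k) (a ∷ as) (b ∷ bs) p q eq with a xor b in ab | p | q
  ... | false | s≤s p | s≤s q = mask-differ k as bs p q (cong Vec.tail eq)
  ... | true  | _     | _     = contradiction (trans (sym ab) (trans (cong (_xor b) (cong Vec.head eq)) (xor-same b))) λ ()

  flagAt : ℕ → Vec Bool n → Bool
  flagAt _       []       = false
  flagAt zero    (f ∷ fs) = f
  flagAt (suc i) (f ∷ fs) = flagAt i fs

  -- A reversal moves the listener to another branch of the strategy, where later flags, set for the
  -- old branch, have lost their meaning; they are cleared.
  reverseAt : ℕ → Vec Bool n → Vec Bool n
  reverseAt _       []       = []
  reverseAt zero    (f ∷ fs) = not f ∷ Vec.replicate _ false
  reverseAt (suc i) (f ∷ fs) = f ∷ reverseAt i fs

  reverseAt-beyond : ∀ j (fs : Vec Bool n) → n ≤ j → reverseAt j fs ≡ fs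
  reverseAt-beyond j       []       _       = refl
  reverseAt-beyond (suc j) (f ∷ fs) (s≤s p) = cong (f ∷_) (reverseAt-beyond j fs p)

  flagAt-replicate : ∀ i n → flagAt i (Vec.replicate n false) ≡ false
  flagAt-replicate i       zero    = refl
  flagAt-replicate zero    (suc n) = refl
  flagAt-replicate (suc i) (suc n) = flagAt-replicate i n

  agreed : Vec Bool n → Strategy n → Strategy n → Vec Bool n → ℕ
  agreed os s t fs = agreement (pathᴬ os s fs) (pathᴮ os t fs)

  -- The mistakes on the true history from the first disagreement on.
  remaining : Vec Bool n → Strategy n → Strategy n → Vec Bool n → ℕ
  remaining []       end        end          []       = 0
  remaining (o ∷ os) (node g s) (node g′ s′) (f ∷ fs) =
    let a = g xor (not o ∧ f) ; b = g′ xor (not (not o) ∧ f) in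
    if a xor b then mistakes (o ∷ os) (node g s) (node g′ s′) else remaining os (s a) (s′ b) fs

  -- Up to and including the first disagreement the histories do not see a flag behind it, so a
  -- reversal made too far along by mistake does no lasting damage.
  agreed-reverse-late : ∀ (os : Vec Bool n) s t fs {j} → agreed os s t fs < j →
    agreed os s t (reverseAt j fs) ≡ agreed os s t fs ×
    flagAt (agreed os s t fs) (reverseAt j fs) ≡ flagAt (agreed os s t fs) fs ×
    remaining os s t (reverseAt j fs) ≡ remaining os s t fs
  agreed-reverse-late [] end end [] _ = refl , refl , refl
  agreed-reverse-late (o ∷ os) (node g s) (node g′ s′) (f ∷ fs) {suc j} (s≤s p)
    with (g xor (not o ∧ f)) xor (g′ xor (not (not o) ∧ f)) | p
  ... | true  | _ = refl , refl , refl
  ... | false | p = let p , q , r = agreed-reverse-late os (s _) (s′ _) fs p in cong suc p , q , r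

  -- Without flags, agreement of the imagined bits means that the guess was right, so the positions
  -- before the first disagreement contribute no mistake.
  remaining-clear : ∀ (os : Vec Bool n) s t → remaining os s t (Vec.replicate n false) ≡ mistakes os s t
  remaining-clear [] end end = refl
  remaining-clear (o ∷ os) (node g s) (node g′ s′)
    rewrite ∧-zeroʳ (not o) | ∧-zeroʳ (not (not o)) | xor-identityʳ g | xor-identityʳ g′
    with g xor g′ in eq
  ... | true = refl
  ... | false with xor≡false⇒≡ g g′ eq
  remaining-clear (true ∷ os) (node g s) (node g s′) | false | refl = remaining-clear os (s g) (s′ g)
  remaining-clear (false ∷ os) (node g s) (node g s′) | false | refl = remaining-clear os (s g) (s′ g)

  -- The speaker's own bit is always right, so at the first disagreement the listener's guess is
  -- wrong; as its flag is clear, the reversal repairs it instead of undoing a repair. Behind it all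
  -- flags are now clear, hence `remaining-clear` applies there.
  reverse-first : ∀ (os : Vec Bool n) s t fs → let i = agreed os s t fs in i < n → flagAt i fs ≡ false →
    let fs′ = reverseAt i fs in
    i < agreed os s t fs′ × flagAt (agreed os s t fs′) fs′ ≡ false × suc (remaining os s t fs′) ≡ remaining os s t fs
  reverse-first (o ∷ os) (node g s) (node g′ s′) (f ∷ fs) p q
    with (g xor (not o ∧ f)) xor (g′ xor (not (not o) ∧ f)) in eq | p | q
  ... | false | s≤s p | q rewrite eq = let p , q , r = reverse-first os (s _) (s′ _) fs p q in s≤s p , q , r
  reverse-first {suc n} (true ∷ os) (node true s) (node false s′) (f ∷ fs) p q | true | _ | refl =
    s≤s z≤n , flagAt-replicate (agreed os (s true) (s′ true) (Vec.replicate n false)) n , cong suc (remaining-clear os (s true) (s′ true))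
  reverse-first {suc n} (true ∷ os) (node false s) (node true s′) (f ∷ fs) p q | true | _ | refl =
    s≤s z≤n , flagAt-replicate (agreed os (s false) (s′ false) (Vec.replicate n false)) n , cong suc (remaining-clear os (s false) (s′ false))
  reverse-first {suc n} (false ∷ os) (node true s) (node false s′) (f ∷ fs) p q | true | _ | refl =
    s≤s z≤n , flagAt-replicate (agreed os (s false) (s′ false) (Vec.replicate n false)) n , cong suc (remaining-clear os (s false) (s′ false))
  reverse-first {suc n} (false ∷ os) (node false s) (node true s′) (f ∷ fs) p q | true | _ | refl =
    s≤s z≤n , flagAt-replicate (agreed os (s true) (s′ true) (Vec.replicate n false)) n , cong suc (remaining-clear os (s true) (s′ true))

  -- Flags never touch the speaker's own bit. Agreement with the speaker at every position is
  -- therefore agreement with the truth, however wrongly the search has gone.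
  agreed-full⇒truth : ∀ (os : Vec Bool n) s t fs → pathᴬ os s fs ≡ pathᴮ os t fs → pathᴬ os s fs ≡ truth os s t
  agreed-full⇒truth [] end end [] _ = refl
  agreed-full⇒truth (o ∷ os) (node g s) (node g′ s′) (f ∷ fs) p = go (cong Vec.head p) (own o (cong Vec.head p)) (cong Vec.tail p)
    where
    own : ∀ o → g xor (not o ∧ f) ≡ g′ xor (not (not o) ∧ f) → g xor (not o ∧ f) ≡ (if o then g else g′)
    own true  _ = xor-identityʳ g
    own false p = trans p (xor-identityʳ g′)
    go : ∀ {a b c} → a ≡ b → a ≡ c → pathᴬ os (s a) fs ≡ pathᴮ os (s′ b) fs → a ∷ pathᴬ os (s a) fs ≡ c ∷ truth os (s c) (s′ c)
    go {a} refl refl p = cong (a ∷_) (agreed-full⇒truth os (s a) (s′ a) fs p)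

  -- A state of the search for the first disagreement: the histories are known to
  -- disagree before `horizon` (unless it is suc n), and believed to agree up to
  -- the positions on the stack, which has 0 at its bottom.
  record State (n : ℕ) : Set where
    constructor ⟨_,_,_⟩
    field
      horizon : ℕ
      stack   : List ℕ
      flags   : Vec Bool n

  open State public

  top : List ℕ → ℕ
  top []      = 0
  top (e ∷ _) = e

  -- A failed comparison discards the topmost belief, whose position becomes the horizon; this is
  -- how an earlier wrong answer is taken back. A passed one bisects between the top and the
  -- horizon. When these are adjacent, the disagreement is believed to be at the top: its flag is
  -- reversed, the old horizon becomes a believed agreement, and the horizon returns to the sentinel
  -- `suc n`.
  step : Bool → State n → State n
  step false ⟨ h , []     , fs ⟩ = ⟨ h , [] , fs ⟩
  step false ⟨ h , e ∷ es , fs ⟩ = ⟨ e , es , fs ⟩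
  step {n} true ⟨ h , es , fs ⟩ with h ≟ suc (top es)
  ... | yes _ = ⟨ suc n , h ∷ es , reverseAt (top es) fs ⟩
  ... | no  _ = ⟨ h , top es + ⌊ h ∸ top es /2⌋ ∷ es , fs ⟩

  start : ∀ n → State n
  start n = ⟨ suc n , [] , Vec.replicate n false ⟩

  -- Entries of the stack up to the first disagreement i are good, the others
  -- bad. The search costs three units per halving of the gap above the topmost
  -- good entry, and one unit per bad entry.
  descent : ℕ → ℕ → List ℕ → ℕ
  descent i f []       = 3 * ⌈log₂ f ⌉ + 2
  descent i f (e ∷ es) with e ≤? i
  ... | yes _ = 3 * ⌈log₂ f ∸ e ⌉ + 2
  ... | no  _ = suc (descent i e es)

  distance : ℕ → ℕ → List ℕ → ℕ
  distance i h []       = 3 * ⌈log₂ h ⌉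
  distance i h (e ∷ es) with e ≤? i
  ... | yes _ = 3 * ⌈log₂ h ∸ e ⌉
  ... | no  _ = descent i e es

  distance-good : ∀ i h es → top es ≤ i → distance i h es ≡ 3 * ⌈log₂ h ∸ top es ⌉
  distance-good i h []       _ = refl
  distance-good i h (e ∷ es) p with e ≤? i
  ... | yes _ = refl
  ... | no ¬p = contradiction p ¬p

  descent-good : ∀ i f es → top es ≤ i → descent i f es ≡ 3 * ⌈log₂ f ∸ top es ⌉ + 2
  descent-good i f []       _ = refl
  descent-good i f (e ∷ es) p with e ≤? i
  ... | yes _ = refl
  ... | no ¬p = contradiction p ¬p

  distance-bad : ∀ i h e es → i < e → distance i h (e ∷ es) ≡ descent i e es
  distance-bad i h e es p with e ≤? i
  ... | yes q = contradiction q (<⇒≱ p)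
  ... | no _  = refl

  distance-pop : ∀ i e es → suc (distance i e es) ≤ descent i e es
  distance-pop i e []        = ≤-trans (n≤1+n _) (≤-reflexive (+-comm 2 _))
  distance-pop i e (e′ ∷ es) with e′ ≤? i
  ... | yes _ = ≤-trans (n≤1+n _) (≤-reflexive (+-comm 2 _))
  ... | no  _ = ≤-refl

  halve-log : ∀ g {k} → 2 ≤ g → k ≤ ⌈ g /2⌉ → suc ⌈log₂ k ⌉ ≤ ⌈log₂ g ⌉
  halve-log g {k} 2≤g k≤ = ≤-trans (s≤s (≤-trans (⌈log₂⌉-mono-≤ k≤) (≤-reflexive (⌈log₂⌈n/2⌉⌉≡⌈log₂n⌉∸1 g))))
    (≤-reflexive (m+[n∸m]≡n {1} (⌈log₂⌉-mono-≤ 2≤g)))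

  module _ (os : Vec Bool n) (s t : Strategy n) where

    first : State n → ℕ
    first σ = agreed os s t (flags σ)

    -- Only the horizon is kept correct at all times; the stack may contain false beliefs. The clear
    -- flag is what `reverse-first` needs.
    Valid : State n → Set
    Valid σ = first σ < horizon σ × flagAt (first σ) (flags σ) ≡ false

    -- Every mistake still to be repaired is charged for a whole bisection, over a gap of at most
    -- `suc n`, and for the step that reverses it; `distance` is what is left of the current
    -- bisection.
    potential : State n → ℕ
    potential σ = suc (3 * ⌈log₂ suc n ⌉) * remaining os s t (flags σ) + distance (first σ) (horizon σ) (stack σ)

    start-valid : Valid (start n)
    start-valid = s≤s (agreement≤n (pathᴬ os s (Vec.replicate n false)) (pathᴮ os t (Vec.replicate n false))) , flagAt-replicate (first (start n)) n

    start-potential : potential (start n) ≡ suc (3 * ⌈log₂ suc n ⌉) * mistakes os s t + 3 * ⌈log₂ suc n ⌉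
    start-potential = cong (λ r → suc (3 * ⌈log₂ suc n ⌉) * r + 3 * ⌈log₂ suc n ⌉) (remaining-clear os s t)

    -- If top and horizon are adjacent, the top is exactly the first disagreement, and the charge of
    -- the repaired mistake pays for the next bisection. Otherwise the midpoint is progress on
    -- either side of the disagreement: a good one halves the gap above it, a bad one will halve it
    -- from above when it is discarded.
    step-good : ∀ σ → Valid σ → first σ < n → top (stack σ) ≤ first σ →
                Valid (step true σ) × suc (potential (step true σ)) ≤ potential σ
    step-good ⟨ h , es , fs ⟩ (i<h , fresh) i<n e≤i with h ≟ suc (top es)
    ... | yes refl with ≤-antisym e≤i (s≤s⁻¹ i<h)
    ...   | e≡i rewrite e≡i =
      let i = first ⟨ h , es , fs ⟩
          fs′ = reverseAt i fs
          D = 3 * ⌈log₂ suc n ⌉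
          r = remaining os s t fs′
          i<i′ , fresh′ , rem = reverse-first os s t fs i<n fresh
      in (s≤s (agreement≤n (pathᴬ os s fs′) (pathᴮ os t fs′)) , fresh′) , (begin
        suc (suc D * r + distance (agreed os s t fs′) (suc n) (suc i ∷ es)) ≡⟨ cong (λ d → suc (suc D * r + d)) (distance-good (agreed os s t fs′) (suc n) (suc i ∷ es) i<i′) ⟩
        suc (suc D * r + 3 * ⌈log₂ n ∸ i ⌉)   ≤⟨ s≤s (+-monoʳ-≤ (suc D * r) (*-monoʳ-≤ 3 (⌈log₂⌉-mono-≤ (≤-trans (m∸n≤m n i) (n≤1+n n))))) ⟩
        suc (suc D * r + D)                   ≡⟨ sym (+-suc (suc D * r) D) ⟩
        suc D * r + suc D                     ≡⟨ trans (+-comm (suc D * r) (suc D)) (sym (*-suc (suc D) r)) ⟩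
        suc D * suc r                         ≡⟨ cong (suc D *_) rem ⟩
        suc D * remaining os s t fs           ≤⟨ m≤m+n _ _ ⟩
        suc D * remaining os s t fs + distance i (suc i) es ∎)
      where open ≤-Reasoning
    step-good ⟨ h , es , fs ⟩ (i<h , fresh) i<n e≤i | no h≢ = (i<h , fresh) , (begin
        suc (K + distance i h (m ∷ es))      ≡⟨ sym (+-suc K _) ⟩
        K + suc (distance i h (m ∷ es))      ≤⟨ +-monoʳ-≤ K smaller ⟩
        K + 3 * ⌈log₂ g ⌉                    ≡⟨ cong (K +_) (sym (distance-good i h es e≤i)) ⟩
        K + distance i h es                  ∎)
      where
      open ≤-Reasoning
      i = first ⟨ h , es , fs ⟩
      K = suc (3 * ⌈log₂ suc n ⌉) * remaining os s t fs
      e = top es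
      g = h ∸ e
      m = e + ⌊ g /2⌋
      e<h : e < h
      e<h = ≤-trans (s≤s e≤i) i<h
      2≤g : 2 ≤ g
      2≤g = m+n≤o⇒m≤o∸n 2 (≤∧≢⇒< e<h (h≢ ∘ sym))
      -- The three units of a halving pay one for this step and two for the surcharge of `descent`
      -- in case the midpoint is bad.
      three : ∀ k → suc k ≤ ⌈log₂ g ⌉ → suc (3 * k + 2) ≤ 3 * ⌈log₂ g ⌉
      three k p = ≤-trans (≤-reflexive (trans (sym (+-suc (3 * k) 2)) (trans (+-comm (3 * k) 3) (sym (*-suc 3 k))))) (*-monoʳ-≤ 3 p)
      smaller : suc (distance i h (m ∷ es)) ≤ 3 * ⌈log₂ g ⌉
      smaller with m ≤? i
      ... | yes _ = ≤-trans (s≤s (m≤m+n _ 2)) (three _ (halve-log g 2≤g (≤-reflexive (trans (sym (∸-+-assoc h e ⌊ g /2⌋)) (trans (cong (_∸ ⌊ g /2⌋) (sym (⌊n/2⌋+⌈n/2⌉≡n g))) (m+n∸m≡n ⌊ g /2⌋ ⌈ g /2⌉))))))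
      ... | no _ rewrite descent-good i m es e≤i = three _ (halve-log g 2≤g (≤-trans (≤-reflexive (m+n∸m≡n e ⌊ g /2⌋)) (⌊n/2⌋≤⌈n/2⌉ g)))

    step-bad-detected : ∀ σ → Valid σ → first σ < top (stack σ) →
                        Valid (step false σ) × suc (potential (step false σ)) ≤ potential σ
    step-bad-detected ⟨ h , e ∷ es , fs ⟩ (i<h , fresh) i<e = (i<e , fresh) ,
      ≤-trans (≤-reflexive (sym (+-suc K _))) (+-monoʳ-≤ K (≤-trans (distance-pop i e es) (≤-reflexive (sym (distance-bad i h e es i<e)))))
      where
      i = first ⟨ h , e ∷ es , fs ⟩
      K = suc (3 * ⌈log₂ suc n ⌉) * remaining os s t fs

    -- The new entry lies behind the disagreement like the old top, so it costs just one further
    -- discard. A reversal made here is late in the sense of `agreed-reverse-late` and changes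
    -- neither `first` nor `remaining`.
    step-bad-missed : ∀ σ → Valid σ → first σ < top (stack σ) →
                      Valid (step true σ) × potential (step true σ) ≤ suc (potential σ)
    step-bad-missed ⟨ h , e ∷ es , fs ⟩ (i<h , fresh) i<e with h ≟ suc e
    ... | yes refl =
      let p , q , r = agreed-reverse-late os s t fs i<e in
      (s≤s (agreement≤n (pathᴬ os s (reverseAt e fs)) (pathᴮ os t (reverseAt e fs))) ,
        trans (cong (λ j → flagAt j (reverseAt e fs)) p) (trans q fresh)) ,
      ≤-trans (≤-reflexive (cong₂ (λ r j → suc (3 * ⌈log₂ suc n ⌉) * r + distance j (suc n) (suc e ∷ e ∷ es)) r p))
        (one-more (suc n) (suc e) (≤-trans i<e (n≤1+n e)))
      where
      i = first ⟨ suc e , e ∷ es , fs ⟩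
      K = suc (3 * ⌈log₂ suc n ⌉) * remaining os s t fs
      one-more : ∀ h′ m → i < m → K + distance i h′ (m ∷ e ∷ es) ≤ suc (K + distance i h (e ∷ es))
      one-more h′ m i<m rewrite distance-bad i h′ m (e ∷ es) i<m | distance-bad i h e es i<e with e ≤? i
      ... | yes q = contradiction q (<⇒≱ i<e)
      ... | no _  = ≤-reflexive (+-suc K _)
    ... | no _ = (i<h , fresh) , one-more (e + ⌊ h ∸ e /2⌋) (≤-trans i<e (m≤m+n e _))
      where
      i = first ⟨ h , e ∷ es , fs ⟩
      K = suc (3 * ⌈log₂ suc n ⌉) * remaining os s t fs
      one-more : ∀ m → i < m → K + distance i h (m ∷ e ∷ es) ≤ suc (K + distance i h (e ∷ es))
      one-more m i<m rewrite distance-bad i h m (e ∷ es) i<m | distance-bad i h e es i<e with e ≤? i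
      ... | yes q = contradiction q (<⇒≱ i<e)
      ... | no _  = ≤-reflexive (+-suc K _)

    -- Once the histories agree, every comparison passes and the search runs against the sentinel; a
    -- reversal there falls behind the last position and has no effect, so surplus rounds are
    -- harmless.
    step-finished : ∀ σ → n < horizon σ → flags (step true σ) ≡ flags σ × n < horizon (step true σ)
    step-finished ⟨ h , es , fs ⟩ n<h with h ≟ suc (top es)
    ... | yes refl = reverseAt-beyond (top es) fs (s≤s⁻¹ n<h) , ≤-refl
    ... | no _     = refl , n<h

module Compressing (lem : ExcludedMiddle 0ℓ) (R : RealNumbers) where

  open Communication lem R

  -- Polynomial identities over ℝ with integer coefficients

  module RingSolving where

    open CommutativeRing commutativeRing
      using (+-assoc; +-comm; +-identityˡ; +-identityʳ; *-assoc; *-comm; *-identityˡ; *-identityʳ; distribˡ; zeroˡ; zeroʳ; -‿inverseˡ; -‿inverseʳ)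
    open IsTotalOrder isTotalOrder public
      using () renaming (refl to ≤-refl; reflexive to ≤-reflexive; trans to ≤-trans; antisym to ≤-antisym; total to ≤-total)
    open SemiringExp semiring public using () renaming (^-homo-* to ^-+; ^-assocʳ to ^-^)

    ≤-poset : Poset 0ℓ 0ℓ 0ℓ
    ≤-poset = record { isPartialOrder = IsTotalOrder.isPartialOrder isTotalOrder }

    module ≤-Reasoning = PosetReasoning ≤-poset

    fromℕ-+ : ∀ m n → fromℕ (m ℕ.+ n) ≡ fromℕ m + fromℕ n
    fromℕ-+ m n = SemiringMult.×-homo-+ semiring 1ℝ m n

    fromℕ-* : ∀ m n → fromℕ (m ℕ.* n) ≡ fromℕ m * fromℕ n
    fromℕ-* = SemiringMult.×1-homo-* semiring

    fromℕ-1 : fromℕ 1 ≡ 1ℝ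
    fromℕ-1 = +-identityʳ 1ℝ

    open RingProperties (CommutativeRing.ring commutativeRing) public using (-‿distribˡ-*; -‿distribʳ-*; -0#≈0#; -‿involutive; -‿+-comm)

    module ℤ-coefficients where

      -- +1 is sent to 1ℝ itself, rather than to fromℕ 1 = 1ℝ + 0ℝ, so that the
      -- solver accepts 1ℝ as a constant.
      ⟦_⟧ : ℤ → ℝ
      ⟦ pos 1 ⟧      = 1ℝ
      ⟦ pos n ⟧      = fromℕ n
      ⟦ -[1+ n ] ⟧ = - fromℕ (suc n)

      ⟦+_⟧ : ∀ n → ⟦ pos n ⟧ ≡ fromℕ n
      ⟦+ 0 ⟧           = refl
      ⟦+ 1 ⟧           = sym fromℕ-1
      ⟦+ suc (suc n) ⟧ = refl

      ⟦⊖⟧ : ∀ m n → ⟦ m ℤ.⊖ n ⟧ ≡ fromℕ m - fromℕ n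
      ⟦⊖⟧ m zero = trans ⟦+ m ⟧ (sym (trans (cong (fromℕ m +_) -0#≈0#) (+-identityʳ _)))
      ⟦⊖⟧ zero (suc n) = sym (+-identityˡ _)
      ⟦⊖⟧ (suc m) (suc n) = begin
        ⟦ suc m ℤ.⊖ suc n ⟧                     ≡⟨ cong ⟦_⟧ (ℤ.[1+m]⊖[1+n]≡m⊖n m n) ⟩
        ⟦ m ℤ.⊖ n ⟧                             ≡⟨ ⟦⊖⟧ m n ⟩
        a - b                                   ≡⟨ cong (_- b) (sym (trans (cong (_+ a) (-‿inverseˡ 1ℝ)) (+-identityˡ a))) ⟩
        ((- 1ℝ + 1ℝ) + a) + - b                 ≡⟨ cong (_+ - b) (trans (+-assoc _ _ _) (+-comm _ _)) ⟩
        ((1ℝ + a) + - 1ℝ) + - b                 ≡⟨ +-assoc _ _ _ ⟩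
        (1ℝ + a) + (- 1ℝ + - b)                 ≡⟨ cong (1ℝ + a +_) (-‿+-comm 1ℝ b) ⟩
        (1ℝ + a) - (1ℝ + b)                     ∎
        where
        open ≡-Reasoning
        a = fromℕ m
        b = fromℕ n

      ⟦-⟧ : ∀ i → ⟦ ℤ.- i ⟧ ≡ - ⟦ i ⟧
      ⟦-⟧ (pos zero)        = sym -0#≈0#
      ⟦-⟧ (pos 1)           = cong -_ fromℕ-1
      ⟦-⟧ (pos (suc (suc n))) = refl
      ⟦-⟧ (-[1+ n ])      = trans ⟦+ suc n ⟧ (sym (-‿involutive _))

      ⟦+⟧ : ∀ i j → ⟦ i ℤ.+ j ⟧ ≡ ⟦ i ⟧ + ⟦ j ⟧
      ⟦+⟧ (pos m) (pos n) = trans ⟦+ m ℕ.+ n ⟧ (trans (fromℕ-+ m n) (sym (cong₂ _+_ ⟦+ m ⟧ ⟦+ n ⟧)))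
      ⟦+⟧ (pos m) -[1+ n ] = trans (⟦⊖⟧ m (suc n)) (cong (_+ _) (sym ⟦+ m ⟧))
      ⟦+⟧ -[1+ m ] (pos n) = trans (⟦⊖⟧ n (suc m)) (trans (+-comm _ _) (cong (_ +_) (sym ⟦+ n ⟧)))
      ⟦+⟧ -[1+ m ] -[1+ n ] = begin
        - fromℕ (suc (suc (m ℕ.+ n)))        ≡⟨ cong (-_ ∘ fromℕ ∘ suc) (sym (ℕ.+-suc m n)) ⟩
        - fromℕ (suc m ℕ.+ suc n)            ≡⟨ cong -_ (fromℕ-+ (suc m) (suc n)) ⟩
        - (fromℕ (suc m) + fromℕ (suc n))    ≡⟨ sym (-‿+-comm _ _) ⟩
        - fromℕ (suc m) + - fromℕ (suc n)    ∎
        where open ≡-Reasoning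

      ⟦+*+⟧ : ∀ m n → ⟦ pos (m ℕ.* n) ⟧ ≡ ⟦ pos m ⟧ * ⟦ pos n ⟧
      ⟦+*+⟧ m n = trans ⟦+ m ℕ.* n ⟧ (trans (fromℕ-* m n) (sym (cong₂ _*_ ⟦+ m ⟧ ⟦+ n ⟧)))

      ⟦+*⟧ : ∀ m j → ⟦ pos m ℤ.* j ⟧ ≡ ⟦ pos m ⟧ * ⟦ j ⟧
      ⟦+*⟧ m (pos n) = trans (cong ⟦_⟧ (sym (ℤ.pos-* m n))) (⟦+*+⟧ m n)
      ⟦+*⟧ m -[1+ n ] = begin
        ⟦ pos m ℤ.* -[1+ n ] ⟧          ≡⟨ cong ⟦_⟧ (sym (ℤ.neg-distribʳ-* (pos m) (pos (suc n)))) ⟩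
        ⟦ ℤ.- (pos m ℤ.* pos (suc n)) ⟧     ≡⟨ ⟦-⟧ (pos m ℤ.* pos (suc n)) ⟩
        - ⟦ pos m ℤ.* pos (suc n) ⟧         ≡⟨ cong -_ (⟦+*⟧ m (pos (suc n))) ⟩
        - (⟦ pos m ⟧ * ⟦ pos (suc n) ⟧)     ≡⟨ -‿distribʳ-* _ _ ⟩
        ⟦ pos m ⟧ * - ⟦ pos (suc n) ⟧       ≡⟨ cong (λ z → ⟦ pos m ⟧ * - z) ⟦+ suc n ⟧ ⟩
        ⟦ pos m ⟧ * - fromℕ (suc n)     ∎
        where open ≡-Reasoning

      ⟦*⟧ : ∀ i j → ⟦ i ℤ.* j ⟧ ≡ ⟦ i ⟧ * ⟦ j ⟧
      ⟦*⟧ (pos m) j = ⟦+*⟧ m j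
      ⟦*⟧ -[1+ m ] j = begin
        ⟦ -[1+ m ] ℤ.* j ⟧            ≡⟨ cong ⟦_⟧ (sym (ℤ.neg-distribˡ-* (pos (suc m)) j)) ⟩
        ⟦ ℤ.- (pos (suc m) ℤ.* j) ⟧       ≡⟨ ⟦-⟧ (pos (suc m) ℤ.* j) ⟩
        - ⟦ pos (suc m) ℤ.* j ⟧           ≡⟨ cong -_ (⟦+*⟧ (suc m) j) ⟩
        - (⟦ pos (suc m) ⟧ * ⟦ j ⟧)       ≡⟨ -‿distribˡ-* _ _ ⟩
        - ⟦ pos (suc m) ⟧ * ⟦ j ⟧         ≡⟨ cong (λ z → - z * ⟦ j ⟧) ⟦+ suc m ⟧ ⟩
        - fromℕ (suc m) * ⟦ j ⟧       ∎
        where open ≡-Reasoning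

      ring : AlmostCommutativeRing 0ℓ 0ℓ
      ring = fromCommutativeRing commutativeRing

      morphism : ℤ.+-*-rawRing -Raw-AlmostCommutative⟶ ring
      morphism = record
        { ⟦_⟧ = ⟦_⟧ ; +-homo = ⟦+⟧ ; *-homo = ⟦*⟧ ; -‿homo = ⟦-⟧ ; 0-homo = refl ; 1-homo = refl }

      coefficient-≟ : ∀ i j → Maybe (⟦ i ⟧ ≡ ⟦ j ⟧)
      coefficient-≟ i j with i ℤ.≟ j
      ... | yes i≡j = just (cong ⟦_⟧ i≡j)
      ... | no  _   = nothing

    open RingSolver ℤ.+-*-rawRing ℤ-coefficients.ring ℤ-coefficients.morphism ℤ-coefficients.coefficient-≟ public
      using (solve; con; _:=_; _:+_; _:*_; _:-_; :-_; _:^_)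

    pattern :0 = con (pos 0)
    pattern :1 = con (pos 1)
    pattern :2 = con (pos 2)
    pattern :3 = con (pos 3)
    pattern :4 = con (pos 4)

  open RingSolving

  -- Inequalities in an ordered field, natural numbers and indicators

  module OrderedField where

    private variable
      a b c d e x y z : ℝ

    module ℝ = CommutativeRing commutativeRing

    -- Nearly all inequalities are proved in this form: the difference is exhibited as a visibly
    -- nonnegative expression `e`, and the identity is left to the ring solver.
    ≤-cert : 0ℝ ≤ e → b ≡ a + e → a ≤ b
    ≤-cert {e} {b} {a} 0≤e b≡ = subst₂ _≤_ (ℝ.+-identityˡ a) (trans (ℝ.+-comm e a) (sym b≡)) (+-monoˡ-≤ a 0≤e)

    x≤y⇒0≤y-x : x ≤ y → 0ℝ ≤ y - x
    x≤y⇒0≤y-x {x} {y} x≤y = subst (_≤ y - x) (ℝ.-‿inverseʳ x) (+-monoˡ-≤ (- x) x≤y)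

    0≤y-x⇒x≤y : 0ℝ ≤ y - x → x ≤ y
    0≤y-x⇒x≤y {y} {x} h = ≤-cert h (solve 2 (λ x y → y := x :+ (y :- x)) refl x y)

    +-mono-≤ : a ≤ b → c ≤ d → a + c ≤ b + d
    +-mono-≤ {a} {b} {c} {d} p q = ≤-trans (+-monoˡ-≤ c p) (subst₂ _≤_ (ℝ.+-comm c b) (ℝ.+-comm d b) (+-monoˡ-≤ b q))

    +-monoʳ-≤ : ∀ c → a ≤ b → c + a ≤ c + b
    +-monoʳ-≤ c = +-mono-≤ ≤-refl

    0≤+ : 0ℝ ≤ a → 0ℝ ≤ b → 0ℝ ≤ a + b
    0≤+ {a} {b} p q = subst (_≤ a + b) (ℝ.+-identityˡ 0ℝ) (+-mono-≤ p q)

    0≤* : 0ℝ ≤ a → 0ℝ ≤ b → 0ℝ ≤ a * b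
    0≤* = *-nonNegative

    neg-mono-≤ : a ≤ b → - b ≤ - a
    neg-mono-≤ {a} {b} p = ≤-cert (x≤y⇒0≤y-x p) (solve 2 (λ a b → :- a := :- b :+ (b :- a)) refl a b)

    -x≤y⇒-y≤x : - a ≤ b → - b ≤ a
    -x≤y⇒-y≤x {a} {b} p = ≤-cert (x≤y⇒0≤y-x p) (solve 2 (λ a b → a := :- b :+ (b :- :- a)) refl a b)

    x≤0⇒0≤-x : a ≤ 0ℝ → 0ℝ ≤ - a
    x≤0⇒0≤-x {a} p = subst (_≤ - a) -0#≈0# (neg-mono-≤ p)

    0≤x² : ∀ x → 0ℝ ≤ x * x
    0≤x² x with ≤-total 0ℝ x
    ... | inj₁ p = 0≤* p p
    ... | inj₂ p = subst (0ℝ ≤_) (solve 1 (λ x → :- x :* :- x := x :* x) refl x) (0≤* (x≤0⇒0≤-x p) (x≤0⇒0≤-x p))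

    0≤1 : 0ℝ ≤ 1ℝ
    0≤1 = subst (0ℝ ≤_) (ℝ.*-identityˡ 1ℝ) (0≤x² 1ℝ)

    0<1 : 0ℝ < 1ℝ
    0<1 = 0≤1 , 1≢0 ∘ sym

    <⇒≤ : a < b → a ≤ b
    <⇒≤ = proj₁

    <⇒≱ : a < b → ¬ (b ≤ a)
    <⇒≱ (p , a≢b) q = a≢b (≤-antisym p q)

    ≰⇒> : ¬ (a ≤ b) → b < a
    ≰⇒> {a} {b} ¬p with ≤-total a b
    ... | inj₁ p = contradiction p ¬p
    ... | inj₂ p = p , λ { refl → ¬p p }

    ≮⇒≥ : ¬ (a < b) → b ≤ a
    ≮⇒≥ {a} {b} ¬p with lem {b ≤ a}
    ... | yes p = p
    ... | no ¬q = contradiction (≰⇒> ¬q) ¬p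

    <-≤-trans : a < b → b ≤ c → a < c
    <-≤-trans p q = ≤-trans (proj₁ p) q , λ { refl → <⇒≱ p q }

    ≤-<-trans : a ≤ b → b < c → a < c
    ≤-<-trans p q = ≤-trans p (proj₁ q) , λ { refl → <⇒≱ q p }

    <-trans : a < b → b < c → a < c
    <-trans p q = <-≤-trans p (<⇒≤ q)

    ≤-<-⊎ : ∀ a b → a ≤ b ⊎ b < a
    ≤-<-⊎ a b with lem {a ≤ b}
    ... | yes p = inj₁ p
    ... | no ¬p = inj₂ (≰⇒> ¬p)

    0≤∧≢⇒0< : 0ℝ ≤ a → a ≢ 0ℝ → 0ℝ < a
    0≤∧≢⇒0< p a≢0 = p , a≢0 ∘ sym

    0<⇒≢ : 0ℝ < a → a ≢ 0ℝ
    0<⇒≢ p a≡0 = proj₂ p (sym a≡0)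

    0≤⇒≡⊎< : 0ℝ ≤ a → a ≡ 0ℝ ⊎ 0ℝ < a
    0≤⇒≡⊎< {a} p with lem {a ≡ 0ℝ}
    ... | yes q = inj₁ q
    ... | no ¬q = inj₂ (0≤∧≢⇒0< p ¬q)

    x<y⇒0<y-x : x < y → 0ℝ < y - x
    x<y⇒0<y-x {x} {y} (x≤y , x≢y) = x≤y⇒0≤y-x x≤y , λ 0≡ → x≢y (trans (sym (ℝ.+-identityʳ x)) (trans (cong (x +_) 0≡) (solve 2 (λ x y → x :+ (y :- x) := y) refl x y)))

    0<y-x⇒x<y : 0ℝ < y - x → x < y
    0<y-x⇒x<y {y} {x} (p , ≢) = 0≤y-x⇒x≤y p , λ { refl → ≢ (sym (ℝ.-‿inverseʳ x)) }

    +-mono-≤-< : a ≤ b → c < d → a + c < b + d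
    +-mono-≤-< {a} {b} {c} {d} p q = 0<y-x⇒x<y (subst (0ℝ <_) (solve 4 (λ a b c d → (d :- c) :+ (b :- a) := b :+ d :- (a :+ c)) refl a b c d)
      (<-≤-trans (x<y⇒0<y-x q) (≤-cert (x≤y⇒0≤y-x p) refl)))

    0<+ : 0ℝ < a → 0ℝ ≤ b → 0ℝ < a + b
    0<+ p q = <-≤-trans p (≤-cert q refl)

    x*y≡0 : a * b ≡ 0ℝ → a ≡ 0ℝ ⊎ b ≡ 0ℝ
    x*y≡0 {a} {b} ab≡0 with lem {a ≡ 0ℝ}
    ... | yes p = inj₁ p
    ... | no ¬p = inj₂ (begin
      b                ≡⟨ sym (ℝ.*-identityˡ b) ⟩
      1ℝ * b           ≡⟨ cong (_* b) (sym (*-inverseʳ a ¬p)) ⟩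
      a * a ⁻¹ * b     ≡⟨ solve 3 (λ a a' b → a :* a' :* b := a' :* (a :* b)) refl a (a ⁻¹) b ⟩
      a ⁻¹ * (a * b)   ≡⟨ cong (a ⁻¹ *_) ab≡0 ⟩
      a ⁻¹ * 0ℝ        ≡⟨ ℝ.zeroʳ _ ⟩
      0ℝ               ∎)
      where open ≡-Reasoning

    0<* : 0ℝ < a → 0ℝ < b → 0ℝ < a * b
    0<* p q = 0≤∧≢⇒0< (0≤* (<⇒≤ p) (<⇒≤ q)) λ ab≡0 → case x*y≡0 ab≡0 of λ where
      (inj₁ a≡0) → 0<⇒≢ p a≡0
      (inj₂ b≡0) → 0<⇒≢ q b≡0

    *-monoˡ-≤ : 0ℝ ≤ c → a ≤ b → a * c ≤ b * c
    *-monoˡ-≤ {c} {a} {b} p q = ≤-cert (0≤* (x≤y⇒0≤y-x q) p) (solve 3 (λ a b c → b :* c := a :* c :+ (b :- a) :* c) refl a b c)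

    *-monoʳ-≤ : 0ℝ ≤ c → a ≤ b → c * a ≤ c * b
    *-monoʳ-≤ {c} {a} {b} p q = subst₂ _≤_ (ℝ.*-comm a c) (ℝ.*-comm b c) (*-monoˡ-≤ p q)

    *-mono-≤ : 0ℝ ≤ a → 0ℝ ≤ d → a ≤ b → c ≤ d → a * c ≤ b * d
    *-mono-≤ 0≤a 0≤d p q = ≤-trans (*-monoʳ-≤ 0≤a q) (*-monoˡ-≤ 0≤d p)

    *-monoˡ-< : 0ℝ < c → a < b → a * c < b * c
    *-monoˡ-< {c} {a} {b} p q = 0<y-x⇒x<y (subst (0ℝ <_) (solve 3 (λ a b c → (b :- a) :* c := b :* c :- a :* c) refl a b c) (0<* (x<y⇒0<y-x q) p))

    *-cancelˡ-≤ : 0ℝ < c → c * a ≤ c * b → a ≤ b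
    *-cancelˡ-≤ {c} {a} {b} p q = ≮⇒≥ λ b<a → <⇒≱ (subst₂ _<_ (ℝ.*-comm b c) (ℝ.*-comm a c) (*-monoˡ-< p b<a)) q

    *-cancelˡ-≡ : c ≢ 0ℝ → c * a ≡ c * b → a ≡ b
    *-cancelˡ-≡ {c} {a} {b} c≢0 p = begin
      a                ≡⟨ sym (ℝ.*-identityˡ a) ⟩
      1ℝ * a           ≡⟨ cong (_* a) (sym (*-inverseʳ c c≢0)) ⟩
      c * c ⁻¹ * a     ≡⟨ solve 3 (λ a a' b → a :* a' :* b := a' :* (a :* b)) refl c (c ⁻¹) a ⟩
      c ⁻¹ * (c * a)   ≡⟨ cong (c ⁻¹ *_) p ⟩
      c ⁻¹ * (c * b)   ≡⟨ solve 3 (λ a a' b → a' :* (a :* b) := a :* a' :* b) refl c (c ⁻¹) b ⟩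
      c * c ⁻¹ * b     ≡⟨ cong (_* b) (*-inverseʳ c c≢0) ⟩
      1ℝ * b           ≡⟨ ℝ.*-identityˡ b ⟩
      b                ∎
      where open ≡-Reasoning

    0≤⁻¹ : 0ℝ ≤ a → 0ℝ ≤ a ⁻¹
    0≤⁻¹ {a} p with lem {a ≡ 0ℝ}
    ... | yes refl = subst (0ℝ ≤_) (sym 0⁻¹≡0) ≤-refl
    ... | no a≢0 with ≤-total 0ℝ (a ⁻¹)
    ...   | inj₁ q = q
    ...   | inj₂ q = ⊥-elim (<⇒≱ 0<1 (≤-cert {e = a * - a ⁻¹} (0≤* p (x≤0⇒0≤-x q))
        (trans (sym (ℝ.-‿inverseʳ 1ℝ)) (trans (cong (λ w → 1ℝ + - w) (sym (*-inverseʳ a a≢0))) (cong (1ℝ +_) (-‿distribʳ-* _ _))))))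

    0<⁻¹ : 0ℝ < a → 0ℝ < a ⁻¹
    0<⁻¹ {a} p = 0≤∧≢⇒0< (0≤⁻¹ (<⇒≤ p)) λ q → 1≢0 (trans (sym (*-inverseʳ a (0<⇒≢ p))) (trans (cong (a *_) q) (ℝ.zeroʳ a)))

    0≤/ : 0ℝ ≤ a → 0ℝ ≤ b → 0ℝ ≤ a / b
    0≤/ p q = 0≤* p (0≤⁻¹ q)

    0</ : 0ℝ < a → 0ℝ < b → 0ℝ < a / b
    0</ p q = 0<* p (0<⁻¹ q)

    x/y*y : b ≢ 0ℝ → a / b * b ≡ a
    x/y*y {b} {a} b≢0 = trans (solve 3 (λ a b b' → a :* b' :* b := a :* (b :* b')) refl a b (b ⁻¹)) (trans (cong (a *_) (*-inverseʳ b b≢0)) (ℝ.*-identityʳ a))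

    x≡z/y : b ≢ 0ℝ → a * b ≡ c → a ≡ c / b
    x≡z/y {b} {a} b≢0 refl = trans (sym (ℝ.*-identityʳ a)) (trans (cong (a *_) (sym (*-inverseʳ b b≢0))) (sym (ℝ.*-assoc a b _)))

    x/0 : b ≡ 0ℝ → a / b ≡ 0ℝ
    x/0 {a = a} refl = trans (cong (a *_) 0⁻¹≡0) (ℝ.zeroʳ a)

    0/x : 0ℝ / b ≡ 0ℝ
    0/x {b} = ℝ.zeroˡ _

    x/x : a ≢ 0ℝ → a / a ≡ 1ℝ
    x/x = *-inverseʳ _

    /-monoˡ-≤ : 0ℝ ≤ c → a ≤ b → a / c ≤ b / c
    /-monoˡ-≤ p = *-monoˡ-≤ (0≤⁻¹ p)

    x≤y/z : 0ℝ < c → a * c ≤ b → a ≤ b / c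
    x≤y/z {c} {a} {b} p q = *-cancelˡ-≤ p (subst₂ _≤_ (ℝ.*-comm a c) (trans (sym (x/y*y (0<⇒≢ p))) (ℝ.*-comm _ c)) q)

    x/z≤y : 0ℝ < c → a ≤ b * c → a / c ≤ b
    x/z≤y {c} {a} {b} p q = *-cancelˡ-≤ p (subst₂ _≤_ (trans (sym (x/y*y (0<⇒≢ p))) (ℝ.*-comm _ c)) (ℝ.*-comm b c) q)

    0≤fromℕ : ∀ n → 0ℝ ≤ fromℕ n
    0≤fromℕ zero    = ≤-refl
    0≤fromℕ (suc n) = 0≤+ 0≤1 (0≤fromℕ n)

    0<fromℕ-suc : ∀ n → 0ℝ < fromℕ (suc n)
    0<fromℕ-suc n = 0<+ 0<1 (0≤fromℕ n)

    fromℕ-mono : ∀ {m n} → m ℕ.≤ n → fromℕ m ≤ fromℕ n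
    fromℕ-mono {n = n} z≤n = 0≤fromℕ n
    fromℕ-mono (s≤s p)     = +-monoʳ-≤ 1ℝ (fromℕ-mono p)

    0<2 : 0ℝ < fromℕ 2
    0<2 = 0<fromℕ-suc 1

    x<x+1 : ∀ x → x < x + 1ℝ
    x<x+1 x = 0<y-x⇒x<y (subst (0ℝ <_) (solve 1 (λ x → :1 := x :+ :1 :- x) refl x) 0<1)

    archimedean : ∀ x → ∃ λ n → x ≤ fromℕ n
    archimedean x with lem {∃ λ n → x ≤ fromℕ n}
    ... | yes p = p
    -- Were the naturals bounded, their supremum s minus one would bound them too, because the
    -- successor of a natural is still at most s.
    ... | no ¬p = ⊥-elim (<⇒≱ s-1<s (least (s - 1ℝ) λ { _ (n , refl) →
          ≤-cert (x≤y⇒0≤y-x (upper (fromℕ (suc n)) (suc n , refl))) (solve 2 (λ s n → s :- :1 := n :+ (s :- (:1 :+ n))) refl s (fromℕ n)) }))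
      where
      S : Pred ℝ 0ℓ
      S r = ∃ λ n → r ≡ fromℕ n
      sup-S = complete S (0ℝ , 0 , refl) (x , λ { _ (n , refl) → case ≤-total (fromℕ n) x of λ where
        (inj₁ q) → q
        (inj₂ q) → ⊥-elim (¬p (n , q)) })
      s = proj₁ sup-S
      upper = proj₁ (proj₂ sup-S)
      least = proj₂ (proj₂ sup-S)
      s-1<s : s - 1ℝ < s
      s-1<s = subst (s - 1ℝ <_) (solve 1 (λ s → s :- :1 :+ :1 := s) refl s) (x<x+1 (s - 1ℝ))

    ceiling : ∀ x → 0ℝ ≤ x → ∃ λ n → x ≤ fromℕ n × fromℕ n ≤ x + 1ℝ
    ceiling x 0≤x = go (proj₁ (archimedean x)) (proj₂ (archimedean x))
      where
      go : ∀ n → x ≤ fromℕ n → ∃ λ n → x ≤ fromℕ n × fromℕ n ≤ x + 1ℝ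
      go zero    p = 0 , p , 0≤+ 0≤x 0≤1
      go (suc n) p with lem {x ≤ fromℕ n}
      ... | yes q = go n q
      ... | no ¬q = suc n , p , subst (_≤ x + 1ℝ) (ℝ.+-comm _ _) (+-monoˡ-≤ 1ℝ (<⇒≤ (≰⇒> ¬q)))

    ε-≤ : (∀ ε → 0ℝ < ε → a ≤ b + ε) → a ≤ b
    ε-≤ {a} {b} h = ≮⇒≥ λ b<a → let g = x<y⇒0<y-x b<a ; g/2 = 0</ g 0<2 in
      <⇒≱ (subst₂ _<_ (cong (b +_) (ℝ.*-comm _ _)) (solve 2 (λ a b → b :+ (a :- b) := a) refl a b)
        (+-mono-≤-< ≤-refl (half<  g))) (h _ (subst (0ℝ <_) (ℝ.*-comm _ _) g/2))
      where
      half< : 0ℝ < c → c / fromℕ 2 < c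
      half< {c} 0<c = 0<y-x⇒x<y (subst (0ℝ <_) (trans (solve 1 (λ h → h := h :* :2 :- h) refl (c / fromℕ 2)) (cong (_- c / fromℕ 2) (x/y*y (0<⇒≢ 0<2)))) (0</ 0<c 0<2))

    ∣∣-nonNeg : ∀ x → 0ℝ ≤ ∣ x ∣
    ∣∣-nonNeg x with ≤-total 0ℝ x
    ... | inj₁ p = p
    ... | inj₂ p = x≤0⇒0≤-x p

    ∣∣-cases : ∀ x → (∣ x ∣ ≡ x × 0ℝ ≤ x) ⊎ (∣ x ∣ ≡ - x × x ≤ 0ℝ)
    ∣∣-cases x with ≤-total 0ℝ x
    ... | inj₁ p = inj₁ (refl , p)
    ... | inj₂ p = inj₂ (refl , p)

    ∣∣-≤ : a ≤ b → - a ≤ b → ∣ a ∣ ≤ b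
    ∣∣-≤ {a} p q with ≤-total 0ℝ a
    ... | inj₁ _ = p
    ... | inj₂ _ = q

    x≤∣x∣ : ∀ x → x ≤ ∣ x ∣
    x≤∣x∣ x with ≤-total 0ℝ x
    ... | inj₁ _ = ≤-refl
    ... | inj₂ p = ≤-trans p (x≤0⇒0≤-x p)

    -x≤∣x∣ : ∀ x → - x ≤ ∣ x ∣
    -x≤∣x∣ x with ≤-total 0ℝ x
    ... | inj₁ p = ≤-trans (subst (- x ≤_) -0#≈0# (neg-mono-≤ p)) p
    ... | inj₂ _ = ≤-refl

    ^-nonNeg : ∀ n → 0ℝ ≤ x → 0ℝ ≤ x ^ n
    ^-nonNeg zero    p = 0≤1
    ^-nonNeg (suc n) p = 0≤* p (^-nonNeg n p)

    ^-pos : ∀ n → 0ℝ < x → 0ℝ < x ^ n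
    ^-pos zero    p = 0<1
    ^-pos (suc n) p = 0<* p (^-pos n p)

    ^-monoˡ : ∀ n → 0ℝ ≤ x → x ≤ y → x ^ n ≤ y ^ n
    ^-monoˡ zero    0≤x p = ≤-refl
    ^-monoˡ (suc n) 0≤x p = *-mono-≤ 0≤x (^-nonNeg n (≤-trans 0≤x p)) p (^-monoˡ n 0≤x p)

    ^-monoʳ : ∀ {m n} → 1ℝ ≤ x → m ℕ.≤ n → x ^ m ≤ x ^ n
    ^-monoʳ {x} {n = n} 1≤x z≤n = 1≤x^ n
      where
      1≤x^ : ∀ n → 1ℝ ≤ x ^ n
      1≤x^ zero    = ≤-refl
      1≤x^ (suc n) = subst (_≤ x ^ suc n) (ℝ.*-identityˡ 1ℝ) (*-mono-≤ 0≤1 (^-nonNeg n (≤-trans 0≤1 1≤x)) 1≤x (1≤x^ n))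
    ^-monoʳ 1≤x (s≤s p) = *-monoʳ-≤ (≤-trans 0≤1 1≤x) (^-monoʳ 1≤x p)

    1^ : ∀ n → 1ℝ ^ n ≡ 1ℝ
    1^ zero    = refl
    1^ (suc n) = trans (ℝ.*-identityˡ _) (1^ n)

    ^-* : ∀ n x y → (x * y) ^ n ≡ x ^ n * y ^ n
    ^-* zero    x y = sym (ℝ.*-identityˡ 1ℝ)
    ^-* (suc n) x y = trans (cong (x * y *_) (^-* n x y)) (solve 4 (λ x y a b → x :* y :* (a :* b) := x :* a :* (y :* b)) refl x y (x ^ n) (y ^ n))

    2≡1+1 : fromℕ 2 ≡ 1ℝ + 1ℝ
    2≡1+1 = cong (1ℝ +_) fromℕ-1

    1≤2 : 1ℝ ≤ fromℕ 2
    1≤2 = ≤-cert 0≤1 2≡1+1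

    n≤2^n : ∀ n → fromℕ n ≤ fromℕ 2 ^ n
    n≤2^n zero    = 0≤1
    n≤2^n (suc n) = ≤-trans (+-mono-≤ (^-monoʳ 1≤2 (z≤n {n})) (n≤2^n n)) (≤-reflexive (solve 1 (λ t → t :+ t := :2 :* t) refl (fromℕ 2 ^ n)))

    opaque
      1[_] : Set → ℝ
      1[ P ] with lem {P}
      ... | yes _ = 1ℝ
      ... | no  _ = 0ℝ

      1[]-yes : ∀ {P} → P → 1[ P ] ≡ 1ℝ
      1[]-yes {P} p with lem {P}
      ... | yes _ = refl
      ... | no ¬p = contradiction p ¬p

      1[]-no : ∀ {P} → ¬ P → 1[ P ] ≡ 0ℝ
      1[]-no {P} ¬p with lem {P}
      ... | yes p = contradiction p ¬p
      ... | no _  = refl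

      0≤1[] : ∀ P → 0ℝ ≤ 1[ P ]
      0≤1[] P with lem {P}
      ... | yes _ = 0≤1
      ... | no _  = ≤-refl

      1[]≤1 : ∀ P → 1[ P ] ≤ 1ℝ
      1[]≤1 P with lem {P}
      ... | yes _ = ≤-refl
      ... | no _  = 0≤1

    1[]-mono : ∀ {P Q} → (P → Q) → 1[ P ] ≤ 1[ Q ]
    1[]-mono {P} {Q} f with lem {P}
    ... | no ¬p = subst (_≤ 1[ Q ]) (sym (1[]-no ¬p)) (0≤1[] Q)
    ... | yes p = subst (1[ P ] ≤_) (sym (1[]-yes (f p))) (1[]≤1 P)

    1[]-cong : ∀ {P Q} → (P → Q) → (Q → P) → 1[ P ] ≡ 1[ Q ]
    1[]-cong f g = ≤-antisym (1[]-mono f) (1[]-mono g)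

    1[]-× : ∀ P Q → 1[ P × Q ] ≡ 1[ P ] * 1[ Q ]
    1[]-× P Q with lem {P}
    ... | no ¬p = trans (1[]-no (¬p ∘ proj₁)) (sym (trans (cong (_* 1[ Q ]) (1[]-no ¬p)) (ℝ.zeroˡ _)))
    ... | yes p = trans (1[]-cong proj₂ (p ,_)) (sym (trans (cong (_* 1[ Q ]) (1[]-yes p)) (ℝ.*-identityˡ _)))

  open OrderedField

  -- Square roots, logarithms and real powers

  module Analysis where

    private variable
      a b c x y s t : ℝ

    sup-isSupremum : ∀ {S : Pred ℝ 0ℓ} → Satisfiable S → Satisfiable (UpperBound _≤_ S) → IsSupremum _≤_ S (sup S)
    sup-isSupremum {S} p q with lem {Satisfiable S × Satisfiable (UpperBound _≤_ S)}
    ... | yes (p , q) = proj₂ (complete S p q)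
    ... | no ¬pq      = contradiction (p , q) ¬pq

    supremum-unique : ∀ {S : Pred ℝ 0ℓ} → IsSupremum _≤_ S s → IsSupremum _≤_ S t → s ≡ t
    supremum-unique (u , l) (u′ , l′) = ≤-antisym (l _ u′) (l′ _ u)

    sup≡ : ∀ {S : Pred ℝ 0ℓ} → Satisfiable S → IsSupremum _≤_ S s → sup S ≡ s
    sup≡ p q = supremum-unique (sup-isSupremum p (_ , proj₁ q)) q

    x²≤y²⇒x≤y : 0ℝ ≤ y → x * x ≤ y * y → x ≤ y
    x²≤y²⇒x≤y {y} {x} 0≤y p = ≮⇒≥ λ y<x → <⇒≱ (<-≤-trans (*-monoˡ-< (≤-<-trans 0≤y y<x) y<x) ≤-refl)
      (≤-trans p (*-monoʳ-≤ 0≤y (<⇒≤ y<x)))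

    x²≡y²⇒x≡y : 0ℝ ≤ x → 0ℝ ≤ y → x * x ≡ y * y → x ≡ y
    x²≡y²⇒x≡y 0≤x 0≤y p = ≤-antisym (x²≤y²⇒x≤y 0≤y (≤-reflexive p)) (x²≤y²⇒x≤y 0≤x (≤-reflexive (sym p)))

    module SquareRoot {x} (0≤x : 0ℝ ≤ x) where

      private
        S : Pred ℝ 0ℓ
        S t = t * t ≤ x

        isSup : IsSupremum _≤_ S (√ x)
        isSup = sup-isSupremum (0ℝ , subst (_≤ x) (sym (ℝ.zeroˡ 0ℝ)) 0≤x)
          (x + 1ℝ , λ t t²≤x → x²≤y²⇒x≤y (0≤+ 0≤x 0≤1) (≤-trans t²≤x (≤-cert (0≤+ (0≤+ 0≤1 0≤x) (0≤x² x))
            (solve 1 (λ x → (x :+ :1) :* (x :+ :1) := x :+ (:1 :+ x :+ x :* x)) refl x))))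

        r = √ x

      √-nonNeg : 0ℝ ≤ √ x
      √-nonNeg = proj₁ isSup 0ℝ (subst (_≤ x) (sym (ℝ.zeroˡ 0ℝ)) 0≤x)

      √-square : √ x * √ x ≡ x
      √-square = ≤-antisym (≮⇒≥ r²>x) (≮⇒≥ r²<x)
        where
        r²<x : ¬ (r * r < x)
        r²<x r²<x = <⇒≱ r<r+ε (proj₁ isSup (r + ε) (≤-cert (0≤* (<⇒≤ 0<ε) (0≤+ (<⇒≤ 0<d) (≤-cert (x≤y⇒0≤y-x ε≤1) refl)))
            (begin
              x                                      ≡⟨ solve 2 (λ x r → x := r :* r :+ (x :- r :* r)) refl x r ⟩
              r * r + d                              ≡⟨ cong (r * r +_) (sym (x/y*y (0<⇒≢ 0<k))) ⟩
              r * r + ε * k                          ≡⟨ solve 3 (λ r ε d → r :* r :+ ε :* (:2 :* r :+ :1 :+ d) := (r :+ ε) :* (r :+ ε) :+ ε :* (d :+ (:0 :+ (:1 :- ε)))) refl r ε d ⟩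
              (r + ε) * (r + ε) + ε * (d + (0ℝ + (1ℝ - ε))) ∎)))
          where
          open ≡-Reasoning
          d = x - r * r
          -- With this k the quotient ε = d / k is at most 1, so ε² is at most ε and (r + ε)²
          -- exceeds r² by at most ε (2 r + 1), which is at most d.
          k = fromℕ 2 * r + 1ℝ + d
          0<d = x<y⇒0<y-x r²<x
          0<k : 0ℝ < k
          0<k = subst (0ℝ <_) (solve 2 (λ d r → d :+ (:2 :* r :+ :1) := :2 :* r :+ :1 :+ d) refl d r) (0<+ 0<d (0≤+ (0≤* (<⇒≤ 0<2) √-nonNeg) 0≤1))
          ε = d / k
          0<ε = 0</ 0<d 0<k
          ε≤1 = x/z≤y 0<k (≤-cert (0≤+ (0≤* (<⇒≤ 0<2) √-nonNeg) 0≤1) (solve 2 (λ d r → :1 :* (:2 :* r :+ :1 :+ d) := d :+ (:2 :* r :+ :1)) refl d r))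
          r<r+ε : r < r + ε
          r<r+ε = 0<y-x⇒x<y (subst (0ℝ <_) (solve 2 (λ r ε → ε := r :+ ε :- r) refl r ε) 0<ε)
        r²>x : ¬ (x < r * r)
        r²>x x<r² = <⇒≱ r-ε<r (proj₂ isSup (r - ε) λ t t²≤x → x²≤y²⇒x≤y 0≤r-ε (≤-trans t²≤x (≤-cert (0≤x² ε) (begin
              (r - ε) * (r - ε)             ≡⟨ solve 2 (λ r ε → (r :- ε) :* (r :- ε) := r :* r :- ε :* (:2 :* r) :+ ε :* ε) refl r ε ⟩
              r * r - ε * (fromℕ 2 * r) + ε * ε ≡⟨ cong (λ w → r * r - w + ε * ε) (x/y*y (0<⇒≢ 0<2r)) ⟩
              r * r - (r * r - x) + ε * ε   ≡⟨ solve 3 (λ r ε x → r :* r :- (r :* r :- x) :+ ε :* ε := x :+ ε :* ε) refl r ε x ⟩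
              x + ε * ε                     ∎))))
          where
          open ≡-Reasoning
          0<r : 0ℝ < r
          0<r = 0≤∧≢⇒0< √-nonNeg λ r≡0 → <⇒≱ x<r² (subst (_≤ x) (sym (trans (cong (_* r) r≡0) (ℝ.zeroˡ r))) 0≤x)
          0<2r = 0<* 0<2 0<r
          -- The Newton step: (r - ε)² is still x + ε², hence r - ε is a smaller upper bound.
          ε = (r * r - x) / (fromℕ 2 * r)
          r-ε<r : r - ε < r
          r-ε<r = 0<y-x⇒x<y (subst (0ℝ <_) (solve 2 (λ r ε → ε := r :- (r :- ε)) refl r ε) (0</ (x<y⇒0<y-x x<r²) 0<2r))
          0≤r-ε : 0ℝ ≤ r - ε
          0≤r-ε = x≤y⇒0≤y-x (x/z≤y 0<2r (≤-cert (0≤+ 0≤x (0≤x² r)) (solve 2 (λ r x → r :* (:2 :* r) := r :* r :- x :+ (x :+ r :* r)) refl r x)))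

    open SquareRoot public using (√-nonNeg; √-square)

    √-pos : 0ℝ < x → 0ℝ < √ x
    √-pos {x} 0<x = 0≤∧≢⇒0< (√-nonNeg (<⇒≤ 0<x)) λ p → 0<⇒≢ 0<x (trans (sym (√-square (<⇒≤ 0<x))) (trans (cong (_* √ x) p) (ℝ.zeroˡ _)))

    √-unique : 0ℝ ≤ x → 0ℝ ≤ y → y * y ≡ x → y ≡ √ x
    √-unique 0≤x 0≤y p = x²≡y²⇒x≡y 0≤y (√-nonNeg 0≤x) (trans p (sym (√-square 0≤x)))

    √-* : 0ℝ ≤ x → 0ℝ ≤ y → √ (x * y) ≡ √ x * √ y
    √-* {x} {y} p q = sym (√-unique (0≤* p q) (0≤* (√-nonNeg p) (√-nonNeg q))
      (trans (solve 2 (λ a b → a :* b :* (a :* b) := a :* a :* (b :* b)) refl (√ x) (√ y)) (cong₂ _*_ (√-square p) (√-square q))))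

    vanishing-≤ : 0ℝ ≤ c → (∀ n → a ≤ b + c / fromℕ 2 ^ n) → a ≤ b
    vanishing-≤ {c} {a} {b} 0≤c h = ε-≤ λ ε 0<ε → let n , p = archimedean (c / ε) in
      ≤-trans (h n) (+-monoʳ-≤ b (x/z≤y (^-pos n 0<2)
        (subst (_≤ ε * fromℕ 2 ^ n) (x/y*y (0<⇒≢ 0<ε)) (subst (c / ε * ε ≤_) (ℝ.*-comm _ ε) (*-monoˡ-≤ (<⇒≤ 0<ε) (≤-trans p (n≤2^n n)))))))

    -- The natural logarithm as the limit of the decreasing sequence 2ⁿ (t^(1/2ⁿ) - 1).
    module Logarithm where

      root : ℕ → ℝ → ℝ
      root zero    t = t
      root (suc n) t = √ root n t

      root-pos : ∀ n → 0ℝ < t → 0ℝ < root n t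
      root-pos zero    p = p
      root-pos (suc n) p = √-pos (root-pos n p)

      root-* : ∀ n → 0ℝ < s → 0ℝ < t → root n (s * t) ≡ root n s * root n t
      root-* zero    p q = refl
      root-* (suc n) p q = trans (cong √_ (root-* n p q)) (√-* (<⇒≤ (root-pos n p)) (<⇒≤ (root-pos n q)))

      ℓ : ℕ → ℝ → ℝ
      ℓ n t = fromℕ 2 ^ n * (root n t - 1ℝ)

      ℓ-suc : ∀ n → 0ℝ < t → ℓ (suc n) t ≤ ℓ n t
      ℓ-suc {t} n p = ≤-cert (0≤* (^-nonNeg n (<⇒≤ 0<2)) (0≤x² (r - 1ℝ)))
        (trans (cong (λ w → k * (w - 1ℝ)) (sym (√-square (<⇒≤ (root-pos n p)))))
          (solve 2 (λ k r → k :* (r :* r :- :1) := :2 :* k :* (r :- :1) :+ k :* ((r :- :1) :* (r :- :1))) refl k r))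
        where
        k = fromℕ 2 ^ n
        r = √ root n t

      ℓ-mono : ∀ {m n} → 0ℝ < t → m ℕ.≤ n → ℓ n t ≤ ℓ m t
      ℓ-mono {t} {m} p m≤n = go (ℕ.≤⇒≤′ m≤n)
        where
        go : ∀ {n} → m ℕ.≤′ n → ℓ n t ≤ ℓ m t
        go (ℕ.≤′-reflexive refl) = ≤-refl
        go {suc n} (ℕ.≤′-step q) = ≤-trans (ℓ-suc n p) (go {n} q)

      ℓ-≤ : ∀ n → 0ℝ < t → ℓ n t ≤ t - 1ℝ
      ℓ-≤ {t} n p = subst (ℓ n t ≤_) (ℝ.*-identityˡ _) (ℓ-mono p (z≤n {n}))

      -- The functional equation of the logarithm holds up to a term that vanishes in the limit,
      -- since `bound` controls `ℓ n` uniformly in n.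
      ℓ-* : ∀ n → 0ℝ < s → 0ℝ < t → ℓ n (s * t) ≡ ℓ n s + ℓ n t + ℓ n s * ℓ n t / fromℕ 2 ^ n
      ℓ-* {s} {t} n p q = begin
        k * (root n (s * t) - 1ℝ)       ≡⟨ cong (λ w → k * (w - 1ℝ)) (root-* n p q) ⟩
        k * (u * v - 1ℝ)                ≡⟨ solve 3 (λ k x y → k :* (x :* y :- :1) := k :* (x :- :1) :+ k :* (y :- :1) :+ k :* (x :- :1) :* (y :- :1)) refl k u v ⟩
        A + B + A * (v - 1ℝ)            ≡⟨ cong (A + B +_) (x≡z/y (0<⇒≢ (^-pos n 0<2)) (solve 3 (λ k x y → k :* (x :- :1) :* (y :- :1) :* k := k :* (x :- :1) :* (k :* (y :- :1))) refl k u v)) ⟩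
        A + B + A * B / k               ∎
        where
        open ≡-Reasoning
        k = fromℕ 2 ^ n
        u = root n s
        v = root n t
        A = ℓ n s
        B = ℓ n t

      root-1 : ∀ n → root n 1ℝ ≡ 1ℝ
      root-1 zero    = refl
      root-1 (suc n) = trans (cong √_ (root-1 n)) (sym (√-unique 0≤1 0≤1 (ℝ.*-identityˡ 1ℝ)))

      ℓ-1 : ∀ n → ℓ n 1ℝ ≡ 0ℝ
      ℓ-1 n = trans (cong (λ w → fromℕ 2 ^ n * (w - 1ℝ)) (root-1 n)) (trans (cong (fromℕ 2 ^ n *_) (ℝ.-‿inverseʳ 1ℝ)) (ℝ.zeroʳ (fromℕ 2 ^ n)))

      -- This is `ℓ-≤` at the inverse of t, because ℓ n t + ℓ n (t ⁻¹) is nonnegative: the two roots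
      -- have product 1, hence sum at least 2.
      1-1/t≤ℓ : ∀ n → 0ℝ < t → 1ℝ - t ⁻¹ ≤ ℓ n t
      1-1/t≤ℓ {t} n p = ≤-trans (0≤y-x⇒x≤y (≤-trans (x≤y⇒0≤y-x (ℓ-≤ n p′)) (≤-reflexive (solve 2 (λ t' l → t' :- :1 :- l := :- l :- (:1 :- t')) refl (t ⁻¹) (ℓ n (t ⁻¹))))))
        (≤-cert 0≤sum (solve 2 (λ a b → a := :- b :+ (a :+ b)) refl (ℓ n t) (ℓ n (t ⁻¹))))
        where
        p′ = 0<⁻¹ p
        u = root n t
        v = root n (t ⁻¹)
        uv≡1 : u * v ≡ 1ℝ
        uv≡1 = trans (sym (root-* n p p′)) (trans (cong (root n) (*-inverseʳ t (0<⇒≢ p))) (root-1 n))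
        0≤sum : 0ℝ ≤ ℓ n t + ℓ n (t ⁻¹)
        0≤sum = subst (0ℝ ≤_) (begin
          fromℕ 2 ^ n * ((u - 1ℝ) * (u - 1ℝ) * v)                         ≡⟨ solve 3 (λ k x y → k :* ((x :- :1) :* (x :- :1) :* y) := k :* ((x :* y) :* x :- :2 :* (x :* y) :+ y)) refl (fromℕ 2 ^ n) u v ⟩
          fromℕ 2 ^ n * (u * v * u - fromℕ 2 * (u * v) + v)              ≡⟨ cong (λ w → fromℕ 2 ^ n * (w * u - fromℕ 2 * w + v)) uv≡1 ⟩
          fromℕ 2 ^ n * (1ℝ * u - fromℕ 2 * 1ℝ + v)                      ≡⟨ solve 3 (λ k x y → k :* (:1 :* x :- :2 :* :1 :+ y) := k :* (x :- :1) :+ k :* (y :- :1)) refl (fromℕ 2 ^ n) u v ⟩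
          ℓ n t + ℓ n (t ⁻¹)                                             ∎)
          (0≤* (^-nonNeg n (<⇒≤ 0<2)) (0≤* (0≤x² _) (<⇒≤ (root-pos n p′))))
          where open ≡-Reasoning

      bound : ℝ → ℝ
      bound t = t + t ⁻¹

      0≤bound : 0ℝ < t → 0ℝ ≤ bound t
      0≤bound p = 0≤+ (<⇒≤ p) (<⇒≤ (0<⁻¹ p))

      ℓ≤bound : ∀ n → 0ℝ < t → ℓ n t ≤ bound t
      ℓ≤bound {t} n p = ≤-trans (ℓ-≤ n p) (≤-cert (0≤+ 0≤1 (<⇒≤ (0<⁻¹ p))) (solve 2 (λ t t' → t :+ t' := t :- :1 :+ (:1 :+ t')) refl t (t ⁻¹)))

      -bound≤ℓ : ∀ n → 0ℝ < t → - bound t ≤ ℓ n t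
      -bound≤ℓ {t} n p = ≤-trans (≤-cert (0≤+ 0≤1 (<⇒≤ p)) (solve 2 (λ t t' → :1 :- t' := :- (t :+ t') :+ (:1 :+ t)) refl t (t ⁻¹))) (1-1/t≤ℓ n p)

      bounded-* : ∀ {m n} → - m ≤ a → a ≤ m → - n ≤ b → b ≤ n → a * b ≤ m * n
      bounded-* {a} {b} {m} {n} p p′ q q′ = *-cancelˡ-≤ 0<2 (≤-cert
        (0≤+ (0≤* (x≤y⇒0≤y-x p′) (x≤y⇒0≤y-x q)) (0≤* (x≤y⇒0≤y-x p) (x≤y⇒0≤y-x q′)))
        (solve 4 (λ a b m n → :2 :* (m :* n) := :2 :* (a :* b) :+ ((m :- a) :* (b :- :- n) :+ (a :- :- m) :* (n :- b))) refl a b m n))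

      opaque
        ln : ℝ → ℝ
        ln t = - sup (λ v → ∃ λ n → v ≡ - ℓ n t)

        private
          isSup : 0ℝ < t → IsSupremum _≤_ (λ v → ∃ λ n → v ≡ - ℓ n t) (sup (λ v → ∃ λ n → v ≡ - ℓ n t))
          isSup {t} p = sup-isSupremum (- ℓ 0 t , 0 , refl) (bound t , λ { _ (n , refl) → -x≤y⇒-y≤x (-bound≤ℓ n p) })

        ln≤ℓ : ∀ n → 0ℝ < t → ln t ≤ ℓ n t
        ln≤ℓ n p = -x≤y⇒-y≤x (proj₁ (isSup p) _ (n , refl))

        ln-greatest : 0ℝ < t → (∀ n → x ≤ ℓ n t) → x ≤ ln t
        ln-greatest p h = subst (_≤ ln _) (-‿involutive _) (neg-mono-≤ (proj₂ (isSup p) _ λ { _ (n , refl) → neg-mono-≤ (h n) }))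

      ln≤x-1 : 0ℝ < t → ln t ≤ t - 1ℝ
      ln≤x-1 p = ≤-trans (ln≤ℓ 0 p) (ℓ-≤ 0 p)

      ln-*-≤ : 0ℝ < s → 0ℝ < t → ln (s * t) ≤ ln s + ln t
      ln-*-≤ {s} {t} p q = swap (ln-greatest q λ n → swap′ (ln-greatest p λ m → step m n))
        where
        swap : ln (s * t) - ln s ≤ x → ln (s * t) ≤ ln s + x
        swap {x} h = ≤-cert (x≤y⇒0≤y-x h) (solve 3 (λ a b x → b :+ x := a :+ (x :- (a :- b))) refl (ln (s * t)) (ln s) x)
        swap′ : ln (s * t) - y ≤ x → ln (s * t) - x ≤ y
        swap′ {y} {x} h = ≤-cert (x≤y⇒0≤y-x h) (solve 3 (λ a y x → y := a :- x :+ (x :- (a :- y))) refl (ln (s * t)) y x)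
        K = bound s * bound t
        step : ∀ m n → ln (s * t) - ℓ n t ≤ ℓ m s
        step m n = vanishing-≤ (0≤* (0≤bound p) (0≤bound q)) λ k → let N = k ℕ.+ (m ℕ.+ n) in begin
          ln (s * t) - ℓ n t                                   ≤⟨ +-monoˡ-≤ _ (ln≤ℓ N (0<* p q)) ⟩
          ℓ N (s * t) - ℓ n t                                  ≡⟨ cong (_- ℓ n t) (ℓ-* N p q) ⟩
          ℓ N s + ℓ N t + ℓ N s * ℓ N t / fromℕ 2 ^ N - ℓ n t  ≤⟨ +-monoˡ-≤ _ (+-mono-≤ (+-mono-≤ (ℓ-mono p (ℕ.≤-trans (ℕ.m≤m+n m n) (ℕ.m≤n+m _ k))) (ℓ-mono q (ℕ.≤-trans (ℕ.m≤n+m n m) (ℕ.m≤n+m _ k))))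
                                                                  (≤-trans (/-monoˡ-≤ (^-nonNeg N (<⇒≤ 0<2)) (bounded-* (-bound≤ℓ N p) (ℓ≤bound N p) (-bound≤ℓ N q) (ℓ≤bound N q))) (shrink k (m ℕ.+ n)))) ⟩
          ℓ m s + ℓ n t + K / fromℕ 2 ^ k - ℓ n t              ≡⟨ solve 3 (λ a b c → a :+ b :+ c :- b := a :+ c) refl (ℓ m s) (ℓ n t) (K / fromℕ 2 ^ k) ⟩
          ℓ m s + K / fromℕ 2 ^ k                              ∎
          where
          open ≤-Reasoning
          shrink : ∀ k l → K / fromℕ 2 ^ (k ℕ.+ l) ≤ K / fromℕ 2 ^ k
          shrink k l = x≤y/z (^-pos k 0<2) (subst (K / fromℕ 2 ^ (k ℕ.+ l) * fromℕ 2 ^ k ≤_) (x/y*y (0<⇒≢ (^-pos (k ℕ.+ l) 0<2)))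
            (*-monoʳ-≤ (0≤/ (0≤* (0≤bound p) (0≤bound q)) (^-nonNeg (k ℕ.+ l) (<⇒≤ 0<2))) (^-monoʳ 1≤2 (ℕ.m≤m+n k l))))

      ln-1 : ln 1ℝ ≡ 0ℝ
      ln-1 = ≤-antisym (subst (ln 1ℝ ≤_) (ℓ-1 0) (ln≤ℓ 0 0<1)) (ln-greatest 0<1 λ n → ≤-reflexive (sym (ℓ-1 n)))

      ln-⁻¹-≤ : 0ℝ < t → ln t + ln (t ⁻¹) ≤ 0ℝ
      ln-⁻¹-≤ {t} p = vanishing-≤ (0≤* (0≤bound p) (0≤bound p′)) λ n → begin
        ln t + ln (t ⁻¹)                  ≤⟨ +-mono-≤ (ln≤ℓ n p) (ln≤ℓ n p′) ⟩
        ℓ n t + ℓ n (t ⁻¹)                ≡⟨ trans (solve 3 (λ a b c → a :+ b := a :+ b :+ c :+ :- c) refl (ℓ n t) (ℓ n (t ⁻¹)) (ℓ n t * ℓ n (t ⁻¹) / fromℕ 2 ^ n)) (cong (_+ - (ℓ n t * ℓ n (t ⁻¹) / fromℕ 2 ^ n)) (sym (ℓ-* n p p′))) ⟩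
        ℓ n (t * t ⁻¹) + - (ℓ n t * ℓ n (t ⁻¹) / fromℕ 2 ^ n) ≡⟨ cong₂ _+_ (trans (cong (ℓ n) (*-inverseʳ t (0<⇒≢ p))) (ℓ-1 n)) (solve 3 (λ a b k → :- (a :* b :* k) := :- a :* b :* k) refl (ℓ n t) (ℓ n (t ⁻¹)) ((fromℕ 2 ^ n) ⁻¹)) ⟩
        0ℝ + (- ℓ n t * ℓ n (t ⁻¹)) / fromℕ 2 ^ n         ≤⟨ +-monoʳ-≤ 0ℝ (/-monoˡ-≤ (^-nonNeg n (<⇒≤ 0<2)) (bounded-* (neg-mono-≤ (ℓ≤bound n p)) (-x≤y⇒-y≤x (-bound≤ℓ n p)) (-bound≤ℓ n p′) (ℓ≤bound n p′))) ⟩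
        0ℝ + bound t * bound (t ⁻¹) / fromℕ 2 ^ n                 ∎
        where
        open ≤-Reasoning
        p′ = 0<⁻¹ p

      -- Subadditivity gives the other direction as well when applied to s = (s t) t⁻¹, once ln t +
      -- ln (t ⁻¹) is known to be at most 0.
      ln-* : 0ℝ < s → 0ℝ < t → ln (s * t) ≡ ln s + ln t
      ln-* {s} {t} p q = ≤-antisym (ln-*-≤ p q) (≤-cert (0≤+ (x≤y⇒0≤y-x h) (x≤y⇒0≤y-x (ln-⁻¹-≤ q)))
        (solve 4 (λ a b c d → a := b :+ c :+ ((a :+ d :- b) :+ (:0 :- (c :+ d)))) refl (ln (s * t)) (ln s) (ln t) (ln (t ⁻¹))))
        where
        h : ln s ≤ ln (s * t) + ln (t ⁻¹)
        h = subst (λ w → ln w ≤ ln (s * t) + ln (t ⁻¹)) (trans (ℝ.*-assoc s t _) (trans (cong (s *_) (*-inverseʳ t (0<⇒≢ q))) (ℝ.*-identityʳ s))) (ln-*-≤ (0<* p q) (0<⁻¹ q))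

    open Logarithm public using (ln; ln≤x-1; ln-*; ln-1)

    ln-⁻¹ : 0ℝ < t → ln (t ⁻¹) ≡ - ln t
    ln-⁻¹ {t} p = begin
      ln (t ⁻¹)                   ≡⟨ solve 2 (λ a b → b := (a :+ b) :- a) refl (ln t) (ln (t ⁻¹)) ⟩
      (ln t + ln (t ⁻¹)) - ln t   ≡⟨ cong (_- ln t) (trans (sym (ln-* p (0<⁻¹ p))) (trans (cong ln (*-inverseʳ t (0<⇒≢ p))) ln-1)) ⟩
      0ℝ - ln t                   ≡⟨ ℝ.+-identityˡ _ ⟩
      - ln t                      ∎
      where open ≡-Reasoning

    ln-/ : 0ℝ < s → 0ℝ < t → ln (s / t) ≡ ln s - ln t
    ln-/ p q = trans (ln-* p (0<⁻¹ q)) (cong (ln _ +_) (ln-⁻¹ q))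

    ln-^ : ∀ n → 0ℝ < t → ln (t ^ n) ≡ fromℕ n * ln t
    ln-^ zero    p = trans ln-1 (sym (ℝ.zeroˡ _))
    ln-^ {t} (suc n) p = trans (ln-* p (^-pos n p)) (trans (cong (ln t +_) (ln-^ n p)) (solve 2 (λ n l → l :+ n :* l := (:1 :+ n) :* l) refl (fromℕ n) (ln t)))

    ln-mono-< : 0ℝ < s → s < t → ln s < ln t
    ln-mono-< {s} {t} p s<t = 0<y-x⇒x<y (<-≤-trans (x<y⇒0<y-x s/t<1) (≤-trans (0≤y-x⇒x≤y (≤-trans (x≤y⇒0≤y-x (ln≤x-1 (0</ p q)))
        (≤-reflexive (solve 2 (λ r l → r :- :1 :- l := :- l :- (:1 :- r)) refl (s / t) (ln (s / t))))))
      (≤-reflexive (trans (cong -_ (ln-/ p q)) (solve 2 (λ a b → :- (a :- b) := b :- a) refl (ln s) (ln t))))))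
      where
      q = <-trans p s<t
      s/t<1 : s / t < 1ℝ
      s/t<1 = subst (s / t <_) (x/x (0<⇒≢ q)) (*-monoˡ-< (0<⁻¹ q) s<t)

    ln-mono-≤ : 0ℝ < s → s ≤ t → ln s ≤ ln t
    ln-mono-≤ {s} {t} p s≤t with lem {s ≡ t}
    ... | yes refl = ≤-refl
    ... | no s≢t   = <⇒≤ (ln-mono-< p (s≤t , s≢t))

    ln-cancel-≤ : 0ℝ < t → ln s ≤ ln t → s ≤ t
    ln-cancel-≤ p h = ≮⇒≥ λ t<s → <⇒≱ (ln-mono-< p t<s) h

    ln2 : ℝ
    ln2 = ln (fromℕ 2)

    0<ln2 : 0ℝ < ln2
    0<ln2 = subst (_< ln2) ln-1 (ln-mono-< 0<1 (subst (1ℝ <_) (sym 2≡1+1) (x<x+1 1ℝ)))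

    ln2≤1 : ln2 ≤ 1ℝ
    ln2≤1 = ≤-trans (ln≤x-1 0<2) (≤-reflexive (solve 0 (:2 :- :1 := :1) refl))

    -- `ln≤x-1` at ½. This numerical bound converts powers of 2 into natural logarithms when the
    -- constants are chosen.
    ½≤ln2 : 1ℝ ≤ fromℕ 2 * ln2
    ½≤ln2 = *-cancelˡ-≤ 0<½ (≤-cert (x≤y⇒0≤y-x (ln≤x-1 0<½))
      (begin
        h * (fromℕ 2 * ln2)             ≡⟨ solve 2 (λ h l → h :* (:2 :* l) := h :* :2 :* l) refl h ln2 ⟩
        h * fromℕ 2 * ln2               ≡⟨ cong (_* ln2) h2 ⟩
        1ℝ * ln2                        ≡⟨ solve 1 (λ l → :1 :* l := :- :- l) refl ln2 ⟩
        - - ln2                         ≡⟨ cong -_ (sym (ln-⁻¹ 0<2)) ⟩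
        - ln h                          ≡⟨ solve 2 (λ h l → :- l := (:1 :- h) :+ (h :- :1 :- l)) refl h (ln h) ⟩
        (1ℝ - h) + (h - 1ℝ - ln h)      ≡⟨ cong (λ w → (w - h) + (h - 1ℝ - ln h)) (sym h2) ⟩
        (h * fromℕ 2 - h) + (h - 1ℝ - ln h) ≡⟨ cong (_+ (h - 1ℝ - ln h)) (solve 1 (λ h → h :* :2 :- h := h :* :1) refl h) ⟩
        h * 1ℝ + (h - 1ℝ - ln h)        ∎))
      where
      open ≡-Reasoning
      h = fromℕ 2 ⁻¹
      0<½ = 0<⁻¹ 0<2
      h2 : h * fromℕ 2 ≡ 1ℝ
      h2 = trans (ℝ.*-comm h _) (*-inverseʳ _ (0<⇒≢ 0<2))

    log₂≡ : 0ℝ < x → log₂ x ≡ ln x / ln2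
    log₂≡ {x} p = sup≡ nonempty (upper , least)
      where
      S : Pred ℝ 0ℓ
      S r = Σ ℕ λ a → Σ ℕ λ b → Σ ℕ λ c → fromℕ 2 ^ a ≤ fromℕ 2 ^ b * x ^ suc c × r ≡ (fromℕ a - fromℕ b) / fromℕ (suc c)
      L = ln x / ln2
      Lln2 : L * ln2 ≡ ln x
      Lln2 = x/y*y (0<⇒≢ 0<ln2)
      to : ∀ a b c → fromℕ 2 ^ a ≤ fromℕ 2 ^ b * x ^ suc c → fromℕ a ≤ fromℕ b + fromℕ (suc c) * L
      to a b c h = *-cancelˡ-≤ 0<ln2 (subst₂ _≤_ (trans (ln-^ a 0<2) (ℝ.*-comm _ _))
        (begin
          ln (fromℕ 2 ^ b * x ^ suc c)               ≡⟨ ln-* (^-pos b 0<2) (^-pos (suc c) p) ⟩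
          ln (fromℕ 2 ^ b) + ln (x ^ suc c)          ≡⟨ cong₂ _+_ (ln-^ b 0<2) (ln-^ (suc c) p) ⟩
          fromℕ b * ln2 + fromℕ (suc c) * ln x       ≡⟨ cong (λ w → fromℕ b * ln2 + fromℕ (suc c) * w) (sym Lln2) ⟩
          fromℕ b * ln2 + fromℕ (suc c) * (L * ln2)  ≡⟨ solve 4 (λ b c L l → b :* l :+ c :* (L :* l) := l :* (b :+ c :* L)) refl (fromℕ b) (fromℕ (suc c)) L ln2 ⟩
          ln2 * (fromℕ b + fromℕ (suc c) * L)        ∎)
        (ln-mono-≤ (^-pos a 0<2) h))
        where open ≡-Reasoning
      from : ∀ a b c → fromℕ a ≤ fromℕ b + fromℕ (suc c) * L → fromℕ 2 ^ a ≤ fromℕ 2 ^ b * x ^ suc c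
      from a b c h = ln-cancel-≤ (0<* (^-pos b 0<2) (^-pos (suc c) p)) (begin
        ln (fromℕ 2 ^ a)                             ≡⟨ ln-^ a 0<2 ⟩
        fromℕ a * ln2                                ≤⟨ *-monoˡ-≤ (<⇒≤ 0<ln2) h ⟩
        (fromℕ b + fromℕ (suc c) * L) * ln2          ≡⟨ solve 4 (λ b c L l → (b :+ c :* L) :* l := b :* l :+ c :* (L :* l)) refl (fromℕ b) (fromℕ (suc c)) L ln2 ⟩
        fromℕ b * ln2 + fromℕ (suc c) * (L * ln2)    ≡⟨ cong (λ w → fromℕ b * ln2 + fromℕ (suc c) * w) Lln2 ⟩
        fromℕ b * ln2 + fromℕ (suc c) * ln x         ≡⟨ sym (cong₂ _+_ (ln-^ b 0<2) (ln-^ (suc c) p)) ⟩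
        ln (fromℕ 2 ^ b) + ln (x ^ suc c)            ≡⟨ sym (ln-* (^-pos b 0<2) (^-pos (suc c) p)) ⟩
        ln (fromℕ 2 ^ b * x ^ suc c)                 ∎)
        where open ≤-Reasoning
      upper : UpperBound _≤_ S L
      upper _ (a , b , c , h , refl) = x/z≤y (0<fromℕ-suc c) (≤-cert (x≤y⇒0≤y-x (to a b c h))
        (solve 4 (λ a b c L → L :* c := a :- b :+ (b :+ c :* L :- a)) refl (fromℕ a) (fromℕ b) (fromℕ (suc c)) L))
      nonempty : Satisfiable S
      nonempty = let b , h = archimedean (- L) in _ , 0 , b , 0 ,
        from 0 b 0 (≤-trans (x≤y⇒0≤y-x h) (≤-reflexive (solve 2 (λ b L → b :- :- L := b :+ (:1 :+ :0) :* L) refl (fromℕ b) L))) , refl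
      least : LowerBound _≤_ (UpperBound _≤_ S) L
      least u ub = ≮⇒≥ λ u<L →
        let g = L - u
            0<g = x<y⇒0<y-x u<L
            -- A denominator C with C (L - u) at least 2 leaves room for an integer strictly above C
            -- u and not above C L; the shift by b keeps numerators natural.
            c , hc = archimedean (fromℕ 2 / g)
            C = fromℕ (suc c)
            b , hb = archimedean (- (C * u))
            0≤v : 0ℝ ≤ C * u + fromℕ b
            0≤v = ≤-trans (x≤y⇒0≤y-x hb) (≤-reflexive (solve 2 (λ b v → b :- :- v := v :+ b) refl (fromℕ b) (C * u)))
            a , a≥ , a≤ = ceiling (C * u + fromℕ b) 0≤v
            2≤Cg : fromℕ 2 ≤ C * g
            2≤Cg = subst (_≤ C * g) (x/y*y (0<⇒≢ 0<g)) (*-monoˡ-≤ (<⇒≤ 0<g) (≤-trans hc (≤-cert 0≤1 (ℝ.+-comm 1ℝ (fromℕ c)))))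
            member : fromℕ (suc a) ≤ fromℕ b + C * L
            member = ≤-cert (0≤+ (x≤y⇒0≤y-x a≤) (x≤y⇒0≤y-x 2≤Cg))
              (solve 5 (λ a b C L u → b :+ C :* L := (:1 :+ a) :+ ((C :* u :+ b :+ :1 :- a) :+ (C :* (L :- u) :- :2))) refl (fromℕ a) (fromℕ b) C L u)
            r = (fromℕ (suc a) - fromℕ b) / C
            r≤u : r ≤ u
            r≤u = ub r (suc a , b , c , from (suc a) b c member , refl)
            bad : fromℕ (suc a) - fromℕ b ≤ u * C
            bad = subst (_≤ u * C) (x/y*y (0<⇒≢ (0<fromℕ-suc c))) (*-monoˡ-≤ (0≤fromℕ (suc c)) r≤u)
        in <⇒≱ 0<1 (≤-cert (0≤+ (x≤y⇒0≤y-x bad) (x≤y⇒0≤y-x a≥))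
              (solve 4 (λ a b C u → :0 := :1 :+ ((u :* C :- (:1 :+ a :- b)) :+ (a :- (C :* u :+ b)))) refl (fromℕ a) (fromℕ b) C u))

    module Exponential (z : ℝ) where

      private
        S : Pred ℝ 0ℓ
        S t = 0ℝ < t × log₂ t ≤ z

        w = z * ln2

        to : S t → ln t ≤ w
        to {t} (p , h) = subst (_≤ w) (x/y*y (0<⇒≢ 0<ln2)) (*-monoˡ-≤ (<⇒≤ 0<ln2) (subst (_≤ z) (log₂≡ p) h))

        from : 0ℝ < t → ln t ≤ w → S t
        from {t} p h = p , subst (_≤ z) (sym (log₂≡ p)) (x/z≤y 0<ln2 h)

        small : ∃ λ t → S t
        small = let n , h = archimedean (- z) in (fromℕ 2 ^ n) ⁻¹ , from (0<⁻¹ (^-pos n 0<2))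
          (subst (_≤ w) (sym (trans (ln-⁻¹ (^-pos n 0<2)) (cong -_ (ln-^ n 0<2))))
            (≤-cert (0≤* (x≤y⇒0≤y-x h) (<⇒≤ 0<ln2)) (solve 3 (λ z n l → z :* l := :- (n :* l) :+ (n :- :- z) :* l) refl z (fromℕ n) ln2)))

        isSup : IsSupremum _≤_ S (exp₂ z)
        isSup = sup-isSupremum small (let n , h = archimedean z in fromℕ 2 ^ n , λ t h′ →
          ln-cancel-≤ (^-pos n 0<2) (≤-trans (to h′) (≤-trans (*-monoˡ-≤ (<⇒≤ 0<ln2) h) (≤-reflexive (sym (ln-^ n 0<2))))))

        σ = exp₂ z

      exp₂-pos : 0ℝ < exp₂ z
      exp₂-pos = <-≤-trans (proj₁ (proj₂ small)) (proj₁ isSup _ (proj₂ small))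

      -- Scaling by 1 + g changes the logarithm by at most g. With g the supposed gap, the supremum
      -- could be scaled up within the set, or scaled down and remain an upper bound.
      ln-exp₂ : ln (exp₂ z) ≡ z * ln2
      ln-exp₂ = ≤-antisym (≮⇒≥ above) (≮⇒≥ below)
        where
        0<1+ : ∀ {g} → 0ℝ < g → 0ℝ < 1ℝ + g
        0<1+ p = 0<+ 0<1 (<⇒≤ p)
        ln1+ : ∀ {g} → 0ℝ < g → ln (1ℝ + g) ≤ g
        ln1+ {g} p = ≤-trans (ln≤x-1 (0<1+ p)) (≤-reflexive (solve 1 (λ g → :1 :+ g :- :1 := g) refl g))
        s<s[1+] : ∀ {g s} → 0ℝ < s → 0ℝ < g → s < s * (1ℝ + g)
        s<s[1+] {g} {s} 0<s p = 0<y-x⇒x<y (subst (0ℝ <_) (solve 2 (λ s g → s :* g := s :* (:1 :+ g) :- s) refl s g) (0<* 0<s p))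
        above : ¬ (w < ln σ)
        above h = <⇒≱ (subst (s′ <_) (x/y*y (0<⇒≢ (0<1+ 0<g))) (s<s[1+] 0<s′ 0<g)) (proj₂ isSup s′ λ t t∈ → ln-cancel-≤ 0<s′ (≤-trans (to t∈)
          (subst (w ≤_) (sym (ln-/ exp₂-pos (0<1+ 0<g))) (≤-cert (x≤y⇒0≤y-x (ln1+ 0<g)) (solve 3 (λ a w l → a :- l := w :+ (a :- w :- l)) refl (ln σ) w (ln (1ℝ + g)))))))
          where
          g = ln σ - w
          0<g = x<y⇒0<y-x h
          s′ = σ / (1ℝ + g)
          0<s′ = 0</ exp₂-pos (0<1+ 0<g)
        below : ¬ (ln σ < w)
        below h = <⇒≱ (s<s[1+] exp₂-pos 0<g) (proj₁ isSup _ (from (0<* exp₂-pos (0<1+ 0<g))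
          (subst (_≤ w) (sym (ln-* exp₂-pos (0<1+ 0<g))) (≤-cert (x≤y⇒0≤y-x (ln1+ 0<g)) (solve 3 (λ a w l → w := a :+ l :+ (w :- a :- l)) refl (ln σ) w (ln (1ℝ + g)))))))
          where
          g = w - ln σ
          0<g = x<y⇒0<y-x h

    open Exponential public

    pow-pos : ∀ x y → 0ℝ < pow x y
    pow-pos x y = exp₂-pos (y * log₂ x)

    ln-pow : ∀ y → 0ℝ < x → ln (pow x y) ≡ y * ln x
    ln-pow {x} y p = trans (ln-exp₂ (y * log₂ x)) (trans (ℝ.*-assoc y _ _) (cong (y *_) (trans (cong (_* ln2) (log₂≡ p)) (x/y*y (0<⇒≢ 0<ln2)))))

  open Analysis

  -- Sums and finitely supported expectations as monotone linear functionals

  module Expectations where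

    private variable
      A B : Set
      a b c s t x y : ℝ
      n : ℕ

    -- Finite sums, sums over transcripts and expectations are all handled through this interface,
    -- so Fubini, Gibbs and the log-sum inequality are proved once for all of them.
    record IsLinear {A : Set} (F : (A → ℝ) → ℝ) : Set where
      field
        additive    : ∀ f g → F (λ x → f x + g x) ≡ F f + F g
        homogeneous : ∀ c f → F (λ x → c * f x) ≡ c * F f
        monotone    : ∀ {f g} → (∀ x → f x ≤ g x) → F f ≤ F g

      congruent : ∀ {f g} → (∀ x → f x ≡ g x) → F f ≡ F g
      congruent h = ≤-antisym (monotone (≤-reflexive ∘ h)) (monotone (≤-reflexive ∘ sym ∘ h))

      homogeneousʳ : ∀ c f → F (λ x → f x * c) ≡ F f * c
      homogeneousʳ c f = trans (congruent λ x → ℝ.*-comm (f x) c) (trans (homogeneous c f) (ℝ.*-comm c _))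

      null : F (λ _ → 0ℝ) ≡ 0ℝ
      null = trans (congruent λ _ → sym (ℝ.zeroˡ 0ℝ)) (trans (homogeneous 0ℝ (λ _ → 0ℝ)) (ℝ.zeroˡ _))

      nonNegative : ∀ {f} → (∀ x → 0ℝ ≤ f x) → 0ℝ ≤ F f
      nonNegative h = subst (_≤ F _) null (monotone h)

      subtractive : ∀ f g → F (λ x → f x - g x) ≡ F f - F g
      subtractive f g = trans (additive f (λ x → - g x)) (cong (F f +_)
        (trans (congruent λ x → solve 1 (λ g → :- g := :- :1 :* g) refl (g x)) (trans (homogeneous (- 1ℝ) g) (solve 1 (λ g → :- :1 :* g := :- g) refl (F g)))))

    open IsLinear

    ∘-linear : ∀ {F : (A → ℝ) → ℝ} {G : A → (B → ℝ) → ℝ} → IsLinear F → (∀ a → IsLinear (G a)) →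
               IsLinear {A = A × B} λ f → F λ a → G a λ b → f (a , b)
    ∘-linear F G = record
      { additive    = λ f g → trans (congruent F λ a → additive (G a) _ _) (additive F _ _)
      ; homogeneous = λ c f → trans (congruent F λ a → homogeneous (G a) c _) (homogeneous F c _)
      ; monotone    = λ h → monotone F λ a → monotone (G a) λ b → h (a , b)
      }

    ∑-linear : ∀ n → IsLinear {A = Fin n} sum
    ∑-linear zero    = record { additive = λ _ _ → sym (ℝ.+-identityˡ 0ℝ) ; homogeneous = λ c _ → sym (ℝ.zeroʳ c) ; monotone = λ _ → ≤-refl }
    ∑-linear (suc n) = record
      { additive = λ f g → trans (cong ((f zero + g zero) +_) (additive (∑-linear n) (f ∘ suc) (g ∘ suc)))
          (solve 4 (λ a b c d → a :+ b :+ (c :+ d) := a :+ c :+ (b :+ d)) refl (f zero) (g zero) (sum (f ∘ suc)) (sum (g ∘ suc)))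
      ; homogeneous = λ c f → trans (cong (c * f zero +_) (homogeneous (∑-linear n) c (f ∘ suc))) (sym (ℝ.distribˡ c (f zero) (sum (f ∘ suc))))
      ; monotone = λ h → +-mono-≤ (h zero) (monotone (∑-linear n) (h ∘ suc))
      }

    ∑-swap : ∀ {F : (A → ℝ) → ℝ} → IsLinear F → ∀ {n} (f : Fin n → A → ℝ) → F (λ a → ∑[ i < n ] f i a) ≡ ∑[ i < n ] F (f i)
    ∑-swap F {zero}  f = null F
    ∑-swap {F = φ} F {suc n} f = trans (additive F (f zero) (λ a → ∑[ i < n ] f (suc i) a)) (cong (φ (f zero) +_) (∑-swap F (f ∘ suc)))

    sumAll-linear : ∀ {n} (ks : Vec ℕ n) → IsLinear (sumAll ks)
    sumAll-linear []       = record { additive = λ _ _ → refl ; homogeneous = λ _ _ → refl ; monotone = λ h → h [] }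
    sumAll-linear (k ∷ ks) = record
      { additive    = λ f g → trans (congruent (∑-linear k) λ a → additive (sumAll-linear ks) (λ m → f (a ∷ m)) (λ m → g (a ∷ m)))
          (additive (∑-linear k) (λ a → sumAll ks λ m → f (a ∷ m)) (λ a → sumAll ks λ m → g (a ∷ m)))
      ; homogeneous = λ c f → trans (congruent (∑-linear k) λ a → homogeneous (sumAll-linear ks) c (λ m → f (a ∷ m)))
          (homogeneous (∑-linear k) c (λ a → sumAll ks λ m → f (a ∷ m)))
      ; monotone    = λ h → monotone (∑-linear k) λ a → monotone (sumAll-linear ks) λ m → h (a ∷ m)
      }

    sumAll-swap : ∀ {F : (A → ℝ) → ℝ} → IsLinear F → ∀ {n} (ks : Vec ℕ n) (f : All Fin ks → A → ℝ) →
                  F (λ a → sumAll ks λ m → f m a) ≡ sumAll ks λ m → F (f m)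
    sumAll-swap F []       f = refl
    sumAll-swap F (k ∷ ks) f = trans (∑-swap F (λ i a → sumAll ks λ m → f (i ∷ m) a)) (congruent (∑-linear k) λ a → sumAll-swap F ks (λ m → f (a ∷ m)))

    term≤∑ : ∀ {n} {f : Fin n → ℝ} → (∀ i → 0ℝ ≤ f i) → ∀ i → f i ≤ sum f
    term≤∑ {suc n} h zero    = ≤-cert (nonNegative (∑-linear n) (h ∘ suc)) refl
    term≤∑ {suc n} {f} h (suc i) = ≤-trans (term≤∑ (h ∘ suc) i) (≤-cert (h zero) (ℝ.+-comm (f zero) (sum (f ∘ suc))))

    term≤sumAll : ∀ {n} {ks : Vec ℕ n} {f : All Fin ks → ℝ} → (∀ m → 0ℝ ≤ f m) → ∀ m → f m ≤ sumAll ks f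
    term≤sumAll h []                     = ≤-refl
    term≤sumAll {ks = k ∷ ks} h (a ∷ m) = ≤-trans (term≤sumAll (λ m → h (a ∷ m)) m) (term≤∑ (λ a → nonNegative (sumAll-linear ks) λ m → h (a ∷ m)) a)

    ∑-zero : ∀ {n} {f : Fin n → ℝ} → (∀ i → f i ≡ 0ℝ) → sum f ≡ 0ℝ
    ∑-zero {n} h = trans (congruent (∑-linear n) h) (null (∑-linear n))

    ∑-indicator : ∀ {n} (j : Fin n) (f : Fin n → ℝ) → ∑[ i < n ] (1[ i ≡ j ] * f i) ≡ f j
    ∑-indicator {suc n} zero f = trans (cong₂ _+_ (trans (cong (_* f zero) (1[]-yes refl)) (ℝ.*-identityˡ _))
      (∑-zero {n} λ i → trans (cong (_* f (suc i)) (1[]-no {P = suc i ≡ zero} λ ())) (ℝ.zeroˡ (f (suc i))))) (ℝ.+-identityʳ (f zero))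
    ∑-indicator {suc n} (suc j) f = trans (cong₂ _+_ (trans (cong (_* f zero) (1[]-no {P = zero ≡ suc j} λ ())) (ℝ.zeroˡ _))
      (trans (congruent (∑-linear n) λ i → cong (_* f (suc i)) (1[]-cong Fin.suc-injective (cong suc))) (∑-indicator j (f ∘ suc)))) (ℝ.+-identityˡ _)

    sumBits : ∀ n → (Vec Bool n → ℝ) → ℝ
    sumBits zero    f = f []
    sumBits (suc n) f = sumBits n (λ m → f (true ∷ m)) + sumBits n (λ m → f (false ∷ m))

    sumBits-linear : ∀ n → IsLinear (sumBits n)
    sumBits-linear zero    = record { additive = λ _ _ → refl ; homogeneous = λ _ _ → refl ; monotone = λ h → h [] }
    sumBits-linear (suc n) = record
      { additive    = λ f g → trans (cong₂ _+_ (additive (sumBits-linear n) _ _) (additive (sumBits-linear n) _ _))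
          (solve 4 (λ a b c d → a :+ b :+ (c :+ d) := a :+ c :+ (b :+ d)) refl (⟨ true ⟩ f) (⟨ true ⟩ g) (⟨ false ⟩ f) (⟨ false ⟩ g))
      ; homogeneous = λ c f → trans (cong₂ _+_ (homogeneous (sumBits-linear n) c _) (homogeneous (sumBits-linear n) c _)) (sym (ℝ.distribˡ c (⟨ true ⟩ f) (⟨ false ⟩ f)))
      ; monotone    = λ h → +-mono-≤ (monotone (sumBits-linear n) λ m → h (true ∷ m)) (monotone (sumBits-linear n) λ m → h (false ∷ m))
      }
      where
      ⟨_⟩_ : Bool → (Vec Bool (suc n) → ℝ) → ℝ
      ⟨ b ⟩ f = sumBits n λ m → f (b ∷ m)

    sumBits-swap : ∀ {F : (A → ℝ) → ℝ} → IsLinear F → ∀ n (f : Vec Bool n → A → ℝ) →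
                   F (λ a → sumBits n λ m → f m a) ≡ sumBits n λ m → F (f m)
    sumBits-swap F zero    f = refl
    sumBits-swap F (suc n) f = trans (additive F _ _) (cong₂ _+_ (sumBits-swap F n _) (sumBits-swap F n _))

    term≤sumBits : ∀ {n} {f : Vec Bool n → ℝ} → (∀ m → 0ℝ ≤ f m) → ∀ m → f m ≤ sumBits n f
    term≤sumBits h []          = ≤-refl
    term≤sumBits {suc n} h (true ∷ m)  = ≤-trans (term≤sumBits (λ m → h (true ∷ m)) m) (≤-cert (nonNegative (sumBits-linear n) λ m → h (false ∷ m)) refl)
    term≤sumBits {suc n} h (false ∷ m) = ≤-trans (term≤sumBits (λ m → h (false ∷ m)) m) (≤-cert (nonNegative (sumBits-linear n) λ m → h (true ∷ m)) (ℝ.+-comm _ _))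

    sumBits-indicator : ∀ {n} (m : Vec Bool n) (f : Vec Bool n → ℝ) → sumBits n (λ m′ → 1[ m′ ≡ m ] * f m′) ≡ f m
    sumBits-indicator [] f = trans (cong (_* f []) (1[]-yes refl)) (ℝ.*-identityˡ _)
    sumBits-indicator {suc n} (b ∷ m) f = case-b b
      where
      same : ∀ b → sumBits n (λ m′ → 1[ b ∷ m′ ≡ b ∷ m ] * f (b ∷ m′)) ≡ f (b ∷ m)
      same b = trans (congruent (sumBits-linear n) λ m′ → cong (_* f (b ∷ m′)) (1[]-cong (λ { refl → refl }) (cong (b ∷_)))) (sumBits-indicator m λ m → f (b ∷ m))
      other : ∀ {b b′} → b ≢ b′ → sumBits n (λ m′ → 1[ b ∷ m′ ≡ b′ ∷ m ] * f (b ∷ m′)) ≡ 0ℝ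
      other {b} b≢ = trans (congruent (sumBits-linear n) λ m′ → trans (cong (_* f (b ∷ m′)) (1[]-no λ { refl → b≢ refl })) (ℝ.zeroˡ _)) (null (sumBits-linear n))
      case-b : ∀ b → sumBits (suc n) (λ m′ → 1[ m′ ≡ b ∷ m ] * f m′) ≡ f (b ∷ m)
      case-b true  = trans (cong₂ _+_ (same true) (other λ ())) (ℝ.+-identityʳ _)
      case-b false = trans (cong₂ _+_ (other λ ()) (same false)) (ℝ.+-identityˡ _)

    -- A finitely supported probability measure, through its expectation functional.
    record Expectation (Ω : Set) : Set₁ where
      field
        E        : (Ω → ℝ) → ℝ
        linear   : IsLinear E
        total    : E (λ _ → 1ℝ) ≡ 1ℝ
        attained : ∀ f → ∃ λ ω → E f ≤ f ω

      E-const : ∀ c → E (λ _ → c) ≡ c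
      E-const c = trans (congruent linear λ _ → sym (ℝ.*-identityʳ c)) (trans (homogeneous linear c _) (trans (cong (c *_) total) (ℝ.*-identityʳ c)))

    open Expectation public using (E; linear; total; attained; E-const)

    larger : ∀ {f : Bool → ℝ} → 0ℝ ≤ a → 0ℝ ≤ b → ∃ λ i → a * f true + b * f false ≤ (a + b) * f i
    larger {a} {b} {f} p q with ≤-total (f true) (f false)
    ... | inj₁ h = false , ≤-cert (0≤* p (x≤y⇒0≤y-x h)) (solve 4 (λ a b u v → (a :+ b) :* v := a :* u :+ b :* v :+ a :* (v :- u)) refl a b (f true) (f false))
    ... | inj₂ h = true , ≤-cert (0≤* q (x≤y⇒0≤y-x h)) (solve 4 (λ a b u v → (a :+ b) :* u := a :* u :+ b :* v :+ b :* (u :- v)) refl a b (f true) (f false))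

    weighted-attained : ∀ {n} (ρ f : Fin (suc n) → ℝ) → (∀ i → 0ℝ ≤ ρ i) → ∃ λ i → ∑[ i < suc n ] (ρ i * f i) ≤ sum ρ * f i
    weighted-attained {zero} ρ f h = zero , ≤-reflexive (solve 2 (λ ρ f → ρ :* f :+ :0 := (ρ :+ :0) :* f) refl (ρ zero) (f zero))
    weighted-attained {suc n} ρ f h =
      let i , p = weighted-attained (ρ ∘ suc) (f ∘ suc) (h ∘ suc)
          pick = λ { true → zero ; false → suc i }
          b , q = larger {f = f ∘ pick} (h zero) (nonNegative (∑-linear (suc n)) (h ∘ suc))
      in pick b , ≤-trans (+-monoʳ-≤ (ρ zero * f zero) p) q

    finite : ∀ {n} (ρ : Fin n → ℝ) → IsProbability ρ → Expectation (Fin n)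
    finite {zero}  ρ (_ , p) = contradiction (sym p) 1≢0
    finite {suc n} ρ (ρ≥0 , p) = record
      { E        = λ f → ∑[ i < suc n ] (ρ i * f i)
      ; linear   = record
        { additive    = λ f g → trans (congruent (∑-linear (suc n)) λ i → ℝ.distribˡ (ρ i) (f i) (g i)) (additive (∑-linear (suc n)) (λ i → ρ i * f i) (λ i → ρ i * g i))
        ; homogeneous = λ c f → trans (congruent (∑-linear (suc n)) λ i → solve 3 (λ ρ c f → ρ :* (c :* f) := c :* (ρ :* f)) refl (ρ i) c (f i)) (homogeneous (∑-linear (suc n)) c (λ i → ρ i * f i))
        ; monotone    = λ h → monotone (∑-linear (suc n)) λ i → *-monoʳ-≤ (ρ≥0 i) (h i)
        }
      ; total    = trans (congruent (∑-linear (suc n)) λ i → ℝ.*-identityʳ (ρ i)) p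
      ; attained = λ f → let i , h = weighted-attained ρ f ρ≥0 in i , ≤-trans h (≤-reflexive (trans (cong (_* f i) p) (ℝ.*-identityˡ (f i))))
      }

    ½ : ℝ
    ½ = fromℕ 2 ⁻¹

    ½+½ : ½ + ½ ≡ 1ℝ
    ½+½ = trans (solve 1 (λ h → h :+ h := :2 :* h) refl ½) (*-inverseʳ _ (0<⇒≢ 0<2))

    0<½ : 0ℝ < ½
    0<½ = 0<⁻¹ 0<2

    coin : Expectation Bool
    coin = record
      { E        = λ f → ½ * f true + ½ * f false
      ; linear   = record
        { additive    = λ f g → solve 5 (λ h a b c d → h :* (a :+ c) :+ h :* (b :+ d) := h :* a :+ h :* b :+ (h :* c :+ h :* d)) refl ½ (f true) (f false) (g true) (g false)
        ; homogeneous = λ c f → solve 4 (λ h c a b → h :* (c :* a) :+ h :* (c :* b) := c :* (h :* a :+ h :* b)) refl ½ c (f true) (f false)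
        ; monotone    = λ h → +-mono-≤ (*-monoʳ-≤ (<⇒≤ 0<½) (h true)) (*-monoʳ-≤ (<⇒≤ 0<½) (h false))
        }
      ; total    = trans (cong₂ _+_ (ℝ.*-identityʳ ½) (ℝ.*-identityʳ ½)) ½+½
      ; attained = λ f → let i , h = larger {f = f} (<⇒≤ 0<½) (<⇒≤ 0<½) in i , ≤-trans h (≤-reflexive (trans (cong (_* f i) ½+½) (ℝ.*-identityˡ (f i))))
      }

    iid : Expectation A → ∀ n → Expectation (Vec A n)
    iid P zero = record
      { E = λ f → f [] ; linear = record { additive = λ _ _ → refl ; homogeneous = λ _ _ → refl ; monotone = λ h → h [] }
      ; total = refl ; attained = λ f → [] , ≤-refl }
    iid P (suc n) = record
      { E        = λ f → E P λ ω → E Pⁿ λ ωs → f (ω ∷ ωs)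
      ; linear   = record
        { additive    = λ f g → trans (congruent (linear P) λ ω → additive (linear Pⁿ) _ _) (additive (linear P) _ _)
        ; homogeneous = λ c f → trans (congruent (linear P) λ ω → homogeneous (linear Pⁿ) c _) (homogeneous (linear P) c _)
        ; monotone    = λ h → monotone (linear P) λ ω → monotone (linear Pⁿ) λ ωs → h (ω ∷ ωs)
        }
      ; total    = trans (congruent (linear P) λ _ → total Pⁿ) (total P)
      ; attained = λ f → let ω , h = attained P (λ ω → E Pⁿ λ ωs → f (ω ∷ ωs)) ; ωs , h′ = attained Pⁿ (λ ωs → f (ω ∷ ωs)) in ω ∷ ωs , ≤-trans h h′
      }
      where Pⁿ = iid P n

    iid-lookup : ∀ (P : Expectation A) {n} (i : Fin n) f → E (iid P n) (λ ωs → f (Vec.lookup ωs i)) ≡ E P f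
    iid-lookup P {suc n} zero    f = congruent (linear P) λ ω → E-const (iid P n) (f ω)
    iid-lookup P {suc n} (suc i) f = trans (congruent (linear P) λ ω → iid-lookup P i f) (E-const P _)

    iid-lookup₂ : ∀ (P : Expectation A) {n} {i j : Fin n} → i ≢ j → ∀ f g →
                  E (iid P n) (λ ωs → f (Vec.lookup ωs i) * g (Vec.lookup ωs j)) ≡ E P f * E P g
    iid-lookup₂ P {suc n} {zero}  {zero}  i≢j f g = contradiction refl i≢j
    iid-lookup₂ P {suc n} {zero}  {suc j} i≢j f g = trans
      (congruent (linear P) λ ω → trans (homogeneous (linear (iid P n)) (f ω) _) (cong (f ω *_) (iid-lookup P j g)))
      (homogeneousʳ (linear P) _ f)
    iid-lookup₂ P {suc n} {suc i} {zero}  i≢j f g = trans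
      (congruent (linear P) λ ω → trans (homogeneousʳ (linear (iid P n)) (g ω) _) (cong (_* g ω) (iid-lookup P i f)))
      (homogeneous (linear P) _ g)
    iid-lookup₂ P {suc n} {suc i} {suc j} i≢j f g = trans (congruent (linear P) λ ω → iid-lookup₂ P (i≢j ∘ cong suc) f g) (E-const P _)

    -- A random real whose distribution function is the identity at finitely many prescribed points of [0, 1].
    module Threshold where

      clamp : ℝ → ℝ → ℝ → ℝ
      clamp a b t with ≤-<-⊎ t a
      ... | inj₁ _ = a
      ... | inj₂ _ with ≤-<-⊎ b t
      ...   | inj₁ _ = b
      ...   | inj₂ _ = t

      data Clamped (a b t : ℝ) : ℝ → Set where
        low  : t ≤ a → Clamped a b t a
        high : a < t → b ≤ t → Clamped a b t b
        mid  : a < t → t < b → Clamped a b t t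

      clamped : ∀ a b t → Clamped a b t (clamp a b t)
      clamped a b t with ≤-<-⊎ t a
      ... | inj₁ p = low p
      ... | inj₂ p with ≤-<-⊎ b t
      ...   | inj₁ q = high p q
      ...   | inj₂ q = mid p q

      clamped-bounds : a ≤ b → Clamped a b t s → a ≤ s × s ≤ b
      clamped-bounds a≤b (low _)    = ≤-refl , a≤b
      clamped-bounds a≤b (high _ _) = a≤b , ≤-refl
      clamped-bounds a≤b (mid p q)  = <⇒≤ p , <⇒≤ q

      -- When [a, b] is cut at x, the lengths of the two pieces below t add up to the length of the
      -- whole below t.
      clamp-split : a ≤ x → x ≤ b → ∀ t → clamp a x t + clamp x b t ≡ x + clamp a b t
      clamp-split {a} {x} {b} a≤x x≤b t with clamp a x t | clamped a x t | clamp x b t | clamped x b t | clamp a b t | clamped a b t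
      ... | _ | low p    | _ | low q    | _ | low r    = ℝ.+-comm a x
      ... | _ | low p    | _ | low q    | _ | high r _ = contradiction p (<⇒≱ r)
      ... | _ | low p    | _ | low q    | _ | mid r _  = contradiction p (<⇒≱ r)
      ... | _ | low p    | _ | high q _ | _ | _        = contradiction (≤-trans p a≤x) (<⇒≱ q)
      ... | _ | low p    | _ | mid q _  | _ | _        = contradiction (≤-trans p a≤x) (<⇒≱ q)
      ... | _ | high p _ | _ | low q    | _ | low r    = contradiction r (<⇒≱ p)
      ... | _ | high p p′ | _ | low q    | _ | high r r′ = cong₂ _+_ refl (≤-antisym x≤b (≤-trans r′ q))
      ... | _ | high p p′ | _ | low q    | _ | mid r r′ = cong (x +_) (≤-antisym p′ q)
      ... | _ | high p _ | _ | high q _ | _ | low r    = contradiction r (<⇒≱ p)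
      ... | _ | high p _ | _ | high q _ | _ | high r _ = refl
      ... | _ | high p _ | _ | high q q′ | _ | mid r r′ = contradiction q′ (<⇒≱ r′)
      ... | _ | high p _ | _ | mid q _  | _ | low r    = contradiction r (<⇒≱ p)
      ... | _ | high p _ | _ | mid q q′ | _ | high r r′ = contradiction r′ (<⇒≱ q′)
      ... | _ | high p _ | _ | mid q _  | _ | mid r _  = refl
      ... | _ | mid p p′ | _ | low q    | _ | low r    = contradiction r (<⇒≱ p)
      ... | _ | mid p p′ | _ | low q    | _ | high r r′ = contradiction (≤-trans x≤b r′) (<⇒≱ p′)
      ... | _ | mid p p′ | _ | low q    | _ | mid r _  = ℝ.+-comm t x
      ... | _ | mid p p′ | _ | high q _ | _ | _        = contradiction (<⇒≤ p′) (<⇒≱ q)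
      ... | _ | mid p p′ | _ | mid q _  | _ | _        = contradiction (<⇒≤ p′) (<⇒≱ q)

      -- The points of the list cut [a, b] into pieces, and each piece is represented by its left
      -- end. On a piece without its right end every event h < t with t in the list is constant, so
      -- this Riemann sum measures it exactly.
      L : ℝ → ℝ → List ℝ → (ℝ → ℝ) → ℝ
      L a b []       f = (b - a) * f a
      L a b (t ∷ ts) f = L a (clamp a b t) ts f + L (clamp a b t) b ts f

      L-linear : ∀ ts → a ≤ b → IsLinear (L a b ts)
      L-linear {a} {b} [] a≤b = record
        { additive    = λ f g → ℝ.distribˡ _ _ _
        ; homogeneous = λ c f → solve 3 (λ k c f → k :* (c :* f) := c :* (k :* f)) refl (b - a) c (f a)
        ; monotone    = λ h → *-monoʳ-≤ (x≤y⇒0≤y-x a≤b) (h a)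
        }
      L-linear {a} {b} (t ∷ ts) a≤b = let p , q = clamped-bounds a≤b (clamped a b t) in record
        { additive    = λ f g → trans (cong₂ _+_ (additive (L-linear ts p) f g) (additive (L-linear ts q) f g))
            (solve 4 (λ a b c d → a :+ b :+ (c :+ d) := a :+ c :+ (b :+ d)) refl (L a k ts f) (L a k ts g) (L k b ts f) (L k b ts g))
        ; homogeneous = λ c f → trans (cong₂ _+_ (homogeneous (L-linear ts p) c f) (homogeneous (L-linear ts q) c f)) (sym (ℝ.distribˡ c (L a k ts f) (L k b ts f)))
        ; monotone    = λ h → +-mono-≤ (monotone (L-linear ts p) h) (monotone (L-linear ts q) h)
        }
        where k = clamp a b t

      L-attained : ∀ ts → a ≤ b → ∀ f → ∃ λ h → L a b ts f ≤ (b - a) * f h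
      L-attained {a} [] a≤b f = a , ≤-refl
      L-attained {a} {b} (t ∷ ts) a≤b f =
        let p , q = clamped-bounds a≤b (clamped a b t)
            h , u = L-attained ts p f
            h′ , u′ = L-attained ts q f
            pick = λ { true → h ; false → h′ }
            i , v = larger {f = f ∘ pick} (x≤y⇒0≤y-x p) (x≤y⇒0≤y-x q)
        in pick i , ≤-trans (+-mono-≤ u u′) (≤-trans v (≤-reflexive (cong (_* f (pick i)) (solve 3 (λ a b t → t :- a :+ (b :- t) := b :- a) refl a b (clamp a b t)))))

      L-const : ∀ ts c → L a b ts (λ _ → c) ≡ (b - a) * c
      L-const [] c = refl
      L-const {a} {b} (t ∷ ts) c = trans (cong₂ _+_ (L-const ts c) (L-const ts c))
        (solve 4 (λ a b t c → (t :- a) :* c :+ (b :- t) :* c := (b :- a) :* c) refl a b (clamp a b t) c)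

      L-support : ∀ ts → a ≤ b → ∀ {f g} → (∀ h → a ≤ h → h < b → f h ≡ g h) → L a b ts f ≡ L a b ts g
      L-support {a} {b} [] a≤b {f} {g} p with lem {a ≡ b}
      ... | yes refl = trans (trans (cong (_* f a) (ℝ.-‿inverseʳ a)) (ℝ.zeroˡ _)) (sym (trans (cong (_* g a) (ℝ.-‿inverseʳ a)) (ℝ.zeroˡ _)))
      ... | no a≢b   = cong ((b - a) *_) (p a ≤-refl (a≤b , a≢b))
      L-support {a} {b} (t ∷ ts) a≤b p = let q , r = clamped-bounds a≤b (clamped a b t) in
        cong₂ _+_ (L-support ts q λ h a≤h h<t → p h a≤h (<-≤-trans h<t r)) (L-support ts r λ h t≤h h<b → p h (≤-trans q t≤h) h<b)

      L-threshold : ∀ {ts} → a ≤ b → t ∈ ts → L a b ts (λ h → 1[ h < t ]) ≡ clamp a b t - a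
      L-threshold {a} {b} {t} {_ ∷ ts} a≤b (here refl) = trans
        (cong₂ _+_ (trans (L-support ts p below) (L-const ts 1ℝ)) (trans (L-support ts q above) (L-const ts 0ℝ)))
        (solve 3 (λ a b t → (t :- a) :* :1 :+ (b :- t) :* :0 := t :- a) refl a b (clamp a b t))
        where
        p = proj₁ (clamped-bounds a≤b (clamped a b t))
        q = proj₂ (clamped-bounds a≤b (clamped a b t))
        below : ∀ h → a ≤ h → h < clamp a b t → 1[ h < t ] ≡ 1ℝ
        below h a≤h h<t with clamp a b t | clamped a b t
        ... | _ | low _    = contradiction a≤h (<⇒≱ h<t)
        ... | _ | high _ r = 1[]-yes (<-≤-trans h<t r)
        ... | _ | mid _ _  = 1[]-yes h<t
        above : ∀ h → clamp a b t ≤ h → h < b → 1[ h < t ] ≡ 0ℝ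
        above h t≤h h<b with clamp a b t | clamped a b t
        ... | _ | low r    = 1[]-no λ h<t → <⇒≱ h<t (≤-trans r t≤h)
        ... | _ | high _ _ = contradiction t≤h (<⇒≱ h<b)
        ... | _ | mid _ _  = 1[]-no λ h<t → <⇒≱ h<t t≤h
      L-threshold {a} {b} {t} {t′ ∷ ts} a≤b (there t∈) = let p , q = clamped-bounds a≤b (clamped a b t′) in begin
        L a k ts f + L k b ts f                  ≡⟨ cong₂ _+_ (L-threshold p t∈) (L-threshold q t∈) ⟩
        clamp a k t - a + (clamp k b t - k)      ≡⟨ solve 4 (λ u v a k → u :- a :+ (v :- k) := u :+ v :- k :- a) refl (clamp a k t) (clamp k b t) a k ⟩
        clamp a k t + clamp k b t - k - a        ≡⟨ cong (λ w → w - k - a) (clamp-split p q t) ⟩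
        k + clamp a b t - k - a                  ≡⟨ solve 3 (λ w a k → k :+ w :- k :- a := w :- a) refl (clamp a b t) a k ⟩
        clamp a b t - a                          ∎
        where
        open ≡-Reasoning
        k = clamp a b t′
        f = λ h → 1[ h < t ]

      threshold : List ℝ → Expectation ℝ
      threshold ts = record
        { E        = L 0ℝ 1ℝ ts
        ; linear   = L-linear ts 0≤1
        ; total    = trans (L-const ts 1ℝ) (solve 0 ((:1 :- :0) :* :1 := :1) refl)
        ; attained = λ f → let h , p = L-attained ts 0≤1 f in h , ≤-trans p (≤-reflexive (solve 1 (λ f → (:1 :- :0) :* f := f) refl (f h)))
        }

      P[h<t] : ∀ {ts} → t ∈ ts → 0ℝ ≤ t → t ≤ 1ℝ → E (threshold ts) (λ h → 1[ h < t ]) ≡ t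
      P[h<t] {t} {ts} t∈ 0≤t t≤1 = trans (L-threshold 0≤1 t∈) (trans (solve 1 (λ x → x :- :0 := x) refl (clamp 0ℝ 1ℝ t)) clamp≡)
        where
        clamp≡ : clamp 0ℝ 1ℝ t ≡ t
        clamp≡ with clamp 0ℝ 1ℝ t | clamped 0ℝ 1ℝ t
        ... | _ | low p    = ≤-antisym 0≤t p
        ... | _ | high _ p = ≤-antisym p t≤1
        ... | _ | mid _ _  = refl

    open Threshold public using (threshold; P[h<t])

  open Expectations

  -- Dialogues, random hashing and the noisy search as a conversation

  module Conversations where

    open Search using (Strategy; State; Valid; potential; agreed; flags; horizon; stack; top; step; mask; pathᴬ; pathᴮ; mistakes; start)

    open IsLinear

    private variable
      A B S T : Set
      c d n : ℕ

    -- A conversation of at most c bits after which both players know a value in S,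
    -- in continuation-passing style.
    record Dialogue (A B S : Set) (c : ℕ) : Set where
      field
        outcome       : A → B → S
        realise       : (S → Tree A B) → Tree A B
        run-realise   : ∀ k a b → run (realise k) a b ≡ run (k (outcome a b)) a b
        depth-realise : ∀ k {e} → (∀ s → depth (k s) ℕ.≤ e) → depth (realise k) ℕ.≤ c ℕ.+ e

    open Dialogue public

    return : S → Dialogue A B S 0
    return s = record { outcome = λ _ _ → s ; realise = λ k → k s ; run-realise = λ _ _ _ → refl ; depth-realise = λ k h → h s }

    infixl 1 _>>=_
    _>>=_ : Dialogue A B S c → (S → Dialogue A B T d) → Dialogue A B T (c ℕ.+ d)
    _>>=_ {c = c} {d = d} D f = record
      { outcome       = λ a b → outcome (f (outcome D a b)) a b
      ; realise       = λ k → realise D λ s → realise (f s) k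
      ; run-realise   = λ k a b → trans (run-realise D _ a b) (run-realise (f _) k a b)
      ; depth-realise = λ k {e} h → ℕ.≤-trans (depth-realise D _ λ s → depth-realise (f s) k h) (ℕ.≤-reflexive (sym (ℕ.+-assoc c d e)))
      }

    aliceSends : (A → Vec Bool c) → Dialogue A B (Vec Bool c) c
    aliceSends {A} {B = B} f = record { outcome = λ a _ → f a ; realise = go f ; run-realise = run-go f ; depth-realise = depth-go f }
      where
      go : ∀ {c} → (A → Vec Bool c) → (Vec Bool c → Tree A B) → Tree A B
      go {zero}  f k = k []
      go {suc c} f k = alice (Vec.head ∘ f) λ b → go (Vec.tail ∘ f) (k ∘ (b ∷_))
      run-go : ∀ {c} (f : A → Vec Bool c) k a b → run (go f k) a b ≡ run (k (f a)) a b
      run-go {zero}  f k a b with [] ← f a = refl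
      run-go {suc c} f k a b = trans (run-go (Vec.tail ∘ f) _ a b) (cong (λ v → run (k v) a b) (head∷tail (f a)))
        where
        head∷tail : ∀ (v : Vec Bool (suc c)) → Vec.head v ∷ Vec.tail v ≡ v
        head∷tail (_ ∷ _) = refl
      depth-go : ∀ {c} (f : A → Vec Bool c) k {e} → (∀ s → depth (k s) ℕ.≤ e) → depth (go f k) ℕ.≤ c ℕ.+ e
      depth-go {zero}  f k h = h []
      depth-go {suc c} f k h = s≤s (ℕ.⊔-lub (depth-go (Vec.tail ∘ f) _ (h ∘ (false ∷_))) (depth-go (Vec.tail ∘ f) _ (h ∘ (true ∷_))))

    bobSends : (B → Bool) → Dialogue A B Bool 1
    bobSends f = record { outcome = λ _ b → f b ; realise = bob f ; run-realise = λ _ _ _ → refl ; depth-realise = λ k h → s≤s (ℕ.⊔-lub (h false) (h true)) }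

    decide : Set → Bool
    decide P = ⌊ lem {P} ⌋

    decide-yes : ∀ {P} → P → decide P ≡ true
    decide-yes {P} p with lem {P}
    ... | yes _ = refl
    ... | no ¬p = contradiction p ¬p

    if-decide : ∀ P {S : Set} (f : Bool → S) → (P × f (decide P) ≡ f true) ⊎ (¬ P × f (decide P) ≡ f false)
    if-decide P f with lem {P}
    ... | yes p = inj₁ (p , refl)
    ... | no ¬p = inj₂ (¬p , refl)

    -- A random function into Bool on the elements of a list, constantly false elsewhere.
    χ : (l : List A) → Vec Bool (length l) → A → Bool
    χ []      []       a = false
    χ (e ∷ l) (z ∷ zs) a = if decide (a ≡ e) then z else χ l zs a

    sign-xor : ∀ a b → sign (a xor b) ≡ sign a * sign b
    sign-xor true  true  = solve 0 (:1 := :- :1 :* :- :1) refl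
    sign-xor true  false = sym (ℝ.*-identityʳ _)
    sign-xor false true  = sym (ℝ.*-identityˡ _)
    sign-xor false false = sym (ℝ.*-identityˡ _)

    -- One listed point is enough: its coin is fair and independent of the value at the other point,
    -- be that another coin or the default. Both hash collisions and the cancellation of failed runs
    -- rest on this.
    χ-orthogonal : ∀ {l : List A} {a b} → a ∈ l → a ≢ b → E (iid coin (length l)) (λ z → sign (χ l z a xor χ l z b)) ≡ 0ℝ
    χ-orthogonal {A} {e ∷ l} {a} {b} a∈ a≢b with if-decide (a ≡ e) id | if-decide (b ≡ e) id
    ... | inj₁ (a≡e , p) | inj₁ (b≡e , q) = contradiction (trans a≡e (sym b≡e)) a≢b
    ... | inj₁ (a≡e , p) | inj₂ (b≢e , q) rewrite p | q = begin
      ½ * F (λ z → sign (not (χ l z b))) + ½ * F (λ z → sign (χ l z b))  ≡⟨ cong (λ w → ½ * w + ½ * F (λ z → sign (χ l z b))) (trans (congruent L λ z → sign-not (χ l z b)) (homogeneous L (- 1ℝ) _)) ⟩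
      ½ * (- 1ℝ * G) + ½ * G                                               ≡⟨ solve 2 (λ h g → h :* (:- :1 :* g) :+ h :* g := :0) refl ½ G ⟩
      0ℝ                                                                   ∎
      where
      open ≡-Reasoning
      F = E (iid coin (length l))
      L = linear (iid coin (length l))
      G = F (λ z → sign (χ l z b))
      sign-not : ∀ c → sign (not c) ≡ - 1ℝ * sign c
      sign-not true  = solve 0 (:1 := :- :1 :* :- :1) refl
      sign-not false = sym (ℝ.*-identityʳ _)
    ... | inj₂ (a≢e , p) | inj₁ (b≡e , q) rewrite p | q = begin
      ½ * F (λ z → sign (χ l z a xor true)) + ½ * F (λ z → sign (χ l z a xor false))  ≡⟨ cong₂ (λ u v → ½ * u + ½ * v)
                                                                                         (trans (congruent L λ z → sign-xor (χ l z a) true) (homogeneousʳ L (- 1ℝ) _))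
                                                                                         (trans (congruent L λ z → sign-xor (χ l z a) false) (homogeneousʳ L 1ℝ _)) ⟩
      ½ * (G * - 1ℝ) + ½ * (G * 1ℝ)                                        ≡⟨ solve 2 (λ h g → h :* (g :* :- :1) :+ h :* (g :* :1) := :0) refl ½ G ⟩
      0ℝ                                                                   ∎
      where
      open ≡-Reasoning
      F = E (iid coin (length l))
      L = linear (iid coin (length l))
      G = F (λ z → sign (χ l z a))
    ... | inj₂ (a≢e , p) | inj₂ (b≢e , q) rewrite p | q = trans (E-const coin _) (χ-orthogonal (tail∈ a∈) a≢b)
      where
      tail∈ : a ∈ e ∷ l → a ∈ l
      tail∈ (here a≡e) = contradiction a≡e a≢e
      tail∈ (there a∈) = a∈

    1[≡]-sign : ∀ a b → 1[ a ≡ b ] ≡ ½ + ½ * sign (a xor b)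
    1[≡]-sign a b with a xor b in eq
    ... | false = trans (1[]-yes (Search.xor≡false⇒≡ a b eq)) (trans (sym ½+½) (cong (½ +_) (sym (ℝ.*-identityʳ ½))))
    ... | true  = trans (1[]-no λ { refl → case trans (sym eq) (xor-same a) of λ () }) (solve 1 (λ h → :0 := h :+ h :* :- :1) refl ½)

    χ-collision : ∀ {l : List A} {a b} → a ∈ l → a ≢ b → E (iid coin (length l)) (λ z → 1[ χ l z a ≡ χ l z b ]) ≡ ½
    χ-collision {l = l} {a} {b} a∈ a≢b = begin
      F (λ z → 1[ χ l z a ≡ χ l z b ])                    ≡⟨ congruent L (λ z → 1[≡]-sign (χ l z a) (χ l z b)) ⟩
      F (λ z → ½ + ½ * sign (χ l z a xor χ l z b))        ≡⟨ additive L (λ _ → ½) _ ⟩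
      F (λ z → ½) + F (λ z → ½ * sign (χ l z a xor χ l z b)) ≡⟨ cong₂ _+_ (E-const (iid coin (length l)) ½) (trans (homogeneous L ½ _) (cong (½ *_) (χ-orthogonal a∈ a≢b))) ⟩
      ½ + ½ * 0ℝ                                          ≡⟨ solve 1 (λ h → h :+ h :* :0 := h) refl ½ ⟩
      ½                                                   ∎
      where
      open ≡-Reasoning
      F = E (iid coin (length l))
      L = linear (iid coin (length l))

    Key : List A → ℕ → Set
    Key l s = Vec (Vec Bool (length l)) s

    keys : (l : List A) (s : ℕ) → Expectation (Key l s)
    keys l s = iid (iid coin (length l)) s

    hash : ∀ {s} (l : List A) → Key l s → A → Vec Bool s
    hash l zs a = Vec.map (λ z → χ l z a) zs

    hash-collision : ∀ s {l : List A} {a b} → a ∈ l → a ≢ b → E (keys l s) (λ z → 1[ hash l z a ≡ hash l z b ]) ≡ ½ ^ s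
    hash-collision zero    a∈ a≢b = 1[]-yes refl
    hash-collision (suc s) {l} {a} {b} a∈ a≢b = begin
      F (λ z → Fs (λ zs → 1[ hash l (z ∷ zs) a ≡ hash l (z ∷ zs) b ]))
        ≡⟨ congruent L (λ z → trans (congruent (linear (keys l s)) λ zs → trans (1[]-cong (λ p → cong Vec.head p , cong Vec.tail p) (λ (p , q) → cong₂ _∷_ p q)) (1[]-× _ _))
            (homogeneous (linear (keys l s)) 1[ χ l z a ≡ χ l z b ] _)) ⟩
      F (λ z → 1[ χ l z a ≡ χ l z b ] * Fs (λ zs → 1[ hash l zs a ≡ hash l zs b ]))
        ≡⟨ congruent L (λ z → cong (1[ χ l z a ≡ χ l z b ] *_) (hash-collision s a∈ a≢b)) ⟩
      F (λ z → 1[ χ l z a ≡ χ l z b ] * ½ ^ s)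
        ≡⟨ homogeneousʳ L (½ ^ s) _ ⟩
      F (λ z → 1[ χ l z a ≡ χ l z b ]) * ½ ^ s
        ≡⟨ cong (_* ½ ^ s) (χ-collision a∈ a≢b) ⟩
      ½ * ½ ^ s ∎
      where
      open ≡-Reasoning
      F = E (iid coin (length l))
      Fs = E (keys l s)
      L = linear (iid coin (length l))

    allBits : ∀ n → List (Vec Bool n)
    allBits zero    = [] ∷ []
    allBits (suc n) = List.map (true ∷_) (allBits n) ++ List.map (false ∷_) (allBits n)

    ∈-allBits : ∀ {n} (m : Vec Bool n) → m ∈ allBits n
    ∈-allBits []          = here refl
    ∈-allBits (true ∷ m)  = ∈-++⁺ˡ (∈-map⁺ (true ∷_) (∈-allBits m))
    ∈-allBits (false ∷ m) = ∈-++⁺ʳ (List.map (true ∷_) (allBits _)) (∈-map⁺ (false ∷_) (∈-allBits m))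

    ¾ : ℝ
    ¾ = fromℕ 3 * (½ * ½)

    0<¾ : 0ℝ < ¾
    0<¾ = 0<* (0<fromℕ-suc 2) (0<* 0<½ 0<½)

    ½+¼≡¾ : ½ + (½ + ½) * (½ * ½) ≡ ¾
    ½+¼≡¾ = begin
      ½ + (½ + ½) * (½ * ½)        ≡⟨ cong (λ w → ½ + w * (½ * ½)) ½+½ ⟩
      ½ + 1ℝ * (½ * ½)             ≡⟨ cong (_+ 1ℝ * (½ * ½)) (trans (sym (ℝ.*-identityˡ ½)) (cong (_* ½) (sym ½+½))) ⟩
      (½ + ½) * ½ + 1ℝ * (½ * ½)   ≡⟨ solve 1 (λ h → (h :+ h) :* h :+ :1 :* (h :* h) := :3 :* (h :* h)) refl ½ ⟩
      ¾                            ∎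
      where open ≡-Reasoning

    module NoisySearch {A B : Set} {n : ℕ} (os : Vec Bool n) (sᴬ : A → Strategy n) (sᴮ : B → Strategy n) where

      Seed : Set
      Seed = Key (allBits n) 3

      seeds : Expectation Seed
      seeds = keys (allBits n) 3

      -- Three hash bits let a disagreement pass with probability 1/8, small enough for the factor ¾
      -- in `failure≤`; the fourth bit is Bob's answer.
      test : Seed → State n → Dialogue A B Bool 4
      test z σ = aliceSends (λ a → hash (allBits n) z (mask (top (stack σ)) (pathᴬ os (sᴬ a) (flags σ)))) >>= λ v →
                 bobSends (λ b → decide (v ≡ hash (allBits n) z (mask (top (stack σ)) (pathᴮ os (sᴮ b) (flags σ)))))

      search : ∀ {r} → Vec Seed r → State n → Dialogue A B (State n) (r ℕ.* 4)
      search []       σ = return σ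
      search (z ∷ zs) σ = test z σ >>= λ m → search zs (step m σ)

      module _ (a : A) (b : B) where

        private
          s = sᴬ a
          t = sᴮ b

        first : State n → ℕ
        first σ = agreed os s t (flags σ)

        failure : ∀ r → State n → ℝ
        failure r σ = E (iid seeds r) λ zs → 1[ first (outcome (search zs σ) a b) ℕ.< n ]

        test-good : ∀ σ z → top (stack σ) ℕ.≤ first σ → outcome (test z σ) a b ≡ true
        test-good σ z p = decide-yes (cong (hash (allBits n) z) (Search.mask-agree (top (stack σ)) (pathᴬ os s (flags σ)) (pathᴮ os t (flags σ)) p))

        finished : ∀ r σ → n ℕ.< horizon σ → n ℕ.≤ first σ → failure r σ ≡ 0ℝ
        finished zero    σ p q = 1[]-no (ℕ.≤⇒≯ q)
        finished (suc r) σ p q = trans (congruent (linear seeds) λ z → stay z (outcome (test z σ) a b) refl) (null (linear seeds))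
          where
          equal : pathᴬ os s (flags σ) ≡ pathᴮ os t (flags σ)
          equal = Search.agreement-full _ _ q
          stay : ∀ z m → outcome (test z σ) a b ≡ m → failure r (step m σ) ≡ 0ℝ
          stay z true _ = let eq , p′ = Search.step-finished os s t σ p in
            finished r (step true σ) p′ (subst (λ fs → n ℕ.≤ agreed os s t fs) (sym eq) q)
          stay z false eq = case trans (sym eq) (decide-yes (cong (λ m → hash (allBits n) z (mask (top (stack σ)) m)) equal)) of λ ()

        2^[1+_]≤_ : ∀ p {q} → suc p ℕ.≤ q → fromℕ 2 * fromℕ 2 ^ p ≤ fromℕ 2 ^ q
        2^[1+ p ]≤ h = ^-monoʳ 1≤2 h

        halves : ∀ p {q} → suc p ℕ.≤ q → fromℕ 2 ^ p ≤ ½ * fromℕ 2 ^ q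
        halves p {q} h = ≤-trans (≤-reflexive (trans (sym (ℝ.*-identityˡ _)) (trans (cong (_* fromℕ 2 ^ p) (sym (trans (ℝ.*-comm ½ _) (*-inverseʳ _ (0<⇒≢ 0<2))))) (ℝ.*-assoc ½ _ _))))
          (*-monoʳ-≤ (<⇒≤ 0<½) (2^[1+ p ]≤ h))

        -- 2 to the potential is a supermartingale with factor ¾ per test. At a good top the test
        -- passes and the power is at least halved. At a bad top it is at least halved upon
        -- detection and at most doubled with probability 1/8, in the mean ½ + 2/8.
        failure≤ : ∀ r σ → Valid os s t σ → failure r σ ≤ ¾ ^ r * fromℕ 2 ^ potential os s t σ
        failure≤ zero σ _ = ≤-trans (1[]≤1 (first σ ℕ.< n)) (≤-trans (^-monoʳ 1≤2 (z≤n {potential os s t σ})) (≤-reflexive (sym (ℝ.*-identityˡ _))))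
        failure≤ (suc r) σ v with first σ ℕ.<? n
        ... | no ¬p = ≤-trans (≤-reflexive (finished (suc r) σ (ℕ.≤-<-trans (ℕ.≮⇒≥ ¬p) (proj₁ v)) (ℕ.≮⇒≥ ¬p)))
                        (0≤* (^-nonNeg (suc r) (<⇒≤ 0<¾)) (^-nonNeg (potential os s t σ) (<⇒≤ 0<2)))
        ... | yes i<n with top (stack σ) ℕ.≤? first σ
        ...   | yes good = let v′ , h = Search.step-good os s t σ v i<n good in begin
          E seeds (λ z → failure r (step (outcome (test z σ) a b) σ)) ≡⟨ congruent (linear seeds) (λ z → cong (λ m → failure r (step m σ)) (test-good σ z good)) ⟩
          E seeds (λ z → failure r (step true σ))                    ≡⟨ E-const seeds _ ⟩
          failure r (step true σ)                                    ≤⟨ failure≤ r (step true σ) v′ ⟩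
          λʳ * fromℕ 2 ^ potential os s t (step true σ)              ≤⟨ *-monoʳ-≤ (^-nonNeg r (<⇒≤ 0<¾)) (halves _ h) ⟩
          λʳ * (½ * P)                                               ≤⟨ ≤-cert (0≤* (^-nonNeg r (<⇒≤ 0<¾)) (0≤* (0≤* (<⇒≤ 0<½) (<⇒≤ 0<½)) (^-nonNeg (potential os s t σ) (<⇒≤ 0<2)))) (begin-equality
              ¾ * λʳ * P                                              ≡⟨ solve 3 (λ h l p → :3 :* (h :* h) :* l :* p := l :* ((h :+ h) :* h :* p) :+ l :* (h :* h :* p)) refl ½ λʳ P ⟩
              λʳ * ((½ + ½) * ½ * P) + λʳ * (½ * ½ * P)               ≡⟨ cong (λ w → λʳ * (w * P) + λʳ * (½ * ½ * P)) (trans (cong (_* ½) ½+½) (ℝ.*-identityˡ ½)) ⟩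
              λʳ * (½ * P) + λʳ * (½ * ½ * P)                         ∎) ⟩
          ¾ * λʳ * P                                                 ∎
          where
          open ≤-Reasoning
          λʳ = ¾ ^ r
          P = fromℕ 2 ^ potential os s t σ
        ...   | no ¬good = begin
          E seeds (λ z → failure r (step (outcome (test z σ) a b) σ)) ≤⟨ monotone (linear seeds) pointwise ⟩
          E seeds (λ z → λʳ * (½ * P) + 1[ missed z ] * (λʳ * (fromℕ 2 * P))) ≡⟨ additive (linear seeds) (λ _ → λʳ * (½ * P)) (λ z → 1[ missed z ] * (λʳ * (fromℕ 2 * P))) ⟩
          E seeds (λ z → λʳ * (½ * P)) + E seeds (λ z → 1[ missed z ] * (λʳ * (fromℕ 2 * P)))
            ≡⟨ cong₂ _+_ (E-const seeds _) (trans (homogeneousʳ (linear seeds) (λʳ * (fromℕ 2 * P)) (λ z → 1[ missed z ])) (cong (_* (λʳ * (fromℕ 2 * P))) (hash-collision 3 (∈-allBits _) differ))) ⟩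
          λʳ * (½ * P) + ½ ^ 3 * (λʳ * (fromℕ 2 * P))                 ≡⟨ solve 3 (λ h l p → l :* (h :* p) :+ (h :* (h :* (h :* :1))) :* (l :* (:2 :* p)) := l :* p :* (h :+ (h :+ h) :* (h :* h))) refl ½ λʳ P ⟩
          λʳ * P * (½ + (½ + ½) * (½ * ½))                            ≡⟨ cong (λ w → λʳ * P * w) ½+¼≡¾ ⟩
          λʳ * P * ¾                                                  ≡⟨ solve 3 (λ l p c → l :* p :* c := c :* l :* p) refl λʳ P ¾ ⟩
          ¾ * λʳ * P                                                  ∎
          where
          open ≤-Reasoning
          λʳ = ¾ ^ r
          P = fromℕ 2 ^ potential os s t σ
          e = top (stack σ)
          bad : first σ ℕ.< e
          bad = ℕ.≰⇒> ¬good
          differ : mask e (pathᴬ os s (flags σ)) ≢ mask e (pathᴮ os t (flags σ))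
          differ = Search.mask-differ e _ _ i<n bad
          missed : Seed → Set
          missed z = hash (allBits n) z (mask e (pathᴬ os s (flags σ))) ≡ hash (allBits n) z (mask e (pathᴮ os t (flags σ)))
          0≤λʳ = ^-nonNeg r (<⇒≤ 0<¾)
          0≤P = ^-nonNeg (potential os s t σ) (<⇒≤ 0<2)
          pointwise : ∀ z → failure r (step (outcome (test z σ) a b) σ) ≤ λʳ * (½ * P) + 1[ missed z ] * (λʳ * (fromℕ 2 * P))
          pointwise z with if-decide (missed z) (λ m → failure r (step m σ))
          ... | inj₁ (m , eq) = let v′ , h = Search.step-bad-missed os s t σ v bad in
            ≤-trans (≤-reflexive eq) (≤-trans (failure≤ r (step true σ) v′) (≤-trans (*-monoʳ-≤ 0≤λʳ (^-monoʳ 1≤2 h))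
              (≤-cert (0≤* 0≤λʳ (0≤* (<⇒≤ 0<½) 0≤P)) (trans (cong (λ w → λʳ * (½ * P) + w * (λʳ * (fromℕ 2 * P))) (1[]-yes m)) (solve 2 (λ u v → u :+ :1 :* v := v :+ u) refl (λʳ * (½ * P)) (λʳ * (fromℕ 2 * P)))))))
          ... | inj₂ (¬m , eq) = let v′ , h = Search.step-bad-detected os s t σ v bad in
            ≤-trans (≤-reflexive eq) (≤-trans (failure≤ r (step false σ) v′) (≤-trans (*-monoʳ-≤ 0≤λʳ (halves _ h))
              (≤-cert (0≤* (0≤1[] (missed z)) (0≤* 0≤λʳ (0≤* (<⇒≤ 0<2) 0≤P))) refl)))

        failure-start≤ : ∀ r → failure r (start n) ≤ ¾ ^ r * fromℕ 2 ^ (suc (3 ℕ.* ⌈log₂ suc n ⌉) ℕ.* mistakes os s t ℕ.+ 3 ℕ.* ⌈log₂ suc n ⌉)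
        failure-start≤ r = subst (λ p → failure r (start n) ≤ ¾ ^ r * fromℕ 2 ^ p) (Search.start-potential os s t) (failure≤ r (start n) (Search.start-valid os s t))

  open Conversations

  -- Relative entropy of unnormalised measures: Gibbs, log-sum, Pinsker

  module Entropy where

    open IsLinear

    private variable
      A : Set
      a c w : ℝ
      n : ℕ

    -- The summand of relative entropy, in nats. The factor a makes it 0 at a = 0, whatever value
    -- `ln` has at 0.
    η : ℝ → ℝ → ℝ
    η a w = a * (ln a - ln w)

    η-zero : a ≡ 0ℝ → η a w ≡ 0ℝ
    η-zero refl = ℝ.zeroˡ _

    η-scale : ∀ a → 0ℝ ≤ a → (0ℝ < a → 0ℝ < w) → 0ℝ < c → η a (c * w) ≡ η a w - a * ln c
    η-scale {w} {c} a 0≤a a⇒w 0<c with 0≤⇒≡⊎< 0≤a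
    ... | inj₁ refl = solve 4 (λ l m n k → :0 :* (l :- m) := :0 :* (l :- n) :- :0 :* k) refl (ln 0ℝ) (ln (c * w)) (ln w) (ln c)
    ... | inj₂ 0<a  = trans (cong (λ z → a * (ln a - z)) (ln-* 0<c (a⇒w 0<a))) (solve 4 (λ a l m n → a :* (l :- (n :+ m)) := a :* (l :- m) :- a :* n) refl a (ln a) (ln w) (ln c))

    gibbs : 0ℝ ≤ a → 0ℝ ≤ w → (0ℝ < a → 0ℝ < w) → a - w ≤ η a w
    gibbs {a} {w} 0≤a 0≤w a⇒w with 0≤⇒≡⊎< 0≤a
    ... | inj₁ refl = ≤-trans (≤-cert 0≤w (solve 1 (λ w → :0 := :0 :- w :+ w) refl w)) (≤-reflexive (sym (η-zero refl)))
    ... | inj₂ 0<a  = ≤-cert (0≤* 0≤a (x≤y⇒0≤y-x (ln≤x-1 (0</ 0<w 0<a)))) (begin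
      a * (ln a - ln w)                               ≡⟨ solve 4 (λ a l m w → a :* (l :- m) := (a :- w) :+ (w :- a :* :1 :- a :* (m :- l))) refl a (ln a) (ln w) w ⟩
      (a - w) + (w - a * 1ℝ - a * (ln w - ln a))      ≡⟨ cong₂ (λ u v → (a - w) + (u - a * 1ℝ - a * v)) (sym (x/y*y (0<⇒≢ 0<a))) (sym (ln-/ 0<w 0<a)) ⟩
      (a - w) + (w / a * a - a * 1ℝ - a * ln (w / a)) ≡⟨ cong (a - w +_) (solve 3 (λ a r l → r :* a :- a :* :1 :- a :* l := a :* (r :- :1 :- l)) refl a (w / a) (ln (w / a))) ⟩
      (a - w) + a * (w / a - 1ℝ - ln (w / a))         ∎)
      where
      open ≡-Reasoning
      0<w = a⇒w 0<a

    module _ {F : (A → ℝ) → ℝ} (lin : IsLinear F) {Q G : A → ℝ} (0≤Q : ∀ i → 0ℝ ≤ Q i) (0≤G : ∀ i → 0ℝ ≤ G i) (Q⇒G : ∀ i → 0ℝ < Q i → 0ℝ < G i) where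

      scaled-gibbs : 0ℝ < c → F Q - c * F G ≤ F (λ i → η (Q i) (G i)) - F Q * ln c
      scaled-gibbs {c} 0<c = begin
        F Q - c * F G                              ≡⟨ sym (trans (subtractive lin Q (λ i → c * G i)) (cong (λ z → F Q - z) (homogeneous lin c G))) ⟩
        F (λ i → Q i - c * G i)                    ≤⟨ monotone lin (λ i → ≤-trans (gibbs (0≤Q i) (0≤* (<⇒≤ 0<c) (0≤G i)) (0<* 0<c ∘ Q⇒G i)) (≤-reflexive (η-scale (Q i) (0≤Q i) (Q⇒G i) 0<c))) ⟩
        F (λ i → η (Q i) (G i) - Q i * ln c)       ≡⟨ trans (subtractive lin (λ i → η (Q i) (G i)) (λ i → Q i * ln c)) (cong (λ z → F (λ i → η (Q i) (G i)) - z) (homogeneousʳ lin (ln c) Q)) ⟩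
        F (λ i → η (Q i) (G i)) - F Q * ln c       ∎
        where open ≤-Reasoning

      -- Gibbs' inequality for Q against c G with the optimal scale c = F Q / W. If F Q is 0, no
      -- such scale is available, and Q need not vanish where F puts no weight; then c tends to 0.
      log-sum : ∀ {W} → F G ≤ W → (0ℝ < F Q → 0ℝ < W) → η (F Q) W ≤ F (λ i → η (Q i) (G i))
      log-sum {W} FG≤W FQ⇒W with 0≤⇒≡⊎< (nonNegative lin 0≤Q)
      ... | inj₁ FQ≡0 = ε-≤ λ ε 0<ε →
        let c = ε / (F G + 1ℝ)
            0<FG+1 = subst (0ℝ <_) (ℝ.+-comm 1ℝ (F G)) (0<+ 0<1 (nonNegative lin 0≤G))
            0<c = 0</ 0<ε 0<FG+1
            h = F (λ i → η (Q i) (G i))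
        in ≤-cert (0≤+ (<⇒≤ 0<c) (x≤y⇒0≤y-x (scaled-gibbs 0<c))) (begin
          h + ε                                                  ≡⟨ cong (h +_) (sym (x/y*y (0<⇒≢ 0<FG+1))) ⟩
          h + c * (F G + 1ℝ)                                     ≡⟨ solve 5 (λ h c g q l → h :+ c :* (g :+ :1) := q :* (:1 :+ l) :+ (c :+ (h :- q :* l :- (q :- c :* g)))) refl h c (F G) (F Q) (ln c) ⟩
          F Q * (1ℝ + ln c) + (c + (h - F Q * ln c - (F Q - c * F G))) ≡⟨ cong (_+ (c + (h - F Q * ln c - (F Q - c * F G)))) (trans (cong (_* (1ℝ + ln c)) FQ≡0) (trans (ℝ.zeroˡ _) (sym (η-zero FQ≡0)))) ⟩
          η (F Q) W + (c + (h - F Q * ln c - (F Q - c * F G)))   ∎)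
        where open ≡-Reasoning
      ... | inj₂ 0<FQ = ≤-cert (0≤+ (0≤* (<⇒≤ 0<k) (x≤y⇒0≤y-x FG≤W)) (x≤y⇒0≤y-x (scaled-gibbs 0<k))) (begin
        h                                                        ≡⟨ solve 6 (λ h c g q l w → h := q :* l :+ (q :- c :* w) :+ (c :* (w :- g) :+ (h :- q :* l :- (q :- c :* g)))) refl h k (F G) (F Q) (ln k) W ⟩
        F Q * ln k + (F Q - k * W) + r                           ≡⟨ cong₂ (λ u v → F Q * u + (F Q - v) + r) (ln-/ 0<FQ 0<W) (x/y*y (0<⇒≢ 0<W)) ⟩
        F Q * (ln (F Q) - ln W) + (F Q - F Q) + r                ≡⟨ cong (_+ r) (trans (cong (η (F Q) W +_) (ℝ.-‿inverseʳ (F Q))) (ℝ.+-identityʳ _)) ⟩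
        η (F Q) W + r                                            ∎)
        where
        open ≡-Reasoning
        0<W = FQ⇒W 0<FQ
        k = F Q / W
        0<k = 0</ 0<FQ 0<W
        h = F (λ i → η (Q i) (G i))
        r = k * (W - F G) + (h - F Q * ln k - (F Q - k * F G))

    -- Pinsker's inequality on two points, through ln (w / a) ≤ 2 (√(w / a) - 1).
    hellinger : 0ℝ ≤ a → 0ℝ ≤ w → (0ℝ < a → 0ℝ < w) → fromℕ 2 * a - fromℕ 2 * (√ a * √ w) ≤ η a w
    hellinger {a} {w} 0≤a 0≤w a⇒w with 0≤⇒≡⊎< 0≤a
    ... | inj₁ refl = ≤-trans (≤-cert (0≤* (<⇒≤ 0<2) (0≤* (√-nonNeg 0≤a) (√-nonNeg 0≤w))) (solve 1 (λ r → :0 := :2 :* :0 :- :2 :* r :+ :2 :* r) refl (√ 0ℝ * √ w)))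
                        (≤-reflexive (sym (η-zero refl)))
    ... | inj₂ 0<a = ≤-cert (0≤* (0≤* (<⇒≤ 0<2) 0≤a) (x≤y⇒0≤y-x (ln≤x-1 (0</ 0<q 0<p)))) (begin
      a * (ln a - ln w)                                        ≡⟨ cong₂ (λ l m → a * (l - m)) (trans (cong ln (sym (√-square 0≤a))) (ln-* 0<p 0<p)) (trans (cong ln (sym (√-square 0≤w))) (ln-* 0<q 0<q)) ⟩
      a * (ln p + ln p - (ln q + ln q))                        ≡⟨ solve 6 (λ a l m p q r → a :* (l :+ l :- (m :+ m)) := :2 :* a :- :2 :* (a :* r) :+ :2 :* a :* (r :- :1 :- (m :- l))) refl a (ln p) (ln q) p q (q / p) ⟩
      fromℕ 2 * a - fromℕ 2 * (a * (q / p)) + fromℕ 2 * a * (q / p - 1ℝ - (ln q - ln p))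
        ≡⟨ cong₂ (λ u v → fromℕ 2 * a - fromℕ 2 * u + fromℕ 2 * a * (q / p - 1ℝ - v)) a*q/p (sym (ln-/ 0<q 0<p)) ⟩
      fromℕ 2 * a - fromℕ 2 * (p * q) + fromℕ 2 * a * (q / p - 1ℝ - ln (q / p)) ∎)
      where
      open ≡-Reasoning
      0<w = a⇒w 0<a
      p = √ a
      q = √ w
      0<p = √-pos 0<a
      0<q = √-pos 0<w
      a*q/p : a * (q / p) ≡ p * q
      a*q/p = trans (cong (_* (q / p)) (sym (√-square 0≤a))) (trans (solve 3 (λ p q i → p :* p :* (q :* i) := p :* (q :* i :* p)) refl p q (p ⁻¹)) (cong (p *_) (x/y*y (0<⇒≢ 0<p))))

    -- a - w is (√a - √w)(√a + √w), and the square of the second factor is at most 4 s for the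
    -- common total s. Equal totals turn the sum of the two instances of `hellinger` into the
    -- squared Hellinger distance.
    pinsker : ∀ {a₁ a₀ w₁ w₀} → 0ℝ ≤ a₁ → 0ℝ ≤ a₀ → 0ℝ ≤ w₁ → 0ℝ ≤ w₀ → (0ℝ < a₁ → 0ℝ < w₁) → (0ℝ < a₀ → 0ℝ < w₀) →
              a₁ + a₀ ≡ w₁ + w₀ → (a₁ - w₁) * (a₁ - w₁) ≤ fromℕ 2 * (a₁ + a₀) * (η a₁ w₁ + η a₀ w₀)
    pinsker {a₁} {a₀} {w₁} {w₀} 0≤a₁ 0≤a₀ 0≤w₁ 0≤w₀ a⇒w₁ a⇒w₀ total≡ = *-cancelˡ-≤ 0<2 (begin
      fromℕ 2 * ((a₁ - w₁) * (a₁ - w₁))                   ≡⟨ solve 2 (λ a w → :2 :* ((a :- w) :* (a :- w)) := (a :- w) :* (a :- w) :+ (w :- a) :* (w :- a)) refl a₁ w₁ ⟩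
      (a₁ - w₁) * (a₁ - w₁) + (w₁ - a₁) * (w₁ - a₁)       ≡⟨ cong (λ d → (a₁ - w₁) * (a₁ - w₁) + d * d) flip ⟩
      (a₁ - w₁) * (a₁ - w₁) + (a₀ - w₀) * (a₀ - w₀)       ≤⟨ +-mono-≤ (one 0≤a₁ 0≤w₁ (≤-cert 0≤a₀ refl) (≤-trans (≤-cert 0≤w₀ refl) (≤-reflexive (sym total≡))))
                                                              (one 0≤a₀ 0≤w₀ (≤-cert 0≤a₁ (ℝ.+-comm a₁ a₀)) (≤-trans (≤-cert 0≤w₁ (ℝ.+-comm w₁ w₀)) (≤-reflexive (sym total≡)))) ⟩
      fromℕ 4 * s * h a₁ w₁ + fromℕ 4 * s * h a₀ w₀       ≡⟨ solve 3 (λ s h h' → :4 :* s :* h :+ :4 :* s :* h' := :4 :* s :* (h :+ h')) refl s (h a₁ w₁) (h a₀ w₀) ⟩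
      fromℕ 4 * s * (h a₁ w₁ + h a₀ w₀)                   ≤⟨ *-monoʳ-≤ (0≤* (0≤fromℕ 4) (0≤+ 0≤a₁ 0≤a₀)) sum≤ ⟩
      fromℕ 4 * s * (η a₁ w₁ + η a₀ w₀)                   ≡⟨ solve 2 (λ s e → :4 :* s :* e := :2 :* (:2 :* s :* e)) refl s (η a₁ w₁ + η a₀ w₀) ⟩
      fromℕ 2 * (fromℕ 2 * s * (η a₁ w₁ + η a₀ w₀))       ∎)
      where
      open ≤-Reasoning
      s = a₁ + a₀
      h : ℝ → ℝ → ℝ
      h a w = (√ a - √ w) * (√ a - √ w)
      flip : w₁ - a₁ ≡ a₀ - w₀
      flip = trans (solve 3 (λ w a v → w :- a := (w :+ v) :- a :- v) refl w₁ a₁ w₀) (trans (cong (λ z → z - a₁ - w₀) (sym total≡)) (solve 3 (λ a b v → a :+ b :- a :- v := b :- v) refl a₁ a₀ w₀))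
      h≡ : ∀ {a w} → 0ℝ ≤ a → 0ℝ ≤ w → h a w ≡ a + w - fromℕ 2 * (√ a * √ w)
      h≡ {a} {w} p q = trans (solve 2 (λ a w → (a :- w) :* (a :- w) := a :* a :+ w :* w :- :2 :* (a :* w)) refl (√ a) (√ w)) (cong₂ (λ u v → u + v - fromℕ 2 * (√ a * √ w)) (√-square p) (√-square q))
      one : ∀ {a w} → 0ℝ ≤ a → 0ℝ ≤ w → a ≤ s → w ≤ s → (a - w) * (a - w) ≤ fromℕ 4 * s * h a w
      one {a} {w} 0≤a 0≤w a≤s w≤s = begin
        (a - w) * (a - w)                                 ≡⟨ cong₂ (λ u v → (u - v) * (u - v)) (sym (√-square 0≤a)) (sym (√-square 0≤w)) ⟩
        (√ a * √ a - √ w * √ w) * (√ a * √ a - √ w * √ w) ≡⟨ solve 2 (λ p q → (p :* p :- q :* q) :* (p :* p :- q :* q) := (:2 :* (p :* p) :+ :2 :* (q :* q) :- (p :- q) :* (p :- q)) :* ((p :- q) :* (p :- q))) refl (√ a) (√ w) ⟩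
        (fromℕ 2 * (√ a * √ a) + fromℕ 2 * (√ w * √ w) - h a w) * h a w ≤⟨ *-monoˡ-≤ (0≤x² _) (≤-cert (0≤+ (0≤+ (0≤* (<⇒≤ 0<2) (x≤y⇒0≤y-x a≤s)) (0≤* (<⇒≤ 0<2) (x≤y⇒0≤y-x w≤s))) (0≤x² (√ a - √ w)))
            (trans (solve 4 (λ s a w h → :4 :* s := :2 :* a :+ :2 :* w :- h :+ (:2 :* (s :- a) :+ :2 :* (s :- w) :+ h)) refl s a w (h a w))
              (cong₂ (λ u v → fromℕ 2 * u + fromℕ 2 * v - h a w + (fromℕ 2 * (s - a) + fromℕ 2 * (s - w) + h a w)) (sym (√-square 0≤a)) (sym (√-square 0≤w))))) ⟩
        fromℕ 4 * s * h a w                               ∎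
      sum≤ : h a₁ w₁ + h a₀ w₀ ≤ η a₁ w₁ + η a₀ w₀
      sum≤ = begin
        h a₁ w₁ + h a₀ w₀ ≡⟨ cong₂ _+_ (h≡ 0≤a₁ 0≤w₁) (h≡ 0≤a₀ 0≤w₀) ⟩
        (a₁ + w₁ - k₁) + (a₀ + w₀ - k₀)      ≡⟨ solve 6 (λ a b v w k l → (a :+ v :- k) :+ (b :+ w :- l) := (a :+ b) :+ (v :+ w) :- k :- l) refl a₁ a₀ w₁ w₀ k₁ k₀ ⟩
        (a₁ + a₀) + (w₁ + w₀) - k₁ - k₀      ≡⟨ cong (λ z → (a₁ + a₀) + z - k₁ - k₀) (sym total≡) ⟩
        (a₁ + a₀) + (a₁ + a₀) - k₁ - k₀      ≡⟨ solve 4 (λ a b k l → a :+ b :+ (a :+ b) :- k :- l := (:2 :* a :- k) :+ (:2 :* b :- l)) refl a₁ a₀ k₁ k₀ ⟩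
        (fromℕ 2 * a₁ - k₁) + (fromℕ 2 * a₀ - k₀) ≤⟨ +-mono-≤ (hellinger 0≤a₁ 0≤w₁ a⇒w₁) (hellinger 0≤a₀ 0≤w₀ a⇒w₀) ⟩
        η a₁ w₁ + η a₀ w₀                    ∎
        where
        k₁ = fromℕ 2 * (√ a₁ * √ w₁)
        k₀ = fromℕ 2 * (√ a₀ * √ w₀)

  open Entropy

  -- The cost of predicting one bit

  module BitCost where

    open IsLinear

    private variable
      n : ℕ
      t v : ℝ

    excess : ℝ → ℝ → ℝ
    excess t v with ≤-total v t
    ... | inj₁ _ = t - v
    ... | inj₂ _ = 0ℝ

    excess-≥ : v ≤ t → excess t v ≡ t - v
    excess-≥ {v} {t} p with ≤-total v t
    ... | inj₁ _ = refl
    ... | inj₂ q = trans (sym (ℝ.-‿inverseʳ t)) (cong (λ w → t - w) (≤-antisym q p))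

    excess-≤ : t ≤ v → excess t v ≡ 0ℝ
    excess-≤ {t} {v} p with ≤-total v t
    ... | inj₁ q = trans (cong (λ w → t - w) (≤-antisym q p)) (ℝ.-‿inverseʳ t)
    ... | inj₂ _ = refl

    weight : ℝ → Bool → ℝ
    weight t true  = t
    weight t false = 1ℝ - t

    -- With one shared uniform threshold h, this is the measure of those h for which the speaker's
    -- bit h < t is the given one and the prediction h < v differs from it.
    miss : ℝ → ℝ → Bool → ℝ
    miss t v true  = excess t v
    miss t v false = excess v t

    -- Relative entropy of the masses a₁, a₀ of the two branches from the same total distributed
    -- with probability t of true.
    divergence : ℝ → ℝ → ℝ → ℝ
    divergence a₁ a₀ t = η a₁ ((a₁ + a₀) * weight t true) + η a₀ ((a₁ + a₀) * weight t false)

    module NodeCost {a₁ a₀} (0≤a₁ : 0ℝ ≤ a₁) (0≤a₀ : 0ℝ ≤ a₀) where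

      private
        s = a₁ + a₀
        0≤s = 0≤+ 0≤a₁ 0≤a₀

      record Admissible (t : ℝ) : Set where
        field
          0≤t : 0ℝ ≤ t
          t≤1 : t ≤ 1ℝ
          a₁⇒ : 0ℝ < a₁ → 0ℝ < weight t true
          a₀⇒ : 0ℝ < a₀ → 0ℝ < weight t false

        0≤1-t : 0ℝ ≤ 1ℝ - t
        0≤1-t = x≤y⇒0≤y-x t≤1

        weights : s * weight t true + s * weight t false ≡ s
        weights = solve 2 (λ s t → s :* t :+ s :* (:1 :- t) := s) refl s t

        s⇒₁ : 0ℝ < a₁ → 0ℝ < s * weight t true
        s⇒₁ p = 0<* (0<+ p 0≤a₀) (a₁⇒ p)

        s⇒₀ : 0ℝ < a₀ → 0ℝ < s * weight t false
        s⇒₀ p = 0<* (subst (0ℝ <_) (ℝ.+-comm a₀ a₁) (0<+ p 0≤a₁)) (a₀⇒ p)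

        divergence-nonNeg : 0ℝ ≤ divergence a₁ a₀ t
        divergence-nonNeg = ≤-trans (≤-reflexive (trans (sym (ℝ.-‿inverseʳ s)) (trans (cong (λ w → s - w) (sym weights)) (solve 4 (λ a b c d → a :+ b :- (c :+ d) := a :- c :+ (b :- d)) refl a₁ a₀ (s * weight t true) (s * weight t false)))))
          (+-mono-≤ (gibbs 0≤a₁ (0≤* 0≤s 0≤t) s⇒₁) (gibbs 0≤a₀ (0≤* 0≤s 0≤1-t) s⇒₀))

        square≤ : (a₁ - s * t) * (a₁ - s * t) ≤ fromℕ 2 * s * divergence a₁ a₀ t
        square≤ = pinsker 0≤a₁ 0≤a₀ (0≤* 0≤s 0≤t) (0≤* 0≤s 0≤1-t) s⇒₁ s⇒₀ (sym weights)

        -- Pinsker made linear by the inequality of arithmetic and geometric means. In this form it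
        -- can be added over all nodes with one k, which replaces an application of Cauchy-Schwarz
        -- to the whole tree.
        deviation≤ : ∀ {k} → 0ℝ ≤ k → fromℕ 2 * k * ∣ a₁ - s * t ∣ ≤ divergence a₁ a₀ t + fromℕ 2 * (k * k) * s
        deviation≤ {k} 0≤k with 0≤⇒≡⊎< 0≤s
        ... | inj₂ 0<s = *-cancelˡ-≤ (0<* 0<2 0<s) (≤-cert (0≤+ (x≤y⇒0≤y-x square≤) (0≤x² (d - fromℕ 2 * k * s)))
            (trans (solve 4 (λ s D k d → :2 :* s :* (D :+ :2 :* (k :* k) :* s) := :2 :* s :* (:2 :* k :* d) :+ (:2 :* s :* D :- d :* d :+ (d :- :2 :* k :* s) :* (d :- :2 :* k :* s))) refl s (divergence a₁ a₀ t) k d)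
              (cong (λ z → fromℕ 2 * s * (fromℕ 2 * k * d) + (fromℕ 2 * s * divergence a₁ a₀ t - z + (d - fromℕ 2 * k * s) * (d - fromℕ 2 * k * s))) d²)))
          where
          d = ∣ a₁ - s * t ∣
          d² : d * d ≡ (a₁ - s * t) * (a₁ - s * t)
          d² with ∣∣-cases (a₁ - s * t)
          ... | inj₁ (eq , _) = cong₂ _*_ eq eq
          ... | inj₂ (eq , _) = trans (cong₂ _*_ eq eq) (solve 1 (λ d → :- d :* :- d := d :* d) refl (a₁ - s * t))
        ... | inj₁ s≡0 = ≤-trans (≤-reflexive (trans (cong (fromℕ 2 * k *_) zero-dev) (ℝ.zeroʳ _))) (0≤+ divergence-nonNeg (0≤* (0≤* (<⇒≤ 0<2) (0≤x² k)) 0≤s))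
          where
          a₁≡0 : a₁ ≡ 0ℝ
          a₁≡0 = ≤-antisym (≤-trans (≤-cert 0≤a₀ refl) (≤-reflexive s≡0)) 0≤a₁
          zero-dev : ∣ a₁ - s * t ∣ ≡ 0ℝ
          zero-dev = trans (cong ∣_∣ (trans (cong₂ (λ u w → u - w * t) a₁≡0 s≡0) (solve 1 (λ t → :0 :- :0 :* t := :0) refl t))) (≤-antisym (∣∣-≤ ≤-refl (≤-reflexive -0#≈0#)) (∣∣-nonNeg 0ℝ))

      -- If a were s t, the left side would be s (t - v). The replacement costs one deviation, as
      -- the quotient is at most 1, and s (t - v) is at most two further deviations by the triangle
      -- inequality.
      one-sided : ∀ {a s} → 0ℝ ≤ v → v ≤ t → a * ((t - v) / t) ≤ fromℕ 2 * ∣ a - s * t ∣ + ∣ a - s * v ∣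
      one-sided {v} {t} {a} {s} 0≤v v≤t with 0≤⇒≡⊎< (≤-trans 0≤v v≤t)
      ... | inj₁ t≡0 = ≤-trans (≤-reflexive (trans (cong (a *_) (x/0 t≡0)) (ℝ.zeroʳ a))) (0≤+ (0≤* (<⇒≤ 0<2) (∣∣-nonNeg _)) (∣∣-nonNeg _))
      ... | inj₂ 0<t = begin
        a * ρ                          ≡⟨ solve 4 (λ a s t r → a :* r := (a :- s :* t) :* r :+ s :* (r :* t)) refl a s t ρ ⟩
        dt * ρ + s * (ρ * t)           ≡⟨ cong (λ w → dt * ρ + s * w) (x/y*y (0<⇒≢ 0<t)) ⟩
        dt * ρ + s * (t - v)           ≡⟨ solve 5 (λ a s t v r → (a :- s :* t) :* r :+ s :* (t :- v) := (a :- s :* t) :* r :+ (:- (a :- s :* t) :+ (a :- s :* v))) refl a s t v ρ ⟩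
        dt * ρ + (- dt + dv)           ≤⟨ +-mono-≤ (≤-trans (*-monoˡ-≤ 0≤ρ (x≤∣x∣ dt)) (*-monoʳ-≤ (∣∣-nonNeg dt) ρ≤1)) (+-mono-≤ (-x≤∣x∣ dt) (x≤∣x∣ dv)) ⟩
        ∣ dt ∣ * 1ℝ + (∣ dt ∣ + ∣ dv ∣) ≡⟨ solve 2 (λ x y → x :* :1 :+ (x :+ y) := :2 :* x :+ y) refl ∣ dt ∣ ∣ dv ∣ ⟩
        fromℕ 2 * ∣ dt ∣ + ∣ dv ∣      ∎
        where
        open ≤-Reasoning
        ρ = (t - v) / t
        dt = a - s * t
        dv = a - s * v
        0≤ρ = 0≤/ (x≤y⇒0≤y-x v≤t) (<⇒≤ 0<t)
        ρ≤1 = x/z≤y 0<t (≤-cert 0≤v (solve 2 (λ t v → :1 :* t := t :- v :+ v) refl t v))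

      -- Each quotient is the conditional probability of a wrong prediction given the bit. The bits
      -- are drawn with probability t, but the mistakes are weighted with the masses a₁, a₀ of q.
      cost : ℝ → ℝ → ℝ
      cost t v = a₁ * (miss t v true / weight t true) + a₀ * (miss t v false / weight t false)

      cost≤deviations : Admissible t → Admissible v → cost t v ≤ fromℕ 2 * ∣ a₁ - s * t ∣ + ∣ a₁ - s * v ∣
      cost≤deviations {t} {v} At Av with ≤-total v t
      ... | inj₁ v≤t = ≤-trans (≤-reflexive (trans (cong (λ e → a₁ * ((t - v) / t) + a₀ * (e / (1ℝ - t))) (excess-≤ v≤t))
                         (trans (cong (λ z → a₁ * ((t - v) / t) + a₀ * z) 0/x) (trans (cong (a₁ * ((t - v) / t) +_) (ℝ.zeroʳ a₀)) (ℝ.+-identityʳ _)))))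
                         (one-sided (Admissible.0≤t Av) v≤t)
      ... | inj₂ t≤v = ≤-trans (≤-reflexive (trans (cong₂ (λ z e → a₁ * z + a₀ * (e / (1ℝ - t))) 0/x (excess-≥ t≤v))
                         (trans (cong (_+ a₀ * ((v - t) / (1ℝ - t))) (ℝ.zeroʳ a₁)) (trans (ℝ.+-identityˡ _) (cong (λ z → a₀ * (z / (1ℝ - t))) (solve 2 (λ t v → v :- t := (:1 :- t) :- (:1 :- v)) refl t v))))))
                         (≤-trans (one-sided {s = s} (Admissible.0≤1-t Av) (≤-cert (x≤y⇒0≤y-x t≤v) (solve 2 (λ t v → :1 :- t := :1 :- v :+ (v :- t)) refl t v)))
                           (≤-reflexive (cong₂ (λ x y → fromℕ 2 * x + y) (flip t) (flip v))))
        where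
        ∣-∣ : ∀ x → ∣ - x ∣ ≡ ∣ x ∣
        ∣-∣ x = ≤-antisym (∣∣-≤ (-x≤∣x∣ x) (≤-trans (≤-reflexive (-‿involutive x)) (x≤∣x∣ x))) (∣∣-≤ (≤-trans (≤-reflexive (sym (-‿involutive x))) (-x≤∣x∣ (- x))) (x≤∣x∣ (- x)))
        flip : ∀ t → ∣ a₀ - s * (1ℝ - t) ∣ ≡ ∣ a₁ - s * t ∣
        flip t = trans (cong ∣_∣ (solve 3 (λ a b t → b :- (a :+ b) :* (:1 :- t) := :- (a :- (a :+ b) :* t)) refl a₁ a₀ t)) (∣-∣ _)

      -- Two deviations from t and one from v, each with an error 2 k² s, make 6 k² s for twice the
      -- cost, whence the 3.
      cost≤ : Admissible t → Admissible v → ∀ {k} → 0ℝ ≤ k →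
              k * cost t v ≤ fromℕ 3 * (k * k) * s + (divergence a₁ a₀ t + divergence a₁ a₀ v)
      cost≤ {t} {v} At Av {k} 0≤k = *-cancelˡ-≤ 0<2 (begin
        fromℕ 2 * (k * cost t v)                            ≤⟨ *-monoʳ-≤ (<⇒≤ 0<2) (*-monoʳ-≤ 0≤k (cost≤deviations At Av)) ⟩
        fromℕ 2 * (k * (fromℕ 2 * dt + dv))                 ≡⟨ solve 3 (λ k x y → :2 :* (k :* (:2 :* x :+ y)) := :2 :* (:2 :* k :* x) :+ :2 :* k :* y) refl k dt dv ⟩
        fromℕ 2 * (fromℕ 2 * k * dt) + fromℕ 2 * k * dv     ≤⟨ +-mono-≤ (*-monoʳ-≤ (<⇒≤ 0<2) (Admissible.deviation≤ At 0≤k)) (Admissible.deviation≤ Av 0≤k) ⟩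
        fromℕ 2 * (D t + fromℕ 2 * (k * k) * s) + (D v + fromℕ 2 * (k * k) * s) ≤⟨ ≤-cert (Admissible.divergence-nonNeg Av)
            (solve 4 (λ x y k s → :2 :* (:3 :* (k :* k) :* s :+ (x :+ y)) := :2 :* (x :+ :2 :* (k :* k) :* s) :+ (y :+ :2 :* (k :* k) :* s) :+ y) refl (D t) (D v) k s) ⟩
        fromℕ 2 * (fromℕ 3 * (k * k) * s + (D t + D v))     ∎)
        where
        open ≤-Reasoning
        dt = ∣ a₁ - s * t ∣
        dv = ∣ a₁ - s * v ∣
        D = divergence a₁ a₀

      divergence-weights : Admissible t →
        divergence a₁ a₀ t ≡ (η a₁ 1ℝ - a₁ * ln (weight t true)) + (η a₀ 1ℝ - a₀ * ln (weight t false)) - η s 1ℝ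
      divergence-weights {t} At with 0≤⇒≡⊎< 0≤s
      ... | inj₂ 0<s = trans (cong₂ _+_ (η-scale a₁ 0≤a₁ (Admissible.a₁⇒ At) 0<s) (η-scale a₀ 0≤a₀ (Admissible.a₀⇒ At) 0<s))
        (solve 8 (λ a b la lb ls l1 wa wb → a :* (la :- wa) :- a :* ls :+ (b :* (lb :- wb) :- b :* ls)
           := (a :* (la :- l1) :- a :* wa) :+ (b :* (lb :- l1) :- b :* wb) :- (a :+ b) :* (ls :- l1)) refl a₁ a₀ (ln a₁) (ln a₀) (ln s) (ln 1ℝ) (ln (weight t true)) (ln (weight t false)))
      ... | inj₁ s≡0 = trans (cong₂ _+_ (η-zero a₁≡0) (η-zero a₀≡0)) (trans (solve 0 (:0 :+ :0 := (:0 :- :0) :+ (:0 :- :0) :- :0) refl) (sym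
        (cong₂ _-_ (cong₂ _+_ (cong₂ _-_ (η-zero a₁≡0) (zero* a₁≡0)) (cong₂ _-_ (η-zero a₀≡0) (zero* a₀≡0))) (η-zero s≡0))))
        where
        a₁≡0 : a₁ ≡ 0ℝ
        a₁≡0 = ≤-antisym (≤-trans (≤-cert 0≤a₀ refl) (≤-reflexive s≡0)) 0≤a₁
        a₀≡0 : a₀ ≡ 0ℝ
        a₀≡0 = ≤-antisym (≤-trans (≤-cert 0≤a₁ (ℝ.+-comm a₁ a₀)) (≤-reflexive s≡0)) 0≤a₀
        zero* : ∀ {a b} → a ≡ 0ℝ → a * b ≡ 0ℝ
        zero* refl = ℝ.zeroˡ _

      module _ {g₁ g₀} (0≤g₁ : 0ℝ ≤ g₁) (0≤g₀ : 0ℝ ≤ g₀) (a⇒g₁ : 0ℝ < a₁ → 0ℝ < g₁) (a⇒g₀ : 0ℝ < a₀ → 0ℝ < g₀) where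

        private
          g = g₁ + g₀
          0≤g = 0≤+ 0≤g₁ 0≤g₀
          v₁ = g₁ / g

          1-v₁ : 0ℝ < g → 1ℝ - v₁ ≡ g₀ / g
          1-v₁ 0<g = trans (cong (λ w → w - v₁) (sym (x/x (0<⇒≢ 0<g)))) (solve 3 (λ a b i → (a :+ b) :* i :- a :* i := b :* i) refl g₁ g₀ (g ⁻¹))

        prediction-admissible : Admissible v₁
        prediction-admissible = record
          { 0≤t = 0≤/ 0≤g₁ 0≤g
          ; t≤1 = case 0≤⇒≡⊎< 0≤g of λ where
              (inj₁ g≡0) → ≤-trans (≤-reflexive (x/0 g≡0)) 0≤1
              (inj₂ 0<g) → x/z≤y 0<g (≤-cert 0≤g₀ (ℝ.*-identityˡ g))
          ; a₁⇒ = λ p → 0</ (a⇒g₁ p) (0<+ (a⇒g₁ p) 0≤g₀)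
          ; a₀⇒ = λ p → let 0<g = subst (0ℝ <_) (ℝ.+-comm g₀ g₁) (0<+ (a⇒g₀ p) 0≤g₁) in subst (0ℝ <_) (sym (1-v₁ 0<g)) (0</ (a⇒g₀ p) 0<g)
          }

        -- The chain rule at a node: for a prediction derived from a measure on histories, the
        -- divergence is the η of the children minus that of the node, which telescopes along the
        -- tree.
        divergence-prediction : divergence a₁ a₀ v₁ ≡ η a₁ g₁ + η a₀ g₀ - η s g
        divergence-prediction = trans (divergence-weights prediction-admissible) (trans (cong₂ (λ x y → x + y - η s 1ℝ) (part 0≤a₁ a⇒v₁) (part 0≤a₀ a⇒v₀))
          (trans (solve 7 (λ x y a b ls l1 lg → (x :+ a :* (lg :- l1)) :+ (y :+ b :* (lg :- l1)) :- (a :+ b) :* (ls :- l1) := x :+ y :- (a :+ b) :* (ls :- lg)) refl (η a₁ g₁) (η a₀ g₀) a₁ a₀ (ln s) (ln 1ℝ) (ln g)) refl))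
          where
          a⇒v₁ : 0ℝ < a₁ → 0ℝ < g₁ × ln v₁ ≡ ln g₁ - ln g
          a⇒v₁ p = a⇒g₁ p , ln-/ (a⇒g₁ p) (0<+ (a⇒g₁ p) 0≤g₀)
          a⇒v₀ : 0ℝ < a₀ → 0ℝ < g₀ × ln (1ℝ - v₁) ≡ ln g₀ - ln g
          a⇒v₀ p = let 0<g = subst (0ℝ <_) (ℝ.+-comm g₀ g₁) (0<+ (a⇒g₀ p) 0≤g₁) in a⇒g₀ p , trans (cong ln (1-v₁ 0<g)) (ln-/ (a⇒g₀ p) 0<g)
          part : ∀ {a h l} → 0ℝ ≤ a → (0ℝ < a → 0ℝ < h × l ≡ ln h - ln g) → η a 1ℝ - a * l ≡ η a h + a * (ln g - ln 1ℝ)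
          part {a} {h} {l} 0≤a p with 0≤⇒≡⊎< 0≤a
          ... | inj₁ refl = solve 6 (λ la l1 l lh lg z → z :* (la :- l1) :- z :* l := z :* (la :- lh) :+ z :* (lg :- l1) :+ z :* (lh :- lg :- l)) refl (ln 0ℝ) (ln 1ℝ) l (ln h) (ln g) 0ℝ ∙ cancel
            where
            cancel : 0ℝ * (ln h - ln g - l) ≡ 0ℝ
            cancel = ℝ.zeroˡ _
            _∙_ : ∀ {x y z} → x ≡ y + z → z ≡ 0ℝ → x ≡ y
            _∙_ {y = y} p refl = trans p (ℝ.+-identityʳ y)
          ... | inj₂ 0<a = trans (cong (λ l → η a 1ℝ - a * l) (proj₂ (p 0<a))) (solve 5 (λ a la l1 lh lg → a :* (la :- l1) :- a :* (lh :- lg) := a :* (la :- lh) :+ a :* (lg :- l1)) refl a (ln a) (ln 1ℝ) (ln h) (ln g))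

        prediction-gain : η s g ≤ η a₁ g₁ + η a₀ g₀
        prediction-gain = ≤-cert (Admissible.divergence-nonNeg prediction-admissible)
          (trans (solve 2 (λ x y → x := y :+ (x :- y)) refl (η a₁ g₁ + η a₀ g₀) (η s g)) (cong (η s g +_) (sym divergence-prediction)))

    -- Binary trees of probabilities of true: at the nodes where a player speaks
    -- the law of her next bit, elsewhere her prediction of the other's next bit.
    data Labels : ℕ → Set where
      end  : Labels 0
      node : ℝ → (Bool → Labels n) → Labels (suc n)

    mass : (Vec Bool n → ℝ) → ℝ
    mass {n} = sumBits n

    restrict : Bool → (Vec Bool (suc n) → ℝ) → Vec Bool n → ℝ
    restrict b F m = F (b ∷ m)

    -- Own bits follow F, later a marginal of p; the other's bits are predicted from G, a marginal
    -- of q. Below a null history the quotient 0 / 0 = 0 still gives a probability.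
    labels : Vec Bool n → (F G : Vec Bool n → ℝ) → Labels n
    labels []       F G = end
    labels (o ∷ os) F G = node (let P = if o then F else G in mass (restrict true P) / mass P)
                               (λ b → labels os (restrict b F) (restrict b G))

    law : Vec Bool n → Labels n → Labels n → Vec Bool n → ℝ
    law []       end        end          []      = 1ℝ
    law (o ∷ os) (node t l) (node t′ l′) (b ∷ m) = weight (if o then t else t′) b * law os (l b) (l′ b) m

    -- The expected number of mistakes on the event that the history is the given one.
    mistakesAt : Vec Bool n → Labels n → Labels n → Vec Bool n → ℝ
    mistakesAt []       end        end          []      = 0ℝ
    mistakesAt (o ∷ os) (node t l) (node t′ l′) (b ∷ m) =
      miss (if o then t else t′) (if o then t′ else t) b * law os (l b) (l′ b) m +
      weight (if o then t else t′) b * mistakesAt os (l b) (l′ b) m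

    -- The relative entropy of the normalised measures times the mass of Q; subtracting the term of
    -- the totals is what makes it a sum of nonnegative increments over the nodes. In `surprise` the
    -- second measure is a law, with 1 in place of its total.
    information : (Q G : Vec Bool n → ℝ) → ℝ
    information Q G = mass (λ m → η (Q m) (G m)) - η (mass Q) (mass G)

    surprise : (Q w : Vec Bool n → ℝ) → ℝ
    surprise Q w = mass (λ m → η (Q m) (w m)) - η (mass Q) 1ℝ

  open BitCost

  -- The expected number of wrong predictions along a history

  module HistoryCost where

    open IsLinear

    private variable
      A : Set
      n : ℕ

    support : ∀ {F : (A → ℝ) → ℝ} {Q : A → ℝ} → IsLinear F → (∀ i → 0ℝ ≤ Q i) → 0ℝ < F Q → ∃ λ i → 0ℝ < Q i
    support {Q = Q} lin 0≤Q 0<FQ with lem {∃ λ i → 0ℝ < Q i}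
    ... | yes p = p
    ... | no ¬p = contradiction 0<FQ λ p → 0<⇒≢ p (trans (congruent lin λ i → ≤-antisym (≮⇒≥ λ q → ¬p (i , q)) (0≤Q i)) (null lin))

    record Dominated {A : Set} (Q G : A → ℝ) : Set where
      field
        0≤Q : ∀ i → 0ℝ ≤ Q i
        0≤G : ∀ i → 0ℝ ≤ G i
        Q⇒G : ∀ i → 0ℝ < Q i → 0ℝ < G i

    open Dominated

    dominated-∘ : ∀ {B : Set} {Q G : A → ℝ} (f : B → A) → Dominated Q G → Dominated (Q ∘ f) (G ∘ f)
    dominated-∘ f d = record { 0≤Q = 0≤Q d ∘ f ; 0≤G = 0≤G d ∘ f ; Q⇒G = Q⇒G d ∘ f }

    dominated-mass : ∀ {Q G : Vec Bool n → ℝ} → Dominated Q G → 0ℝ < mass Q → 0ℝ < mass G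
    dominated-mass {n} d p = let m , q = support (sumBits-linear n) (0≤Q d) p in <-≤-trans (Q⇒G d m q) (term≤sumBits (0≤G d) m)

    mass-nonNeg : ∀ {Q : Vec Bool n → ℝ} → (∀ m → 0ℝ ≤ Q m) → 0ℝ ≤ mass Q
    mass-nonNeg {n} = nonNegative (sumBits-linear n)

    Probability : ℝ → Set
    Probability t = 0ℝ ≤ t × t ≤ 1ℝ

    weight-nonNeg : ∀ {t} b → Probability t → 0ℝ ≤ weight t b
    weight-nonNeg true  (0≤t , _) = 0≤t
    weight-nonNeg false (_ , t≤1) = x≤y⇒0≤y-x t≤1

    fraction : ∀ {a b} → 0ℝ ≤ a → 0ℝ ≤ b → Probability (a / (a + b))
    fraction {a} {b} p q = 0≤/ p (0≤+ p q) , (case 0≤⇒≡⊎< (0≤+ p q) of λ where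
      (inj₁ s≡0) → ≤-trans (≤-reflexive (x/0 s≡0)) 0≤1
      (inj₂ 0<s) → x/z≤y 0<s (≤-cert q (ℝ.*-identityˡ _)))

    data LabelsIn (P : ℝ → Set) : Labels n → Set where
      end  : LabelsIn P end
      node : ∀ {t} {l : Bool → Labels n} → P t → (∀ b → LabelsIn P (l b)) → LabelsIn P (node t l)

    labels-probability : ∀ (os : Vec Bool n) {F G} → (∀ m → 0ℝ ≤ F m) → (∀ m → 0ℝ ≤ G m) → LabelsIn Probability (labels os F G)
    labels-probability []       p q = end
    labels-probability (o ∷ os) {F} {G} p q = node (own o) λ b → labels-probability os (p ∘ (b ∷_)) (q ∘ (b ∷_))
      where
      own : ∀ o → Probability (let P = if o then F else G in mass (restrict true P) / mass P)
      own true  = fraction (mass-nonNeg (p ∘ (true ∷_))) (mass-nonNeg (p ∘ (false ∷_)))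
      own false = fraction (mass-nonNeg (q ∘ (true ∷_))) (mass-nonNeg (q ∘ (false ∷_)))

    law-nonNeg : ∀ (os : Vec Bool n) {l l′} → LabelsIn Probability l → LabelsIn Probability l′ → ∀ m → 0ℝ ≤ law os l l′ m
    law-nonNeg []           end        end          []      = 0≤1
    law-nonNeg (true ∷ os)  (node p l) (node p′ l′) (b ∷ m) = 0≤* (weight-nonNeg b p) (law-nonNeg os (l b) (l′ b) m)
    law-nonNeg (false ∷ os) (node p l) (node p′ l′) (b ∷ m) = 0≤* (weight-nonNeg b p′) (law-nonNeg os (l b) (l′ b) m)

    -- One step of the induction: the next bit has probability t for its owner,
    -- whereas the other player predicts it from G.
    module _ {n} (k : ℝ) (0≤k : 0ℝ ≤ k) {t : ℝ} (t∈ : Probability t) {Q : Vec Bool (suc n) → ℝ} {law′ mis′ : Bool → Vec Bool n → ℝ}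
             {G H : Vec Bool (suc n) → ℝ} (Q≪law : Dominated Q (λ m → weight t (Vec.head m) * law′ (Vec.head m) (Vec.tail m)))
             (0≤law′ : ∀ b m → 0ℝ ≤ law′ b m) (Q≪G : Dominated Q G) (Q≪H : Dominated Q H) where

      private
        v = mass (restrict true G) / mass G
        a g h : Bool → ℝ
        a b = mass (restrict b Q)
        g b = mass (restrict b G)
        h b = mass (restrict b H)
        0≤a : ∀ b → 0ℝ ≤ a b
        0≤a b = mass-nonNeg (0≤Q Q≪G ∘ (b ∷_))
        0≤g : ∀ b → 0ℝ ≤ g b
        0≤g b = mass-nonNeg (0≤G Q≪G ∘ (b ∷_))
        0≤h : ∀ b → 0ℝ ≤ h b
        0≤h b = mass-nonNeg (0≤G Q≪H ∘ (b ∷_))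
        w = weight t
        lin = sumBits-linear n
        term : Bool → ℝ
        term b = mass (λ m → Q (b ∷ m) * (mis′ b m / law′ b m))

      factors : ∀ b m → 0ℝ < Q (b ∷ m) → 0ℝ < w b × 0ℝ < law′ b m
      factors b m p = let q = Q⇒G Q≪law (b ∷ m) p in
        0≤∧≢⇒0< (weight-nonNeg b t∈) (λ w≡0 → 0<⇒≢ q (trans (cong (_* law′ b m) w≡0) (ℝ.zeroˡ _))) ,
        0≤∧≢⇒0< (0≤law′ b m) (λ l≡0 → 0<⇒≢ q (trans (cong (w b *_) l≡0) (ℝ.zeroʳ _)))

      a⇒w : ∀ b → 0ℝ < a b → 0ℝ < w b
      a⇒w b p = let m , q = support lin (0≤Q Q≪G ∘ (b ∷_)) p in proj₁ (factors b m q)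

      open NodeCost (0≤a true) (0≤a false)

      admissible : Admissible t
      admissible = record { 0≤t = proj₁ t∈ ; t≤1 = proj₂ t∈ ; a₁⇒ = a⇒w true ; a₀⇒ = a⇒w false }

      -- Dividing by the likelihood of the whole history separates the mistake at this node from the
      -- later ones; where the likelihood vanishes, Q does too.
      split-term : ∀ b → mass (λ m → Q (b ∷ m) * ((miss t v b * law′ b m + w b * mis′ b m) / (w b * law′ b m))) ≡ a b * (miss t v b / w b) + term b
      split-term b = trans (congruent lin pointwise) (trans (additive lin (λ m → Q (b ∷ m) * (miss t v b / w b)) (λ m → Q (b ∷ m) * (mis′ b m / law′ b m)))
        (cong (_+ term b) (homogeneousʳ lin (miss t v b / w b) (restrict b Q))))
        where
        pointwise : ∀ m → Q (b ∷ m) * ((miss t v b * law′ b m + w b * mis′ b m) / (w b * law′ b m)) ≡ Q (b ∷ m) * (miss t v b / w b) + Q (b ∷ m) * (mis′ b m / law′ b m)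
        pointwise m with 0≤⇒≡⊎< (0≤Q Q≪G (b ∷ m))
        ... | inj₁ q≡0 = trans (zero* q≡0) (trans (sym (ℝ.+-identityˡ 0ℝ)) (sym (cong₂ _+_ (zero* q≡0) (zero* q≡0))))
          where
          zero* : ∀ {x y} → x ≡ 0ℝ → x * y ≡ 0ℝ
          zero* refl = ℝ.zeroˡ _
        ... | inj₂ 0<q = let 0<w , 0<l = factors b m 0<q ; M = miss t v b ; l = law′ b m ; e = mis′ b m in
          trans (cong (Q (b ∷ m) *_) (sym (x≡z/y (0<⇒≢ (0<* 0<w 0<l)) (trans (solve 6 (λ M wi e li w l → (M :* wi :+ e :* li) :* (w :* l) := M :* wi :* w :* l :+ w :* (e :* li :* l)) refl M (w b ⁻¹) e (l ⁻¹) (w b) l)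
            (cong₂ (λ x y → x * l + w b * y) (x/y*y (0<⇒≢ 0<w)) (x/y*y (0<⇒≢ 0<l))))))) (ℝ.distribˡ _ _ _)

      surprise-split : ∀ b → mass (λ m → η (Q (b ∷ m)) (w b * law′ b m)) ≡ mass (λ m → η (Q (b ∷ m)) (law′ b m)) - a b * ln (w b)
      surprise-split b = trans (congruent lin pointwise) (trans (subtractive lin (λ m → η (Q (b ∷ m)) (law′ b m)) (λ m → Q (b ∷ m) * ln (w b)))
        (cong (λ z → mass (λ m → η (Q (b ∷ m)) (law′ b m)) - z) (homogeneousʳ lin (ln (w b)) (restrict b Q))))
        where
        pointwise : ∀ m → η (Q (b ∷ m)) (w b * law′ b m) ≡ η (Q (b ∷ m)) (law′ b m) - Q (b ∷ m) * ln (w b)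
        pointwise m with 0≤⇒≡⊎< (0≤Q Q≪G (b ∷ m))
        ... | inj₂ 0<q = η-scale (Q (b ∷ m)) (<⇒≤ 0<q) (λ _ → proj₂ (factors b m 0<q)) (proj₁ (factors b m 0<q))
        ... | inj₁ q≡0 = trans (η-zero q≡0) (trans (solve 0 (:0 := :0 :- :0) refl) (sym (cong₂ _-_ (η-zero q≡0) (trans (cong (_* ln (w b)) q≡0) (ℝ.zeroˡ _)))))

      tree-step : (∀ b → k * term b ≤ fromℕ 3 * (k * k) * (fromℕ n * a b) + (surprise (restrict b Q) (law′ b) + (information (restrict b Q) (restrict b G) + information (restrict b Q) (restrict b H)))) →
        k * mass (λ m → Q m * ((miss t v (Vec.head m) * law′ (Vec.head m) (Vec.tail m) + w (Vec.head m) * mis′ (Vec.head m) (Vec.tail m)) / (w (Vec.head m) * law′ (Vec.head m) (Vec.tail m)))) ≤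
        fromℕ 3 * (k * k) * (fromℕ (suc n) * mass Q) + (surprise Q (λ m → w (Vec.head m) * law′ (Vec.head m) (Vec.tail m)) + (information Q G + information Q H))
      tree-step ih = begin
        k * (_ + _)                                    ≡⟨ cong (k *_) (cong₂ _+_ (split-term true) (split-term false)) ⟩
        k * ((c₁ + T₁) + (c₀ + T₀))                    ≡⟨ solve 5 (λ k c d s t → k :* ((c :+ s) :+ (d :+ t)) := k :* (c :+ d) :+ (k :* s :+ k :* t)) refl k c₁ c₀ T₁ T₀ ⟩
        k * (c₁ + c₀) + (k * T₁ + k * T₀)              ≤⟨ +-mono-≤ (cost≤ admissible (prediction-admissible (0≤g true) (0≤g false) (dominated-mass (dominated-∘ (true ∷_) Q≪G)) (dominated-mass (dominated-∘ (false ∷_) Q≪G))) 0≤k) (+-mono-≤ (ih true) (ih false)) ⟩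
        K * s + (D t + D v) + ((K * (N * a true) + (S₁ - η (a true) 1ℝ + (I₁ - η (a true) (g true) + (J₁ - η (a true) (h true))))) + (K * (N * a false) + (S₀ - η (a false) 1ℝ + (I₀ - η (a false) (g false) + (J₀ - η (a false) (h false))))))
          ≡⟨ cong₂ (λ x y → K * s + (x + y) + ((K * (N * a true) + (S₁ - η (a true) 1ℝ + (I₁ - η (a true) (g true) + (J₁ - η (a true) (h true))))) + (K * (N * a false) + (S₀ - η (a false) 1ℝ + (I₀ - η (a false) (g false) + (J₀ - η (a false) (h false)))))))
               (divergence-weights admissible) (divergence-prediction (0≤g true) (0≤g false) (dominated-mass (dominated-∘ (true ∷_) Q≪G)) (dominated-mass (dominated-∘ (false ∷_) Q≪G))) ⟩
        K * s + ((η (a true) 1ℝ - L₁ + (η (a false) 1ℝ - L₀) - η s 1ℝ) + (η (a true) (g true) + η (a false) (g false) - η s gg)) + ((K * (N * a true) + (S₁ - η (a true) 1ℝ + (I₁ - η (a true) (g true) + (J₁ - η (a true) (h true))))) + (K * (N * a false) + (S₀ - η (a false) 1ℝ + (I₀ - η (a false) (g false) + (J₀ - η (a false) (h false))))))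
          ≡⟨ rearrange K N (a true) (a false) (η (a true) 1ℝ) (η (a false) 1ℝ) L₁ L₀ (η s 1ℝ) (η (a true) (g true)) (η (a false) (g false)) (η s gg) S₁ S₀ I₁ I₀ J₁ J₀ (η (a true) (h true)) (η (a false) (h false)) ⟩
        K * ((1ℝ + N) * s) + (((S₁ - L₁) + (S₀ - L₀) - η s 1ℝ) + ((I₁ + I₀ - η s gg) + (J₁ + J₀ - (η (a true) (h true) + η (a false) (h false)))))
          -- H is the marginal of the player who speaks here. Nothing is predicted from it at this
          -- node, and its information increment is nonnegative.
          ≤⟨ +-monoʳ-≤ _ (+-monoʳ-≤ _ (+-monoʳ-≤ _ (+-monoʳ-≤ _ (neg-mono-≤ (prediction-gain (0≤h true) (0≤h false) (dominated-mass (dominated-∘ (true ∷_) Q≪H)) (dominated-mass (dominated-∘ (false ∷_) Q≪H))))))) ⟩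
        K * ((1ℝ + N) * s) + (((S₁ - L₁) + (S₀ - L₀) - η s 1ℝ) + ((I₁ + I₀ - η s gg) + (J₁ + J₀ - η s hh)))
          ≡⟨ cong₂ (λ x y → K * ((1ℝ + N) * s) + ((x + y - η s 1ℝ) + ((I₁ + I₀ - η s gg) + (J₁ + J₀ - η s hh)))) (sym (surprise-split true)) (sym (surprise-split false)) ⟩
        _ ∎
        where
        open ≤-Reasoning
        K = fromℕ 3 * (k * k)
        N = fromℕ n
        s = a true + a false
        gg = g true + g false
        hh = h true + h false
        D = divergence (a true) (a false)
        c₁ = a true * (miss t v true / w true)
        c₀ = a false * (miss t v false / w false)
        T₁ = term true
        T₀ = term false
        S₁ = mass (λ m → η (Q (true ∷ m)) (law′ true m))
        S₀ = mass (λ m → η (Q (false ∷ m)) (law′ false m))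
        I₁ = mass (λ m → η (Q (true ∷ m)) (G (true ∷ m)))
        I₀ = mass (λ m → η (Q (false ∷ m)) (G (false ∷ m)))
        J₁ = mass (λ m → η (Q (true ∷ m)) (H (true ∷ m)))
        J₀ = mass (λ m → η (Q (false ∷ m)) (H (false ∷ m)))
        L₁ = a true * ln (w true)
        L₀ = a false * ln (w false)
        rearrange : ∀ K N a b ea eb l m es ga gb gs S T I J U V ha hb →
          K * (a + b) + ((ea - l + (eb - m) - es) + (ga + gb - gs)) + ((K * (N * a) + (S - ea + (I - ga + (U - ha)))) + (K * (N * b) + (T - eb + (J - gb + (V - hb)))))
          ≡ K * ((1ℝ + N) * (a + b)) + (((S - l) + (T - m) - es) + ((I + J - gs) + (U + V - (ha + hb))))
        rearrange = solve 20 (λ K N a b ea eb l m es ga gb gs S T I J U V ha hb →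
          K :* (a :+ b) :+ ((ea :- l :+ (eb :- m) :- es) :+ (ga :+ gb :- gs)) :+ ((K :* (N :* a) :+ (S :- ea :+ (I :- ga :+ (U :- ha)))) :+ (K :* (N :* b) :+ (T :- eb :+ (J :- gb :+ (V :- hb)))))
          := K :* ((:1 :+ N) :* (a :+ b)) :+ (((S :- l) :+ (T :- m) :- es) :+ ((I :+ J :- gs) :+ (U :+ V :- (ha :+ hb))))) refl

    -- A wrong prediction at a node is paid for by the divergence of q from the speaker's law, an
    -- increment of `surprise`, and by its divergence from the listener's prediction, an increment
    -- of `information`. The error terms 3 k² add up to the mass of Q once per level.
    mistakes-bound : ∀ {n} (os : Vec Bool n) {Q Fᴬ Gᴬ Fᴮ Gᴮ : Vec Bool n → ℝ} {k} → 0ℝ ≤ k →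
      (∀ m → 0ℝ ≤ Fᴬ m) → (∀ m → 0ℝ ≤ Fᴮ m) → Dominated Q Gᴬ → Dominated Q Gᴮ →
      let lᴬ = labels os Fᴬ Gᴬ ; lᴮ = labels (Vec.map not os) Fᴮ Gᴮ in
      (∀ m → 0ℝ < Q m → 0ℝ < law os lᴬ lᴮ m) →
      k * mass (λ m → Q m * (mistakesAt os lᴬ lᴮ m / law os lᴬ lᴮ m)) ≤
      fromℕ 3 * (k * k) * (fromℕ n * mass Q) + (surprise Q (law os lᴬ lᴮ) + (information Q Gᴬ + information Q Gᴮ))
    mistakes-bound [] {Q} {Gᴬ = Gᴬ} {Gᴮ = Gᴮ} {k} 0≤k 0≤Fᴬ 0≤Fᴮ Q≪Gᴬ Q≪Gᴮ Q⇒law = ≤-reflexive (trans (cong (λ z → k * (Q [] * z)) 0/x)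
      (solve 5 (λ k q s g h → k :* (q :* :0) := :3 :* (k :* k) :* (:0 :* q) :+ (s :- s :+ (g :- g :+ (h :- h)))) refl k (Q []) (η (Q []) 1ℝ) (η (Q []) (Gᴬ [])) (η (Q []) (Gᴮ []))))
    mistakes-bound {suc n} (o ∷ os) {Q} {Fᴬ} {Gᴬ} {Fᴮ} {Gᴮ} {k} 0≤k 0≤Fᴬ 0≤Fᴮ Q≪Gᴬ Q≪Gᴮ Q⇒law = go o Q⇒law
      where
      lᴬ lᴮ : ∀ b → Labels n
      lᴬ b = labels os (restrict b Fᴬ) (restrict b Gᴬ)
      lᴮ b = labels (Vec.map not os) (restrict b Fᴮ) (restrict b Gᴮ)
      0≤law : ∀ b m → 0ℝ ≤ law os (lᴬ b) (lᴮ b) m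
      0≤law b = law-nonNeg os (labels-probability os (0≤Fᴬ ∘ (b ∷_)) (0≤G Q≪Gᴬ ∘ (b ∷_))) (labels-probability (Vec.map not os) (0≤Fᴮ ∘ (b ∷_)) (0≤G Q≪Gᴮ ∘ (b ∷_)))
      own : (F : Vec Bool (suc n) → ℝ) → ℝ
      own F = mass (restrict true F) / mass F
      dominated : ∀ t → Probability t → (∀ b m → 0ℝ < Q (b ∷ m) → 0ℝ < weight t b * law os (lᴬ b) (lᴮ b) m) →
        Dominated Q (λ m → weight t (Vec.head m) * law os (lᴬ (Vec.head m)) (lᴮ (Vec.head m)) (Vec.tail m))
      dominated t t∈ h = record
        { 0≤Q = 0≤Q Q≪Gᴬ
        ; 0≤G = λ m → 0≤* (weight-nonNeg (Vec.head m) t∈) (0≤law (Vec.head m) (Vec.tail m))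
        ; Q⇒G = λ { (b ∷ m) → h b m }
        }
      ih : (∀ b m → 0ℝ < Q (b ∷ m) → 0ℝ < law os (lᴬ b) (lᴮ b) m) → ∀ b →
        k * mass (λ m → Q (b ∷ m) * (mistakesAt os (lᴬ b) (lᴮ b) m / law os (lᴬ b) (lᴮ b) m)) ≤
        fromℕ 3 * (k * k) * (fromℕ n * mass (restrict b Q)) + (surprise (restrict b Q) (law os (lᴬ b) (lᴮ b)) + (information (restrict b Q) (restrict b Gᴬ) + information (restrict b Q) (restrict b Gᴮ)))
      ih h b = mistakes-bound os 0≤k (0≤Fᴬ ∘ (b ∷_)) (0≤Fᴮ ∘ (b ∷_)) (dominated-∘ (b ∷_) Q≪Gᴬ) (dominated-∘ (b ∷_) Q≪Gᴮ) (h b)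
      law⇒ : ∀ {w l} → 0ℝ ≤ l → 0ℝ < w * l → 0ℝ < l
      law⇒ {w} 0≤l p = 0≤∧≢⇒0< 0≤l λ l≡0 → 0<⇒≢ p (trans (cong (w *_) l≡0) (ℝ.zeroʳ w))
      go : ∀ o → (∀ m → 0ℝ < Q m → 0ℝ < law (o ∷ os) (labels (o ∷ os) Fᴬ Gᴬ) (labels (not o ∷ Vec.map not os) Fᴮ Gᴮ) m) →
        k * mass (λ m → Q m * (mistakesAt (o ∷ os) (labels (o ∷ os) Fᴬ Gᴬ) (labels (not o ∷ Vec.map not os) Fᴮ Gᴮ) m / law (o ∷ os) (labels (o ∷ os) Fᴬ Gᴬ) (labels (not o ∷ Vec.map not os) Fᴮ Gᴮ) m)) ≤
        fromℕ 3 * (k * k) * (fromℕ (suc n) * mass Q) + (surprise Q (law (o ∷ os) (labels (o ∷ os) Fᴬ Gᴬ) (labels (not o ∷ Vec.map not os) Fᴮ Gᴮ)) + (information Q Gᴬ + information Q Gᴮ))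
      go true h = let t∈ = fraction (mass-nonNeg (0≤Fᴬ ∘ (true ∷_))) (mass-nonNeg (0≤Fᴬ ∘ (false ∷_))) in
        ≤-trans (tree-step k 0≤k {t = own Fᴬ} t∈ {Q = Q} {law′ = λ b → law os (lᴬ b) (lᴮ b)} {mis′ = λ b → mistakesAt os (lᴬ b) (lᴮ b)} {G = Gᴮ} {H = Gᴬ}
            (dominated (own Fᴬ) t∈ (λ b m → h (b ∷ m))) 0≤law Q≪Gᴮ Q≪Gᴬ
            (λ b → ≤-trans (ih (λ b m → law⇒ (0≤law b m) ∘ h (b ∷ m)) b) (≤-reflexive (swap _ _ (information (restrict b Q) (restrict b Gᴬ)) (information (restrict b Q) (restrict b Gᴮ))))))
          (≤-reflexive (swap _ _ (information Q Gᴮ) (information Q Gᴬ)))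
        where
        swap : ∀ x y u v → x + (y + (u + v)) ≡ x + (y + (v + u))
        swap x y u v = cong (λ z → x + (y + z)) (ℝ.+-comm u v)
      go false h = let t∈ = fraction (mass-nonNeg (0≤Fᴮ ∘ (true ∷_))) (mass-nonNeg (0≤Fᴮ ∘ (false ∷_))) in
        tree-step k 0≤k {t = own Fᴮ} t∈ {Q = Q} {law′ = λ b → law os (lᴬ b) (lᴮ b)} {mis′ = λ b → mistakesAt os (lᴬ b) (lᴮ b)} {G = Gᴬ} {H = Gᴮ}
            (dominated (own Fᴮ) t∈ (λ b m → h (b ∷ m))) 0≤law Q≪Gᴬ Q≪Gᴮ
            (ih (λ b m → law⇒ (0≤law b m) ∘ h (b ∷ m)))

  open HistoryCost

  -- Sampling a history from shared thresholds

  module HistorySimulation where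

    open Search using (Strategy; State; flags; pathᴬ; pathᴮ; truth; mistakes; start)

    open IsLinear

    private variable
      n : ℕ

    -- One threshold per level serves both players and all nodes of the level: sharing it correlates
    -- the guesses, and a history meets each level only once, so its bits still have the prescribed
    -- law.
    strategy : Vec ℝ n → Labels n → Strategy n
    strategy []       end        = Search.end
    strategy (h ∷ hs) (node t l) = Search.node (decide (h < t)) λ b → strategy hs (l b)

    module _ (ts : List ℝ) where

      private
        P : Expectation ℝ
        P = threshold ts

      Realisable : ℝ → Set
      Realisable t = Probability t × t ∈ ts

      P[h<_] : ∀ {t} → Realisable t → E P (λ h → 1[ h < t ]) ≡ t
      P[h< (0≤t , t≤1) , t∈ ] = P[h<t] t∈ 0≤t t≤1

      1[decide]-true : ∀ Q → 1[ decide Q ≡ true ] ≡ 1[ Q ]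
      1[decide]-true Q with lem {Q}
      ... | yes q = 1[]-cong (λ _ → q) (λ _ → refl)
      ... | no ¬q = 1[]-cong (λ ()) (λ q → contradiction q ¬q)

      1[decide]-false : ∀ Q → 1[ decide Q ≡ false ] ≡ 1ℝ - 1[ Q ]
      1[decide]-false Q with lem {Q}
      ... | yes q = trans (1[]-no λ ()) (trans (sym (ℝ.-‿inverseʳ 1ℝ)) (cong (λ w → 1ℝ - w) (sym (1[]-yes q))))
      ... | no ¬q = trans (1[]-yes refl) (trans (solve 0 (:1 := :1 :- :0) refl) (cong (λ w → 1ℝ - w) (sym (1[]-no ¬q))))

      bit-law : ∀ {t} → Realisable t → ∀ b → E P (λ h → 1[ decide (h < t) ≡ b ]) ≡ weight t b
      bit-law {t} r true  = trans (congruent (linear P) λ h → 1[decide]-true (h < t)) P[h< r ]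
      bit-law {t} r false = trans (congruent (linear P) λ h → 1[decide]-false (h < t))
        (trans (subtractive (linear P) (λ _ → 1ℝ) (λ h → 1[ h < t ])) (cong₂ _-_ (total P) P[h< r ]))

      differ : Bool → Bool → ℝ
      differ a b = fromℕ (if a xor b then 1 else 0)

      bit-miss : ∀ {t v} → Realisable t → Realisable v → ∀ b →
                 E P (λ h → 1[ decide (h < t) ≡ b ] * differ (decide (h < t)) (decide (h < v))) ≡ miss t v b
      bit-miss {t} {v} rt rv b with ≤-total v t
      ... | inj₁ v≤t = trans (congruent (linear P) (pointwise b)) (value b)
        where
        pointwise : ∀ b h → 1[ decide (h < t) ≡ b ] * differ (decide (h < t)) (decide (h < v)) ≡ (if b then 1[ h < t ] - 1[ h < v ] else 0ℝ)
        pointwise b h with lem {h < t} | lem {h < v}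
        pointwise true  h | yes p | yes q = trans (ℝ.zeroʳ _) (trans (sym (ℝ.-‿inverseʳ 1ℝ)) (sym (cong₂ _-_ (1[]-yes p) (1[]-yes q))))
        pointwise false h | yes p | yes q = ℝ.zeroʳ _
        pointwise true  h | yes p | no ¬q = trans (cong₂ _*_ (1[]-yes refl) fromℕ-1) (trans (solve 0 (:1 :* :1 := :1 :- :0) refl) (sym (cong₂ _-_ (1[]-yes p) (1[]-no ¬q))))
        pointwise false h | yes p | no ¬q = trans (cong (_* fromℕ 1) (1[]-no λ ())) (ℝ.zeroˡ _)
        pointwise b     h | no ¬p | yes q = contradiction (<-≤-trans q v≤t) ¬p
        pointwise true  h | no ¬p | no ¬q = trans (ℝ.zeroʳ _) (trans (sym (ℝ.-‿inverseʳ 0ℝ)) (sym (cong₂ _-_ (1[]-no ¬p) (1[]-no ¬q))))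
        pointwise false h | no ¬p | no ¬q = ℝ.zeroʳ _
        value : ∀ b → E P (λ h → if b then 1[ h < t ] - 1[ h < v ] else 0ℝ) ≡ miss t v b
        value true  = trans (subtractive (linear P) (λ h → 1[ h < t ]) (λ h → 1[ h < v ])) (trans (cong₂ _-_ P[h< rt ] P[h< rv ]) (sym (excess-≥ v≤t)))
        value false = trans (null (linear P)) (sym (excess-≤ v≤t))
      ... | inj₂ t≤v = trans (congruent (linear P) (pointwise b)) (value b)
        where
        pointwise : ∀ b h → 1[ decide (h < t) ≡ b ] * differ (decide (h < t)) (decide (h < v)) ≡ (if b then 0ℝ else 1[ h < v ] - 1[ h < t ])
        pointwise b h with lem {h < t} | lem {h < v}
        pointwise false h | yes p | yes q = trans (ℝ.zeroʳ _) (trans (sym (ℝ.-‿inverseʳ 1ℝ)) (sym (cong₂ _-_ (1[]-yes q) (1[]-yes p))))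
        pointwise true  h | yes p | yes q = ℝ.zeroʳ _
        pointwise b     h | yes p | no ¬q = contradiction (<-≤-trans p t≤v) ¬q
        pointwise false h | no ¬p | yes q = trans (cong₂ _*_ (1[]-yes refl) fromℕ-1) (trans (solve 0 (:1 :* :1 := :1 :- :0) refl) (sym (cong₂ _-_ (1[]-yes q) (1[]-no ¬p))))
        pointwise true  h | no ¬p | yes q = trans (cong (_* fromℕ 1) (1[]-no λ ())) (ℝ.zeroˡ _)
        pointwise false h | no ¬p | no ¬q = trans (ℝ.zeroʳ _) (trans (sym (ℝ.-‿inverseʳ 0ℝ)) (sym (cong₂ _-_ (1[]-no ¬q) (1[]-no ¬p))))
        pointwise true  h | no ¬p | no ¬q = ℝ.zeroʳ _
        value : ∀ b → E P (λ h → if b then 0ℝ else 1[ h < v ] - 1[ h < t ]) ≡ miss t v b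
        value false = trans (subtractive (linear P) (λ h → 1[ h < v ]) (λ h → 1[ h < t ])) (trans (cong₂ _-_ P[h< rv ] P[h< rt ]) (sym (excess-≥ t≤v)))
        value true  = trans (null (linear P)) (sym (excess-≤ t≤v))

      Pⁿ : ∀ n → Expectation (Vec ℝ n)
      Pⁿ = iid P

      1[∷] : ∀ {b b′} (m : Vec Bool n) (f : Bool → Vec Bool n) → 1[ b ∷ f b ≡ b′ ∷ m ] ≡ 1[ b ≡ b′ ] * 1[ f b′ ≡ m ]
      1[∷] {b = b} {b′} m f = trans (1[]-cong (λ p → cong Vec.head p , trans (cong f (sym (cong Vec.head p))) (cong Vec.tail p)) λ { (refl , refl) → refl }) (1[]-× (b ≡ b′) (f b′ ≡ m))

      truth-law : ∀ (os : Vec Bool n) {l l′} → LabelsIn Realisable l → LabelsIn Realisable l′ → ∀ m →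
                  E (Pⁿ n) (λ hs → 1[ truth os (strategy hs l) (strategy hs l′) ≡ m ]) ≡ law os l l′ m
      truth-law [] end end [] = 1[]-yes refl
      truth-law {suc n} (o ∷ os) {node t l} {node t′ l′} (node r rs) (node r′ rs′) (b ∷ m) = go o
        where
        rest : Vec ℝ n → Bool → Vec Bool n
        rest hs c = truth os (strategy hs (l c)) (strategy hs (l′ c))
        value : ∀ {t} → Realisable t → E P (λ h → E (Pⁿ n) λ hs → 1[ decide (h < t) ∷ rest hs (decide (h < t)) ≡ b ∷ m ]) ≡ weight t b * law os (l b) (l′ b) m
        value {t} r = trans (congruent (linear P) λ h → trans (congruent (linear (Pⁿ n)) λ hs → 1[∷] m (rest hs))
            (trans (homogeneous (linear (Pⁿ n)) 1[ decide (h < t) ≡ b ] (λ hs → 1[ rest hs b ≡ m ])) (cong (1[ decide (h < t) ≡ b ] *_) (truth-law os (rs b) (rs′ b) m))))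
          (trans (homogeneousʳ (linear P) (law os (l b) (l′ b) m) (λ h → 1[ decide (h < t) ≡ b ])) (cong (_* law os (l b) (l′ b) m) (bit-law r b)))
        go : ∀ o → E (Pⁿ (suc n)) (λ hs → 1[ truth (o ∷ os) (strategy hs (node t l)) (strategy hs (node t′ l′)) ≡ b ∷ m ]) ≡ law (o ∷ os) (node t l) (node t′ l′) (b ∷ m)
        go true  = value r
        go false = value r′

      truth-mistakes : ∀ (os : Vec Bool n) {l l′} → LabelsIn Realisable l → LabelsIn Realisable l′ → ∀ m →
        E (Pⁿ n) (λ hs → 1[ truth os (strategy hs l) (strategy hs l′) ≡ m ] * fromℕ (mistakes os (strategy hs l) (strategy hs l′))) ≡ mistakesAt os l l′ m
      truth-mistakes [] end end [] = ℝ.zeroʳ _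
      truth-mistakes {suc n} (o ∷ os) {node t l} {node t′ l′} (node r rs) (node r′ rs′) (b ∷ m) = go o
        where
        rest : Vec ℝ n → Bool → Vec Bool n
        rest hs c = truth os (strategy hs (l c)) (strategy hs (l′ c))
        N : Vec ℝ n → Bool → ℕ
        N hs c = mistakes os (strategy hs (l c)) (strategy hs (l′ c))
        value : ∀ {t} (g : ℝ → Bool) {M} → Realisable t → E P (λ h → 1[ decide (h < t) ≡ b ] * fromℕ (if g h then 1 else 0)) ≡ M →
          E P (λ h → E (Pⁿ n) λ hs → 1[ decide (h < t) ∷ rest hs (decide (h < t)) ≡ b ∷ m ] * fromℕ ((if g h then 1 else 0) ℕ.+ N hs (decide (h < t)))) ≡
          M * law os (l b) (l′ b) m + weight t b * mistakesAt os (l b) (l′ b) m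
        value {t} g {M} r eq = trans (congruent (linear P) inner) (trans (additive (linear P) (λ h → I h * d h * L) (λ h → I h * K))
          (cong₂ _+_ (trans (homogeneousʳ (linear P) L (λ h → I h * d h)) (cong (_* L) eq)) (trans (homogeneousʳ (linear P) K I) (cong (_* K) (bit-law r b)))))
          where
          L = law os (l b) (l′ b) m
          K = mistakesAt os (l b) (l′ b) m
          I d : ℝ → ℝ
          I h = 1[ decide (h < t) ≡ b ]
          d h = fromℕ (if g h then 1 else 0)
          J : Vec ℝ n → ℝ
          J hs = 1[ rest hs b ≡ m ]
          pointwise : ∀ h hs → 1[ decide (h < t) ∷ rest hs (decide (h < t)) ≡ b ∷ m ] * fromℕ ((if g h then 1 else 0) ℕ.+ N hs (decide (h < t))) ≡ I h * d h * J hs + I h * (J hs * fromℕ (N hs b))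
          pointwise h hs = trans (cong₂ _*_ (1[∷] m (rest hs)) (fromℕ-+ (if g h then 1 else 0) (N hs (decide (h < t))))) (step (decide (h < t)))
            where
            step : ∀ c → 1[ c ≡ b ] * J hs * (d h + fromℕ (N hs c)) ≡ 1[ c ≡ b ] * d h * J hs + 1[ c ≡ b ] * (J hs * fromℕ (N hs b))
            step c with lem {c ≡ b}
            ... | yes refl = solve 4 (λ i j d n → i :* j :* (d :+ n) := i :* d :* j :+ i :* (j :* n)) refl 1[ c ≡ c ] (J hs) (d h) (fromℕ (N hs c))
            ... | no c≢b = trans (cong (λ i → i * J hs * (d h + fromℕ (N hs c))) (1[]-no c≢b)) (trans (solve 4 (λ j d n n' → :0 :* j :* (d :+ n) := :0 :* d :* j :+ :0 :* (j :* n')) refl (J hs) (d h) (fromℕ (N hs c)) (fromℕ (N hs b)))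
                  (cong (λ i → i * d h * J hs + i * (J hs * fromℕ (N hs b))) (sym (1[]-no c≢b))))
          inner : ∀ h → E (Pⁿ n) (λ hs → 1[ decide (h < t) ∷ rest hs (decide (h < t)) ≡ b ∷ m ] * fromℕ ((if g h then 1 else 0) ℕ.+ N hs (decide (h < t)))) ≡ I h * d h * L + I h * K
          inner h = trans (congruent (linear (Pⁿ n)) (pointwise h)) (trans (additive (linear (Pⁿ n)) (λ hs → I h * d h * J hs) (λ hs → I h * (J hs * fromℕ (N hs b))))
            (cong₂ _+_ (trans (homogeneous (linear (Pⁿ n)) (I h * d h) J) (cong (I h * d h *_) (truth-law os (rs b) (rs′ b) m)))
                       (trans (homogeneous (linear (Pⁿ n)) (I h) (λ hs → J hs * fromℕ (N hs b))) (cong (I h *_) (truth-mistakes os (rs b) (rs′ b) m)))))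
        go : ∀ o → E (Pⁿ (suc n)) (λ hs → 1[ truth (o ∷ os) (strategy hs (node t l)) (strategy hs (node t′ l′)) ≡ b ∷ m ] * fromℕ (mistakes (o ∷ os) (strategy hs (node t l)) (strategy hs (node t′ l′)))) ≡ mistakesAt (o ∷ os) (node t l) (node t′ l′) (b ∷ m)
        go true  = value (λ h → decide (h < t) xor decide (h < t′)) r (bit-miss r r′ b)
        go false = value (λ h → decide (h < t) xor decide (h < t′)) r′ (trans (congruent (linear P) λ h → cong (λ c → 1[ decide (h < t′) ≡ b ] * fromℕ (if c then 1 else 0)) (xor-comm (decide (h < t)) (decide (h < t′)))) (bit-miss r′ r b))

      module Simulation {A B : Set} {n : ℕ} (os : Vec Bool n) (sᴬ : Vec ℝ n → A → Strategy n) (sᴮ : Vec ℝ n → B → Strategy n)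
                        (a : A) (b : B) {l l′ : Labels n} (sᴬ≡ : ∀ hs → sᴬ hs a ≡ strategy hs l) (sᴮ≡ : ∀ hs → sᴮ hs b ≡ strategy hs l′)
                        (l∈ : LabelsIn Realisable l) (l′∈ : LabelsIn Realisable l′) (r : ℕ) where

        module N hs = NoisySearch os (sᴬ hs) (sᴮ hs)

        final : (hs : Vec ℝ n) → Vec (N.Seed hs) r → State n
        final hs zs = outcome (N.search hs zs (start n)) a b

        Agree : Vec Bool n → (hs : Vec ℝ n) → Vec (N.Seed hs) r → Set
        Agree m hs zs = pathᴬ os (sᴬ hs a) (flags (final hs zs)) ≡ m × pathᴮ os (sᴮ hs b) (flags (final hs zs)) ≡ m

        agreement : Vec Bool n → ℝ
        agreement m = E (Pⁿ n) λ hs → E (iid (N.seeds hs) r) λ zs → 1[ Agree m hs zs ]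

        private
          True : Vec Bool n → Vec ℝ n → Set
          True m hs = truth os (sᴬ hs a) (sᴮ hs b) ≡ m

          E-true : ∀ m → E (Pⁿ n) (λ hs → 1[ True m hs ]) ≡ law os l l′ m
          E-true m = trans (congruent (linear (Pⁿ n)) λ hs → cong₂ (λ s t → 1[ truth os s t ≡ m ]) (sᴬ≡ hs) (sᴮ≡ hs)) (truth-law os l∈ l′∈ m)

          mis : Vec ℝ n → ℕ
          mis hs = mistakes os (sᴬ hs a) (sᴮ hs b)

          E-mistakes : ∀ m → E (Pⁿ n) (λ hs → 1[ True m hs ] * fromℕ (mis hs)) ≡ mistakesAt os l l′ m
          E-mistakes m = trans (congruent (linear (Pⁿ n)) λ hs → cong₂ (λ s t → 1[ truth os s t ≡ m ] * fromℕ (mistakes os s t)) (sᴬ≡ hs) (sᴮ≡ hs)) (truth-mistakes os l∈ l′∈ m)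

          agree⇒true : ∀ m hs zs → Agree m hs zs → True m hs
          agree⇒true m hs zs (p , q) = trans (sym (Search.agreed-full⇒truth os (sᴬ hs a) (sᴮ hs b) (flags (final hs zs)) (trans p (sym q)))) p

        -- By `agreed-full⇒truth` the search can lose a history but never make the players agree on
        -- a wrong one, so no m is favoured.
        agreement≤law : ∀ m → agreement m ≤ law os l l′ m
        agreement≤law m = ≤-trans (monotone (linear (Pⁿ n)) λ hs → ≤-trans (monotone (linear (iid (N.seeds hs) r)) λ zs → 1[]-mono (agree⇒true m hs zs)) (≤-reflexive (E-const (iid (N.seeds hs) r) _)))
          (≤-reflexive (E-true m))

        module _ {β ε} (0<β : 0ℝ < fromℕ β) (0≤ε : 0ℝ ≤ ε)
                 (rounds : ¾ ^ r * fromℕ 2 ^ (suc (3 ℕ.* ⌈log₂ suc n ⌉) ℕ.* β ℕ.+ 3 ℕ.* ⌈log₂ suc n ⌉) ≤ ε) where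

          private
            -- Markov's inequality in pointwise form: up to β mistakes the number of rounds
            -- suffices, beyond β the quotient alone is at least 1. Being linear in the mistakes,
            -- the bound can be averaged over the thresholds.
            failure≤ : ∀ hs → N.failure hs a b r (start n) ≤ ε + fromℕ (mis hs) / fromℕ β
            failure≤ hs with mis hs ℕ.≤? β
            ... | yes p = ≤-trans (N.failure-start≤ hs a b r) (≤-trans (*-monoʳ-≤ (^-nonNeg r (<⇒≤ 0<¾)) (^-monoʳ 1≤2 (ℕ.+-monoˡ-≤ (3 ℕ.* ⌈log₂ suc n ⌉) (ℕ.*-monoʳ-≤ (suc (3 ℕ.* ⌈log₂ suc n ⌉)) p))))
                            (≤-trans rounds (≤-cert (0≤/ (0≤fromℕ (mis hs)) (<⇒≤ 0<β)) refl)))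
            ... | no ¬p = ≤-trans (monotone (linear (iid (N.seeds hs) r)) λ zs → 1[]≤1 _) (≤-trans (≤-reflexive (total (iid (N.seeds hs) r)))
                            (≤-trans (x≤y/z 0<β (≤-trans (≤-reflexive (ℝ.*-identityˡ _)) (fromℕ-mono (ℕ.<⇒≤ (ℕ.≰⇒> ¬p))))) (≤-cert 0≤ε (ℝ.+-comm ε _))))

            agree-or-fail : ∀ m hs zs → 1[ True m hs ] ≤ 1[ Agree m hs zs ] + 1[ N.first hs a b (final hs zs) ℕ.< n ]
            agree-or-fail m hs zs with N.first hs a b (final hs zs) ℕ.<? n
            ... | yes p = ≤-trans (1[]≤1 _) (≤-trans (≤-reflexive (sym (1[]-yes p))) (≤-cert (0≤1[] _) (ℝ.+-comm 1[ Agree m hs zs ] _)))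
            ... | no ¬p = ≤-trans (1[]-mono λ true → let eq = Search.agreement-full _ _ (ℕ.≮⇒≥ ¬p) ; eq′ = Search.agreed-full⇒truth os (sᴬ hs a) (sᴮ hs b) (flags (final hs zs)) eq in
                            trans eq′ true , trans (sym eq) (trans eq′ true)) (≤-cert (0≤1[] _) refl)

          -- The loss is stated for each m separately, since the transcripts will be reweighted by q
          -- / p before the losses are summed.
          agreement≥ : ∀ m → law os l l′ m - (ε * law os l l′ m + mistakesAt os l l′ m / fromℕ β) ≤ agreement m
          agreement≥ m = ≤-trans (≤-reflexive (trans (cong₂ (λ x y → x - (ε * x + y / fromℕ β)) (sym (E-true m)) (sym (E-mistakes m))) (sym expand))) (monotone (linear (Pⁿ n)) pointwise)
            where
            expand : E (Pⁿ n) (λ hs → 1[ True m hs ] - (ε * 1[ True m hs ] + 1[ True m hs ] * fromℕ (mis hs) / fromℕ β)) ≡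
                     E (Pⁿ n) (λ hs → 1[ True m hs ]) - (ε * E (Pⁿ n) (λ hs → 1[ True m hs ]) + E (Pⁿ n) (λ hs → 1[ True m hs ] * fromℕ (mis hs)) / fromℕ β)
            expand = trans (subtractive (linear (Pⁿ n)) (λ hs → 1[ True m hs ]) (λ hs → ε * 1[ True m hs ] + 1[ True m hs ] * fromℕ (mis hs) / fromℕ β))
              (cong (λ z → E (Pⁿ n) (λ hs → 1[ True m hs ]) - z) (trans (additive (linear (Pⁿ n)) (λ hs → ε * 1[ True m hs ]) (λ hs → 1[ True m hs ] * fromℕ (mis hs) / fromℕ β))
                (cong₂ _+_ (homogeneous (linear (Pⁿ n)) ε (λ hs → 1[ True m hs ])) (homogeneousʳ (linear (Pⁿ n)) (fromℕ β ⁻¹) (λ hs → 1[ True m hs ] * fromℕ (mis hs))))))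
            pointwise : ∀ hs → 1[ True m hs ] - (ε * 1[ True m hs ] + 1[ True m hs ] * fromℕ (mis hs) / fromℕ β) ≤ E (iid (N.seeds hs) r) (λ zs → 1[ Agree m hs zs ])
            pointwise hs with lem {True m hs}
            ... | no ¬p = ≤-trans (≤-reflexive (trans (cong (λ i → i - (ε * i + i * fromℕ (mis hs) / fromℕ β)) (1[]-no ¬p)) (solve 3 (λ e k b → :0 :- (e :* :0 :+ :0 :* k :* b) := :0) refl ε (fromℕ (mis hs)) (fromℕ β ⁻¹))))
                            (nonNegative (linear (iid (N.seeds hs) r)) λ zs → 0≤1[] _)
            ... | yes p = begin
              1[ True m hs ] - (ε * 1[ True m hs ] + 1[ True m hs ] * k / fromℕ β)   ≡⟨ trans (cong (λ i → i - (ε * i + i * k / fromℕ β)) (1[]-yes p)) (solve 3 (λ e k b → :1 :- (e :* :1 :+ :1 :* k :* b) := :1 :- (e :+ k :* b)) refl ε k (fromℕ β ⁻¹)) ⟩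
              1ℝ - (ε + k / fromℕ β)                         ≤⟨ +-monoʳ-≤ 1ℝ (neg-mono-≤ (failure≤ hs)) ⟩
              1ℝ - Ez (λ zs → 1[ N.first hs a b (final hs zs) ℕ.< n ])      ≡⟨ cong (λ z → z - Ez (λ zs → 1[ N.first hs a b (final hs zs) ℕ.< n ])) (trans (sym (E-const (iid (N.seeds hs) r) 1ℝ)) (congruent (linear (iid (N.seeds hs) r)) λ _ → sym (1[]-yes p))) ⟩
              Ez (λ zs → 1[ True m hs ]) - Ez (λ zs → 1[ N.first hs a b (final hs zs) ℕ.< n ]) ≡⟨ sym (subtractive (linear (iid (N.seeds hs) r)) (λ zs → 1[ True m hs ]) (λ zs → 1[ N.first hs a b (final hs zs) ℕ.< n ])) ⟩
              Ez (λ zs → 1[ True m hs ] - 1[ N.first hs a b (final hs zs) ℕ.< n ]) ≤⟨ monotone (linear (iid (N.seeds hs) r)) (λ zs → ≤-trans (+-monoˡ-≤ _ (agree-or-fail m hs zs)) (≤-reflexive (solve 2 (λ x y → x :+ y :- y := x) refl _ _))) ⟩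
              Ez (λ zs → 1[ Agree m hs zs ])                 ∎
              where
              open ≤-Reasoning
              k = fromℕ (mis hs)
              Ez = E (iid (N.seeds hs) r)

  open HistorySimulation

  -- Naming the first message and rejection sampling

  module MessageAndAcceptance where

    open IsLinear

    private variable
      A : Set
      a b c : ℝ
      n : ℕ

    unique : (A → Set) → Maybe A
    unique P with lem {∃ λ u → P u × (∀ u′ → P u′ → u′ ≡ u)}
    ... | yes (u , _) = just u
    ... | no _        = nothing

    unique-just : ∀ {P : A → Set} {u} → unique P ≡ just u → P u
    unique-just {P = P} eq with lem {∃ λ u → P u × (∀ u′ → P u′ → u′ ≡ u)}
    unique-just refl | yes (_ , p , _) = p

    unique-intro : ∀ {P : A → Set} {u} → P u → (∀ u′ → P u′ → u′ ≡ u) → unique P ≡ just u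
    unique-intro {P = P} {u} p q with lem {∃ λ u → P u × (∀ u′ → P u′ → u′ ≡ u)}
    ... | yes (u′ , p′ , _) = cong just (q u′ p′)
    ... | no ¬e             = contradiction (u , p , q) ¬e

    ∑-const : ∀ n c → sum {n} (λ _ → c) ≡ fromℕ n * c
    ∑-const zero    c = sym (ℝ.zeroˡ c)
    ∑-const (suc n) c = trans (cong (c +_) (∑-const n c)) (solve 2 (λ n c → c :+ n :* c := (:1 :+ n) :* c) refl (fromℕ n) c)

    -- Alice names a message by a short hash. Every message has a public height;
    -- Alice selects the one below her threshold, Bob the one below his threshold
    -- with the right hash.
    module Naming (ts : List ℝ) (k s : ℕ) where

      heights : Expectation (Vec ℝ k)
      heights = Pⁿ ts k

      hashKeys : Expectation (Key (allFin k) s)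
      hashKeys = keys (allFin k) s

      below : Vec ℝ k → (Fin k → ℝ) → Fin k → Set
      below hs t u = Vec.lookup hs u < t u

      alice-selects : (Fin k → ℝ) → Vec ℝ k → Maybe (Fin k)
      alice-selects t hs = unique (below hs t)

      bob-selects : (Fin k → ℝ) → Vec ℝ k → Key (allFin k) s → Vec Bool s → Maybe (Fin k)
      bob-selects t hs zs v = unique λ u → below hs t u × hash (allFin k) zs u ≡ v

      name : Key (allFin k) s → Maybe (Fin k) → Vec Bool s
      name zs = maybe′ (hash (allFin k) zs) (Vec.replicate s false)

      Both : (tᴬ tᴮ : Fin k → ℝ) → Fin k → Vec ℝ k → Key (allFin k) s → Set
      Both tᴬ tᴮ u hs zs = alice-selects tᴬ hs ≡ just u × bob-selects tᴮ hs zs (name zs (alice-selects tᴬ hs)) ≡ just u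

      module _ (tᴬ tᴮ : Fin k → ℝ) (rᴬ : ∀ u → Realisable ts (tᴬ u)) (rᴮ : ∀ u → Realisable ts (tᴮ u)) where

        both : Fin k → ℝ
        both u = E heights λ hs → E hashKeys λ zs → 1[ Both tᴬ tᴮ u hs zs ]

        P[below] : ∀ {t} → (∀ u → Realisable ts (t u)) → ∀ u → E heights (λ hs → 1[ below hs t u ]) ≡ t u
        P[below] {t} r u = trans (iid-lookup (threshold ts) u (λ h → 1[ h < t u ])) (P[h<_] ts (r u))

        both≤ : ∀ u → both u ≤ tᴬ u
        both≤ u = ≤-trans (monotone (linear heights) λ hs → ≤-trans (monotone (linear hashKeys) λ zs → 1[]-mono (unique-just ∘ proj₁)) (≤-reflexive (E-const hashKeys _)))
          (≤-reflexive (P[below] rᴬ u))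

        module _ (u : Fin k) (tᴬ≤tᴮ : tᴬ u ≤ tᴮ u) where

          private
            -- Counts what a message other than u can do to spoil the naming of u: being eligible
            -- for Alice, or being eligible for Bob with the hash of u. A sum of two indicators
            -- makes the union bound linear.
            clash : Vec ℝ k → Key (allFin k) s → Fin k → ℝ
            clash hs zs u′ = 1[ u′ ≢ u ] * (1[ below hs tᴬ u′ ] + 1[ below hs tᴮ u′ ] * 1[ hash (allFin k) zs u′ ≡ hash (allFin k) zs u ])

            0≤clash : ∀ hs zs u′ → 0ℝ ≤ clash hs zs u′
            0≤clash hs zs u′ = 0≤* (0≤1[] _) (0≤+ (0≤1[] _) (0≤* (0≤1[] _) (0≤1[] _)))

            pointwise : ∀ hs zs → 1[ below hs tᴬ u ] * (1ℝ - sum (clash hs zs)) ≤ 1[ Both tᴬ tᴮ u hs zs ]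
            pointwise hs zs with lem {below hs tᴬ u}
            ... | no ¬p = ≤-trans (≤-reflexive (trans (cong (_* (1ℝ - sum (clash hs zs))) (1[]-no ¬p)) (ℝ.zeroˡ _))) (0≤1[] _)
            ... | yes p with lem {∃ λ u′ → u′ ≢ u × (below hs tᴬ u′ ⊎ below hs tᴮ u′ × hash (allFin k) zs u′ ≡ hash (allFin k) zs u)}
            ...   | yes (u′ , u′≢u , bad) = ≤-trans (≤-reflexive (trans (cong (_* (1ℝ - sum (clash hs zs))) (1[]-yes p)) (ℝ.*-identityˡ _)))
                      (≤-trans (≤-trans (+-monoʳ-≤ 1ℝ (neg-mono-≤ (≤-trans one≤ (term≤∑ (0≤clash hs zs) u′)))) (≤-reflexive (ℝ.-‿inverseʳ 1ℝ))) (0≤1[] _))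
              where
              one≤ : 1ℝ ≤ clash hs zs u′
              one≤ = ≤-trans (one bad) (≤-reflexive (sym (trans (cong (_* (X + Y)) (1[]-yes u′≢u)) (ℝ.*-identityˡ _))))
                where
                X = 1[ below hs tᴬ u′ ]
                Y = 1[ below hs tᴮ u′ ] * 1[ hash (allFin k) zs u′ ≡ hash (allFin k) zs u ]
                one : below hs tᴬ u′ ⊎ below hs tᴮ u′ × hash (allFin k) zs u′ ≡ hash (allFin k) zs u → 1ℝ ≤ X + Y
                one (inj₁ q)       = ≤-trans (≤-reflexive (sym (1[]-yes q))) (≤-cert (0≤* (0≤1[] _) (0≤1[] _)) refl)
                one (inj₂ (q , r)) = ≤-trans (≤-reflexive (sym (trans (cong₂ _*_ (1[]-yes q) (1[]-yes r)) (ℝ.*-identityˡ 1ℝ)))) (≤-cert (0≤1[] _) (ℝ.+-comm X Y))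
            ...   | no ¬bad = ≤-trans (≤-reflexive (trans (cong (_* (1ℝ - sum (clash hs zs))) (1[]-yes p)) (ℝ.*-identityˡ _)))
                      (≤-trans (≤-trans (+-monoʳ-≤ 1ℝ (neg-mono-≤ (nonNegative (∑-linear k) (0≤clash hs zs)))) (≤-reflexive (solve 0 (:1 :- :0 := :1) refl))) (≤-reflexive (sym (1[]-yes good))))
              where
              alice≡ : alice-selects tᴬ hs ≡ just u
              alice≡ = unique-intro p λ u′ q → case u′ Fin.≟ u of λ where
                (yes eq) → eq
                (no neq) → contradiction (u′ , neq , inj₁ q) ¬bad
              good : Both tᴬ tᴮ u hs zs
              good = alice≡ , unique-intro (<-≤-trans p tᴬ≤tᴮ , cong (name zs) (sym alice≡)) λ u′ (q , r) → case u′ Fin.≟ u of λ where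
                (yes eq) → eq
                (no neq) → contradiction (u′ , neq , inj₂ (q , trans r (cong (name zs) alice≡))) ¬bad

            joint : ∀ {t} → (∀ u → Realisable ts (t u)) → ∀ {u′} → u′ ≢ u → E heights (λ hs → 1[ below hs tᴬ u ] * 1[ below hs t u′ ]) ≡ tᴬ u * t u′
            joint {t} r {u′} u′≢u = trans (iid-lookup₂ (threshold ts) (u′≢u ∘ sym) (λ h → 1[ h < tᴬ u ]) (λ h → 1[ h < t u′ ])) (cong₂ _*_ (P[h<_] ts (rᴬ u)) (P[h<_] ts (r u′)))

            clash≤ : ∀ u′ → E heights (λ hs → E hashKeys λ zs → 1[ below hs tᴬ u ] * clash hs zs u′) ≤ tᴬ u * (tᴬ u′ + tᴮ u′ * ½ ^ s)
            clash≤ u′ with u′ Fin.≟ u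
            ... | yes refl = ≤-trans (≤-reflexive (trans (congruent (linear heights) λ hs → trans (congruent (linear hashKeys) λ zs → trans (cong (λ i → 1[ below hs tᴬ u ] * (i * (1[ below hs tᴬ u ] + 1[ below hs tᴮ u ] * 1[ hash (allFin k) zs u ≡ hash (allFin k) zs u ]))) (1[]-no λ f → f refl)) (solve 2 (λ x y → x :* (:0 :* y) := :0) refl _ _)) (null (linear hashKeys))) (null (linear heights))))
                               (0≤* (proj₁ (proj₁ (rᴬ u))) (0≤+ (proj₁ (proj₁ (rᴬ u))) (0≤* (proj₁ (proj₁ (rᴮ u))) (^-nonNeg s (<⇒≤ 0<½)))))
            ... | no u′≢u = ≤-reflexive (begin
              E heights (λ hs → E hashKeys λ zs → 1[ below hs tᴬ u ] * clash hs zs u′)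
                ≡⟨ congruent (linear heights) (λ hs → inner hs) ⟩
              E heights (λ hs → 1[ below hs tᴬ u ] * 1[ below hs tᴬ u′ ] + 1[ below hs tᴬ u ] * 1[ below hs tᴮ u′ ] * ½ ^ s)
                ≡⟨ additive (linear heights) (λ hs → 1[ below hs tᴬ u ] * 1[ below hs tᴬ u′ ]) (λ hs → 1[ below hs tᴬ u ] * 1[ below hs tᴮ u′ ] * ½ ^ s) ⟩
              E heights (λ hs → 1[ below hs tᴬ u ] * 1[ below hs tᴬ u′ ]) + E heights (λ hs → 1[ below hs tᴬ u ] * 1[ below hs tᴮ u′ ] * ½ ^ s)
                ≡⟨ cong₂ _+_ (joint rᴬ u′≢u) (trans (homogeneousʳ (linear heights) (½ ^ s) (λ hs → 1[ below hs tᴬ u ] * 1[ below hs tᴮ u′ ])) (cong (_* ½ ^ s) (joint rᴮ u′≢u))) ⟩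
              tᴬ u * tᴬ u′ + tᴬ u * tᴮ u′ * ½ ^ s
                ≡⟨ solve 4 (λ a b c h → a :* b :+ a :* c :* h := a :* (b :+ c :* h)) refl (tᴬ u) (tᴬ u′) (tᴮ u′) (½ ^ s) ⟩
              tᴬ u * (tᴬ u′ + tᴮ u′ * ½ ^ s) ∎)
              where
              open ≡-Reasoning
              inner : ∀ hs → E hashKeys (λ zs → 1[ below hs tᴬ u ] * clash hs zs u′) ≡ 1[ below hs tᴬ u ] * 1[ below hs tᴬ u′ ] + 1[ below hs tᴬ u ] * 1[ below hs tᴮ u′ ] * ½ ^ s
              inner hs = trans (congruent (linear hashKeys) λ zs → trans (cong (λ i → X * (i * (Y + Z * C zs))) (1[]-yes u′≢u)) (solve 4 (λ x y z c → x :* (:1 :* (y :+ z :* c)) := x :* y :+ x :* z :* c) refl X Y Z (C zs)))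
                (trans (additive (linear hashKeys) (λ _ → X * Y) (λ zs → X * Z * C zs)) (cong₂ _+_ (E-const hashKeys (X * Y))
                  (trans (homogeneous (linear hashKeys) (X * Z) C) (cong (X * Z *_) (hash-collision s (∈-allFin u′) u′≢u)))))
                where
                X = 1[ below hs tᴬ u ]
                Y = 1[ below hs tᴬ u′ ]
                Z = 1[ below hs tᴮ u′ ]
                C : Key (allFin k) s → ℝ
                C zs = 1[ hash (allFin k) zs u′ ≡ hash (allFin k) zs u ]

          -- A union bound over the clashes. The heights of different messages are independent, so
          -- given that u is selected the expected number of clashes is at most `sum tᴬ` plus
          -- `sum tᴮ` times the collision probability of the hash.
          both≥ : tᴬ u * (1ℝ - (sum tᴬ + sum tᴮ * ½ ^ s)) ≤ both u
          both≥ = begin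
            tᴬ u * (1ℝ - (sum tᴬ + sum tᴮ * ½ ^ s))
              ≡⟨ cong (λ z → tᴬ u * (1ℝ - z)) (sym (trans (additive (∑-linear k) tᴬ (λ u′ → tᴮ u′ * ½ ^ s)) (cong (sum tᴬ +_) (homogeneousʳ (∑-linear k) (½ ^ s) tᴮ)))) ⟩
            tᴬ u * (1ℝ - sum (λ u′ → tᴬ u′ + tᴮ u′ * ½ ^ s))
              ≡⟨ trans (solve 2 (λ t x → t :* (:1 :- x) := t :- t :* x) refl (tᴬ u) (sum (λ u′ → tᴬ u′ + tᴮ u′ * ½ ^ s))) (cong (λ z → tᴬ u - z) (sym (homogeneous (∑-linear k) (tᴬ u) (λ u′ → tᴬ u′ + tᴮ u′ * ½ ^ s)))) ⟩
            tᴬ u - sum (λ u′ → tᴬ u * (tᴬ u′ + tᴮ u′ * ½ ^ s))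
              ≤⟨ +-monoʳ-≤ (tᴬ u) (neg-mono-≤ (monotone (∑-linear k) clash≤)) ⟩
            tᴬ u - sum (λ u′ → F λ hs zs → 1[ below hs tᴬ u ] * clash hs zs u′)
              ≡⟨ cong₂ _-_ (sym (trans (congruent (linear heights) λ hs → E-const hashKeys _) (P[below] rᴬ u)))
                   (sym (trans (congruent (linear heights) λ hs → ∑-swap (linear hashKeys) (λ u′ zs → 1[ below hs tᴬ u ] * clash hs zs u′)) (∑-swap (linear heights) (λ u′ hs → E hashKeys λ zs → 1[ below hs tᴬ u ] * clash hs zs u′)))) ⟩
            F (λ hs zs → 1[ below hs tᴬ u ]) - F (λ hs zs → sum (λ u′ → 1[ below hs tᴬ u ] * clash hs zs u′))
              ≡⟨ sym (trans (congruent (linear heights) λ hs → subtractive (linear hashKeys) (λ zs → 1[ below hs tᴬ u ]) (λ zs → sum (λ u′ → 1[ below hs tᴬ u ] * clash hs zs u′)))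
                   (subtractive (linear heights) (λ hs → E hashKeys λ zs → 1[ below hs tᴬ u ]) (λ hs → E hashKeys λ zs → sum (λ u′ → 1[ below hs tᴬ u ] * clash hs zs u′)))) ⟩
            F (λ hs zs → 1[ below hs tᴬ u ] - sum (λ u′ → 1[ below hs tᴬ u ] * clash hs zs u′))
              ≤⟨ monotone (linear heights) (λ hs → monotone (linear hashKeys) λ zs → ≤-trans (≤-reflexive (trans (cong (λ z → 1[ below hs tᴬ u ] - z) (homogeneous (∑-linear k) 1[ below hs tᴬ u ] (clash hs zs)))
                   (solve 2 (λ t x → t :- t :* x := t :* (:1 :- x)) refl 1[ below hs tᴬ u ] (sum (clash hs zs))))) (pointwise hs zs)) ⟩
            both u ∎
            where
            open ≤-Reasoning
            F : (Vec ℝ k → Key (allFin k) s → ℝ) → ℝ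
            F f = E heights λ hs → E hashKeys λ zs → f hs zs

    doubling : ∀ x → 1ℝ ≤ x → ∃ λ j → x ≤ fromℕ 2 ^ j × fromℕ 2 ^ j ≤ fromℕ 2 * x
    doubling x 1≤x = go (proj₁ (archimedean x)) (≤-trans (proj₂ (archimedean x)) (n≤2^n (proj₁ (archimedean x))))
      where
      go : ∀ j → x ≤ fromℕ 2 ^ j → ∃ λ j → x ≤ fromℕ 2 ^ j × fromℕ 2 ^ j ≤ fromℕ 2 * x
      go zero    h = 0 , h , ≤-trans 1≤x (≤-cert (≤-trans 0≤1 1≤x) (solve 1 (λ x → :2 :* x := x :+ x) refl x))
      go (suc j) h with ≤-<-⊎ x (fromℕ 2 ^ j)
      ... | inj₁ p = go j p
      ... | inj₂ p = suc j , h , *-monoʳ-≤ (<⇒≤ 0<2) (<⇒≤ p)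

    ^-cancel-≤ : ∀ {m n} → fromℕ 2 ^ m ≤ fromℕ 2 ^ n → m ℕ.≤ n
    ^-cancel-≤ {m} {n} h with m ℕ.≤? n
    ... | yes p = p
    ... | no ¬p = contradiction h (<⇒≱ (<-≤-trans (subst (fromℕ 2 ^ n <_) (solve 1 (λ t → t :+ t := :2 :* t) refl (fromℕ 2 ^ n))
          (0<y-x⇒x<y (subst (0ℝ <_) (solve 1 (λ t → t := t :+ t :- t) refl (fromℕ 2 ^ n)) (^-pos n 0<2)))) (^-monoʳ 1≤2 (ℕ.≰⇒> ¬p))))

    uniform : ∀ n → Expectation (Fin (suc n))
    uniform n = finite (λ _ → fromℕ (suc n) ⁻¹) ((λ _ → 0≤⁻¹ (0≤fromℕ (suc n))) , trans (∑-const (suc n) _) (*-inverseʳ _ (0<⇒≢ (0<fromℕ-suc n))))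

    -- Rejection sampling with acceptance probability proportional to a * b, where
    -- Alice knows a and Bob knows b. Alice's tag is the order of magnitude of a,
    -- which Bob guesses as a random one making a * b lie in [2⁻ᵗ, 2ᵗ].
    module Acceptance (ts : List ℝ) (N t : ℕ) where

      -- Rounding a and b up to powers of two adds at most 2 to the exponent of a * b, which lies
      -- between -t and t. After the shift by t the possible values are 0 to 2 t + 2.
      window : ℕ
      window = 2 ℕ.* t ℕ.+ 2

      rate : ℝ
      rate = fromℕ (suc window) ⁻¹ * (fromℕ 2 ^ t / fromℕ 2 ^ window)

      0<rate : 0ℝ < rate
      0<rate = 0<* (0<⁻¹ (0<fromℕ-suc window)) (0</ (^-pos t 0<2) (^-pos window 0<2))

      -- 2 ^ j is a 2 ^ N rounded up by at most a factor 2. The shift by N keeps j natural when a is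
      -- small; for a = 0 any j will do.
      IsMagnitude : ℝ → ℕ → Set
      IsMagnitude a j = a * fromℕ 2 ^ N ≤ fromℕ 2 ^ j × (0ℝ < a → fromℕ 2 ^ j ≤ fromℕ 2 * (a * fromℕ 2 ^ N))

      thresholdᴬ : ℝ → ℕ → ℝ
      thresholdᴬ a j = a * fromℕ 2 ^ N / fromℕ 2 ^ j

      -- The factor 2 ^ d undoes the rounding: if d is the right guess, the product of both
      -- thresholds is a * b times 2 ^ t / 2 ^ window, a constant independent of the magnitudes.
      thresholdᴮ : ℝ → ℕ → ℕ → ℝ
      thresholdᴮ b e d = b * fromℕ 2 ^ N / fromℕ 2 ^ e * (fromℕ 2 ^ d / fromℕ 2 ^ window)

      thresholdᴬ-probability : ∀ {a} j → 0ℝ ≤ a → IsMagnitude a j → Probability (thresholdᴬ a j)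
      thresholdᴬ-probability {a} j 0≤a (h , _) = 0≤/ (0≤* 0≤a (^-nonNeg N (<⇒≤ 0<2))) (^-nonNeg j (<⇒≤ 0<2)) ,
        x/z≤y (^-pos j 0<2) (≤-trans h (≤-reflexive (sym (ℝ.*-identityˡ _))))

      thresholdᴮ-probability : ∀ {b} e → 0ℝ ≤ b → IsMagnitude b e → ∀ (d : Fin (suc window)) → Probability (thresholdᴮ b e (toℕ d))
      thresholdᴮ-probability {b} e 0≤b m d =
        let p , q = thresholdᴬ-probability e 0≤b m
            p′ = 0≤/ (^-nonNeg (toℕ d) (<⇒≤ 0<2)) (^-nonNeg window (<⇒≤ 0<2))
        in 0≤* p p′ , ≤-trans (*-mono-≤ p p′ q ≤-refl) (≤-trans (≤-reflexive (ℝ.*-identityˡ _)) (x/z≤y (^-pos window 0<2)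
          (≤-trans (^-monoʳ 1≤2 (ℕ.s≤s⁻¹ (Fin.toℕ<n d))) (≤-reflexive (sym (ℝ.*-identityˡ _))))))

      module _ {a b} (j e : ℕ) (0≤a : 0ℝ ≤ a) (0≤b : 0ℝ ≤ b) (aj : IsMagnitude a j) (be : IsMagnitude b e)
               (a∈ : thresholdᴬ a j ∈ ts) (b∈ : ∀ (d : Fin (suc window)) → thresholdᴮ b e (toℕ d) ∈ ts) where

        Matched : Fin (suc window) → Set
        Matched d = j ℕ.+ (e ℕ.+ t) ≡ 2 ℕ.* N ℕ.+ toℕ d

        accept : ℝ
        accept = E (uniform window) λ d → E (threshold ts) λ h → E (threshold ts) λ h′ →
          1[ Matched d × h < thresholdᴬ a j × h′ < thresholdᴮ b e (toℕ d) ]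

        private
          x : ℝ
          x = fromℕ (suc window) ⁻¹

          accept≡ : accept ≡ ∑[ d < suc window ] (x * (1[ Matched d ] * (thresholdᴬ a j * thresholdᴮ b e (toℕ d))))
          accept≡ = congruent (∑-linear (suc window)) λ d → cong (x *_) (begin
            E P (λ h → E P λ h′ → 1[ Matched d × h < α × h′ < β d ])
              ≡⟨ congruent (linear P) (λ h → congruent (linear P) λ h′ → trans (1[]-× _ _) (trans (cong (1[ Matched d ] *_) (1[]-× _ _)) (sym (ℝ.*-assoc _ _ _)))) ⟩
            E P (λ h → E P λ h′ → 1[ Matched d ] * 1[ h < α ] * 1[ h′ < β d ])
              ≡⟨ congruent (linear P) (λ h → trans (homogeneous (linear P) (1[ Matched d ] * 1[ h < α ]) (λ h′ → 1[ h′ < β d ])) (cong (1[ Matched d ] * 1[ h < α ] *_) (P[h<_] ts (thresholdᴮ-probability e 0≤b be d , b∈ d)))) ⟩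
            E P (λ h → 1[ Matched d ] * 1[ h < α ] * β d)
              ≡⟨ trans (homogeneousʳ (linear P) (β d) (λ h → 1[ Matched d ] * 1[ h < α ])) (cong (_* β d) (trans (homogeneous (linear P) 1[ Matched d ] (λ h → 1[ h < α ])) (cong (1[ Matched d ] *_) (P[h<_] ts (thresholdᴬ-probability j 0≤a aj , a∈))))) ⟩
            1[ Matched d ] * α * β d
              ≡⟨ ℝ.*-assoc _ _ _ ⟩
            1[ Matched d ] * (α * β d) ∎)
            where
            open ≡-Reasoning
            P = threshold ts
            α = thresholdᴬ a j
            β : Fin (suc window) → ℝ
            β d = thresholdᴮ b e (toℕ d)

          product≡ : ∀ d → Matched d → thresholdᴬ a j * thresholdᴮ b e (toℕ d) ≡ a * b * (fromℕ 2 ^ t / fromℕ 2 ^ window)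
          product≡ d m = begin
            a * p / J * (b * p / K * (D / W))    ≡⟨ solve 8 (λ a b p J' K' D W' z → a :* p :* J' :* (b :* p :* K' :* (D :* W')) := a :* b :* W' :* ((p :* p :* D) :* (J' :* K'))) refl a b p (J ⁻¹) (K ⁻¹) D (W ⁻¹) 0ℝ ⟩
            a * b * W ⁻¹ * (p * p * D * (J ⁻¹ * K ⁻¹)) ≡⟨ cong (λ z → a * b * W ⁻¹ * (z * (J ⁻¹ * K ⁻¹))) powers ⟩
            a * b * W ⁻¹ * (J * (K * T) * (J ⁻¹ * K ⁻¹)) ≡⟨ cong (a * b * W ⁻¹ *_) (trans (solve 5 (λ J K T J' K' → J :* (K :* T) :* (J' :* K') := (J :* J') :* ((K :* K') :* T)) refl J K T (J ⁻¹) (K ⁻¹))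
                                                        (trans (cong₂ (λ u v → u * (v * T)) (x/x (0<⇒≢ (^-pos j 0<2))) (x/x (0<⇒≢ (^-pos e 0<2)))) (solve 1 (λ T → :1 :* (:1 :* T) := T) refl T))) ⟩
            a * b * W ⁻¹ * T                     ≡⟨ solve 3 (λ ab w t → ab :* w :* t := ab :* (t :* w)) refl (a * b) (W ⁻¹) T ⟩
            a * b * (T / W)                      ∎
            where
            open ≡-Reasoning
            p = fromℕ 2 ^ N
            J = fromℕ 2 ^ j
            K = fromℕ 2 ^ e
            D = fromℕ 2 ^ toℕ d
            W = fromℕ 2 ^ window
            T = fromℕ 2 ^ t
            powers : p * p * D ≡ J * (K * T)
            powers = trans (sym (trans (^-+ (fromℕ 2) (2 ℕ.* N) (toℕ d)) (cong (_* D) (trans (^-+ (fromℕ 2) N (N ℕ.+ 0)) (cong (λ k → p * fromℕ 2 ^ k) (ℕ.+-identityʳ N))))))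
              (trans (cong (fromℕ 2 ^_) (sym m)) (trans (^-+ (fromℕ 2) j (e ℕ.+ t)) (cong (J *_) (^-+ (fromℕ 2) e t))))

          term≡ : ∀ d → x * (1[ Matched d ] * (thresholdᴬ a j * thresholdᴮ b e (toℕ d))) ≡ 1[ Matched d ] * (rate * (a * b))
          term≡ d with lem {Matched d}
          ... | yes m = trans (cong (λ z → x * (1[ Matched d ] * z)) (product≡ d m)) (solve 4 (λ x i ab r → x :* (i :* (ab :* r)) := i :* (x :* r :* ab)) refl x 1[ Matched d ] (a * b) (fromℕ 2 ^ t / fromℕ 2 ^ window))
          ... | no ¬m = trans (cong (λ i → x * (i * (thresholdᴬ a j * thresholdᴮ b e (toℕ d)))) (1[]-no ¬m)) (trans (solve 3 (λ x y z → x :* (:0 :* y) := :0 :* z) refl x (thresholdᴬ a j * thresholdᴮ b e (toℕ d)) (rate * (a * b))) (cong (_* (rate * (a * b))) (sym (1[]-no ¬m))))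

          value : accept ≡ sum {suc window} (λ d → 1[ Matched d ]) * (rate * (a * b))
          value = trans accept≡ (trans (congruent (∑-linear (suc window)) term≡) (homogeneousʳ (∑-linear (suc window)) (rate * (a * b)) (λ d → 1[ Matched d ])))

          at-most-one : sum {suc window} (λ d → 1[ Matched d ]) ≤ 1ℝ
          at-most-one with lem {∃ Matched}
          ... | no ¬m = ≤-trans (≤-reflexive (∑-zero {suc window} λ d → 1[]-no λ m → ¬m (d , m))) 0≤1
          ... | yes (d , m) = ≤-reflexive (trans (congruent (∑-linear (suc window)) λ d′ → trans (1[]-cong (λ m′ → Fin.toℕ-injective {i = d′} {j = d} (ℕ.+-cancelˡ-≡ (2 ℕ.* N) (toℕ d′) (toℕ d) (trans (sym m′) m))) λ { refl → m }) (sym (ℝ.*-identityʳ _))) (∑-indicator d (λ _ → 1ℝ)))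

        -- Holds for all magnitudes, inside the window or not, because at most one guess d can
        -- match.
        accept≤ : accept ≤ rate * (a * b)
        accept≤ = ≤-trans (≤-reflexive value) (≤-trans (*-monoˡ-≤ (0≤* (<⇒≤ 0<rate) (0≤* 0≤a 0≤b)) at-most-one) (≤-reflexive (ℝ.*-identityˡ _)))

        accept-nonNeg : 0ℝ ≤ accept
        accept-nonNeg = ≤-trans (0≤* (nonNegative (∑-linear (suc window)) λ d → 0≤1[] (Matched d)) (0≤* (<⇒≤ 0<rate) (0≤* 0≤a 0≤b))) (≤-reflexive (sym value))

        accept≥ : 0ℝ < a → 0ℝ < b → 1ℝ ≤ a * b * fromℕ 2 ^ t → a * b ≤ fromℕ 2 ^ t → rate * (a * b) ≤ accept
        accept≥ 0<a 0<b low high = ≤-trans (≤-reflexive (sym (ℝ.*-identityˡ _))) (≤-trans (*-monoˡ-≤ (0≤* (<⇒≤ 0<rate) (0≤* 0≤a 0≤b))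
          (≤-trans (≤-reflexive (sym (1[]-yes matched))) (term≤∑ (λ d → 0≤1[] (Matched d)) d))) (≤-reflexive (sym value)))
          where
          open ≤-Reasoning
          p = fromℕ 2 ^ N
          T = fromℕ 2 ^ t
          0≤p = ^-nonNeg N (<⇒≤ 0<2)
          0≤T = ^-nonNeg t (<⇒≤ 0<2)
          2N : ∀ k → fromℕ 2 ^ (2 ℕ.* N ℕ.+ k) ≡ p * p * fromℕ 2 ^ k
          2N k = trans (^-+ (fromℕ 2) (2 ℕ.* N) k) (cong (_* fromℕ 2 ^ k) (trans (^-+ (fromℕ 2) N (N ℕ.+ 0)) (cong (λ k → p * fromℕ 2 ^ k) (ℕ.+-identityʳ N))))
          total≡ : fromℕ 2 ^ (j ℕ.+ (e ℕ.+ t)) ≡ fromℕ 2 ^ j * (fromℕ 2 ^ e * T)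
          total≡ = trans (^-+ (fromℕ 2) j (e ℕ.+ t)) (cong (fromℕ 2 ^ j *_) (^-+ (fromℕ 2) e t))
          lower : 2 ℕ.* N ℕ.+ 0 ℕ.≤ j ℕ.+ (e ℕ.+ t)
          lower = ^-cancel-≤ (begin
            fromℕ 2 ^ (2 ℕ.* N ℕ.+ 0)       ≡⟨ 2N 0 ⟩
            p * p * 1ℝ                      ≤⟨ *-monoʳ-≤ (0≤* 0≤p 0≤p) low ⟩
            p * p * (a * b * T)             ≡⟨ solve 4 (λ p a b T → p :* p :* (a :* b :* T) := a :* p :* (b :* p :* T)) refl p a b T ⟩
            a * p * (b * p * T)             ≤⟨ *-mono-≤ (0≤* 0≤a 0≤p) (0≤* (^-nonNeg e (<⇒≤ 0<2)) 0≤T) (proj₁ aj) (*-monoˡ-≤ 0≤T (proj₁ be)) ⟩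
            fromℕ 2 ^ j * (fromℕ 2 ^ e * T) ≡⟨ sym total≡ ⟩
            fromℕ 2 ^ (j ℕ.+ (e ℕ.+ t))     ∎)
          upper : j ℕ.+ (e ℕ.+ t) ℕ.≤ 2 ℕ.* N ℕ.+ window
          upper = ^-cancel-≤ (begin
            fromℕ 2 ^ (j ℕ.+ (e ℕ.+ t))     ≡⟨ total≡ ⟩
            fromℕ 2 ^ j * (fromℕ 2 ^ e * T) ≤⟨ *-mono-≤ (^-nonNeg j (<⇒≤ 0<2)) (0≤* (0≤* (<⇒≤ 0<2) (0≤* 0≤b 0≤p)) 0≤T) (proj₂ aj 0<a) (*-monoˡ-≤ 0≤T (proj₂ be 0<b)) ⟩
            fromℕ 2 * (a * p) * (fromℕ 2 * (b * p) * T) ≡⟨ solve 4 (λ p a b T → :2 :* (a :* p) :* (:2 :* (b :* p) :* T) := p :* p :* (:2 :* (:2 :* :1)) :* (a :* b :* T)) refl p a b T ⟩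
            p * p * fromℕ 2 ^ 2 * (a * b * T)           ≤⟨ *-monoʳ-≤ (0≤* (0≤* 0≤p 0≤p) (^-nonNeg 2 (<⇒≤ 0<2))) (*-monoˡ-≤ 0≤T high) ⟩
            p * p * fromℕ 2 ^ 2 * (T * T)               ≡⟨ trans (solve 3 (λ p f T → p :* p :* f :* (T :* T) := p :* p :* (T :* T :* f)) refl p (fromℕ 2 ^ 2) T)
                                                             (cong (p * p *_) (sym (trans (^-+ (fromℕ 2) (2 ℕ.* t) 2) (cong (_* fromℕ 2 ^ 2) (trans (^-+ (fromℕ 2) t (t ℕ.+ 0)) (cong (λ k → T * fromℕ 2 ^ k) (ℕ.+-identityʳ t))))))) ⟩
            p * p * fromℕ 2 ^ window                    ≡⟨ sym (2N window) ⟩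
            fromℕ 2 ^ (2 ℕ.* N ℕ.+ window)  ∎)
          gap = j ℕ.+ (e ℕ.+ t) ℕ.∸ 2 ℕ.* N
          2N≤ : 2 ℕ.* N ℕ.≤ j ℕ.+ (e ℕ.+ t)
          2N≤ = ℕ.≤-trans (ℕ.≤-reflexive (sym (ℕ.+-identityʳ _))) lower
          gap< : gap ℕ.< suc window
          gap< = s≤s (ℕ.≤-trans (ℕ.∸-monoˡ-≤ (2 ℕ.* N) upper) (ℕ.≤-reflexive (ℕ.m+n∸m≡n (2 ℕ.* N) window)))
          d = fromℕ< gap<
          matched : Matched d
          matched = trans (sym (ℕ.m+[n∸m]≡n 2N≤)) (cong (2 ℕ.* N ℕ.+_) (sym (Fin.toℕ-fromℕ< gap<)))

  open MessageAndAcceptance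

  -- Information-theoretic consequences of a small marginal information

  module InformationBounds where

    open IsLinear
    open Dominated

    private
      module Order = ExtremaOrder _≤_

      variable
        r s : ℝ

    [≤]⇒≤ : [ r ] ≤± [ s ] → r ≤ s
    [≤]⇒≤ Order.[ p ] = p

    sup±-upper : ∀ {S : Pred (ℝ ±) 0ℓ} {v} → sup± S ≤± [ s ] → S [ v ] → v ≤ s
    sup±-upper {S = S} {v} h v∈ with lem {∃ λ b → UpperBound _≤±_ S [ b ]}
    sup±-upper () v∈ | no _
    ... | yes (b′ , ub) with lem {∃ λ x → S [ x ]}
    ...   | no ¬v = contradiction (_ , v∈) ¬v
    ...   | yes e = ≤-trans (proj₁ (sup-isSupremum {S = λ x → S [ x ]} e (b′ , λ x x∈ → [≤]⇒≤ (ub [ x ] x∈))) v v∈) ([≤]⇒≤ h)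

    sup±-proper : ∀ {S : Pred (ℝ ±) 0ℓ} → sup± S ≤± [ s ] → ¬ S ⊤±
    sup±-proper {S = S} h ⊤∈ with lem {∃ λ b → UpperBound _≤±_ S [ b ]}
    sup±-proper () ⊤∈ | no _
    ... | yes (b′ , ub) = case ub ⊤± ⊤∈ of λ ()

    ≤-sup± : ∀ {S : Pred (ℝ ±) 0ℓ} {v} → r ≤ v → S [ v ] → [ r ] ≤± sup± S
    ≤-sup± {r} {S} r≤v v∈ with lem {∃ λ b → UpperBound _≤±_ S [ b ]}
    ... | no _ = Order.[ r ]≤⊤±
    ... | yes (b′ , ub) with lem {∃ λ x → S [ x ]}
    ...   | no ¬v = contradiction (_ , v∈) ¬v
    ...   | yes e = Order.[ ≤-trans r≤v (proj₁ (sup-isSupremum {S = λ x → S [ x ]} e (b′ , λ x x∈ → [≤]⇒≤ (ub [ x ] x∈))) _ v∈) ]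

    ≤±-total : ∀ a v → [ a ] ≤± v ⊎ v ≤± [ a ]
    ≤±-total a ⊥±    = inj₂ Order.⊥±≤[ a ]
    ≤±-total a [ v ] with ≤-total a v
    ... | inj₁ p = inj₁ Order.[ p ]
    ... | inj₂ p = inj₂ Order.[ p ]
    ≤±-total a ⊤±    = inj₁ Order.[ a ]≤⊤±

    inf±-attained : ∀ {S : Pred (ℝ ±) 0ℓ} → inf± S ≤± [ r ] → r < s → ∃ λ v → S v × v ≤± [ s ]
    inf±-attained {r} {s} {S} h r<s with lem {∃ λ v → S v × v ≤± [ s ]}
    ... | yes e = e
    ... | no ¬e = contradiction (sup±-upper h λ v v∈ → case ≤±-total s v of λ where
      (inj₁ p) → p
      (inj₂ p) → contradiction (v , v∈ , p) ¬e) (<⇒≱ r<s)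

    module _ {X Y n : ℕ} {ks : Vec ℕ n} where

      Point : Set
      Point = Fin X × Fin Y × All Fin ks

      total³ : (Point → ℝ) → ℝ
      total³ f = ∑[ x < X ] ∑[ y < Y ] sumAll ks λ m → f (x , y , m)

      total³-linear : IsLinear total³
      total³-linear = ∘-linear (∑-linear X) λ x → ∘-linear (∑-linear Y) λ y → sumAll-linear ks

    module Extraction {X Y n : ℕ} {ks : Vec ℕ n} (p : Joint X Y ks) (f : Fin X → Fin Y → Bool)
                      (p-dist : Probabilities.IsDistribution p) (I β : ℝ) (1≤I : 1ℝ ≤ I) where

      open Probabilities
      open MarginalInformation I p f using (logRatio; cost; δ)

      record Cheap (q : Joint X Y ks) : Set where
        field
          q-dist      : IsDistribution q
          rectangular : Rectangular q (p[xy] p)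
          cost≤       : cost q ≤± [ β ]

      module _ {q : Joint X Y ks} (cheap : Cheap q) where
        open Cheap cheap

        0≤q = proj₁ q-dist
        0≤p = proj₁ p-dist

        exponent : ℝ
        exponent = fromℕ 12 * I / δ

        -- Lets the budget α₂ I of the bias factor be divided by I, which leaves a constant bound on
        -- the mean of -ln |bias|.
        I≤exponent : I ≤ exponent
        I≤exponent = x≤y/z 0<δ (≤-trans (*-monoʳ-≤ 0≤I δ≤1) (≤-trans (≤-reflexive (ℝ.*-comm I 1ℝ)) (*-monoˡ-≤ 0≤I (≤-trans (≤-reflexive (sym fromℕ-1)) (fromℕ-mono (s≤s {n = 11} z≤n))))))
          where
          0≤I = ≤-trans 0≤1 1≤I
          0<δ : 0ℝ < δ
          0<δ = 0</ 0<1 (0<fromℕ-suc 14)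
          δ≤1 : δ ≤ 1ℝ
          δ≤1 = x/z≤y (0<fromℕ-suc 14) (≤-trans (≤-reflexive (sym fromℕ-1)) (≤-trans (fromℕ-mono (s≤s {n = 14} z≤n)) (≤-reflexive (sym (ℝ.*-identityˡ _)))))

        qˣ : Fin X → All Fin ks → ℝ
        qˣ x m = ∑[ y < Y ] q x y m

        qʸ : Fin Y → All Fin ks → ℝ
        qʸ y m = ∑[ x < X ] q x y m

        pˣ : Fin X → ℝ
        pˣ x = ∑[ y < Y ] p[xy] p x y

        pʸ : Fin Y → ℝ
        pʸ y = ∑[ x < X ] p[xy] p x y

        q≤qˣ : ∀ x y m → q x y m ≤ qˣ x m
        q≤qˣ x y m = term≤∑ (λ y → 0≤q x y m) y

        q≤qʸ : ∀ x y m → q x y m ≤ qʸ y m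
        q≤qʸ x y m = term≤∑ (λ x → 0≤q x y m) x

        0≤qˣ : ∀ x m → 0ℝ ≤ qˣ x m
        0≤qˣ x m = nonNegative (∑-linear Y) λ y → 0≤q x y m

        0≤qʸ : ∀ y m → 0ℝ ≤ qʸ y m
        0≤qʸ y m = nonNegative (∑-linear X) λ x → 0≤q x y m

        0≤q[xy] : ∀ x y → 0ℝ ≤ p[xy] q x y
        0≤q[xy] x y = nonNegative (sumAll-linear ks) (0≤q x y)

        0≤p[xy] : ∀ x y → 0ℝ ≤ p[xy] p x y
        0≤p[xy] x y = nonNegative (sumAll-linear ks) (0≤p x y)

        b : All Fin ks → ℝ
        b m = ∣ bias q f m ∣

        record Supported (x : Fin X) (y : Fin Y) (m : All Fin ks) : Set where
          field
            0<p : 0ℝ < p x y m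
            0<b : 0ℝ < b m
            bound : (ln (q x y m) - ln (qʸ y m) - (ln (p[xy] p x y) - ln (pʸ y))) + (ln (q x y m) - ln (qˣ x m) - (ln (p[xy] p x y) - ln (pˣ x)))
                    + I * (ln (q x y m) - ln (p x y m)) + exponent * (- ln (b m)) ≤ β * ln2

        supported : ∀ x y m → 0ℝ < q x y m → Supported x y m
        supported x y m 0<q with lem {p[x|y] p x y ≡ 0ℝ ⊎ p[y|x] p x y ≡ 0ℝ ⊎ p x y m ≡ 0ℝ ⊎ bias q f m ≡ 0ℝ} | inspect-cost
          where
          inspect-cost : ¬ (logRatio q x y m ≡ ⊤±) × (∀ v → logRatio q x y m ≡ [ v ] → v ≤ β)
          inspect-cost = (λ eq → sup±-proper cost≤ (x , y , m , 0<q , sym eq)) , λ v eq → sup±-upper cost≤ (x , y , m , 0<q , sym eq)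
        ... | yes _ | proper , _ = contradiction refl proper
        ... | no ¬0 | _ , upper = record
          { 0<p = 0<p
          ; 0<b = 0<b
          ; bound = subst (_≤ β * ln2) expand (≤-trans (≤-reflexive (sym (x/y*y (0<⇒≢ 0<ln2)))) (*-monoˡ-≤ (<⇒≤ 0<ln2) (≤-trans (≤-reflexive (sym (log₂≡ 0<Z))) (upper _ refl))))
          }
          where
          0<p : 0ℝ < p x y m
          0<p = 0≤∧≢⇒0< (0≤p x y m) (¬0 ∘ inj₂ ∘ inj₂ ∘ inj₁)
          bias≢0 : bias q f m ≢ 0ℝ
          bias≢0 = ¬0 ∘ inj₂ ∘ inj₂ ∘ inj₂
          0<b : 0ℝ < b m
          0<b = 0≤∧≢⇒0< (∣∣-nonNeg _) λ b≡0 → case ∣∣-cases (bias q f m) of λ where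
            (inj₁ (eq , _)) → bias≢0 (trans (sym eq) b≡0)
            (inj₂ (eq , _)) → bias≢0 (trans (sym (-‿involutive _)) (trans (cong -_ (trans (sym eq) b≡0)) -0#≈0#))
          0<pxy : 0ℝ < p[xy] p x y
          0<pxy = <-≤-trans 0<p (term≤sumAll (0≤p x y) m)
          0<pʸ : 0ℝ < pʸ y
          0<pʸ = <-≤-trans 0<pxy (term≤∑ (λ x → 0≤p[xy] x y) x)
          0<pˣ : 0ℝ < pˣ x
          0<pˣ = <-≤-trans 0<pxy (term≤∑ (λ y → 0≤p[xy] x y) y)
          0<qʸ = <-≤-trans 0<q (q≤qʸ x y m)
          0<qˣ = <-≤-trans 0<q (q≤qˣ x y m)
          S₁ = p[x|ym] q x y m / p[x|y] p x y
          S₂ = p[y|xm] q x y m / p[y|x] p x y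
          0<S₁ : 0ℝ < S₁
          0<S₁ = 0</ (0</ 0<q 0<qʸ) (0</ 0<pxy 0<pʸ)
          0<S₂ : 0ℝ < S₂
          0<S₂ = 0</ (0</ 0<q 0<qˣ) (0</ 0<pxy 0<pˣ)
          R₁ = pow (q x y m / p x y m) I
          R₂ = pow (b m) (- exponent)
          0<R₁ = pow-pos (q x y m / p x y m) I
          0<R₂ = pow-pos (b m) (- exponent)
          0<Z : 0ℝ < S₁ * S₂ * R₁ * R₂
          0<Z = 0<* (0<* (0<* 0<S₁ 0<S₂) 0<R₁) 0<R₂
          expand : ln (S₁ * S₂ * R₁ * R₂) ≡ _
          expand = trans (ln-* (0<* (0<* 0<S₁ 0<S₂) 0<R₁) 0<R₂) (cong₂ _+_ (trans (ln-* (0<* 0<S₁ 0<S₂) 0<R₁) (cong₂ _+_ (trans (ln-* 0<S₁ 0<S₂) (cong₂ _+_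
            (trans (ln-/ (0</ 0<q 0<qʸ) (0</ 0<pxy 0<pʸ)) (cong₂ _-_ (ln-/ 0<q 0<qʸ) (ln-/ 0<pxy 0<pʸ)))
            (trans (ln-/ (0</ 0<q 0<qˣ) (0</ 0<pxy 0<pˣ)) (cong₂ _-_ (ln-/ 0<q 0<qˣ) (ln-/ 0<pxy 0<pˣ)))))
            (trans (ln-pow I (0</ 0<q 0<p)) (cong (I *_) (ln-/ 0<q 0<p)))))
            (trans (ln-pow (- exponent) 0<b) (solve 2 (λ e l → :- e :* l := e :* (:- l)) refl exponent (ln (b m)))))

        supp : ∀ x y m → 0ℝ < q x y m → 0ℝ < p x y m
        supp x y m = Supported.0<p ∘ supported x y m

        private
          F : (Point {X} {Y} {ks = ks} → ℝ) → ℝ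
          F = total³
          lin : IsLinear F
          lin = total³-linear

          Q : Point {X} {Y} {ks = ks} → ℝ
          Q (x , y , m) = q x y m

          FQ≡1 : F Q ≡ 1ℝ
          FQ≡1 = proj₂ q-dist

          e₁ e₂ e₃ e₄ : Point {X} {Y} {ks = ks} → ℝ
          e₁ (x , y , m) = η (q x y m) (qʸ y m) - q x y m * (ln (p[xy] p x y) - ln (pʸ y))
          e₂ (x , y , m) = η (q x y m) (qˣ x m) - q x y m * (ln (p[xy] p x y) - ln (pˣ x))
          e₃ (x , y , m) = η (q x y m) (p x y m)
          e₄ (x , y , m) = q x y m * (- ln (b m))

          pointwise : ∀ i → e₁ i + e₂ i + I * e₃ i + exponent * e₄ i ≤ Q i * (β * ln2)
          pointwise (x , y , m) with 0≤⇒≡⊎< (0≤q x y m)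
          ... | inj₂ 0<q = ≤-trans (≤-reflexive (solve 11 (λ q lq ly px py lx pxx I lp e lb → (q :* (lq :- ly) :- q :* (px :- py)) :+ (q :* (lq :- lx) :- q :* (px :- pxx)) :+ I :* (q :* (lq :- lp)) :+ e :* (q :* (:- lb))
                             := q :* ((lq :- ly :- (px :- py)) :+ (lq :- lx :- (px :- pxx)) :+ I :* (lq :- lp) :+ e :* (:- lb))) refl
                             (q x y m) (ln (q x y m)) (ln (qʸ y m)) (ln (p[xy] p x y)) (ln (pʸ y)) (ln (qˣ x m)) (ln (pˣ x)) I (ln (p x y m)) exponent (ln (b m))))
                             (*-monoʳ-≤ (<⇒≤ 0<q) (Supported.bound (supported x y m 0<q)))
          ... | inj₁ q≡0 = ≤-reflexive (subst (λ z → (z * A₁ - z * A₂) + (z * A₃ - z * A₄) + I * (z * A₅) + exponent * (z * A₆) ≡ z * (β * ln2)) (sym q≡0)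
                             (solve 9 (λ A₁ A₂ A₃ A₄ A₅ A₆ I e B → (:0 :* A₁ :- :0 :* A₂) :+ (:0 :* A₃ :- :0 :* A₄) :+ I :* (:0 :* A₅) :+ e :* (:0 :* A₆) := :0 :* B) refl A₁ A₂ A₃ A₄ A₅ A₆ I exponent (β * ln2)))
            where
            A₁ = ln (q x y m) - ln (qʸ y m)
            A₂ = ln (p[xy] p x y) - ln (pʸ y)
            A₃ = ln (q x y m) - ln (qˣ x m)
            A₄ = ln (p[xy] p x y) - ln (pˣ x)
            A₅ = ln (q x y m) - ln (p x y m)
            A₆ = - ln (b m)

        -- The supremum over the support of q bounds the mean under q. In the mean each of the four
        -- logarithms is nonnegative, so the budget holds for each one separately.
        budget : F e₁ + F e₂ + I * F e₃ + exponent * F e₄ ≤ β * ln2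
        budget = begin
          F e₁ + F e₂ + I * F e₃ + exponent * F e₄ ≡⟨ sym (trans (additive lin (λ i → e₁ i + e₂ i + I * e₃ i) (λ i → exponent * e₄ i)) (cong₂ _+_
             (trans (additive lin (λ i → e₁ i + e₂ i) (λ i → I * e₃ i)) (cong₂ _+_ (additive lin e₁ e₂) (homogeneous lin I e₃))) (homogeneous lin exponent e₄))) ⟩
          F (λ i → e₁ i + e₂ i + I * e₃ i + exponent * e₄ i) ≤⟨ monotone lin pointwise ⟩
          F (λ i → Q i * (β * ln2))                ≡⟨ trans (homogeneousʳ lin (β * ln2) Q) (trans (cong (_* (β * ln2)) FQ≡1) (ℝ.*-identityˡ _)) ⟩
          β * ln2                                  ∎
          where open ≤-Reasoning

        -- For g the marginal qʸ this is q(xy) times the divergence of q(m|xy) from q(m|y); the sum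
        -- over the inputs is the mutual information of x and m given y under q. For qˣ the roles
        -- are exchanged.
        gain : (g : Fin X → Fin Y → All Fin ks → ℝ) → Fin X → Fin Y → ℝ
        gain g x y = sumAll ks (λ m → η (q x y m) (g x y m)) - η (p[xy] q x y) (sumAll ks (g x y))

        gain-nonNeg : ∀ g → (∀ x y m → q x y m ≤ g x y m) → ∀ x y → 0ℝ ≤ gain g x y
        gain-nonNeg g q≤g x y = x≤y⇒0≤y-x (log-sum (sumAll-linear ks) (0≤q x y) (λ m → ≤-trans (0≤q x y m) (q≤g x y m)) (λ m 0<q → <-≤-trans 0<q (q≤g x y m)) ≤-refl
          (λ 0<q → <-≤-trans 0<q (monotone (sumAll-linear ks) (q≤g x y))))

        private
          input-gain : ∀ {n} (w : Fin n → ℝ) (v : Fin n → ℝ) → (∀ i → 0ℝ ≤ w i) → (∀ i → 0ℝ ≤ v i) → (∀ i → 0ℝ < w i → 0ℝ < v i) →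
                       0ℝ ≤ ∑[ i < n ] (η (w i) (sum w) - w i * (ln (v i) - ln (sum v)))
          input-gain {n} w v 0≤w 0≤v w⇒v = ≤-trans (x≤y⇒0≤y-x (log-sum (∑-linear n) 0≤w 0≤v w⇒v ≤-refl λ 0<s → let i , 0<wi = support (∑-linear n) 0≤w 0<s in <-≤-trans (w⇒v i 0<wi) (term≤∑ 0≤v i)))
            (≤-reflexive (trans (cong (λ z → sum (λ i → η (w i) (v i)) - z) (sym (homogeneousʳ (∑-linear n) (ln (sum w) - ln (sum v)) w))) (trans (sym (subtractive (∑-linear n) (λ i → η (w i) (v i)) (λ i → w i * (ln (sum w) - ln (sum v)))))
              (congruent (∑-linear n) λ i → solve 5 (λ w lw lv sw sv → w :* (lw :- lv) :- w :* (sw :- sv) := w :* (lw :- sw) :- w :* (lv :- sv)) refl (w i) (ln (w i)) (ln (v i)) (ln (sum w)) (ln (sum v))))))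

          q⇒p : ∀ x y → 0ℝ < p[xy] q x y → 0ℝ < p[xy] p x y
          q⇒p x y 0<q = let m , h = support (sumAll-linear ks) (0≤q x y) 0<q in <-≤-trans (supp x y m h) (term≤sumAll (0≤p x y) m)

          -- By Bayes q(x|ym) / p(x|y) is q(m|xy) / q(m|y) times q(x|y) / p(x|y). The second factor
          -- contributes a divergence, nonnegative by `input-gain`, so the budget bounds the
          -- information about m alone.
          e₁≡ : ∀ x y → sumAll ks (λ m → e₁ (x , y , m)) ≡ gain (λ x y → qʸ y) x y + (η (p[xy] q x y) (∑[ x < X ] p[xy] q x y) - p[xy] q x y * (ln (p[xy] p x y) - ln (pʸ y)))
          e₁≡ x y = trans (trans (subtractive (sumAll-linear ks) (λ m → η (q x y m) (qʸ y m)) (λ m → q x y m * K)) (cong (λ z → G - z) (homogeneousʳ (sumAll-linear ks) K (q x y))))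
            (trans (solve 3 (λ g e k → g :- k := (g :- e) :+ (e :- k)) refl G (η (p[xy] q x y) (sumAll ks (qʸ y))) (p[xy] q x y * K))
              (cong (λ s → gain (λ x y → qʸ y) x y + (η (p[xy] q x y) s - p[xy] q x y * K)) (sumAll-swap-∑ )))
            where
            K = ln (p[xy] p x y) - ln (pʸ y)
            G = sumAll ks (λ m → η (q x y m) (qʸ y m))
            sumAll-swap-∑ : sumAll ks (qʸ y) ≡ ∑[ x < X ] p[xy] q x y
            sumAll-swap-∑ = ∑-swap (sumAll-linear ks) (λ x m → q x y m)

          e₂≡ : ∀ x y → sumAll ks (λ m → e₂ (x , y , m)) ≡ gain (λ x y → qˣ x) x y + (η (p[xy] q x y) (∑[ y < Y ] p[xy] q x y) - p[xy] q x y * (ln (p[xy] p x y) - ln (pˣ x)))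
          e₂≡ x y = trans (trans (subtractive (sumAll-linear ks) (λ m → η (q x y m) (qˣ x m)) (λ m → q x y m * K)) (cong (λ z → G - z) (homogeneousʳ (sumAll-linear ks) K (q x y))))
            (trans (solve 3 (λ g e k → g :- k := (g :- e) :+ (e :- k)) refl G (η (p[xy] q x y) (sumAll ks (qˣ x))) (p[xy] q x y * K))
              (cong (λ s → gain (λ x y → qˣ x) x y + (η (p[xy] q x y) s - p[xy] q x y * K)) (∑-swap (sumAll-linear ks) (λ y m → q x y m))))
            where
            K = ln (p[xy] p x y) - ln (pˣ x)
            G = sumAll ks (λ m → η (q x y m) (qˣ x m))

          ∑² : (Fin X → Fin Y → ℝ) → ℝ
          ∑² g = ∑[ x < X ] ∑[ y < Y ] g x y

          ∑²-+ : ∀ g h → ∑² (λ x y → g x y + h x y) ≡ ∑² g + ∑² h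
          ∑²-+ g h = trans (congruent (∑-linear X) λ x → additive (∑-linear Y) (g x) (h x)) (additive (∑-linear X) (λ x → sum (g x)) (λ x → sum (h x)))

          gain₁≤ : ∑² (gain (λ x y → qʸ y)) ≤ F e₁
          gain₁≤ = ≤-cert rest (trans (congruent (∑-linear X) λ x → congruent (∑-linear Y) λ y → e₁≡ x y) (∑²-+ (gain (λ x y → qʸ y)) h))
            where
            h : Fin X → Fin Y → ℝ
            h x y = η (p[xy] q x y) (∑[ x < X ] p[xy] q x y) - p[xy] q x y * (ln (p[xy] p x y) - ln (pʸ y))
            rest : 0ℝ ≤ ∑² h
            rest = subst (0ℝ ≤_) (sym (∑-swap (∑-linear X) (λ y x → h x y))) (nonNegative (∑-linear Y) λ y → input-gain (λ x → p[xy] q x y) (λ x → p[xy] p x y) (λ x → 0≤q[xy] x y) (λ x → 0≤p[xy] x y) (λ x → q⇒p x y))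

          gain₂≤ : ∑² (gain (λ x y → qˣ x)) ≤ F e₂
          gain₂≤ = ≤-cert rest (trans (congruent (∑-linear X) λ x → congruent (∑-linear Y) λ y → e₂≡ x y) (∑²-+ (gain (λ x y → qˣ x)) h))
            where
            h : Fin X → Fin Y → ℝ
            h x y = η (p[xy] q x y) (∑[ y < Y ] p[xy] q x y) - p[xy] q x y * (ln (p[xy] p x y) - ln (pˣ x))
            rest : 0ℝ ≤ ∑² h
            rest = nonNegative (∑-linear X) λ x → input-gain (p[xy] q x) (p[xy] p x) (0≤q[xy] x) (0≤p[xy] x) (q⇒p x)

          0≤∑²gain : ∀ g → (∀ x y m → q x y m ≤ g x y m) → 0ℝ ≤ ∑² (gain g)
          0≤∑²gain g h = nonNegative (∑-linear X) λ x → nonNegative (∑-linear Y) λ y → gain-nonNeg g h x y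

          0≤Fe₁ = ≤-trans (0≤∑²gain (λ x y → qʸ y) q≤qʸ) gain₁≤
          0≤Fe₂ = ≤-trans (0≤∑²gain (λ x y → qˣ x) q≤qˣ) gain₂≤

          0≤Fe₃ : 0ℝ ≤ F e₃
          0≤Fe₃ = ≤-trans (≤-reflexive (trans (sym (ℝ.-‿inverseʳ 1ℝ)) (sym (trans (subtractive lin Q (λ (x , y , m) → p x y m)) (cong₂ _-_ FQ≡1 (proj₂ p-dist))))))
            (monotone lin λ (x , y , m) → gibbs (0≤q x y m) (0≤p x y m) (supp x y m))

          b≤1 : ∀ {x y} m → 0ℝ < q x y m → b m ≤ 1ℝ
          b≤1 {x} {y} m 0<q = ∣∣-≤ (≤-trans upper one) (≤-trans lower one)
            where
            qm = ∑[ x < X ] ∑[ y < Y ] q x y m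
            cond : Fin X → Fin Y → ℝ
            cond x y = p[xy|m] q x y m
            0≤qm : 0ℝ ≤ qm
            0≤qm = nonNegative (∑-linear X) λ x → nonNegative (∑-linear Y) λ y → 0≤q x y m
            0≤cond : ∀ x y → 0ℝ ≤ cond x y
            0≤cond x y = 0≤/ (0≤q x y m) 0≤qm
            one : ∑² cond ≤ 1ℝ
            one = ≤-reflexive (trans (congruent (∑-linear X) λ x → homogeneousʳ (∑-linear Y) (qm ⁻¹) (λ y → q x y m)) (trans (homogeneousʳ (∑-linear X) (qm ⁻¹) (λ x → ∑[ y < Y ] q x y m))
              (*-inverseʳ qm (0<⇒≢ (<-≤-trans 0<q (≤-trans (q≤qˣ x y m) (term≤∑ (λ x → 0≤qˣ x m) x)))))))
            sign≤1 : ∀ c → sign c ≤ 1ℝ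
            sign≤1 true  = ≤-trans (≤-cert (0≤+ 0≤1 0≤1) refl) (≤-reflexive (solve 0 (:- :1 :+ (:1 :+ :1) := :1) refl))
            sign≤1 false = ≤-refl
            -sign≤1 : ∀ c → - sign c ≤ 1ℝ
            -sign≤1 true  = ≤-reflexive (-‿involutive 1ℝ)
            -sign≤1 false = sign≤1 true
            upper : bias q f m ≤ ∑² cond
            upper = monotone (∑-linear X) λ x → monotone (∑-linear Y) λ y → ≤-trans (*-monoʳ-≤ (0≤cond x y) (sign≤1 (f x y))) (≤-reflexive (ℝ.*-identityʳ _))
            lower : - bias q f m ≤ ∑² cond
            lower = -x≤y⇒-y≤x (≤-trans (≤-reflexive (sym neg)) (monotone (∑-linear X) λ x → monotone (∑-linear Y) λ y →
              ≤-trans (≤-reflexive (solve 1 (λ c → :- :1 :* c := c :* (:- :1)) refl (cond x y))) (*-monoʳ-≤ (0≤cond x y) (-x≤y⇒-y≤x (-sign≤1 (f x y))))))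
              where
              neg : ∑² (λ x y → - 1ℝ * cond x y) ≡ - ∑² cond
              neg = trans (congruent (∑-linear X) λ x → homogeneous (∑-linear Y) (- 1ℝ) (cond x)) (trans (homogeneous (∑-linear X) (- 1ℝ) (λ x → sum (cond x))) (solve 1 (λ s → :- :1 :* s := :- s) refl (∑² cond)))

          0≤Fe₄ : 0ℝ ≤ F e₄
          0≤Fe₄ = nonNegative lin λ (x , y , m) → term x y m (0≤⇒≡⊎< (0≤q x y m))
            where
            term : ∀ x y m → q x y m ≡ 0ℝ ⊎ 0ℝ < q x y m → 0ℝ ≤ e₄ (x , y , m)
            term x y m (inj₁ q≡0) = ≤-reflexive (sym (trans (cong (_* (- ln (b m))) q≡0) (ℝ.zeroˡ _)))
            term x y m (inj₂ 0<q) = 0≤* (<⇒≤ 0<q) (x≤0⇒0≤-x (≤-trans (ln-mono-≤ (Supported.0<b (supported x y m 0<q)) (b≤1 m 0<q)) (≤-reflexive ln-1)))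

        module Budgets {α₂} (0≤α₂ : 0ℝ ≤ α₂) (β≤ : β * ln2 ≤ α₂ * I) where

          private
            0<I = <-≤-trans 0<1 1≤I
            0≤e = ≤-trans (<⇒≤ 0<I) I≤exponent

            le : ∀ {a b c d} → 0ℝ ≤ a → 0ℝ ≤ b → 0ℝ ≤ c → 0ℝ ≤ d → a + b + c + d ≤ β * ln2 → (a ≤ α₂ * I × b ≤ α₂ * I) × c ≤ α₂ * I × d ≤ α₂ * I
            le {a} {b} {c} {d} pa pb pc pd h =
              (≤-trans (≤-cert (0≤+ (0≤+ pb pc) pd) (solve 4 (λ a b c d → a :+ b :+ c :+ d := a :+ (b :+ c :+ d)) refl a b c d)) k ,
               ≤-trans (≤-cert (0≤+ (0≤+ pa pc) pd) (solve 4 (λ a b c d → a :+ b :+ c :+ d := b :+ (a :+ c :+ d)) refl a b c d)) k) ,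
              ≤-trans (≤-cert (0≤+ (0≤+ pb pa) pd) (solve 4 (λ a b c d → a :+ b :+ c :+ d := c :+ (b :+ a :+ d)) refl a b c d)) k ,
              ≤-trans (≤-cert (0≤+ (0≤+ pb pc) pa) (solve 4 (λ a b c d → a :+ b :+ c :+ d := d :+ (b :+ c :+ a)) refl a b c d)) k
              where k = ≤-trans h β≤

            all = le 0≤Fe₁ 0≤Fe₂ (0≤* (<⇒≤ 0<I) 0≤Fe₃) (0≤* 0≤e 0≤Fe₄) budget

          bob-gain : ∑[ x < X ] ∑[ y < Y ] gain (λ x y → qʸ y) x y ≤ α₂ * I
          bob-gain = ≤-trans gain₁≤ (proj₁ (proj₁ all))

          alice-gain : ∑[ x < X ] ∑[ y < Y ] gain (λ x y → qˣ x) x y ≤ α₂ * I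
          alice-gain = ≤-trans gain₂≤ (proj₂ (proj₁ all))

          relative-entropy : total³ (λ ((x , y , m) : Point {X} {Y} {ks = ks}) → η (q x y m) (p x y m)) ≤ α₂
          relative-entropy = *-cancelˡ-≤ 0<I (≤-trans (proj₁ (proj₂ all)) (≤-reflexive (ℝ.*-comm α₂ I)))

          -- Jensen's inequality through the tangent 1 + ln (K b) ≤ K b: in the mean -ln b is at
          -- most α₂, hence at most ln K.
          mean-bias : ∀ {K} → 0ℝ < K → α₂ ≤ ln K → 1ℝ ≤ K * total³ (λ ((x , y , m) : Point {X} {Y} {ks = ks}) → q x y m * b m)
          mean-bias {K} 0<K h = begin
            1ℝ                                              ≤⟨ ≤-cert (0≤+ (x≤y⇒0≤y-x h) (x≤y⇒0≤y-x Fe₄≤)) (solve 3 (λ l a e → (:1 :+ l) :- e := :1 :+ ((l :- a) :+ (a :- e))) refl (ln K) α₂ (F e₄)) ⟩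
            (1ℝ + ln K) - F e₄                              ≡⟨ cong (λ z → z - F e₄) (trans (sym (ℝ.*-identityˡ _)) (trans (cong (_* (1ℝ + ln K)) (sym FQ≡1)) (sym (homogeneousʳ lin (1ℝ + ln K) Q)))) ⟩
            F (λ i → Q i * (1ℝ + ln K)) - F e₄              ≡⟨ sym (subtractive lin (λ i → Q i * (1ℝ + ln K)) e₄) ⟩
            F (λ i → Q i * (1ℝ + ln K) - e₄ i)              ≤⟨ monotone lin (λ (x , y , m) → term x y m (0≤⇒≡⊎< (0≤q x y m))) ⟩
            F (λ (x , y , m) → K * (q x y m * b m))         ≡⟨ homogeneous lin K (λ (x , y , m) → q x y m * b m) ⟩
            K * F (λ (x , y , m) → q x y m * b m)           ∎
            where
            open ≤-Reasoning
            Fe₄≤ : F e₄ ≤ α₂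
            Fe₄≤ = *-cancelˡ-≤ 0<I (≤-trans (*-monoˡ-≤ 0≤Fe₄ I≤exponent) (≤-trans (proj₂ (proj₂ all)) (≤-reflexive (ℝ.*-comm α₂ I))))
            term : ∀ x y m → q x y m ≡ 0ℝ ⊎ 0ℝ < q x y m → q x y m * (1ℝ + ln K) - e₄ (x , y , m) ≤ K * (q x y m * b m)
            term x y m (inj₁ q≡0) = ≤-reflexive (subst (λ z → z * (1ℝ + ln K) - z * (- ln (b m)) ≡ K * (z * b m)) (sym q≡0) (solve 4 (λ l e K b → :0 :* (:1 :+ l) :- :0 :* (:- e) := K :* (:0 :* b)) refl (ln K) (ln (b m)) K (b m)))
            term x y m (inj₂ 0<q) = ≤-trans (≤-reflexive (solve 3 (λ q l e → q :* (:1 :+ l) :- q :* (:- e) := q :* (:1 :+ (l :+ e))) refl (q x y m) (ln K) (ln (b m))))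
              (≤-trans (*-monoʳ-≤ (<⇒≤ 0<q) (≤-trans (+-monoʳ-≤ 1ℝ (≤-trans (≤-reflexive (sym (ln-* 0<K 0<b))) (ln≤x-1 (0<* 0<K 0<b)))) (≤-reflexive (solve 1 (λ z → :1 :+ (z :- :1) := z) refl (K * b m)))))
                (≤-reflexive (solve 3 (λ q K b → q :* (K :* b) := K :* (q :* b)) refl (q x y m) K (b m))))
              where 0<b = Supported.0<b (supported x y m 0<q)

      exists-cheap : ∀ {a} → M I p f ≤± [ a ] → a < β → ∃ Cheap
      exists-cheap h a<β with inf±-attained h a<β
      ... | _ , (q , d , r , refl) , c = q , record { q-dist = d ; rectangular = r ; cost≤ = c }

  open InformationBounds

  -- The transition kernels of a protocol distribution

  module Kernels where

    open IsLinear

    private variable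
      n : ℕ

    product-cong : ∀ {n} {f g : Fin n → ℝ} → (∀ i → f i ≡ g i) → product f ≡ product g
    product-cong {zero}  h = refl
    product-cong {suc n} h = cong₂ _*_ (h zero) (product-cong (h ∘ suc))

    product-nonNeg : ∀ {n} {f : Fin n → ℝ} → (∀ i → 0ℝ ≤ f i) → 0ℝ ≤ product f
    product-nonNeg {zero}  h = 0≤1
    product-nonNeg {suc n} h = 0≤* (h zero) (product-nonNeg (h ∘ suc))

    product-if : ∀ {n} (c : Fin n → Bool) (f g : Fin n → ℝ) →
      product (λ i → if c i then f i else g i) ≡ product (λ i → if c i then f i else 1ℝ) * product (λ i → if c i then 1ℝ else g i)
    product-if {zero}  c f g = sym (ℝ.*-identityˡ 1ℝ)
    product-if {suc n} c f g = trans (cong (head *_) (product-if (c ∘ suc) (f ∘ suc) (g ∘ suc))) (split (c zero) (f zero) (g zero) u v)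
      where
      head = if c zero then f zero else g zero
      u = product (λ i → if c (suc i) then f (suc i) else 1ℝ)
      v = product (λ i → if c (suc i) then 1ℝ else g (suc i))
      split : ∀ c a b u v → (if c then a else b) * (u * v) ≡ (if c then a else 1ℝ) * u * ((if c then 1ℝ else b) * v)
      split true  a b u v = solve 3 (λ a u v → a :* (u :* v) := a :* u :* (:1 :* v)) refl a u v
      split false a b u v = solve 3 (λ b u v → b :* (u :* v) := :1 :* u :* (b :* v)) refl b u v

    -- `true` becomes index 0 so that `sumAll` and `sumBits` add their terms in the same order.
    encode : Vec Bool n → All Fin (replicate n 2)
    encode []          = []
    encode (true ∷ m)  = zero ∷ encode m
    encode (false ∷ m) = suc zero ∷ encode m

    decode : All Fin (replicate n 2) → Vec Bool n
    decode {zero}  []             = []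
    decode {suc n} (zero ∷ m)     = true ∷ decode m
    decode {suc n} (suc zero ∷ m) = false ∷ decode m

    encode-decode : (m : All Fin (replicate n 2)) → encode (decode m) ≡ m
    encode-decode {zero}  []             = refl
    encode-decode {suc n} (zero ∷ m)     = cong (zero ∷_) (encode-decode m)
    encode-decode {suc n} (suc zero ∷ m) = cong (suc zero ∷_) (encode-decode m)

    sumAll-bits : ∀ n (f : All Fin (replicate n 2) → ℝ) → sumAll (replicate n 2) f ≡ mass (f ∘ encode)
    sumAll-bits zero    f = refl
    sumAll-bits (suc n) f = trans (cong (sumAll (replicate n 2) (λ m → f (zero ∷ m)) +_) (ℝ.+-identityʳ _))
      (cong₂ _+_ (sumAll-bits n (λ m → f (zero ∷ m))) (sumAll-bits n (λ m → f (suc zero ∷ m))))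

    prefixMass : ∀ {n} {ks : Vec ℕ n} → ℕ → (All Fin ks → ℝ) → All Fin ks → ℝ
    prefixMass {ks = ks} i F m = sumAll ks λ m′ → if agree i m m′ then F m′ else 0ℝ

    prefixMass-∷ : ∀ {n k} {ks : Vec ℕ n} i (F : All Fin (k ∷ ks) → ℝ) a m → prefixMass (suc i) F (a ∷ m) ≡ prefixMass i (λ m → F (a ∷ m)) m
    prefixMass-∷ {k = k} {ks} i F a m = trans (congruent (∑-linear k) term) (∑-indicator a (λ a′ → prefixMass i (λ m → F (a′ ∷ m)) m))
      where
      term : ∀ a′ → sumAll ks (λ m′ → if ⌊ a Fin.≟ a′ ⌋ ∧ agree i m m′ then F (a′ ∷ m′) else 0ℝ) ≡ 1[ a′ ≡ a ] * prefixMass i (λ m → F (a′ ∷ m)) m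
      term a′ with a Fin.≟ a′
      ... | yes refl = sym (trans (cong (_* prefixMass i (λ m → F (a ∷ m)) m) (1[]-yes refl)) (ℝ.*-identityˡ _))
      ... | no a≢a′  = trans (null (sumAll-linear ks)) (sym (trans (cong (_* prefixMass i (λ m → F (a′ ∷ m)) m) (1[]-no (a≢a′ ∘ sym))) (ℝ.zeroˡ _)))

    prefixMass-swap : ∀ {N n} {ks : Vec ℕ n} i (F : Fin N → All Fin ks → ℝ) m → ∑[ x < N ] prefixMass i (F x) m ≡ prefixMass i (λ m → ∑[ x < N ] F x m) m
    prefixMass-swap {N} {ks = ks} i F m = trans (sym (∑-swap (sumAll-linear ks) (λ x m′ → if agree i m m′ then F x m′ else 0ℝ))) (congruent (sumAll-linear ks) λ m′ → choose (agree i m m′) m′)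
      where
      choose : ∀ c m′ → ∑[ x < N ] (if c then F x m′ else 0ℝ) ≡ (if c then ∑[ x < N ] F x m′ else 0ℝ)
      choose true  m′ = refl
      choose false m′ = null (∑-linear N)

    prefixMass-nonNeg : ∀ {n} {ks : Vec ℕ n} i {F : All Fin ks → ℝ} m → (∀ m → 0ℝ ≤ F m) → 0ℝ ≤ prefixMass i F m
    prefixMass-nonNeg {ks = ks} i {F} m h = nonNegative (sumAll-linear ks) λ m′ → choose (agree i m m′) m′
      where
      choose : ∀ c m′ → 0ℝ ≤ (if c then F m′ else 0ℝ)
      choose true  m′ = h m′
      choose false m′ = ≤-refl

    conditional : ∀ {n} {ks : Vec ℕ n} → ℕ → (All Fin ks → ℝ) → All Fin ks → ℝ
    conditional i F m = prefixMass (suc i) F m / prefixMass i F m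

    conditional-∷ : ∀ {n k} {ks : Vec ℕ n} i (F : All Fin (k ∷ ks) → ℝ) a m → conditional (suc i) F (a ∷ m) ≡ conditional i (λ m → F (a ∷ m)) m
    conditional-∷ i F a m = cong₂ _/_ (prefixMass-∷ (suc i) F a m) (prefixMass-∷ i F a m)

    conditional-nonNeg : ∀ {n} {ks : Vec ℕ n} i {F : All Fin ks → ℝ} m → (∀ m → 0ℝ ≤ F m) → 0ℝ ≤ conditional i F m
    conditional-nonNeg i m h = 0≤/ (prefixMass-nonNeg (suc i) m h) (prefixMass-nonNeg i m h)

    turns : (ℕ → Bool) → ∀ n → Vec Bool n
    turns own zero    = []
    turns own (suc n) = own 0 ∷ turns (own ∘ suc) n

    conditionals : ∀ {n} {ks : Vec ℕ n} → (ℕ → Bool) → (F G : All Fin ks → ℝ) → All Fin ks → ℝ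
    conditionals {n} own F G m = product {n} λ j → if own (toℕ j) then conditional (toℕ j) F m else conditional (toℕ j) G m

    conditionals-∷ : ∀ {n k} {ks : Vec ℕ n} own (F G : All Fin (k ∷ ks) → ℝ) a m → conditionals own F G (a ∷ m) ≡
      (if own 0 then sumAll ks (λ m → F (a ∷ m)) / sumAll (k ∷ ks) F else sumAll ks (λ m → G (a ∷ m)) / sumAll (k ∷ ks) G) *
      conditionals (own ∘ suc) (λ m → F (a ∷ m)) (λ m → G (a ∷ m)) m
    conditionals-∷ {n} own F G a m = cong₂ _*_
      (cong₂ (λ u v → if own 0 then u else v) (cong (_/ sumAll _ F) (prefixMass-∷ 0 F a m)) (cong (_/ sumAll _ G) (prefixMass-∷ 0 G a m)))
      (product-cong {n} λ j → cong₂ (λ u v → if own (suc (toℕ j)) then u else v) (conditional-∷ (toℕ j) F a m) (conditional-∷ (toℕ j) G a m))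

    conditionals-nonNeg : ∀ {n} {ks : Vec ℕ n} own {F G : All Fin ks → ℝ} m → (∀ m → 0ℝ ≤ F m) → (∀ m → 0ℝ ≤ G m) → 0ℝ ≤ conditionals own F G m
    conditionals-nonNeg {n} own {F} {G} m p q = product-nonNeg {n} λ j → choose (own (toℕ j)) (conditional-nonNeg (toℕ j) m p) (conditional-nonNeg (toℕ j) m q)
      where
      choose : ∀ c {a b} → 0ℝ ≤ a → 0ℝ ≤ b → 0ℝ ≤ (if c then a else b)
      choose true  p q = p
      choose false p q = q

    *-pos⁻¹ : ∀ {a b} → 0ℝ ≤ a → 0ℝ ≤ b → 0ℝ < a * b → 0ℝ < a × 0ℝ < b
    *-pos⁻¹ {a} {b} 0≤a 0≤b p = 0≤∧≢⇒0< 0≤a (λ a≡0 → 0<⇒≢ p (trans (cong (_* b) a≡0) (ℝ.zeroˡ b))) , 0≤∧≢⇒0< 0≤b (λ b≡0 → 0<⇒≢ p (trans (cong (a *_) b≡0) (ℝ.zeroʳ a)))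

    -- A null event makes a conditional vanish, whereas the law of the labels is
    -- always a probability; so the two agree only at histories of positive mass.
    conditionals-law : ∀ n own {F G : All Fin (replicate n 2) → ℝ} (H K : Vec Bool n → ℝ) → (∀ m → 0ℝ ≤ F m) → (∀ m → 0ℝ ≤ G m) → ∀ m →
      0ℝ < conditionals own F G (encode m) →
      conditionals own F G (encode m) ≡ law (turns own n) (labels (turns own n) (F ∘ encode) H) (labels (Vec.map not (turns own n)) (G ∘ encode) K) m
    conditionals-law zero own H K 0≤F 0≤G [] _ = refl
    conditionals-law (suc n) own {F} {G} H K 0≤F 0≤G (b ∷ m) 0<c = trans (unfold b) (cong₂ _*_ (head≡ (own 0) b (proj₁ positive)) (conditionals-law n (own ∘ suc) (restrict b H) (restrict b K) (0≤F ∘ (bit b ∷_)) (0≤G ∘ (bit b ∷_)) m (proj₂ positive) ∙ restrict≡ b))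
      where
      bit : Bool → Fin 2
      bit true  = zero
      bit false = suc zero
      ratio : Bool → Bool → ℝ
      ratio o b = if o then sumAll (replicate n 2) (λ m → F (bit b ∷ m)) / sumAll (2 ∷ replicate n 2) F else sumAll (replicate n 2) (λ m → G (bit b ∷ m)) / sumAll (2 ∷ replicate n 2) G
      rest : Bool → ℝ
      rest b = conditionals (own ∘ suc) (λ m → F (bit b ∷ m)) (λ m → G (bit b ∷ m)) (encode m)
      unfold : ∀ b → conditionals own F G (encode (b ∷ m)) ≡ ratio (own 0) b * rest b
      unfold true  = conditionals-∷ own F G zero (encode m)
      unfold false = conditionals-∷ own F G (suc zero) (encode m)
      0≤ratio : ∀ o b → 0ℝ ≤ ratio o b
      0≤ratio true  b = 0≤/ (nonNegative (sumAll-linear (replicate n 2)) λ m → 0≤F (bit b ∷ m)) (nonNegative (sumAll-linear (2 ∷ replicate n 2)) 0≤F)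
      0≤ratio false b = 0≤/ (nonNegative (sumAll-linear (replicate n 2)) λ m → 0≤G (bit b ∷ m)) (nonNegative (sumAll-linear (2 ∷ replicate n 2)) 0≤G)
      positive : 0ℝ < ratio (own 0) b × 0ℝ < rest b
      positive = *-pos⁻¹ (0≤ratio (own 0) b) (conditionals-nonNeg (own ∘ suc) (encode m) (0≤F ∘ (bit b ∷_)) (0≤G ∘ (bit b ∷_))) (subst (0ℝ <_) (unfold b) 0<c)
      weight≡ : ∀ (F : All Fin (replicate (suc n) 2) → ℝ) b → 0ℝ < sumAll (replicate n 2) (λ m → F (bit b ∷ m)) / sumAll (2 ∷ replicate n 2) F →
        sumAll (replicate n 2) (λ m → F (bit b ∷ m)) / sumAll (2 ∷ replicate n 2) F ≡ weight (mass (restrict true (F ∘ encode)) / mass (F ∘ encode)) b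
      weight≡ F true  _ = cong₂ _/_ (sumAll-bits n (λ m → F (zero ∷ m))) (sumAll-bits (suc n) F)
      weight≡ F false p = trans (cong₂ _/_ (sumAll-bits n (λ m → F (suc zero ∷ m))) (sumAll-bits (suc n) F))
        (trans (solve 3 (λ a b i → b :* i := (a :+ b) :* i :- a :* i) refl A B ((A + B) ⁻¹)) (cong (_- A / (A + B)) (x/x nonzero)))
        where
        A = mass (restrict true (F ∘ encode))
        B = mass (restrict false (F ∘ encode))
        nonzero : A + B ≢ 0ℝ
        nonzero s≡0 = 0<⇒≢ p (x/0 (trans (sumAll-bits (suc n) F) s≡0))
      head≡ : ∀ o b → 0ℝ < ratio o b → ratio o b ≡ weight (if o then (let P = if o then (F ∘ encode) else H in mass (restrict true P) / mass P) else (let P = if not o then (G ∘ encode) else K in mass (restrict true P) / mass P)) b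
      head≡ true  b p = weight≡ F b p
      head≡ false b p = weight≡ G b p
      _∙_ : ∀ {x y z : ℝ} → x ≡ y → y ≡ z → x ≡ z
      _∙_ = trans
      restrict≡ : ∀ b → law (turns (own ∘ suc) n) (labels (turns (own ∘ suc) n) (λ m → F (bit b ∷ encode m)) (restrict b H)) (labels (Vec.map not (turns (own ∘ suc) n)) (λ m → G (bit b ∷ encode m)) (restrict b K)) m
        ≡ law (turns (own ∘ suc) n) (labels (turns (own ∘ suc) n) (restrict b (F ∘ encode)) (restrict b H)) (labels (Vec.map not (turns (own ∘ suc) n)) (restrict b (G ∘ encode)) (restrict b K)) m
      restrict≡ true  = refl
      restrict≡ false = refl

    -- Index j stands for the message with number j + 1, because m₀ precedes the factors of the
    -- product.
    aliceSpeaks : ℕ → Bool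
    aliceSpeaks j = suc j % 2 ≡ᵇ 1

    module ProtocolDistribution {X Y C : ℕ} {ks : Vec ℕ (suc C)} (p : Joint X Y ks) (protocol : IsProtocolDistribution p) where

      open Probabilities p
      open Prefixes p
      open IsProtocolDistribution protocol

      0≤p : ∀ x y m → 0ℝ ≤ p x y m
      0≤p = proj₁ isDistribution

      pᵃ : Fin X → All Fin ks → ℝ
      pᵃ x m = ∑[ y < Y ] p x y m

      pᵇ : Fin Y → All Fin ks → ℝ
      pᵇ y m = ∑[ x < X ] p x y m

      0≤pᵃ : ∀ x m → 0ℝ ≤ pᵃ x m
      0≤pᵃ x m = nonNegative (∑-linear Y) λ y → 0≤p x y m

      0≤pᵇ : ∀ y m → 0ℝ ≤ pᵇ y m
      0≤pᵇ y m = nonNegative (∑-linear X) λ x → 0≤p x y m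

      p[m|x]≡ : ∀ i x m → p[m i |x] x m ≡ conditional i (pᵃ x) m
      p[m|x]≡ i x m = cong₂ _/_ (prefixMass-swap (suc i) (p x) m) (prefixMass-swap i (p x) m)

      p[m|y]≡ : ∀ i y m → p[m i |y] y m ≡ conditional i (pᵇ y) m
      p[m|y]≡ i y m = cong₂ _/_ (prefixMass-swap (suc i) (λ x → p x y) m) (prefixMass-swap i (λ x → p x y) m)

      0≤p[xy] : ∀ x y → 0ℝ ≤ p[xy] x y
      0≤p[xy] x y = nonNegative (sumAll-linear ks) (0≤p x y)

      0≤p[m₀] : ∀ m → 0ℝ ≤ p[m₀] m
      0≤p[m₀] m = nonNegative (∑-linear X) λ x → nonNegative (∑-linear Y) λ y → prefixMass-nonNeg 1 m (0≤p x y)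

      alicePart : Fin X → All Fin ks → ℝ
      alicePart x m = product {C} λ j → if aliceSpeaks (toℕ j) then p[m suc (toℕ j) |x] x m else 1ℝ

      -- As m₀ is public, its probability may be counted on either side. With it here, p is
      -- rectangular with respect to p(xy) just like q.
      bobPart : Fin Y → All Fin ks → ℝ
      bobPart y m = p[m₀] m * product {C} λ j → if aliceSpeaks (toℕ j) then 1ℝ else p[m suc (toℕ j) |y] y m

      alicePart-nonNeg : ∀ x m → 0ℝ ≤ alicePart x m
      alicePart-nonNeg x m = product-nonNeg {C} λ j → choose (aliceSpeaks (toℕ j)) (≤-trans (conditional-nonNeg (suc (toℕ j)) m (0≤pᵃ x)) (≤-reflexive (sym (p[m|x]≡ (suc (toℕ j)) x m))))
        where
        choose : ∀ c {a} → 0ℝ ≤ a → 0ℝ ≤ (if c then a else 1ℝ)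
        choose true  p = p
        choose false _ = 0≤1

      bobPart-nonNeg : ∀ y m → 0ℝ ≤ bobPart y m
      bobPart-nonNeg y m = 0≤* (0≤p[m₀] m) (product-nonNeg {C} λ j → choose (aliceSpeaks (toℕ j)) (≤-trans (conditional-nonNeg (suc (toℕ j)) m (0≤pᵇ y)) (≤-reflexive (sym (p[m|y]≡ (suc (toℕ j)) y m)))))
        where
        choose : ∀ c {a} → 0ℝ ≤ a → 0ℝ ≤ (if c then 1ℝ else a)
        choose true  _ = 0≤1
        choose false p = p

      p-parts : ∀ x y m → p x y m ≡ p[xy] x y * alicePart x m * bobPart y m
      p-parts x y m = trans (factorisation x y m) (trans (cong (p[xy] x y * p[m₀] m *_) (product-if {C} (aliceSpeaks ∘ toℕ) (λ j → p[m suc (toℕ j) |x] x m) (λ j → p[m suc (toℕ j) |y] y m)))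
        (solve 4 (λ a b u v → a :* b :* (u :* v) := a :* u :* (b :* v)) refl (p[xy] x y) (p[m₀] m) (alicePart x m) (product {C} λ j → if aliceSpeaks (toℕ j) then 1ℝ else p[m suc (toℕ j) |y] y m)))

    module BinaryProtocol {X Y k₀ k₁ n : ℕ} (p : Joint X Y (k₀ ∷ k₁ ∷ replicate n 2)) (protocol : IsProtocolDistribution p) where

      open ProtocolDistribution p protocol public
      open Probabilities p
      open Prefixes p
      open IsProtocolDistribution protocol

      p₀ : Fin k₀ → ℝ
      p₀ m₀ = ∑[ x < X ] ∑[ y < Y ] sumAll (k₁ ∷ replicate n 2) λ m → p x y (m₀ ∷ m)

      p₁ : Fin X → Fin k₀ → Fin k₁ → ℝ
      p₁ x m₀ m₁ = sumAll (replicate n 2) (λ m → pᵃ x (m₀ ∷ m₁ ∷ m)) / sumAll (k₁ ∷ replicate n 2) (λ m → pᵃ x (m₀ ∷ m))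

      -- Bit j of the history is the message with number j + 2, hence the shift by one against
      -- `aliceSpeaks`.
      owners : Vec Bool n
      owners = turns (aliceSpeaks ∘ suc) n

      p₀-probability : IsProbability p₀
      p₀-probability = (λ m₀ → nonNegative (∑-linear X) λ x → nonNegative (∑-linear Y) λ y → nonNegative (sumAll-linear (k₁ ∷ replicate n 2)) λ m → 0≤p x y (m₀ ∷ m)) ,
        trans (sym (trans (congruent (∑-linear X) λ x → ∑-swap (∑-linear Y) (λ m₀ y → sumAll (k₁ ∷ replicate n 2) λ m → p x y (m₀ ∷ m))) (∑-swap (∑-linear X) (λ m₀ x → ∑[ y < Y ] sumAll (k₁ ∷ replicate n 2) λ m → p x y (m₀ ∷ m))))) (proj₂ isDistribution)

      p₁-nonNeg : ∀ x m₀ m₁ → 0ℝ ≤ p₁ x m₀ m₁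
      p₁-nonNeg x m₀ m₁ = 0≤/ (nonNegative (sumAll-linear (replicate n 2)) λ m → 0≤pᵃ x _) (nonNegative (sumAll-linear (k₁ ∷ replicate n 2)) λ m → 0≤pᵃ x (m₀ ∷ m))

      p₁-total : ∀ x m₀ → sum (p₁ x m₀) ≤ 1ℝ
      p₁-total x m₀ = ≤-trans (≤-reflexive (homogeneousʳ (∑-linear k₁) _ (λ m₁ → sumAll (replicate n 2) (λ m → pᵃ x (m₀ ∷ m₁ ∷ m)))))
        (case 0≤⇒≡⊎< (nonNegative (sumAll-linear (k₁ ∷ replicate n 2)) λ m → 0≤pᵃ x (m₀ ∷ m)) of λ where
          (inj₁ s≡0) → ≤-trans (≤-reflexive (x/0 s≡0)) 0≤1
          (inj₂ 0<s) → ≤-reflexive (x/x (0<⇒≢ 0<s)))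

      p-law : ∀ x y m₀ m₁ (m : Vec Bool n) (H K : Vec Bool n → ℝ) → 0ℝ < p x y (m₀ ∷ m₁ ∷ encode m) →
        p x y (m₀ ∷ m₁ ∷ encode m) ≡ p[xy] x y * p₀ m₀ * p₁ x m₀ m₁ *
          law owners (labels owners (λ m → pᵃ x (m₀ ∷ m₁ ∷ encode m)) H) (labels (Vec.map not owners) (λ m → pᵇ y (m₀ ∷ m₁ ∷ encode m)) K) m
      p-law x y m₀ m₁ m H K 0<p = trans unfolded (trans (sym (ℝ.*-assoc _ _ _)) (cong (p[xy] x y * p₀ m₀ * p₁ x m₀ m₁ *_)
        (conditionals-law n (aliceSpeaks ∘ suc) H K (λ _ → 0≤pᵃ x _) (λ _ → 0≤pᵇ y _) m 0<rest)))
        where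
        rest : ℝ
        rest = conditionals (aliceSpeaks ∘ suc) (λ m → pᵃ x (m₀ ∷ m₁ ∷ m)) (λ m → pᵇ y (m₀ ∷ m₁ ∷ m)) (encode m)
        head≡ : p[m₀] (m₀ ∷ m₁ ∷ encode m) ≡ p₀ m₀
        head≡ = congruent (∑-linear X) λ x → congruent (∑-linear Y) λ y → prefixMass-∷ 0 (p x y) m₀ (m₁ ∷ encode m)
        choose : ∀ c {a a′ b b′ : ℝ} → a ≡ a′ → b ≡ b′ → (if c then a else b) ≡ (if c then a′ else b′)
        choose true  p q = p
        choose false p q = q
        unfolded : p x y (m₀ ∷ m₁ ∷ encode m) ≡ p[xy] x y * p₀ m₀ * (p₁ x m₀ m₁ * rest)
        unfolded = trans (factorisation x y (m₀ ∷ m₁ ∷ encode m)) (cong₂ (λ u v → p[xy] x y * u * v) head≡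
          (trans (product-cong {suc n} λ j → choose (aliceSpeaks (toℕ j))
              (trans (p[m|x]≡ (suc (toℕ j)) x _) (conditional-∷ (toℕ j) (pᵃ x) m₀ (m₁ ∷ encode m)))
              (trans (p[m|y]≡ (suc (toℕ j)) y _) (conditional-∷ (toℕ j) (pᵇ y) m₀ (m₁ ∷ encode m))))
            (conditionals-∷ aliceSpeaks (λ m → pᵃ x (m₀ ∷ m)) (λ m → pᵇ y (m₀ ∷ m)) m₁ (encode m))))
        0<rest : 0ℝ < rest
        0<rest = proj₂ (*-pos⁻¹ (p₁-nonNeg x m₀ m₁) 0≤rest (proj₂ (*-pos⁻¹ (0≤* (0≤p[xy] x y) (proj₁ p₀-probability m₀)) (0≤* (p₁-nonNeg x m₀ m₁) 0≤rest) (subst (0ℝ <_) unfolded 0<p))))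
          where 0≤rest = conditionals-nonNeg (aliceSpeaks ∘ suc) (encode m) (λ m → 0≤pᵃ x (m₀ ∷ m₁ ∷ m)) (λ m → 0≤pᵇ y (m₀ ∷ m₁ ∷ m))

  open Kernels

  -- Bounds on the errors of the simulation in the mean under q

  module SimulationErrors where

    open IsLinear

    module Errors {X Y k₀ k₁ n : ℕ} (p : Joint X Y (k₀ ∷ k₁ ∷ replicate n 2)) (f : Fin X → Fin Y → Bool)
                  (protocol : IsProtocolDistribution p) (I β : ℝ) (1≤I : 1ℝ ≤ I)
                  {q : Joint X Y (k₀ ∷ k₁ ∷ replicate n 2)}
                  (cheap : Extraction.Cheap p f (IsProtocolDistribution.isDistribution protocol) I β 1≤I q)
                  {α₂ : ℝ} (0≤α₂ : 0ℝ ≤ α₂) (β≤ : β * ln2 ≤ α₂ * I) where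

      open BinaryProtocol p protocol public
      open Probabilities
      module Ex = Extraction p f (IsProtocolDistribution.isDistribution protocol) I β 1≤I
      open Ex.Cheap cheap public
      open Ex.Budgets cheap 0≤α₂ β≤ public

      0≤q : ∀ x y m → 0ℝ ≤ q x y m
      0≤q = proj₁ q-dist

      Node : Set
      Node = Fin X × Fin Y × Fin k₀ × Fin k₁

      ∑⁴ : (Node → ℝ) → ℝ
      ∑⁴ g = ∑[ x < X ] ∑[ y < Y ] ∑[ m₀ < k₀ ] ∑[ m₁ < k₁ ] g (x , y , m₀ , m₁)

      ∑⁴-linear : IsLinear ∑⁴
      ∑⁴-linear = ∘-linear (∑-linear X) λ x → ∘-linear (∑-linear Y) λ y → ∘-linear (∑-linear k₀) λ m₀ → ∑-linear k₁

      Q P : Node → Vec Bool n → ℝ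
      Q (x , y , m₀ , m₁) m = q x y (m₀ ∷ m₁ ∷ encode m)
      P (x , y , m₀ , m₁) m = p x y (m₀ ∷ m₁ ∷ encode m)

      labelsᵃ : Fin X → Fin k₀ → Fin k₁ → Labels n
      labelsᵃ x m₀ m₁ = labels owners (λ m → pᵃ x (m₀ ∷ m₁ ∷ encode m)) (λ m → Ex.qˣ cheap x (m₀ ∷ m₁ ∷ encode m))

      labelsᵇ : Fin Y → Fin k₀ → Fin k₁ → Labels n
      labelsᵇ y m₀ m₁ = labels (Vec.map not owners) (λ m → pᵇ y (m₀ ∷ m₁ ∷ encode m)) (λ m → Ex.qʸ cheap y (m₀ ∷ m₁ ∷ encode m))

      L mis : Node → Vec Bool n → ℝ
      L (x , y , m₀ , m₁) = law owners (labelsᵃ x m₀ m₁) (labelsᵇ y m₀ m₁)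
      mis (x , y , m₀ , m₁) = mistakesAt owners (labelsᵃ x m₀ m₁) (labelsᵇ y m₀ m₁)

      -- The probability of reaching the node under p; wherever p is positive, it is W times the law
      -- L of the remaining bits.
      W : Node → ℝ
      W (x , y , m₀ , m₁) = p[xy] p x y * p₀ m₀ * p₁ x m₀ m₁

      labelsᵃ∈ : ∀ x m₀ m₁ → LabelsIn Probability (labelsᵃ x m₀ m₁)
      labelsᵃ∈ x m₀ m₁ = labels-probability owners (λ m → 0≤pᵃ x (m₀ ∷ m₁ ∷ encode m)) (λ m → Ex.0≤qˣ cheap x (m₀ ∷ m₁ ∷ encode m))

      labelsᵇ∈ : ∀ y m₀ m₁ → LabelsIn Probability (labelsᵇ y m₀ m₁)
      labelsᵇ∈ y m₀ m₁ = labels-probability (Vec.map not owners) (λ m → 0≤pᵇ y (m₀ ∷ m₁ ∷ encode m)) (λ m → Ex.0≤qʸ cheap y (m₀ ∷ m₁ ∷ encode m))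

      0≤L : ∀ i m → 0ℝ ≤ L i m
      0≤L (x , y , m₀ , m₁) = law-nonNeg owners (labelsᵃ∈ x m₀ m₁) (labelsᵇ∈ y m₀ m₁)

      0≤Q : ∀ i m → 0ℝ ≤ Q i m
      0≤Q (x , y , m₀ , m₁) m = 0≤q x y _

      0≤P : ∀ i m → 0ℝ ≤ P i m
      0≤P (x , y , m₀ , m₁) m = 0≤p x y _

      0≤W : ∀ i → 0ℝ ≤ W i
      0≤W (x , y , m₀ , m₁) = 0≤* (0≤* (0≤p[xy] x y) (proj₁ p₀-probability m₀)) (p₁-nonNeg x m₀ m₁)

      Q⇒P : ∀ i m → 0ℝ < Q i m → 0ℝ < P i m
      Q⇒P (x , y , m₀ , m₁) m = Ex.supp cheap x y _

      P≡WL : ∀ i m → 0ℝ < P i m → P i m ≡ W i * L i m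
      P≡WL (x , y , m₀ , m₁) m 0<P = p-law x y m₀ m₁ m _ _ 0<P

      Q⇒W,L : ∀ i m → 0ℝ < Q i m → 0ℝ < W i × 0ℝ < L i m
      Q⇒W,L i m 0<Q = *-pos⁻¹ (0≤W i) (0≤L i m) (subst (0ℝ <_) (P≡WL i m (Q⇒P i m 0<Q)) (Q⇒P i m 0<Q))

      total³≡ : ∀ (g : Fin X → Fin Y → All Fin (k₀ ∷ k₁ ∷ replicate n 2) → ℝ) →
                total³ (λ (x , y , m) → g x y m) ≡ ∑⁴ (λ (x , y , m₀ , m₁) → mass (λ m → g x y (m₀ ∷ m₁ ∷ encode m)))
      total³≡ g = congruent (∑-linear X) λ x → congruent (∑-linear Y) λ y → congruent (∑-linear k₀) λ m₀ → congruent (∑-linear k₁) λ m₁ → sumAll-bits n (λ m → g x y (m₀ ∷ m₁ ∷ m))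

      ∑⁴Q≡1 : ∑⁴ (mass ∘ Q) ≡ 1ℝ
      ∑⁴Q≡1 = trans (sym (total³≡ q)) (proj₂ q-dist)

      -- An inequality only, since after a null event `p₁` is 0 for every message.
      ∑⁴W≤1 : ∑⁴ W ≤ 1ℝ
      ∑⁴W≤1 = ≤-trans (monotone (∑-linear X) λ x → monotone (∑-linear Y) λ y → ≤-trans (monotone (∑-linear k₀) λ m₀ →
          ≤-trans (≤-reflexive (homogeneous (∑-linear k₁) (p[xy] p x y * p₀ m₀) (p₁ x m₀))) (*-monoʳ-≤ (0≤* (0≤p[xy] x y) (proj₁ p₀-probability m₀)) (p₁-total x m₀)))
          (≤-reflexive (trans (congruent (∑-linear k₀) λ m₀ → ℝ.*-identityʳ _) (trans (homogeneous (∑-linear k₀) (p[xy] p x y) p₀) (trans (cong (p[xy] p x y *_) (proj₂ p₀-probability)) (ℝ.*-identityʳ _))))))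
        (≤-reflexive (proj₂ (IsProtocolDistribution.isDistribution protocol)))

      module Split (g : Fin X → Fin Y → All Fin (k₀ ∷ k₁ ∷ replicate n 2) → ℝ) (q≤g : ∀ x y m → q x y m ≤ g x y m) where

        G : Node → Vec Bool n → ℝ
        G (x , y , m₀ , m₁) m = g x y (m₀ ∷ m₁ ∷ encode m)

        q₀ g₀ : Fin X → Fin Y → Fin k₀ → ℝ
        q₀ x y m₀ = sumAll (k₁ ∷ replicate n 2) λ m → q x y (m₀ ∷ m)
        g₀ x y m₀ = sumAll (k₁ ∷ replicate n 2) λ m → g x y (m₀ ∷ m)

        q₀≡ : ∀ x y m₀ → q₀ x y m₀ ≡ ∑[ m₁ < k₁ ] mass (Q (x , y , m₀ , m₁))
        q₀≡ x y m₀ = congruent (∑-linear k₁) λ m₁ → sumAll-bits n (λ m → q x y (m₀ ∷ m₁ ∷ m))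

        g₀≡ : ∀ x y m₀ → g₀ x y m₀ ≡ ∑[ m₁ < k₁ ] mass (G (x , y , m₀ , m₁))
        g₀≡ x y m₀ = congruent (∑-linear k₁) λ m₁ → sumAll-bits n (λ m → g x y (m₀ ∷ m₁ ∷ m))

        0≤g : ∀ x y m → 0ℝ ≤ g x y m
        0≤g x y m = ≤-trans (0≤q x y m) (q≤g x y m)

        Q≪G : ∀ i → Dominated (Q i) (G i)
        Q≪G (x , y , m₀ , m₁) = record { 0≤Q = λ m → 0≤q x y _ ; 0≤G = λ m → 0≤g x y _ ; Q⇒G = λ m 0<q → <-≤-trans 0<q (q≤g x y _) }

        mass≤ : ∀ i → mass (Q i) ≤ mass (G i)
        mass≤ (x , y , m₀ , m₁) = monotone (sumBits-linear n) λ m → q≤g x y _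

        q₀≤g₀ : ∀ x y m₀ → q₀ x y m₀ ≤ g₀ x y m₀
        q₀≤g₀ x y m₀ = monotone (sumAll-linear (k₁ ∷ replicate n 2)) λ m → q≤g x y (m₀ ∷ m)

        0≤q₀ : ∀ x y m₀ → 0ℝ ≤ q₀ x y m₀
        0≤q₀ x y m₀ = nonNegative (sumAll-linear (k₁ ∷ replicate n 2)) λ m → 0≤q x y (m₀ ∷ m)

        bits : Node → ℝ
        bits i = information (Q i) (G i)

        0≤bits : ∀ i → 0ℝ ≤ bits i
        0≤bits i = x≤y⇒0≤y-x (log-sum (sumBits-linear n) (0≤Q i) (Dominated.0≤G (Q≪G i)) (Dominated.Q⇒G (Q≪G i)) ≤-refl (dominated-mass (Q≪G i)))

        message : Fin X → Fin Y → Fin k₀ → ℝ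
        message x y m₀ = ∑[ m₁ < k₁ ] η (mass (Q (x , y , m₀ , m₁))) (mass (G (x , y , m₀ , m₁))) - η (q₀ x y m₀) (g₀ x y m₀)

        0≤message : ∀ x y m₀ → 0ℝ ≤ message x y m₀
        0≤message x y m₀ = x≤y⇒0≤y-x (subst (_≤ sum (λ m₁ → η (mass (Q (x , y , m₀ , m₁))) (mass (G (x , y , m₀ , m₁))))) (cong₂ η (sym (q₀≡ x y m₀)) (sym (g₀≡ x y m₀)))
          (log-sum (∑-linear k₁) (λ m₁ → mass-nonNeg (0≤Q (x , y , m₀ , m₁))) (λ m₁ → mass-nonNeg (Dominated.0≤G (Q≪G (x , y , m₀ , m₁)))) (λ m₁ → dominated-mass (Q≪G (x , y , m₀ , m₁))) ≤-refl
            λ p → <-≤-trans p (monotone (∑-linear k₁) λ m₁ → mass≤ (x , y , m₀ , m₁))))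

        public-gain : Fin X → Fin Y → ℝ
        public-gain x y = ∑[ m₀ < k₀ ] η (q₀ x y m₀) (g₀ x y m₀) - η (p[xy] q x y) (sumAll (k₀ ∷ k₁ ∷ replicate n 2) (g x y))

        0≤public-gain : ∀ x y → 0ℝ ≤ public-gain x y
        0≤public-gain x y = x≤y⇒0≤y-x (log-sum (∑-linear k₀) (0≤q₀ x y) (λ m₀ → ≤-trans (0≤q₀ x y m₀) (q₀≤g₀ x y m₀)) (λ m₀ p → <-≤-trans p (q₀≤g₀ x y m₀)) ≤-refl λ p → <-≤-trans p (monotone (∑-linear k₀) (q₀≤g₀ x y)))

        -- The chain rule along m₀, m₁ and the remaining bits. Every increment is nonnegative, so
        -- the information gain bounds the part of m₁ and the part of the bits separately.
        split : ∀ x y → Ex.gain cheap g x y ≡ public-gain x y + ∑[ m₀ < k₀ ] (message x y m₀ + ∑[ m₁ < k₁ ] bits (x , y , m₀ , m₁))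
        split x y = trans (cong (λ z → z - e) leaves) (trans (solve 3 (λ l h e → (h :+ l) :- e := (h :- e) :+ l) refl rest head e) refl)
          where
          e = η (p[xy] q x y) (sumAll (k₀ ∷ k₁ ∷ replicate n 2) (g x y))
          head = ∑[ m₀ < k₀ ] η (q₀ x y m₀) (g₀ x y m₀)
          rest = ∑[ m₀ < k₀ ] (message x y m₀ + ∑[ m₁ < k₁ ] bits (x , y , m₀ , m₁))
          leaf : Fin k₀ → Fin k₁ → ℝ
          leaf m₀ m₁ = mass (λ m → η (Q (x , y , m₀ , m₁) m) (G (x , y , m₀ , m₁) m))
          branch : Fin k₀ → Fin k₁ → ℝ
          branch m₀ m₁ = η (mass (Q (x , y , m₀ , m₁))) (mass (G (x , y , m₀ , m₁)))
          leaves : sumAll (k₀ ∷ k₁ ∷ replicate n 2) (λ m → η (q x y m) (g x y m)) ≡ head + rest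
          leaves = trans (congruent (∑-linear k₀) λ m₀ → trans (congruent (∑-linear k₁) λ m₁ → sumAll-bits n (λ m → η (q x y (m₀ ∷ m₁ ∷ m)) (g x y (m₀ ∷ m₁ ∷ m))))
              (trans (solve 3 (λ l n h → l := h :+ ((n :- h) :+ (l :- n))) refl (sum (leaf m₀)) (sum (branch m₀)) (η (q₀ x y m₀) (g₀ x y m₀)))
                (cong (λ z → η (q₀ x y m₀) (g₀ x y m₀) + (message x y m₀ + z)) (sym (subtractive (∑-linear k₁) (leaf m₀) (branch m₀))))))
            (additive (∑-linear k₀) (λ m₀ → η (q₀ x y m₀) (g₀ x y m₀)) (λ m₀ → message x y m₀ + ∑[ m₁ < k₁ ] bits (x , y , m₀ , m₁)))

        bits≤gain : ∑⁴ bits ≤ ∑[ x < X ] ∑[ y < Y ] Ex.gain cheap g x y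
        bits≤gain = monotone (∑-linear X) λ x → monotone (∑-linear Y) λ y → ≤-trans (monotone (∑-linear k₀) λ m₀ → ≤-cert (0≤message x y m₀) (ℝ.+-comm (message x y m₀) (∑[ m₁ < k₁ ] bits (x , y , m₀ , m₁))))
          (≤-trans (≤-cert (0≤public-gain x y) (ℝ.+-comm (public-gain x y) _)) (≤-reflexive (sym (split x y))))

        message≤gain : (∑[ x < X ] ∑[ y < Y ] ∑[ m₀ < k₀ ] message x y m₀) ≤ ∑[ x < X ] ∑[ y < Y ] Ex.gain cheap g x y
        message≤gain = monotone (∑-linear X) λ x → monotone (∑-linear Y) λ y → ≤-trans (monotone (∑-linear k₀) λ m₀ → ≤-cert (nonNegative (∑-linear k₁) λ m₁ → 0≤bits (x , y , m₀ , m₁)) refl)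
          (≤-trans (≤-cert (0≤public-gain x y) (ℝ.+-comm (public-gain x y) _)) (≤-reflexive (sym (split x y))))

      module Alice = Split (λ x y → Ex.qˣ cheap x) (Ex.q≤qˣ cheap)
      module Bob = Split (λ x y → Ex.qʸ cheap y) (Ex.q≤qʸ cheap)

      relative≤ : ∑⁴ (λ i → mass (λ m → η (Q i m) (P i m))) ≤ α₂
      relative≤ = ≤-trans (≤-reflexive (sym (total³≡ (λ x y m → η (q x y m) (p x y m))))) relative-entropy

      -- The divergence of q from p is the divergence on nodes, of the masses of Q from W, plus the
      -- divergence of the histories given the node; the former is nonnegative by Gibbs.
      surprise≤ : ∑⁴ (λ i → surprise (Q i) (L i)) ≤ α₂
      surprise≤ = ≤-trans (≤-cert rest (trans (congruent ∑⁴-linear split) (additive ∑⁴-linear (λ i → surprise (Q i) (L i)) (λ i → η (mass (Q i)) (W i))))) relative≤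
        where
        Q⇒W : ∀ i → 0ℝ < mass (Q i) → 0ℝ < W i
        Q⇒W i p = let m , h = support (sumBits-linear n) (0≤Q i) p in proj₁ (Q⇒W,L i m h)
        pointwise : ∀ i m → η (Q i m) (P i m) ≡ η (Q i m) (L i m) - Q i m * ln (W i)
        pointwise i m with 0≤⇒≡⊎< (0≤Q i m)
        ... | inj₁ q≡0 = trans (η-zero q≡0) (sym (trans (cong₂ _-_ (η-zero q≡0) (trans (cong (_* ln (W i)) q≡0) (ℝ.zeroˡ _))) (ℝ.-‿inverseʳ 0ℝ)))
        ... | inj₂ 0<q = trans (cong (η (Q i m)) (P≡WL i m (Q⇒P i m 0<q))) (η-scale (Q i m) (<⇒≤ 0<q) (λ _ → proj₂ (Q⇒W,L i m 0<q)) (proj₁ (Q⇒W,L i m 0<q)))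
        split : ∀ i → mass (λ m → η (Q i m) (P i m)) ≡ surprise (Q i) (L i) + η (mass (Q i)) (W i)
        split i = trans (congruent (sumBits-linear n) (pointwise i)) (trans (trans (subtractive (sumBits-linear n) (λ m → η (Q i m) (L i m)) (λ m → Q i m * ln (W i))) (cong (λ z → mass (λ m → η (Q i m) (L i m)) - z) (homogeneousʳ (sumBits-linear n) (ln (W i)) (Q i))))
          (trans (solve 4 (λ a s l w → a :- s :* w := a :- s :* (l :- :0) :+ s :* (l :- w)) refl (mass (λ m → η (Q i m) (L i m))) (mass (Q i)) (ln (mass (Q i))) (ln (W i)))
            (cong (λ z → mass (λ m → η (Q i m) (L i m)) - mass (Q i) * (ln (mass (Q i)) - z) + η (mass (Q i)) (W i)) (sym ln-1))))
        rest : 0ℝ ≤ ∑⁴ (λ i → η (mass (Q i)) (W i))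
        rest = ≤-trans (≤-trans (x≤y⇒0≤y-x ∑⁴W≤1) (≤-reflexive (trans (cong (_- ∑⁴ W) (sym ∑⁴Q≡1)) (sym (subtractive ∑⁴-linear (mass ∘ Q) W)))))
          (monotone ∑⁴-linear λ i → gibbs (mass-nonNeg (0≤Q i)) (0≤W i) (Q⇒W i))

      -- The last three units of α₂ I are the surprise of the speakers' laws and the information
      -- gains of both listeners.
      history-error : ∀ {k} → 0ℝ ≤ k → k * ∑⁴ (λ i → mass (λ m → Q i m * (mis i m / L i m))) ≤ fromℕ 3 * (k * k) * fromℕ n + fromℕ 3 * (α₂ * I)
      history-error {k} 0≤k = begin
        k * ∑⁴ (λ i → mass (λ m → Q i m * (mis i m / L i m)))         ≡⟨ sym (homogeneous ∑⁴-linear k _) ⟩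
        ∑⁴ (λ i → k * mass (λ m → Q i m * (mis i m / L i m)))         ≤⟨ monotone ∑⁴-linear node-bound ⟩
        ∑⁴ (λ i → fromℕ 3 * (k * k) * (fromℕ n * mass (Q i)) + (surprise (Q i) (L i) + (Alice.bits i + Bob.bits i)))
          ≡⟨ trans (additive ∑⁴-linear (λ i → fromℕ 3 * (k * k) * (fromℕ n * mass (Q i))) (λ i → surprise (Q i) (L i) + (Alice.bits i + Bob.bits i)))
               (cong₂ _+_ (trans (homogeneous ∑⁴-linear (fromℕ 3 * (k * k)) (λ i → fromℕ n * mass (Q i))) (cong (fromℕ 3 * (k * k) *_) (trans (homogeneous ∑⁴-linear (fromℕ n) (mass ∘ Q)) (trans (cong (fromℕ n *_) ∑⁴Q≡1) (ℝ.*-identityʳ _)))))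
                 (trans (additive ∑⁴-linear (λ i → surprise (Q i) (L i)) (λ i → Alice.bits i + Bob.bits i)) (cong (∑⁴ (λ i → surprise (Q i) (L i)) +_) (additive ∑⁴-linear Alice.bits Bob.bits)))) ⟩
        fromℕ 3 * (k * k) * fromℕ n + (∑⁴ (λ i → surprise (Q i) (L i)) + (∑⁴ Alice.bits + ∑⁴ Bob.bits))
          ≤⟨ +-monoʳ-≤ (fromℕ 3 * (k * k) * fromℕ n) (+-mono-≤ (≤-trans surprise≤ α₂≤α₂I) (+-mono-≤ (≤-trans Alice.bits≤gain alice-gain) (≤-trans Bob.bits≤gain bob-gain))) ⟩
        fromℕ 3 * (k * k) * fromℕ n + (α₂ * I + (α₂ * I + α₂ * I))     ≡⟨ cong (fromℕ 3 * (k * k) * fromℕ n +_) (solve 1 (λ a → a :+ (a :+ a) := :3 :* a) refl (α₂ * I)) ⟩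
        fromℕ 3 * (k * k) * fromℕ n + fromℕ 3 * (α₂ * I)               ∎
        where
        open ≤-Reasoning
        α₂≤α₂I : α₂ ≤ α₂ * I
        α₂≤α₂I = ≤-trans (≤-reflexive (sym (ℝ.*-identityʳ α₂))) (*-monoʳ-≤ 0≤α₂ 1≤I)
        node-bound : ∀ i → k * mass (λ m → Q i m * (mis i m / L i m)) ≤ fromℕ 3 * (k * k) * (fromℕ n * mass (Q i)) + (surprise (Q i) (L i) + (Alice.bits i + Bob.bits i))
        node-bound (x , y , m₀ , m₁) = mistakes-bound owners 0≤k (λ m → 0≤pᵃ x (m₀ ∷ m₁ ∷ encode m)) (λ m → 0≤pᵇ y (m₀ ∷ m₁ ∷ encode m)) (Alice.Q≪G (x , y , m₀ , m₁)) (Bob.Q≪G (x , y , m₀ , m₁)) (λ m → proj₂ ∘ Q⇒W,L (x , y , m₀ , m₁) m)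

      -- Bob's prediction of m₁.
      v₁ : Fin Y → Fin k₀ → Fin k₁ → ℝ
      v₁ y m₀ m₁ = sumAll (replicate n 2) (λ m → Ex.qʸ cheap y (m₀ ∷ m₁ ∷ m)) / sumAll (k₁ ∷ replicate n 2) (λ m → Ex.qʸ cheap y (m₀ ∷ m))

      v₁-nonNeg : ∀ y m₀ m₁ → 0ℝ ≤ v₁ y m₀ m₁
      v₁-nonNeg y m₀ m₁ = 0≤/ (nonNegative (sumAll-linear (replicate n 2)) λ m → Ex.0≤qʸ cheap y (m₀ ∷ m₁ ∷ m)) (nonNegative (sumAll-linear (k₁ ∷ replicate n 2)) λ m → Ex.0≤qʸ cheap y (m₀ ∷ m))

      v₁-total : ∀ y m₀ → sum (v₁ y m₀) ≤ 1ℝ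
      v₁-total y m₀ = ≤-trans (≤-reflexive (homogeneousʳ (∑-linear k₁) _ (λ m₁ → sumAll (replicate n 2) (λ m → Ex.qʸ cheap y (m₀ ∷ m₁ ∷ m)))))
        (case 0≤⇒≡⊎< (nonNegative (sumAll-linear (k₁ ∷ replicate n 2)) λ m → Ex.0≤qʸ cheap y (m₀ ∷ m)) of λ where
          (inj₁ s≡0) → ≤-trans (≤-reflexive (x/0 s≡0)) 0≤1
          (inj₂ 0<s) → ≤-reflexive (x/x (0<⇒≢ 0<s)))

      -- Even enlarged by K, Bob's prediction of m₁ falls below Alice's probability of sending it,
      -- so he may overlook it.
      Surprising : ℝ → Node → Set
      Surprising K (x , y , m₀ , m₁) = K * v₁ y m₀ m₁ < p₁ x m₀ m₁

      -- Let s be the mass of m₁ and w, w′ the total s₀ times `v₁` and `p₁`. On a surprising message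
      -- s ln K is at most s ln (w′ / w) = η s w - η s w′, hence at most η s w + w′ by Gibbs. Adding
      -- w keeps the bound nonnegative on the other messages. The terms η s w add up to Bob's
      -- information, the masses w and w′ to at most 2.
      naming-error : ∀ {K} → 1ℝ ≤ K → ln K * ∑⁴ (λ i → mass (Q i) * 1[ Surprising K i ]) ≤ α₂ * I + fromℕ 2
      naming-error {K} 1≤K = begin
        ln K * ∑⁴ (λ i → mass (Q i) * 1[ Surprising K i ])   ≡⟨ sym (homogeneous ∑⁴-linear (ln K) _) ⟩
        ∑⁴ (λ i → ln K * (mass (Q i) * 1[ Surprising K i ])) ≤⟨ (monotone (∑-linear X) λ x → monotone (∑-linear Y) λ y → monotone (∑-linear k₀) λ m₀ → per-m₀ x y m₀) ⟩
        (∑[ x < X ] ∑[ y < Y ] ∑[ m₀ < k₀ ] (Bob.message x y m₀ + fromℕ 2 * Bob.q₀ x y m₀))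
          ≡⟨ trans (additive lin³ (λ (x , y , m₀) → Bob.message x y m₀) (λ (x , y , m₀) → fromℕ 2 * Bob.q₀ x y m₀)) (cong ((∑[ x < X ] ∑[ y < Y ] ∑[ m₀ < k₀ ] Bob.message x y m₀) +_)
               (trans (homogeneous lin³ (fromℕ 2) (λ (x , y , m₀) → Bob.q₀ x y m₀)) (trans (cong (fromℕ 2 *_) (proj₂ q-dist)) (ℝ.*-identityʳ _)))) ⟩
        (∑[ x < X ] ∑[ y < Y ] ∑[ m₀ < k₀ ] Bob.message x y m₀) + fromℕ 2 ≤⟨ +-monoˡ-≤ (fromℕ 2) (≤-trans Bob.message≤gain bob-gain) ⟩
        α₂ * I + fromℕ 2 ∎
        where
        open ≤-Reasoning
        lin³ : IsLinear {A = Fin X × Fin Y × Fin k₀} (λ g → ∑[ x < X ] ∑[ y < Y ] ∑[ m₀ < k₀ ] g (x , y , m₀))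
        lin³ = ∘-linear (∑-linear X) λ x → ∘-linear (∑-linear Y) λ y → ∑-linear k₀
        0<K = <-≤-trans 0<1 1≤K
        per-m₀ : ∀ x y m₀ → ∑[ m₁ < k₁ ] (ln K * (mass (Q (x , y , m₀ , m₁)) * 1[ Surprising K (x , y , m₀ , m₁) ])) ≤ Bob.message x y m₀ + fromℕ 2 * Bob.q₀ x y m₀
        per-m₀ x y m₀ = begin
          ∑[ m₁ < k₁ ] (ln K * (s m₁ * 1[ Surprising K (x , y , m₀ , m₁) ]))          ≤⟨ monotone (∑-linear k₁) pointwise ⟩
          ∑[ m₁ < k₁ ] ((η (s m₁) (g m₁) - s m₁ * c) + (s₀ * v m₁ + s₀ * u m₁))       ≡⟨ trans (additive (∑-linear k₁) (λ m₁ → η (s m₁) (g m₁) - s m₁ * c) (λ m₁ → s₀ * v m₁ + s₀ * u m₁))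
                                                                                           (cong₂ _+_ (trans (subtractive (∑-linear k₁) (λ m₁ → η (s m₁) (g m₁)) (λ m₁ → s m₁ * c)) (cong (λ z → sum (λ m₁ → η (s m₁) (g m₁)) - z) (trans (homogeneousʳ (∑-linear k₁) c s) (cong (_* c) (sym (Bob.q₀≡ x y m₀))))))
                                                                                             (trans (additive (∑-linear k₁) (λ m₁ → s₀ * v m₁) (λ m₁ → s₀ * u m₁)) (cong₂ _+_ (homogeneous (∑-linear k₁) s₀ v) (homogeneous (∑-linear k₁) s₀ u)))) ⟩
          Bob.message x y m₀ + (s₀ * sum v + s₀ * sum u)                              ≤⟨ +-monoʳ-≤ (Bob.message x y m₀) (+-mono-≤ (*-monoʳ-≤ 0≤s₀ (v₁-total y m₀)) (*-monoʳ-≤ 0≤s₀ (p₁-total x m₀))) ⟩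
          Bob.message x y m₀ + (s₀ * 1ℝ + s₀ * 1ℝ)                                    ≡⟨ cong (Bob.message x y m₀ +_) (solve 1 (λ s → s :* :1 :+ s :* :1 := :2 :* s) refl s₀) ⟩
          Bob.message x y m₀ + fromℕ 2 * s₀                                           ∎
          where
          s g v u : Fin k₁ → ℝ
          s m₁ = mass (Q (x , y , m₀ , m₁))
          g m₁ = mass (Bob.G (x , y , m₀ , m₁))
          v = v₁ y m₀
          u = p₁ x m₀
          s₀ = Bob.q₀ x y m₀
          c = ln s₀ - ln (Bob.g₀ x y m₀)
          0≤s₀ = Bob.0≤q₀ x y m₀
          pointwise : ∀ m₁ → ln K * (s m₁ * 1[ Surprising K (x , y , m₀ , m₁) ]) ≤ (η (s m₁) (g m₁) - s m₁ * c) + (s₀ * v m₁ + s₀ * u m₁)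
          pointwise m₁ with 0≤⇒≡⊎< (mass-nonNeg (0≤Q (x , y , m₀ , m₁)))
          ... | inj₁ s≡0 = ≤-trans (≤-reflexive (trans (cong (λ z → ln K * (z * 1[ Surprising K (x , y , m₀ , m₁) ])) s≡0) (solve 2 (λ k i → k :* (:0 :* i) := :0) refl (ln K) 1[ Surprising K (x , y , m₀ , m₁) ])))
              (≤-trans (0≤+ (0≤* 0≤s₀ (v₁-nonNeg y m₀ m₁)) (0≤* 0≤s₀ (p₁-nonNeg x m₀ m₁))) (≤-reflexive (trans (solve 1 (λ z → z := (:0 :- :0) :+ z) refl (s₀ * v m₁ + s₀ * u m₁))
                (cong (_+ (s₀ * v m₁ + s₀ * u m₁)) (cong₂ _-_ (sym (η-zero s≡0)) (sym (trans (cong (_* c) s≡0) (ℝ.zeroˡ c))))))))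
          ... | inj₂ 0<s = subst (λ z → ln K * (s m₁ * 1[ Surprising K (x , y , m₀ , m₁) ]) ≤ z + (w + w′)) (sym η≡) (go (lem {Surprising K (x , y , m₀ , m₁)}))
            where
            i = (x , y , m₀ , m₁)
            0<g : 0ℝ < g m₁
            0<g = dominated-mass (Bob.Q≪G i) 0<s
            0<s₀ : 0ℝ < s₀
            0<s₀ = <-≤-trans 0<s (≤-trans (term≤∑ (λ m₁ → mass-nonNeg (0≤Q (x , y , m₀ , m₁))) m₁) (≤-reflexive (sym (Bob.q₀≡ x y m₀))))
            0<g₀ : 0ℝ < Bob.g₀ x y m₀
            0<g₀ = <-≤-trans 0<s₀ (Bob.q₀≤g₀ x y m₀)
            v≡ : v m₁ ≡ g m₁ / Bob.g₀ x y m₀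
            v≡ = cong (_/ Bob.g₀ x y m₀) (sumAll-bits n (λ m → Ex.qʸ cheap y (m₀ ∷ m₁ ∷ m)))
            0<v : 0ℝ < v m₁
            0<v = subst (0ℝ <_) (sym v≡) (0</ 0<g 0<g₀)
            0<u : 0ℝ < u m₁
            0<u = proj₂ (*-pos⁻¹ (0≤* (0≤p[xy] x y) (proj₁ p₀-probability m₀)) (p₁-nonNeg x m₀ m₁) (let m , h = support (sumBits-linear n) (0≤Q i) 0<s in proj₁ (Q⇒W,L i m h)))
            w = s₀ * v m₁
            w′ = s₀ * u m₁
            0<w = 0<* 0<s₀ 0<v
            0<w′ = 0<* 0<s₀ 0<u
            η≡ : η (s m₁) (g m₁) - s m₁ * c ≡ η (s m₁) w
            η≡ = trans (solve 5 (λ s ls lg l0 lg0 → s :* (ls :- lg) :- s :* (l0 :- lg0) := s :* (ls :- (l0 :+ (lg :- lg0)))) refl (s m₁) (ln (s m₁)) (ln (g m₁)) (ln s₀) (ln (Bob.g₀ x y m₀)))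
              (cong (λ z → s m₁ * (ln (s m₁) - z)) (sym (trans (ln-* 0<s₀ 0<v) (cong (ln s₀ +_) (trans (cong ln v≡) (ln-/ 0<g 0<g₀))))))
            lower : ∀ {w} → 0ℝ < w → 0ℝ ≤ η (s m₁) w + w
            lower {w} 0<w = ≤-trans (<⇒≤ 0<s) (≤-cert (x≤y⇒0≤y-x (gibbs (<⇒≤ 0<s) (<⇒≤ 0<w) (λ _ → 0<w))) (solve 3 (λ e w s → e :+ w := s :+ (e :- (s :- w))) refl (η (s m₁) w) w (s m₁)))
            go : Dec (Surprising K i) → ln K * (s m₁ * 1[ Surprising K i ]) ≤ η (s m₁) w + (w + w′)
            go (no ¬b) = ≤-trans (≤-reflexive (trans (cong (λ z → ln K * (s m₁ * z)) (1[]-no ¬b)) (solve 2 (λ k s → k :* (s :* :0) := :0) refl (ln K) (s m₁))))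
              (≤-trans (0≤+ (lower 0<w) (<⇒≤ 0<w′)) (≤-reflexive (ℝ.+-assoc _ w w′)))
            go (yes b) = ≤-trans (≤-reflexive (trans (cong (λ z → ln K * (s m₁ * z)) (1[]-yes b)) (solve 2 (λ k s → k :* (s :* :1) := s :* k) refl (ln K) (s m₁))))
              (≤-trans (*-monoʳ-≤ (<⇒≤ 0<s) lnK≤) (≤-cert (0≤+ (lower 0<w′) (<⇒≤ 0<w)) (trans (solve 6 (λ s ls lw lw' w w' → s :* (ls :- lw) :+ (w :+ w') := s :* (lw' :- lw) :+ ((s :* (ls :- lw') :+ w') :+ w)) refl (s m₁) (ln (s m₁)) (ln w) (ln w′) w w′) refl)))
              where
              lnK≤ : ln K ≤ ln w′ - ln w
              lnK≤ = ≤-cert (x≤y⇒0≤y-x (subst (_≤ ln w′) (ln-* 0<K 0<w) (ln-mono-≤ (0<* 0<K 0<w) (≤-trans (≤-reflexive (solve 3 (λ k s v → k :* (s :* v) := s :* (k :* v)) refl K s₀ (v m₁))) (*-monoʳ-≤ 0≤s₀ (<⇒≤ b))))))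
                (solve 3 (λ a k w → a :- w := k :+ (a :- (k :+ w))) refl (ln w′) (ln K) (ln w))

      Ratio : ℕ → ℝ → ℝ → Set
      Ratio t a b = b ≤ a * fromℕ 2 ^ t × a ≤ b * fromℕ 2 ^ t

      -- If Q / P is large, its logarithm is the integrand of the relative entropy. If it is small,
      -- a large negative logarithm is bounded by Gibbs: -η is at most η + 2 P. The added terms 2 P
      -- have total mass 2.
      window-error : ∀ t → fromℕ t * ln2 * ∑⁴ (λ i → mass (λ m → Q i m * 1[ ¬ Ratio t (Q i m) (P i m) ])) ≤ α₂ + fromℕ 2
      window-error t = begin
        T * ∑⁴ (λ i → mass (λ m → Q i m * 1[ ¬ Ratio t (Q i m) (P i m) ]))   ≡⟨ sym (trans (congruent ∑⁴-linear λ i → homogeneous (sumBits-linear n) T (λ m → Q i m * 1[ ¬ Ratio t (Q i m) (P i m) ])) (homogeneous ∑⁴-linear T (λ i → mass (λ m → Q i m * 1[ ¬ Ratio t (Q i m) (P i m) ])))) ⟩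
        ∑⁴ (λ i → mass (λ m → T * (Q i m * 1[ ¬ Ratio t (Q i m) (P i m) ]))) ≤⟨ (monotone ∑⁴-linear λ i → monotone (sumBits-linear n) λ m → pointwise (0≤Q i m) (0≤P i m) (Q⇒P i m)) ⟩
        ∑⁴ (λ i → mass (λ m → η (Q i m) (P i m) + fromℕ 2 * P i m))          ≡⟨ trans (congruent ∑⁴-linear λ i → trans (additive (sumBits-linear n) (λ m → η (Q i m) (P i m)) (λ m → fromℕ 2 * P i m)) (cong (mass (λ m → η (Q i m) (P i m)) +_) (homogeneous (sumBits-linear n) (fromℕ 2) (P i))))
                                                                                (trans (additive ∑⁴-linear (λ i → mass (λ m → η (Q i m) (P i m))) (λ i → fromℕ 2 * mass (P i))) (cong (∑⁴ (λ i → mass (λ m → η (Q i m) (P i m))) +_) (trans (homogeneous ∑⁴-linear (fromℕ 2) (mass ∘ P)) (trans (cong (fromℕ 2 *_) (trans (sym (total³≡ p)) (proj₂ (IsProtocolDistribution.isDistribution protocol)))) (ℝ.*-identityʳ _))))) ⟩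
        ∑⁴ (λ i → mass (λ m → η (Q i m) (P i m))) + fromℕ 2                  ≤⟨ +-monoˡ-≤ (fromℕ 2) relative≤ ⟩
        α₂ + fromℕ 2                                                         ∎
        where
        open ≤-Reasoning
        T = fromℕ t * ln2
        T≡ : ln (fromℕ 2 ^ t) ≡ T
        T≡ = ln-^ t 0<2
        pointwise : ∀ {a b} → 0ℝ ≤ a → 0ℝ ≤ b → (0ℝ < a → 0ℝ < b) → T * (a * 1[ ¬ Ratio t a b ]) ≤ η a b + fromℕ 2 * b
        pointwise {a} {b} 0≤a 0≤b a⇒b with 0≤⇒≡⊎< 0≤a
        ... | inj₁ a≡0 = ≤-trans (≤-reflexive (trans (cong (λ z → T * (z * 1[ ¬ Ratio t a b ])) a≡0) (solve 2 (λ k i → k :* (:0 :* i) := :0) refl T 1[ ¬ Ratio t a b ])))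
                           (≤-trans (0≤* (<⇒≤ 0<2) 0≤b) (≤-reflexive (trans (sym (ℝ.+-identityˡ _)) (cong (_+ fromℕ 2 * b) (sym (η-zero a≡0))))))
        ... | inj₂ 0<a with lem {Ratio t a b}
        ...   | yes r = ≤-trans (≤-reflexive (trans (cong (λ z → T * (a * z)) (1[]-no λ ¬r → ¬r r)) (solve 2 (λ k a → k :* (a :* :0) := :0) refl T a)))
                          (≤-trans 0≤a (≤-cert (0≤+ 0≤b (x≤y⇒0≤y-x gibbs′)) (solve 3 (λ e b a → e :+ :2 :* b := a :+ (b :+ (e :- (a :- b)))) refl (η a b) b a)))
          where gibbs′ = gibbs 0≤a 0≤b a⇒b
        ...   | no ¬r = ≤-trans (≤-reflexive (trans (cong (λ z → T * (a * z)) (1[]-yes ¬r)) (solve 2 (λ k a → k :* (a :* :1) := a :* k) refl T a))) (cases (≤-<-⊎ b (a * fromℕ 2 ^ t)))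
          where
          0<b = a⇒b 0<a
          0<2^t = ^-pos t 0<2
          cases : b ≤ a * fromℕ 2 ^ t ⊎ a * fromℕ 2 ^ t < b → a * T ≤ η a b + fromℕ 2 * b
          cases (inj₁ p) = ≤-trans (*-monoʳ-≤ 0≤a T≤) (≤-cert (0≤* (<⇒≤ 0<2) 0≤b) refl)
            where
            T≤ : T ≤ ln a - ln b
            T≤ = ≤-cert (x≤y⇒0≤y-x (subst (_≤ ln a) (trans (ln-* 0<b 0<2^t) (cong (ln b +_) T≡)) (ln-mono-≤ (0<* 0<b 0<2^t) (<⇒≤ (≰⇒> λ q → ¬r (p , q))))))
              (solve 3 (λ a b t → a :- b := t :+ (a :- (b :+ t))) refl (ln a) (ln b) T)
          cases (inj₂ p) = ≤-trans (*-monoʳ-≤ 0≤a T≤) (≤-cert (0≤* (<⇒≤ 0<2) (0≤+ 0≤a (x≤y⇒0≤y-x (gibbs 0≤a 0≤b a⇒b))))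
              (solve 4 (λ a b la lb → a :* (la :- lb) :+ :2 :* b := a :* (lb :- la) :+ :2 :* (a :+ (a :* (la :- lb) :- (a :- b)))) refl a b (ln a) (ln b)))
            where
            T≤ : T ≤ ln b - ln a
            T≤ = ≤-cert (x≤y⇒0≤y-x (subst (_≤ ln b) (trans (ln-* 0<a 0<2^t) (cong (ln a +_) T≡)) (ln-mono-≤ (0<* 0<a 0<2^t) (<⇒≤ p))))
              (solve 3 (λ b a t → b :- a := t :+ (b :- (a :+ t))) refl (ln b) (ln a) T)

  open SimulationErrors

  -- Product randomness, random signs and the best guess

  module Dialogues where

    open Search using (Strategy)

    open IsLinear

    private variable
      A B S Tag : Set
      n : ℕ

    infixr 5 _⊗_
    _⊗_ : Expectation A → Expectation B → Expectation (A × B)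
    P ⊗ P′ = record
      { E        = λ f → E P λ a → E P′ λ b → f (a , b)
      ; linear   = ∘-linear (linear P) λ _ → linear P′
      ; total    = trans (congruent (linear P) λ _ → total P′) (total P)
      ; attained = λ f → let a , h = attained P (λ a → E P′ λ b → f (a , b)) ; b , h′ = attained P′ (λ b → f (a , b)) in (a , b) , ≤-trans h h′
      }

    ⊗-independent : ∀ (P : Expectation A) (P′ : Expectation B) (f : A → ℝ) (g : B → ℝ) → E (P ⊗ P′) (λ (a , b) → f a * g b) ≡ E P f * E P′ g
    ⊗-independent P P′ f g = trans (congruent (linear P) λ a → homogeneous (linear P′) (f a) g) (homogeneousʳ (linear P) (E P′ g) f)

    collect : ∀ {N} → (Fin N → List ℝ) → List ℝ
    collect {N} F = concatMap F (allFin N)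

    ∈-collect : ∀ {N} {F : Fin N → List ℝ} {t} i → t ∈ F i → t ∈ collect F
    ∈-collect {F = F} i t∈ = ∈-concatMap⁺ F (lose (∈-allFin i) t∈)

    collectBits : ∀ {n} → (Vec Bool n → List ℝ) → List ℝ
    collectBits {n} F = concatMap F (allBits n)

    ∈-collectBits : ∀ {n} {F : Vec Bool n → List ℝ} {t} m → t ∈ F m → t ∈ collectBits F
    ∈-collectBits {F = F} m t∈ = ∈-concatMap⁺ F (lose (∈-allBits m) t∈)

    entries : Labels n → List ℝ
    entries end        = []
    entries (node t l) = t ∷ entries (l true) ++ entries (l false)

    realisable : ∀ ts {l : Labels n} → LabelsIn Probability l → (∀ {t} → t ∈ entries l → t ∈ ts) → LabelsIn (Realisable ts) l
    realisable ts end _ = end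
    realisable ts (node {l = l} p ps) h = node (p , h (here refl)) λ where
      true  → realisable ts (ps true) (h ∘ there ∘ ∈-++⁺ˡ)
      false → realisable ts (ps false) (h ∘ there ∘ ∈-++⁺ʳ (entries (l true)))

    bounded-Fin : ∀ {N} (g : Fin N → ℕ) → ∃ λ b → ∀ i → g i ℕ.≤ b
    bounded-Fin {zero}  g = 0 , λ ()
    bounded-Fin {suc N} g = let b , h = bounded-Fin (g ∘ suc) in g zero ℕ.⊔ b , λ where
      zero    → ℕ.m≤m⊔n (g zero) b
      (suc i) → ℕ.≤-trans (h i) (ℕ.m≤n⊔m (g zero) b)

    bounded-All : ∀ {n} {ks : Vec ℕ n} (g : All Fin ks → ℕ) → ∃ λ b → ∀ m → g m ℕ.≤ b
    bounded-All {ks = []}     g = g [] , λ { [] → ℕ.≤-refl }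
    bounded-All {ks = k ∷ ks} g = let b , h = bounded-Fin (λ a → proj₁ (bounded-All λ m → g (a ∷ m))) in b , λ where
      (a ∷ m) → ℕ.≤-trans (proj₂ (bounded-All λ m → g (a ∷ m)) m) (h a)

    enlarging-exponent : ∀ a → 0ℝ ≤ a → ∃ λ N → ∀ {N′} → N ℕ.≤ N′ → 0ℝ < a → 1ℝ ≤ a * fromℕ 2 ^ N′
    enlarging-exponent a 0≤a with 0≤⇒≡⊎< 0≤a
    ... | inj₁ a≡0 = 0 , λ _ 0<a → contradiction a≡0 (0<⇒≢ 0<a)
    ... | inj₂ 0<a = let N , h = archimedean (1ℝ / a) in N , λ {N′} N≤ _ →
      ≤-trans (≤-reflexive (sym (trans (ℝ.*-comm a _) (x/y*y (0<⇒≢ 0<a))))) (*-monoʳ-≤ (<⇒≤ 0<a) (≤-trans h (≤-trans (n≤2^n N) (^-monoʳ 1≤2 N≤))))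

    magnitude : ∀ N t a → 0ℝ ≤ a → (0ℝ < a → 1ℝ ≤ a * fromℕ 2 ^ N) → ∃ λ j → Acceptance.IsMagnitude [] N t a j
    magnitude N t a 0≤a h with 0≤⇒≡⊎< 0≤a
    ... | inj₁ a≡0 = 0 , ≤-trans (≤-reflexive (trans (cong (_* fromℕ 2 ^ N) a≡0) (ℝ.zeroˡ _))) 0≤1 , λ 0<a → contradiction a≡0 (0<⇒≢ 0<a)
    ... | inj₂ 0<a = let j , p , q = doubling (a * fromℕ 2 ^ N) (h 0<a) in j , p , λ _ → q

    value : ∀ {X Y} → (Fin X → Fin Y → ℝ) → (Fin X → Fin Y → Bool) → (Fin X → Fin Y → Bool) → ℝ
    value {X} {Y} μ f g = ∑[ x < X ] ∑[ y < Y ] (μ x y * sign (g x y xor f x y))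

    -- The players xor a random sign of their tags into the output, so that in
    -- expectation only the inputs on which the tags agree contribute.
    module Signing {X Y c} (μ : Fin X → Fin Y → ℝ) (f : Fin X → Fin Y → Bool) (D : Dialogue (Fin X) (Fin Y) S c)
                   (tagᴬ : Fin X → S → Tag) (tagᴮ : Fin Y → S → Tag) (out : Fin Y → S → Bool) where

      private
        s : Fin X → Fin Y → S
        s = outcome D

        -- Listing Alice's tags is enough, because `χ-orthogonal` asks for only one of the two
        -- points.
        tags : List Tag
        tags = concatMap (λ x → List.map (λ y → tagᴬ x (s x y)) (allFin Y)) (allFin X)

        tag∈ : ∀ x y → tagᴬ x (s x y) ∈ tags
        tag∈ x y = ∈-concatMap⁺ (λ x → List.map (λ y → tagᴬ x (s x y)) (allFin Y)) (lose (∈-allFin x) (∈-map⁺ (λ y → tagᴬ x (s x y)) (∈-allFin y)))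

        Z = Vec Bool (length tags)

        -- Two bits: Alice's sign, and Bob's sign combined with hers and with his guess. The
        -- transcript thereby determines the output, although Bob's view does not appear in it.
        finish : Z → S → Tree (Fin X) (Fin Y)
        finish z σ = alice (λ x → χ tags z (tagᴬ x σ)) λ v → bob (λ y → (v xor χ tags z (tagᴮ y σ)) xor out y σ) output

        tree : Z → Tree (Fin X) (Fin Y)
        tree z = realise D (finish z)

        run≡ : ∀ z x y → run (tree z) x y ≡ (χ tags z (tagᴬ x (s x y)) xor χ tags z (tagᴮ y (s x y))) xor out y (s x y)
        run≡ z x y = run-realise D (finish z) x y

        signs = iid coin (length tags)

        mean : ∀ x y → E signs (λ z → sign (run (tree z) x y xor f x y)) ≡ 1[ tagᴬ x (s x y) ≡ tagᴮ y (s x y) ] * (sign (out y (s x y)) * sign (f x y))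
        mean x y = trans (congruent (linear signs) λ z → trans (cong (λ b → sign (b xor f x y)) (run≡ z x y)) (trans (sign-xor ((χ tags z a xor χ tags z b) xor o) (f x y)) (trans (cong (_* sign (f x y)) (sign-xor (χ tags z a xor χ tags z b) o)) (ℝ.*-assoc _ _ _))))
          (trans (homogeneousʳ (linear signs) (sign o * sign (f x y)) (λ z → sign (χ tags z a xor χ tags z b))) (cong (_* (sign o * sign (f x y))) orthogonal))
          where
          a = tagᴬ x (s x y)
          b = tagᴮ y (s x y)
          o = out y (s x y)
          orthogonal : E signs (λ z → sign (χ tags z a xor χ tags z b)) ≡ 1[ a ≡ b ]
          orthogonal with lem {a ≡ b}
          ... | no a≢b  = trans (χ-orthogonal (tag∈ x y) a≢b) (sym (1[]-no a≢b))
          ... | yes a≡b = trans (congruent (linear signs) λ z → trans (cong (λ b → sign (χ tags z a xor χ tags z b)) (sym a≡b)) (cong sign (xor-same (χ tags z a)))) (trans (total signs) (sym (1[]-yes a≡b)))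

      signed : ∃ λ t → depth t ℕ.≤ c ℕ.+ 2 ×
        (∑[ x < X ] ∑[ y < Y ] (μ x y * (1[ tagᴬ x (s x y) ≡ tagᴮ y (s x y) ] * (sign (out y (s x y)) * sign (f x y))))) ≤ value μ f (run t)
      signed = let z , h = attained signs (λ z → value μ f (run (tree z))) in
        tree z , depth-realise D (finish z) (λ _ → ℕ.≤-refl) , ≤-trans (≤-reflexive (sym average)) h
        where
        average : E signs (λ z → value μ f (run (tree z))) ≡ _
        average = trans (∑-swap (linear signs) (λ x z → ∑[ y < Y ] (μ x y * sign (run (tree z) x y xor f x y)))) (congruent (∑-linear X) λ x →
          trans (∑-swap (linear signs) (λ y z → μ x y * sign (run (tree z) x y xor f x y))) (congruent (∑-linear Y) λ y →
            trans (homogeneous (linear signs) (μ x y) (λ z → sign (run (tree z) x y xor f x y))) (cong (μ x y *_) (mean x y))))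

    module BestGuess {X Y n : ℕ} {ks : Vec ℕ n} (q : Joint X Y ks) (f : Fin X → Fin Y → Bool) (0≤q : ∀ x y m → 0ℝ ≤ q x y m) where

      open Probabilities q

      guess : All Fin ks → Bool
      guess m = decide (bias f m < 0ℝ)

      guess-bias : ∀ m → sign (guess m) * bias f m ≡ ∣ bias f m ∣
      guess-bias m with lem {bias f m < 0ℝ} | ∣∣-cases (bias f m)
      ... | yes p | inj₁ (_ , 0≤b)  = contradiction 0≤b (<⇒≱ p)
      ... | yes p | inj₂ (eq , _)   = trans (solve 1 (λ b → :- :1 :* b := :- b) refl (bias f m)) (sym eq)
      ... | no ¬p | inj₁ (eq , _)   = trans (ℝ.*-identityˡ _) (sym eq)
      ... | no ¬p | inj₂ (eq , b≤0) = trans (ℝ.*-identityˡ _) (trans (trans b≡0 (trans (sym -0#≈0#) (cong -_ (sym b≡0)))) (sym eq))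
        where b≡0 = ≤-antisym b≤0 (≮⇒≥ ¬p)

      private
        ∑² : (Fin X → Fin Y → ℝ) → ℝ
        ∑² g = ∑[ x < X ] ∑[ y < Y ] g x y

        lin : IsLinear {A = Fin X × Fin Y} (λ g → ∑² (λ x y → g (x , y)))
        lin = ∘-linear (∑-linear X) λ x → ∑-linear Y

        qm : All Fin ks → ℝ
        qm m = ∑² (λ x y → q x y m)

        qm*bias : ∀ m → qm m * bias f m ≡ ∑² (λ x y → q x y m * sign (f x y))
        qm*bias m = trans (sym (homogeneous lin (qm m) (λ (x , y) → p[xy|m] x y m * sign (f x y)))) (congruent lin λ (x , y) → trans (sym (ℝ.*-assoc _ _ _)) (cong (_* sign (f x y)) (cancel x y)))
          where
          cancel : ∀ x y → qm m * p[xy|m] x y m ≡ q x y m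
          cancel x y with lem {qm m ≡ 0ℝ}
          ... | no qm≢0 = trans (ℝ.*-comm _ _) (x/y*y qm≢0)
          ... | yes qm≡0 = trans (cong (_* p[xy|m] x y m) qm≡0) (trans (ℝ.zeroˡ _) (sym (≤-antisym (≤-trans (≤-trans (term≤∑ (λ y → 0≤q x y m) y) (term≤∑ (λ x → nonNegative (∑-linear Y) λ y → 0≤q x y m) x)) (≤-reflexive qm≡0)) (0≤q x y m))))

        swap³ : ∀ (g : Fin X → Fin Y → All Fin ks → ℝ) → ∑² (λ x y → sumAll ks (g x y)) ≡ sumAll ks (λ m → ∑² λ x y → g x y m)
        swap³ g = sumAll-swap lin ks (λ m (x , y) → g x y m)

      -- For fixed m the signed mass of f is q(m) times the bias, and the guess depends on m alone,
      -- so it can be pulled out and turns the bias into its absolute value.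
      guess-value : ∑² (λ x y → sumAll ks λ m → q x y m * (sign (guess m) * sign (f x y))) ≡ ∑² (λ x y → sumAll ks λ m → q x y m * ∣ bias f m ∣)
      guess-value = trans (swap³ (λ x y m → q x y m * (sign (guess m) * sign (f x y)))) (trans (congruent (sumAll-linear ks) per-m) (sym (swap³ (λ x y m → q x y m * ∣ bias f m ∣))))
        where
        per-m : ∀ m → ∑² (λ x y → q x y m * (sign (guess m) * sign (f x y))) ≡ ∑² (λ x y → q x y m * ∣ bias f m ∣)
        per-m m = begin
          ∑² (λ x y → q x y m * (sign (guess m) * sign (f x y))) ≡⟨ congruent lin (λ (x , y) → solve 3 (λ q g f → q :* (g :* f) := g :* (q :* f)) refl (q x y m) (sign (guess m)) (sign (f x y))) ⟩
          ∑² (λ x y → sign (guess m) * (q x y m * sign (f x y))) ≡⟨ homogeneous lin (sign (guess m)) (λ (x , y) → q x y m * sign (f x y)) ⟩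
          sign (guess m) * ∑² (λ x y → q x y m * sign (f x y))   ≡⟨ cong (sign (guess m) *_) (sym (qm*bias m)) ⟩
          sign (guess m) * (qm m * bias f m)                     ≡⟨ solve 3 (λ g q b → g :* (q :* b) := q :* (g :* b)) refl (sign (guess m)) (qm m) (bias f m) ⟩
          qm m * (sign (guess m) * bias f m)                     ≡⟨ cong (qm m *_) (guess-bias m) ⟩
          qm m * ∣ bias f m ∣                                    ≡⟨ sym (homogeneousʳ lin ∣ bias f m ∣ (λ (x , y) → q x y m)) ⟩
          ∑² (λ x y → q x y m * ∣ bias f m ∣)                    ∎
          where open ≡-Reasoning

    -- The search sees the inputs only through the strategies. Once both players have selected m₁,
    -- the search actually carried out can thus be exchanged for the one analysed with m₁ fixed in
    -- advance.
    search-outcome : ∀ {n r} (os : Vec Bool n) (sᴬ : A → Strategy n) (sᴮ : B → Strategy n) (zs : Vec (Key (allBits n) 3) r) σ a b →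
      outcome (NoisySearch.search os sᴬ sᴮ zs σ) a b ≡ outcome (NoisySearch.search {Strategy n} {Strategy n} os id id zs σ) (sᴬ a) (sᴮ b)
    search-outcome os sᴬ sᴮ []       σ a b = refl
    search-outcome os sᴬ sᴮ (z ∷ zs) σ a b = search-outcome os sᴬ sᴮ zs (Search.step (outcome (NoisySearch.test os sᴬ sᴮ z σ) a b) σ) a b

  open Dialogues

  -- The compressed conversation and the event that both views coincide

  module CompressedDialogue where

    open Search using (Strategy; State; start; flags; pathᴬ; pathᴮ)

    open IsLinear

    cap : ℝ → ℝ
    cap x with ≤-total x 1ℝ
    ... | inj₁ _ = x
    ... | inj₂ _ = 1ℝ

    cap≤ : ∀ x → cap x ≤ x
    cap≤ x with ≤-total x 1ℝ
    ... | inj₁ _ = ≤-refl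
    ... | inj₂ p = p

    cap-probability : ∀ {x} → 0ℝ ≤ x → Probability (cap x)
    cap-probability {x} p with ≤-total x 1ℝ
    ... | inj₁ q = p , q
    ... | inj₂ _ = 0≤1 , ≤-refl

    ≤cap : ∀ {x y} → y ≤ x → y ≤ 1ℝ → y ≤ cap x
    ≤cap {x} p q with ≤-total x 1ℝ
    ... | inj₁ _ = p
    ... | inj₂ _ = q

    -- Followed by a player who has selected no m₁, so that the conversation keeps its form; the tag
    -- of such a player is a failure anyway.
    blank : ∀ n → Labels n
    blank zero    = end
    blank (suc n) = node 0ℝ λ _ → blank n

    module Compression {X Y k₀ k₁ n : ℕ} (p : Joint X Y (k₀ ∷ k₁ ∷ replicate n 2)) (f : Fin X → Fin Y → Bool)
                       (protocol : IsProtocolDistribution p) (I β : ℝ) (1≤I : 1ℝ ≤ I)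
                       {q : Joint X Y (k₀ ∷ k₁ ∷ replicate n 2)}
                       (cheap : Extraction.Cheap p f (IsProtocolDistribution.isDistribution protocol) I β 1≤I q)
                       {α₂ : ℝ} (0≤α₂ : 0ℝ ≤ α₂) (β≤ : β * ln2 ≤ α₂ * I) (e s κ t r : ℕ) where

      open Errors p f protocol I β 1≤I cheap 0≤α₂ β≤ public
      open Probabilities using (p[xy]; bias)
      open BestGuess q f 0≤q

      Message : Set
      Message = All Fin (k₀ ∷ k₁ ∷ replicate n 2)

      θ K : ℝ
      θ = ½ ^ e
      K = fromℕ 2 ^ κ

      0<θ : 0ℝ < θ
      0<θ = ^-pos e 0<½

      ½≤1 : ½ ≤ 1ℝ
      ½≤1 = ≤-trans (≤-cert (<⇒≤ 0<½) refl) (≤-reflexive ½+½)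

      θ≤1 : θ ≤ 1ℝ
      θ≤1 = ≤-trans (^-monoˡ e (<⇒≤ 0<½) ½≤1) (≤-reflexive (1^ e))

      0<K : 0ℝ < K
      0<K = ^-pos κ 0<2

      A : Fin X → Message → ℝ
      A = proj₁ rectangular

      B : Fin Y → Message → ℝ
      B = proj₁ (proj₂ rectangular)

      -- Only the product μ A B is known to be nonnegative. Absolute values make both factors
      -- nonnegative and do not change the product, which is q.
      a : Fin X → Message → ℝ
      a x m = ∣ A x m ∣ / alicePart x m

      b : Fin Y → Message → ℝ
      b y m = ∣ B y m ∣ / bobPart y m

      0≤a : ∀ x m → 0ℝ ≤ a x m
      0≤a x m = 0≤/ (∣∣-nonNeg _) (alicePart-nonNeg x m)

      0≤b : ∀ y m → 0ℝ ≤ b y m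
      0≤b y m = 0≤/ (∣∣-nonNeg _) (bobPart-nonNeg y m)

      ∣∣-zero : ∀ {x} → x ≡ 0ℝ → ∣ x ∣ ≡ 0ℝ
      ∣∣-zero refl = ≤-antisym (∣∣-≤ ≤-refl (≤-reflexive -0#≈0#)) (∣∣-nonNeg 0ℝ)

      ∣∣-* : ∀ x y → ∣ x * y ∣ ≡ ∣ x ∣ * ∣ y ∣
      ∣∣-* x y = x²≡y²⇒x≡y (∣∣-nonNeg _) (0≤* (∣∣-nonNeg x) (∣∣-nonNeg y))
        (trans (square (x * y)) (trans (solve 2 (λ x y → x :* y :* (x :* y) := x :* x :* (y :* y)) refl x y) (trans (cong₂ _*_ (sym (square x)) (sym (square y))) (solve 2 (λ x y → x :* x :* (y :* y) := x :* y :* (x :* y)) refl (∣ x ∣) (∣ y ∣)))))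
        where
        square : ∀ z → ∣ z ∣ * ∣ z ∣ ≡ z * z
        square z with ∣∣-cases z
        ... | inj₁ (eq , _) = cong₂ _*_ eq eq
        ... | inj₂ (eq , _) = trans (cong₂ _*_ eq eq) (solve 1 (λ z → :- z :* :- z := z :* z) refl z)

      ratio-product : ∀ x y m → 0ℝ < p x y m → p x y m * (a x m * b y m) ≡ q x y m
      ratio-product x y m 0<p = begin
        p x y m * (a x m * b y m)                   ≡⟨ cong (_* (a x m * b y m)) (p-parts x y m) ⟩
        p[xy] p x y * α * γ * (∣ A x m ∣ / α * (∣ B y m ∣ / γ)) ≡⟨ solve 7 (λ m α γ A α' B γ' → m :* α :* γ :* (A :* α' :* (B :* γ')) := m :* (A :* α' :* α) :* (B :* γ' :* γ)) refl (p[xy] p x y) α γ (∣ A x m ∣) (α ⁻¹) (∣ B y m ∣) (γ ⁻¹) ⟩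
        p[xy] p x y * (∣ A x m ∣ / α * α) * (∣ B y m ∣ / γ * γ) ≡⟨ cong₂ (λ u v → p[xy] p x y * u * v) (x/y*y (0<⇒≢ 0<α)) (x/y*y (0<⇒≢ 0<γ)) ⟩
        p[xy] p x y * ∣ A x m ∣ * ∣ B y m ∣          ≡⟨ trans (ℝ.*-assoc _ _ _) (cong₂ _*_ (sym ∣μ∣) (sym (∣∣-* (A x m) (B y m)))) ⟩
        ∣ p[xy] p x y ∣ * ∣ A x m * B y m ∣          ≡⟨ trans (sym (∣∣-* _ _)) (cong ∣_∣ (sym (trans (proj₂ (proj₂ rectangular) x y m) (ℝ.*-assoc _ _ _)))) ⟩
        ∣ q x y m ∣                                  ≡⟨ ∣∣-nonNeg≡ (0≤q x y m) ⟩
        q x y m                                      ∎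
        where
        open ≡-Reasoning
        α = alicePart x m
        γ = bobPart y m
        ∣∣-nonNeg≡ : ∀ {z} → 0ℝ ≤ z → ∣ z ∣ ≡ z
        ∣∣-nonNeg≡ {z} 0≤z = ≤-antisym (∣∣-≤ ≤-refl (≤-trans (≤-trans (neg-mono-≤ 0≤z) (≤-reflexive -0#≈0#)) 0≤z)) (x≤∣x∣ z)
        ∣μ∣ = ∣∣-nonNeg≡ (0≤p[xy] x y)
        split : 0ℝ < p[xy] p x y * α × 0ℝ < γ
        split = *-pos⁻¹ (0≤* (0≤p[xy] x y) (alicePart-nonNeg x m)) (bobPart-nonNeg y m) (subst (0ℝ <_) (p-parts x y m) 0<p)
        0<γ = proj₂ split
        0<α = proj₂ (*-pos⁻¹ (0≤p[xy] x y) (alicePart-nonNeg x m) (proj₁ split))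

      -- Outside the support of q nothing may be accepted. There p may vanish while the simulated
      -- law does not, so this case of `WLab≡Q` cannot be reduced to `p-law` and uses the
      -- rectangular form of q itself.
      ratio-null : ∀ x y m → q x y m ≡ 0ℝ → p[xy] p x y ≡ 0ℝ ⊎ a x m * b y m ≡ 0ℝ
      ratio-null x y m q≡0 with x*y≡0 (trans (sym (proj₂ (proj₂ rectangular) x y m)) q≡0)
      ... | inj₂ B≡0 = inj₂ (trans (cong (λ z → a x m * (z / bobPart y m)) (∣∣-zero B≡0)) (trans (cong (a x m *_) 0/x) (ℝ.zeroʳ _)))
      ... | inj₁ μA≡0 with x*y≡0 μA≡0
      ...   | inj₁ μ≡0 = inj₁ μ≡0
      ...   | inj₂ A≡0 = inj₂ (trans (cong (λ z → z / alicePart x m * b y m) (∣∣-zero A≡0)) (trans (cong (_* b y m) 0/x) (ℝ.zeroˡ _)))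

      private
        Nᵃ : ∃ λ N → ∀ x m → proj₁ (enlarging-exponent (a x m) (0≤a x m)) ℕ.≤ N
        Nᵃ = let N , h = bounded-Fin (λ x → proj₁ (bounded-All λ m → proj₁ (enlarging-exponent (a x m) (0≤a x m)))) in
          N , λ x m → ℕ.≤-trans (proj₂ (bounded-All λ m → proj₁ (enlarging-exponent (a x m) (0≤a x m))) m) (h x)

        Nᵇ : ∃ λ N → ∀ y m → proj₁ (enlarging-exponent (b y m) (0≤b y m)) ℕ.≤ N
        Nᵇ = let N , h = bounded-Fin (λ y → proj₁ (bounded-All λ m → proj₁ (enlarging-exponent (b y m) (0≤b y m)))) in
          N , λ y m → ℕ.≤-trans (proj₂ (bounded-All λ m → proj₁ (enlarging-exponent (b y m) (0≤b y m))) m) (h y)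

      opaque
        N : ℕ
        N = proj₁ Nᵃ ℕ.⊔ proj₁ Nᵇ

        magnitudeᵃ : ∀ x m → ∃ λ j → Acceptance.IsMagnitude [] N t (a x m) j
        magnitudeᵃ x m = magnitude N t (a x m) (0≤a x m) (proj₂ (enlarging-exponent (a x m) (0≤a x m)) (ℕ.≤-trans (proj₂ Nᵃ x m) (ℕ.m≤m⊔n (proj₁ Nᵃ) (proj₁ Nᵇ))))

        magnitudeᵇ : ∀ y m → ∃ λ j → Acceptance.IsMagnitude [] N t (b y m) j
        magnitudeᵇ y m = magnitude N t (b y m) (0≤b y m) (proj₂ (enlarging-exponent (b y m) (0≤b y m)) (ℕ.≤-trans (proj₂ Nᵇ y m) (ℕ.m≤n⊔m (proj₁ Nᵃ) (proj₁ Nᵇ))))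

      jᵃ : Fin X → Message → ℕ
      jᵃ x m = proj₁ (magnitudeᵃ x m)

      jᵇ : Fin Y → Message → ℕ
      jᵇ y m = proj₁ (magnitudeᵇ y m)

      window : ℕ
      window = Acceptance.window [] N t

      rate : ℝ
      rate = Acceptance.rate [] N t

      0<rate : 0ℝ < rate
      0<rate = Acceptance.0<rate [] N t

      acceptᵃ : Fin X → Message → ℝ
      acceptᵃ x m = Acceptance.thresholdᴬ [] N t (a x m) (jᵃ x m)

      acceptᵇ : Fin Y → Message → Fin (suc window) → ℝ
      acceptᵇ y m d = Acceptance.thresholdᴮ [] N t (b y m) (jᵇ y m) (toℕ d)

      -- With the factor θ Alice expects at most θ further messages below her threshold, so that the
      -- selected one is mostly unique; the price is the factor θ in the rate `c`.
      nameᵃ : Fin X → Fin k₀ → Fin k₁ → ℝ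
      nameᵃ x m₀ m₁ = θ * p₁ x m₀ m₁

      -- The factor K lifts Bob's threshold above Alice's unless m₁ is surprising. He then expects
      -- up to K candidates, which the hash sorts out, as K times 2 ^ -s is at most θ.
      nameᵇ : Fin Y → Fin k₀ → Fin k₁ → ℝ
      nameᵇ y m₀ m₁ = cap (K * v₁ y m₀ m₁)

      thresholdsᵃ : Fin X → Fin k₀ → Fin k₁ → List ℝ
      thresholdsᵃ x m₀ m₁ = nameᵃ x m₀ m₁ ∷ entries (labelsᵃ x m₀ m₁) ++ collectBits λ m → acceptᵃ x (m₀ ∷ m₁ ∷ encode m) ∷ []

      thresholdsᵇ : Fin Y → Fin k₀ → Fin k₁ → List ℝ
      thresholdsᵇ y m₀ m₁ = nameᵇ y m₀ m₁ ∷ entries (labelsᵇ y m₀ m₁) ++ collectBits λ m → collect λ d → acceptᵇ y (m₀ ∷ m₁ ∷ encode m) d ∷ []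

      opaque
        -- Every threshold that any input can call for, so that one finite distribution can serve as
        -- shared randomness before the inputs are known.
        ts : List ℝ
        ts = collect (λ x → collect λ m₀ → collect λ m₁ → thresholdsᵃ x m₀ m₁) ++ collect (λ y → collect λ m₀ → collect λ m₁ → thresholdsᵇ y m₀ m₁)

        ∈ᵃ : ∀ x m₀ m₁ {z} → z ∈ thresholdsᵃ x m₀ m₁ → z ∈ ts
        ∈ᵃ x m₀ m₁ z∈ = ∈-++⁺ˡ (∈-collect x (∈-collect m₀ (∈-collect m₁ z∈)))

        ∈ᵇ : ∀ y m₀ m₁ {z} → z ∈ thresholdsᵇ y m₀ m₁ → z ∈ ts
        ∈ᵇ y m₀ m₁ z∈ = ∈-++⁺ʳ (collect (λ x → collect λ m₀ → collect λ m₁ → thresholdsᵃ x m₀ m₁)) (∈-collect y (∈-collect m₀ (∈-collect m₁ z∈)))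

      acceptᵃ∈ : ∀ x m₀ m₁ m → acceptᵃ x (m₀ ∷ m₁ ∷ encode m) ∈ ts
      acceptᵃ∈ x m₀ m₁ m = ∈ᵃ x m₀ m₁ (there (∈-++⁺ʳ (entries (labelsᵃ x m₀ m₁)) (∈-collectBits m (here refl))))

      acceptᵇ∈ : ∀ y m₀ m₁ m d → acceptᵇ y (m₀ ∷ m₁ ∷ encode m) d ∈ ts
      acceptᵇ∈ y m₀ m₁ m d = ∈ᵇ y m₀ m₁ (there (∈-++⁺ʳ (entries (labelsᵇ y m₀ m₁)) (∈-collectBits m (∈-collect {F = λ d → acceptᵇ y (m₀ ∷ m₁ ∷ encode m) d ∷ []} d (here refl)))))

      p₁≤1 : ∀ x m₀ m₁ → p₁ x m₀ m₁ ≤ 1ℝ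
      p₁≤1 x m₀ m₁ = ≤-trans (term≤∑ (p₁-nonNeg x m₀) m₁) (p₁-total x m₀)

      nameᵃ∈ : ∀ x m₀ m₁ → Realisable ts (nameᵃ x m₀ m₁)
      nameᵃ∈ x m₀ m₁ = (0≤* (<⇒≤ 0<θ) (p₁-nonNeg x m₀ m₁) , ≤-trans (*-mono-≤ (<⇒≤ 0<θ) 0≤1 θ≤1 (p₁≤1 x m₀ m₁)) (≤-reflexive (ℝ.*-identityˡ 1ℝ))) , ∈ᵃ x m₀ m₁ (here refl)

      nameᵇ∈ : ∀ y m₀ m₁ → Realisable ts (nameᵇ y m₀ m₁)
      nameᵇ∈ y m₀ m₁ = cap-probability (0≤* (<⇒≤ 0<K) (v₁-nonNeg y m₀ m₁)) , ∈ᵇ y m₀ m₁ (here refl)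

      realisableᵃ : ∀ x m₀ m₁ → LabelsIn (Realisable ts) (labelsᵃ x m₀ m₁)
      realisableᵃ x m₀ m₁ = realisable ts (labelsᵃ∈ x m₀ m₁) (∈ᵃ x m₀ m₁ ∘ there ∘ ∈-++⁺ˡ)

      realisableᵇ : ∀ y m₀ m₁ → LabelsIn (Realisable ts) (labelsᵇ y m₀ m₁)
      realisableᵇ y m₀ m₁ = realisable ts (labelsᵇ∈ y m₀ m₁) (∈ᵇ y m₀ m₁ ∘ there ∘ ∈-++⁺ˡ)

      module Nam = Naming ts k₁ s
      module Acc = Acceptance ts N t
      module Sim (x : Fin X) (y : Fin Y) (m₀ : Fin k₀) (m₁ : Fin k₁) =
        Simulation ts owners (λ us x → strategy us (labelsᵃ x m₀ m₁)) (λ us y → strategy us (labelsᵇ y m₀ m₁)) x y (λ _ → refl) (λ _ → refl) (realisableᵃ x m₀ m₁) (realisableᵇ y m₀ m₁) r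

      Seeds : Set
      Seeds = Vec (Key (allBits n) 3) r

      Ω₁ Ω₂ Ω₃ Ω : Set
      Ω₁ = Vec ℝ k₁ × Key (allFin k₁) s
      Ω₂ = Vec ℝ n × Seeds
      Ω₃ = Fin (suc window) × ℝ × ℝ
      Ω  = Ω₁ × Ω₂ × Ω₃

      P₁ : Expectation Ω₁
      P₁ = Nam.heights ⊗ Nam.hashKeys

      P₂ : Expectation Ω₂
      P₂ = Pⁿ ts n ⊗ iid (keys (allBits n) 3) r

      P₃ : Expectation Ω₃
      P₃ = uniform window ⊗ threshold ts ⊗ threshold ts

      Pω : Expectation Ω
      Pω = P₁ ⊗ P₂ ⊗ P₃

      S : Set
      S = Vec Bool s × State n

      -- Two layers of failure: `nothing` is Alice's and `just nothing` is Bob's, so that two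
      -- failures do not agree with each other either.
      Tag : Set
      Tag = Maybe (Maybe (Fin k₁ × Vec Bool n × ℕ))

      module Round (m₀ : Fin k₀) (ω : Ω) where

        hs = proj₁ (proj₁ ω)
        zs = proj₂ (proj₁ ω)
        us = proj₁ (proj₁ (proj₂ ω))
        ss = proj₂ (proj₁ (proj₂ ω))
        d  = proj₁ (proj₂ (proj₂ ω))
        hᵃ = proj₁ (proj₂ (proj₂ (proj₂ ω)))
        hᵇ = proj₂ (proj₂ (proj₂ (proj₂ ω)))

        selectᵃ : Fin X → Maybe (Fin k₁)
        selectᵃ x = Nam.alice-selects (nameᵃ x m₀) hs

        selectᵇ : Vec Bool s → Fin Y → Maybe (Fin k₁)
        selectᵇ v y = Nam.bob-selects (nameᵇ y m₀) hs zs v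

        strategyᵃ : Fin X → Maybe (Fin k₁) → Strategy n
        strategyᵃ x = maybe′ (λ u → strategy us (labelsᵃ x m₀ u)) (strategy us (blank n))

        strategyᵇ : Fin Y → Maybe (Fin k₁) → Strategy n
        strategyᵇ y = maybe′ (λ u → strategy us (labelsᵇ y m₀ u)) (strategy us (blank n))

        dialogue : Dialogue (Fin X) (Fin Y) S (s ℕ.+ (r ℕ.* 4 ℕ.+ 0))
        dialogue = aliceSends (λ x → Nam.name zs (selectᵃ x)) >>= λ v →
          (NoisySearch.search owners (λ x → strategyᵃ x (selectᵃ x)) (λ y → strategyᵇ y (selectᵇ v y)) ss (start n) >>= λ σ → return (v , σ))

        acceptTagᵃ : Fin X → Fin k₁ → Vec Bool n → Tag
        acceptTagᵃ x u m = if decide (hᵃ < acceptᵃ x (m₀ ∷ u ∷ encode m)) then just (just (u , m , jᵃ x (m₀ ∷ u ∷ encode m))) else nothing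

        -- The second condition keeps the subtraction in the tag from being truncated; without
        -- truncation equal tags mean an exact match of the magnitudes.
        Acceptsᵇ : Fin Y → Fin k₁ → Vec Bool n → Set
        Acceptsᵇ y u m = hᵇ < acceptᵇ y (m₀ ∷ u ∷ encode m) d × jᵇ y (m₀ ∷ u ∷ encode m) ℕ.+ t ℕ.≤ 2 ℕ.* N ℕ.+ toℕ d

        -- Bob's guess d determines the magnitude that Alice's factor must have. Placing it in the
        -- tag tests the guess without any communication.
        acceptTagᵇ : Fin Y → Fin k₁ → Vec Bool n → Tag
        acceptTagᵇ y u m = if decide (Acceptsᵇ y u m) then just (just (u , m , (2 ℕ.* N ℕ.+ toℕ d) ℕ.∸ (jᵇ y (m₀ ∷ u ∷ encode m) ℕ.+ t))) else just nothing

        historyᵃ : Fin X → Fin k₁ → State n → Vec Bool n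
        historyᵃ x u σ = pathᴬ owners (strategy us (labelsᵃ x m₀ u)) (flags σ)

        historyᵇ : Fin Y → Fin k₁ → State n → Vec Bool n
        historyᵇ y u σ = pathᴮ owners (strategy us (labelsᵇ y m₀ u)) (flags σ)

        tagᵃ : Fin X → Maybe (Fin k₁) → State n → Tag
        tagᵃ x u? σ = maybe′ (λ u → acceptTagᵃ x u (historyᵃ x u σ)) nothing u?

        tagᵇ : Fin Y → Maybe (Fin k₁) → State n → Tag
        tagᵇ y u? σ = maybe′ (λ u → acceptTagᵇ y u (historyᵇ y u σ)) (just nothing) u?

        outᵇ : Fin Y → Maybe (Fin k₁) → State n → Bool
        outᵇ y u? σ = maybe′ (λ u → guess (m₀ ∷ u ∷ encode (historyᵇ y u σ))) false u?

        module At (x : Fin X) (y : Fin Y) where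

          u?ᵃ u?ᵇ : Maybe (Fin k₁)
          u?ᵃ = selectᵃ x
          u?ᵇ = selectᵇ (Nam.name zs u?ᵃ) y

          σ : State n
          σ = proj₂ (outcome dialogue x y)

          σ≡ : ∀ {m₁} → u?ᵃ ≡ just m₁ → u?ᵇ ≡ just m₁ → σ ≡ Sim.final x y m₀ m₁ us ss
          σ≡ {m₁} p q = trans (search-outcome owners (λ x → strategyᵃ x (selectᵃ x)) (λ y → strategyᵇ y (selectᵇ (Nam.name zs u?ᵃ) y)) ss (start n) x y)
            (trans (cong₂ (outcome (NoisySearch.search {Strategy n} {Strategy n} owners id id ss (start n))) (cong (strategyᵃ x) p) (cong (strategyᵇ y) q))
              (sym (search-outcome owners (λ x → strategy us (labelsᵃ x m₀ m₁)) (λ y → strategy us (labelsᵇ y m₀ m₁)) ss (start n) x y)))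

          Accepted : Fin k₁ → Vec Bool n → Set
          Accepted m₁ m = jᵃ x (m₀ ∷ m₁ ∷ encode m) ℕ.+ (jᵇ y (m₀ ∷ m₁ ∷ encode m) ℕ.+ t) ≡ 2 ℕ.* N ℕ.+ toℕ d ×
                          hᵃ < acceptᵃ x (m₀ ∷ m₁ ∷ encode m) × hᵇ < acceptᵇ y (m₀ ∷ m₁ ∷ encode m) d

          Event : Fin k₁ → Vec Bool n → Set
          Event m₁ m = Nam.Both (nameᵃ x m₀) (nameᵇ y m₀) m₁ hs zs × Sim.Agree x y m₀ m₁ m us ss × Accepted m₁ m

          tag : Fin k₁ → Vec Bool n → Tag
          tag m₁ m = just (just (m₁ , m , jᵃ x (m₀ ∷ m₁ ∷ encode m)))

          event⇒tags : ∀ {m₁ m} → Event m₁ m → tagᵃ x u?ᵃ σ ≡ tag m₁ m × tagᵇ y u?ᵇ σ ≡ tag m₁ m × outᵇ y u?ᵇ σ ≡ guess (m₀ ∷ m₁ ∷ encode m)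
          event⇒tags {m₁} {m} ((pᵃ , pᵇ) , (hisᵃ , hisᵇ) , (j≡ , acᵃ , acᵇ)) =
            trans (cong₂ (tagᵃ x) pᵃ (σ≡ pᵃ pᵇ)) (trans (cong (acceptTagᵃ x m₁) hisᵃ) (cong (λ c → if c then tag m₁ m else nothing) (decide-yes acᵃ))) ,
            trans (cong₂ (tagᵇ y) pᵇ (σ≡ pᵃ pᵇ)) (trans (cong (acceptTagᵇ y m₁) hisᵇ) (trans (cong (λ c → if c then just (just (m₁ , m , (2 ℕ.* N ℕ.+ toℕ d) ℕ.∸ (jᵇ y ms ℕ.+ t))) else just nothing) (decide-yes (acᵇ , le))) (cong (λ j → just (just (m₁ , m , j))) (trans (cong (ℕ._∸ (jᵇ y ms ℕ.+ t)) (sym j≡)) (ℕ.m+n∸n≡m (jᵃ x ms) (jᵇ y ms ℕ.+ t)))))) ,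
            trans (cong₂ (outᵇ y) pᵇ (σ≡ pᵃ pᵇ)) (cong (λ h → guess (m₀ ∷ m₁ ∷ encode h)) hisᵇ)
            where
            ms = m₀ ∷ m₁ ∷ encode m
            le : jᵇ y ms ℕ.+ t ℕ.≤ 2 ℕ.* N ℕ.+ toℕ d
            le = ℕ.≤-trans (ℕ.m≤n+m _ (jᵃ x ms)) (ℕ.≤-reflexive j≡)

          formᵃ : ∀ u? → tagᵃ x u? σ ≡ nothing ⊎ ∃ λ u → u? ≡ just u × tagᵃ x u? σ ≡ tag u (historyᵃ x u σ) × hᵃ < acceptᵃ x (m₀ ∷ u ∷ encode (historyᵃ x u σ))
          formᵃ nothing  = inj₁ refl
          formᵃ (just u) = case if-decide (hᵃ < acceptᵃ x (m₀ ∷ u ∷ encode (historyᵃ x u σ))) (λ c → if c then tag u (historyᵃ x u σ) else nothing) of λ where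
            (inj₁ (h , eq)) → inj₂ (u , refl , eq , h)
            (inj₂ (_ , eq)) → inj₁ eq

          formᵇ : ∀ u? → tagᵇ y u? σ ≡ just nothing ⊎ ∃ λ u → u? ≡ just u × Acceptsᵇ y u (historyᵇ y u σ) ×
                  tagᵇ y u? σ ≡ just (just (u , historyᵇ y u σ , (2 ℕ.* N ℕ.+ toℕ d) ℕ.∸ (jᵇ y (m₀ ∷ u ∷ encode (historyᵇ y u σ)) ℕ.+ t)))
          formᵇ nothing  = inj₁ refl
          formᵇ (just u) = case if-decide (Acceptsᵇ y u (historyᵇ y u σ)) (λ c → if c then just (just (u , historyᵇ y u σ , (2 ℕ.* N ℕ.+ toℕ d) ℕ.∸ (jᵇ y (m₀ ∷ u ∷ encode (historyᵇ y u σ)) ℕ.+ t))) else just nothing) of λ where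
            (inj₁ (h , eq)) → inj₂ (u , refl , h , eq)
            (inj₂ (_ , eq)) → inj₁ eq

          tags⇒event : tagᵃ x u?ᵃ σ ≡ tagᵇ y u?ᵇ σ → ∃ λ m₁ → ∃ λ m → Event m₁ m
          tags⇒event eq = go (formᵃ u?ᵃ) (formᵇ u?ᵇ)
            where
            conclude : ∀ {u u′} → u ≡ u′ → u?ᵃ ≡ just u → u?ᵇ ≡ just u′ → hᵃ < acceptᵃ x (m₀ ∷ u ∷ encode (historyᵃ x u σ)) → Acceptsᵇ y u′ (historyᵇ y u′ σ) →
              historyᵃ x u σ ≡ historyᵇ y u′ σ →
              jᵃ x (m₀ ∷ u ∷ encode (historyᵃ x u σ)) ≡ (2 ℕ.* N ℕ.+ toℕ d) ℕ.∸ (jᵇ y (m₀ ∷ u′ ∷ encode (historyᵇ y u′ σ)) ℕ.+ t) →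
              ∃ λ m₁ → ∃ λ m → Event m₁ m
            conclude {u} refl pᵃ pᵇ acᵃ (acᵇ , le) his≡ j≡ = u , historyᵃ x u σ , (pᵃ , pᵇ) ,
              (cong (historyᵃ x u) (sym (σ≡ pᵃ pᵇ)) , trans (cong (historyᵇ y u) (sym (σ≡ pᵃ pᵇ))) (sym his≡)) ,
              (trans (cong (λ h → jᵃ x (m₀ ∷ u ∷ encode (historyᵃ x u σ)) ℕ.+ (jᵇ y (m₀ ∷ u ∷ encode h) ℕ.+ t)) his≡)
                (trans (cong (ℕ._+ (jᵇ y (m₀ ∷ u ∷ encode (historyᵇ y u σ)) ℕ.+ t)) j≡) (ℕ.m∸n+n≡m le))) ,
              acᵃ , subst (λ h → hᵇ < acceptᵇ y (m₀ ∷ u ∷ encode h) d) (sym his≡) acᵇ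
            go : _ → _ → ∃ λ m₁ → ∃ λ m → Event m₁ m
            go (inj₁ eᵃ) (inj₁ eᵇ) = case trans (sym eᵃ) (trans eq eᵇ) of λ ()
            go (inj₁ eᵃ) (inj₂ (_ , _ , _ , eᵇ)) = case trans (sym eᵃ) (trans eq eᵇ) of λ ()
            go (inj₂ (_ , _ , eᵃ , _)) (inj₁ eᵇ) = case trans (sym eᵃ) (trans eq eᵇ) of λ ()
            go (inj₂ (u , pᵃ , eᵃ , acᵃ)) (inj₂ (u′ , pᵇ , acᵇ , eᵇ)) =
              let eq′ = just-injective (just-injective (trans (sym eᵃ) (trans eq eᵇ))) in
              conclude (cong proj₁ eq′) pᵃ pᵇ acᵃ acᵇ (cong (proj₁ ∘ proj₂) eq′) (cong (proj₂ ∘ proj₂) eq′)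

          -- The common tag determines m₁ and the history, so the events are disjoint, and the tags
          -- agree exactly on their union.
          contribution : ∀ c → 1[ tagᵃ x u?ᵃ σ ≡ tagᵇ y u?ᵇ σ ] * (sign (outᵇ y u?ᵇ σ) * c) ≡ ∑[ m₁ < k₁ ] mass (λ m → 1[ Event m₁ m ] * (sign (guess (m₀ ∷ m₁ ∷ encode m)) * c))
          contribution c = go lem
            where
            G : Fin k₁ → Vec Bool n → ℝ
            G m₁ m = sign (guess (m₀ ∷ m₁ ∷ encode m)) * c
            go : Dec (tagᵃ x u?ᵃ σ ≡ tagᵇ y u?ᵇ σ) → 1[ tagᵃ x u?ᵃ σ ≡ tagᵇ y u?ᵇ σ ] * (sign (outᵇ y u?ᵇ σ) * c) ≡ ∑[ m₁ < k₁ ] mass (λ m → 1[ Event m₁ m ] * G m₁ m)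
            go (no ¬eq) = trans (cong (_* (sign (outᵇ y u?ᵇ σ) * c)) (1[]-no ¬eq)) (trans (ℝ.zeroˡ _) (sym (∑-zero {k₁} λ m₁ →
              trans (congruent (sumBits-linear n) λ m → trans (cong (_* G m₁ m) (1[]-no λ ev → ¬eq (trans (proj₁ (event⇒tags ev)) (sym (proj₁ (proj₂ (event⇒tags ev))))))) (ℝ.zeroˡ _)) (null (sumBits-linear n)))))
            go (yes eq) = found (tags⇒event eq)
              where
              found : (∃ λ m₁ → ∃ λ m → Event m₁ m) → 1[ tagᵃ x u?ᵃ σ ≡ tagᵇ y u?ᵇ σ ] * (sign (outᵇ y u?ᵇ σ) * c) ≡ ∑[ m₁ < k₁ ] mass (λ m → 1[ Event m₁ m ] * G m₁ m)
              found (u , h , ev) = trans (trans (cong (_* (sign (outᵇ y u?ᵇ σ) * c)) (1[]-yes eq)) (trans (ℝ.*-identityˡ _) (cong (λ o → sign o * c) (proj₂ (proj₂ (event⇒tags ev))))))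
                  (sym (trans (congruent (∑-linear k₁) λ m₁ → trans (congruent (sumBits-linear n) λ m → trans (cong (_* G m₁ m) (single m₁ m)) (ℝ.*-assoc _ _ _))
                       (trans (homogeneous (sumBits-linear n) 1[ m₁ ≡ u ] (λ m → 1[ m ≡ h ] * G m₁ m)) (cong (1[ m₁ ≡ u ] *_) (sumBits-indicator h (G m₁)))))
                     (∑-indicator u (λ m₁ → G m₁ h))))
                where
                single : ∀ m₁ m → 1[ Event m₁ m ] ≡ 1[ m₁ ≡ u ] * 1[ m ≡ h ]
                single m₁ m = trans (1[]-cong (λ ev′ → let eq = just-injective (just-injective (trans (sym (proj₁ (event⇒tags ev′))) (proj₁ (event⇒tags ev)))) in cong proj₁ eq , cong (proj₁ ∘ proj₂) eq)
                  (λ { (refl , refl) → ev })) (1[]-× (m₁ ≡ u) (m ≡ h))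

  open CompressedDialogue

  -- The advantage of the compressed conversation

  module CompressedAdvantage where

    open IsLinear

    E-finite : ∀ {n} (ρ : Fin n → ℝ) (h : IsProbability ρ) f → E (finite ρ h) f ≡ ∑[ i < n ] (ρ i * f i)
    E-finite {zero}  ρ (_ , h) f = contradiction (sym h) 1≢0
    E-finite {suc n} ρ h       f = refl

    sign≤1 : ∀ c → sign c ≤ 1ℝ
    sign≤1 true  = ≤-cert (0≤+ 0≤1 0≤1) (solve 0 (:1 := :- :1 :+ (:1 :+ :1)) refl)
    sign≤1 false = ≤-refl

    module CompressionBound
      {X Y k₀ k₁ n : ℕ} (p : Joint X Y (k₀ ∷ k₁ ∷ replicate n 2)) (f : Fin X → Fin Y → Bool)
      (protocol : IsProtocolDistribution p) (I β : ℝ) (1≤I : 1ℝ ≤ I)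
      {q : Joint X Y (k₀ ∷ k₁ ∷ replicate n 2)}
      (cheap : Extraction.Cheap p f (IsProtocolDistribution.isDistribution protocol) I β 1≤I q)
      {α₂ : ℝ} (0≤α₂ : 0ℝ ≤ α₂) (β≤ : β * ln2 ≤ α₂ * I) (e s κ t r : ℕ) where

      open Compression p f protocol I β 1≤I cheap 0≤α₂ β≤ e s κ t r
      open Probabilities using (p[xy]; bias)
      open BestGuess q f 0≤q using (guess; guess-value)

      message : Node → Vec Bool n → Message
      message (x , y , m₀ , m₁) m = m₀ ∷ m₁ ∷ encode m

      ab : Node → Vec Bool n → ℝ
      ab (x , y , m₀ , m₁) m = a x (m₀ ∷ m₁ ∷ encode m) * b y (m₀ ∷ m₁ ∷ encode m)

      0≤ab : ∀ i m → 0ℝ ≤ ab i m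
      0≤ab (x , y , m₀ , m₁) m = 0≤* (0≤a x _) (0≤b y _)

      both agreed accepted : Node → Vec Bool n → ℝ
      both (x , y , m₀ , m₁) m = Nam.both (nameᵃ x m₀) (nameᵇ y m₀) (nameᵃ∈ x m₀) (nameᵇ∈ y m₀) m₁
      agreed (x , y , m₀ , m₁) m = Sim.agreement x y m₀ m₁ m
      accepted (x , y , m₀ , m₁) m = Acc.accept (jᵃ x M′) (jᵇ y M′) (0≤a x M′) (0≤b y M′) (proj₂ (magnitudeᵃ x M′)) (proj₂ (magnitudeᵇ y M′)) (acceptᵃ∈ x m₀ m₁ m) (acceptᵇ∈ y m₀ m₁ m)
        where M′ = m₀ ∷ m₁ ∷ encode m

      Event : Node → Vec Bool n → Ω → Set
      Event (x , y , m₀ , m₁) m ω = Round.At.Event m₀ ω x y m₁ m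

      -- Naming, history and acceptance draw on independent parts of the randomness, and each
      -- condition refers to the fixed m₁ and m rather than to the outcome of the others.
      event-probability : ∀ i m → E Pω (λ ω → 1[ Event i m ω ]) ≡ both i m * (agreed i m * accepted i m)
      event-probability (x , y , m₀ , m₁) m = trans (congruent (linear Pω) λ ω → trans (1[]-× (F₁ (proj₁ ω)) (F₂ (proj₁ (proj₂ ω)) × F₃ (proj₂ (proj₂ ω)))) (cong (1[ F₁ (proj₁ ω) ] *_) (1[]-× (F₂ (proj₁ (proj₂ ω))) (F₃ (proj₂ (proj₂ ω))))))
        (trans (⊗-independent P₁ (P₂ ⊗ P₃) (λ ω₁ → 1[ F₁ ω₁ ]) (λ (ω₂ , ω₃) → 1[ F₂ ω₂ ] * 1[ F₃ ω₃ ]))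
          (cong (E P₁ (λ ω₁ → 1[ F₁ ω₁ ]) *_) (⊗-independent P₂ P₃ (λ ω₂ → 1[ F₂ ω₂ ]) (λ ω₃ → 1[ F₃ ω₃ ]))))
        where
        F₁ : Ω₁ → Set
        F₁ (hs , zs) = Nam.Both (nameᵃ x m₀) (nameᵇ y m₀) m₁ hs zs
        F₂ : Ω₂ → Set
        F₂ (us , ss) = Sim.Agree x y m₀ m₁ m us ss
        F₃ : Ω₃ → Set
        F₃ (d , hᵃ , hᵇ) = jᵃ x (m₀ ∷ m₁ ∷ encode m) ℕ.+ (jᵇ y (m₀ ∷ m₁ ∷ encode m) ℕ.+ t) ≡ 2 ℕ.* N ℕ.+ toℕ d ×
                           hᵃ < acceptᵃ x (m₀ ∷ m₁ ∷ encode m) × hᵇ < acceptᵇ y (m₀ ∷ m₁ ∷ encode m) d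

      μ₀ : Node → ℝ
      μ₀ (x , y , m₀ , m₁) = p[xy] p x y * p₀ m₀

      u : Node → ℝ
      u (x , y , m₀ , m₁) = p₁ x m₀ m₁

      0≤μ₀ : ∀ i → 0ℝ ≤ μ₀ i
      0≤μ₀ (x , y , m₀ , m₁) = 0≤* (0≤p[xy] x y) (proj₁ p₀-probability m₀)

      0≤u : ∀ i → 0ℝ ≤ u i
      0≤u (x , y , m₀ , m₁) = p₁-nonNeg x m₀ m₁

      σ : Node → Vec Bool n → ℝ
      σ (x , y , m₀ , m₁) m = sign (guess (m₀ ∷ m₁ ∷ encode m)) * sign (f x y)

      T : Node → Vec Bool n → ℝ
      T i m = μ₀ i * (both i m * (agreed i m * accepted i m))

      module D m₀ ω = Round m₀ ω

      payoff : Fin k₀ → Ω → ℝ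
      payoff m₀ ω = ∑[ x < X ] ∑[ y < Y ] (p[xy] p x y * (1[ D.tagᵃ m₀ ω x (D.At.u?ᵃ m₀ ω x y) (D.At.σ m₀ ω x y) ≡ D.tagᵇ m₀ ω y (D.At.u?ᵇ m₀ ω x y) (D.At.σ m₀ ω x y) ]
        * (sign (D.outᵇ m₀ ω y (D.At.u?ᵇ m₀ ω x y) (D.At.σ m₀ ω x y)) * sign (f x y))))

      mean-payoff : E (finite p₀ p₀-probability ⊗ Pω) (λ (m₀ , ω) → payoff m₀ ω) ≡ ∑⁴ (λ i → mass (λ m → T i m * σ i m))
      mean-payoff = trans (E-finite p₀ p₀-probability (λ m₀ → E Pω (payoff m₀))) (trans (congruent (∑-linear k₀) λ m₀ → trans (cong (p₀ m₀ *_) (inner m₀)) (sym (homogeneous lin (p₀ m₀) (λ (x , y) → G x y m₀))))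
        (trans (sym (∑-swap lin (λ m₀ (x , y) → p₀ m₀ * G x y m₀))) (congruent (∑-linear X) λ x → congruent (∑-linear Y) λ y → congruent (∑-linear k₀) λ m₀ → scale x y m₀)))
        where
        lin : IsLinear {A = Fin X × Fin Y} (λ g → ∑[ x < X ] ∑[ y < Y ] g (x , y))
        lin = ∘-linear (∑-linear X) λ x → ∑-linear Y
        pr : Node → Vec Bool n → ℝ
        pr i m = both i m * (agreed i m * accepted i m)
        G : Fin X → Fin Y → Fin k₀ → ℝ
        G x y m₀ = p[xy] p x y * ∑[ m₁ < k₁ ] mass (λ m → pr (x , y , m₀ , m₁) m * σ (x , y , m₀ , m₁) m)
        tagged : ∀ x y m₀ ω → 1[ D.tagᵃ m₀ ω x (D.At.u?ᵃ m₀ ω x y) (D.At.σ m₀ ω x y) ≡ D.tagᵇ m₀ ω y (D.At.u?ᵇ m₀ ω x y) (D.At.σ m₀ ω x y) ] * (sign (D.outᵇ m₀ ω y (D.At.u?ᵇ m₀ ω x y) (D.At.σ m₀ ω x y)) * sign (f x y))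
          ≡ ∑[ m₁ < k₁ ] mass (λ m → 1[ Event (x , y , m₀ , m₁) m ω ] * σ (x , y , m₀ , m₁) m)
        tagged x y m₀ ω = D.At.contribution m₀ ω x y (sign (f x y))
        per-input : ∀ x y m₀ → E Pω (λ ω → ∑[ m₁ < k₁ ] mass (λ m → 1[ Event (x , y , m₀ , m₁) m ω ] * σ (x , y , m₀ , m₁) m)) ≡ ∑[ m₁ < k₁ ] mass (λ m → pr (x , y , m₀ , m₁) m * σ (x , y , m₀ , m₁) m)
        per-input x y m₀ = trans (∑-swap (linear Pω) (λ m₁ ω → mass (λ m → 1[ Event (x , y , m₀ , m₁) m ω ] * σ (x , y , m₀ , m₁) m))) (congruent (∑-linear k₁) λ m₁ →
          trans (sumBits-swap (linear Pω) n (λ m ω → 1[ Event (x , y , m₀ , m₁) m ω ] * σ (x , y , m₀ , m₁) m)) (congruent (sumBits-linear n) λ m →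
            trans (homogeneousʳ (linear Pω) (σ (x , y , m₀ , m₁) m) (λ ω → 1[ Event (x , y , m₀ , m₁) m ω ])) (cong (_* σ (x , y , m₀ , m₁) m) (event-probability (x , y , m₀ , m₁) m))))
        inner : ∀ m₀ → E Pω (payoff m₀) ≡ ∑[ x < X ] ∑[ y < Y ] G x y m₀
        inner m₀ = trans (congruent (linear Pω) λ ω → congruent lin λ (x , y) → cong (p[xy] p x y *_) (tagged x y m₀ ω))
          (trans (∑-swap (linear Pω) (λ x ω → ∑[ y < Y ] (p[xy] p x y * H x y m₀ ω))) (congruent (∑-linear X) λ x →
            trans (∑-swap (linear Pω) (λ y ω → p[xy] p x y * H x y m₀ ω)) (congruent (∑-linear Y) λ y →
              trans (homogeneous (linear Pω) (p[xy] p x y) (H x y m₀)) (cong (p[xy] p x y *_) (per-input x y m₀)))))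
          where
          H : Fin X → Fin Y → Fin k₀ → Ω → ℝ
          H x y m₀ ω = ∑[ m₁ < k₁ ] mass (λ m → 1[ Event (x , y , m₀ , m₁) m ω ] * σ (x , y , m₀ , m₁) m)
        scale : ∀ x y m₀ → p₀ m₀ * G x y m₀ ≡ ∑[ m₁ < k₁ ] mass (λ m → T (x , y , m₀ , m₁) m * σ (x , y , m₀ , m₁) m)
        scale x y m₀ = trans (solve 3 (λ a b c → a :* (b :* c) := b :* a :* c) refl (p₀ m₀) (p[xy] p x y) _) (trans (sym (homogeneous (∑-linear k₁) (p[xy] p x y * p₀ m₀) (λ m₁ → mass (λ m → pr (x , y , m₀ , m₁) m * σ (x , y , m₀ , m₁) m))))
          (congruent (∑-linear k₁) λ m₁ → trans (sym (homogeneous (sumBits-linear n) (p[xy] p x y * p₀ m₀) (λ m → pr (x , y , m₀ , m₁) m * σ (x , y , m₀ , m₁) m))) (congruent (sumBits-linear n) λ m → sym (ℝ.*-assoc _ _ _))))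

      -- The common factor between the ideal probability of a transcript and q: θ from Alice's
      -- naming threshold, `rate` from the acceptance.
      c : ℝ
      c = θ * rate

      0<c : 0ℝ < c
      0<c = 0<* 0<θ 0<rate

      WLab≡Q : ∀ i m → μ₀ i * u i * L i m * ab i m ≡ Q i m
      WLab≡Q i@(x , y , m₀ , m₁) m = case 0≤⇒≡⊎< (0≤Q i m) of λ where
        (inj₂ 0<q) → trans (cong (_* ab i m) (sym (P≡WL i m (Q⇒P i m 0<q)))) (ratio-product x y (m₀ ∷ m₁ ∷ encode m) (Q⇒P i m 0<q))
        (inj₁ q≡0) → trans (case ratio-null x y (m₀ ∷ m₁ ∷ encode m) q≡0 of λ where
          (inj₁ μ≡0)  → trans (cong (λ z → z * p₀ m₀ * u i * L i m * ab i m) μ≡0) (solve 4 (λ a b c d → :0 :* a :* b :* c :* d := :0) refl (p₀ m₀) (u i) (L i m) (ab i m))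
          (inj₂ ab≡0) → trans (cong (μ₀ i * u i * L i m *_) ab≡0) (ℝ.zeroʳ _)) (sym q≡0)

      both-nonNeg : ∀ i m → 0ℝ ≤ both i m
      both-nonNeg (x , y , m₀ , m₁) m = nonNegative (linear P₁) λ (hs , zs) → 0≤1[] (Nam.Both (nameᵃ x m₀) (nameᵇ y m₀) m₁ hs zs)

      agreed-nonNeg : ∀ i m → 0ℝ ≤ agreed i m
      agreed-nonNeg (x , y , m₀ , m₁) m = nonNegative (linear P₂) λ (us , ss) → 0≤1[] (Sim.Agree x y m₀ m₁ m us ss)

      accepted-nonNeg : ∀ i m → 0ℝ ≤ accepted i m
      accepted-nonNeg (x , y , m₀ , m₁) m = Acc.accept-nonNeg (jᵃ x M′) (jᵇ y M′) (0≤a x M′) (0≤b y M′) (proj₂ (magnitudeᵃ x M′)) (proj₂ (magnitudeᵇ y M′)) (acceptᵃ∈ x m₀ m₁ m) (acceptᵇ∈ y m₀ m₁ m)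
        where M′ = m₀ ∷ m₁ ∷ encode m

      both≤ : ∀ i m → both i m ≤ θ * u i
      both≤ (x , y , m₀ , m₁) m = Nam.both≤ (nameᵃ x m₀) (nameᵇ y m₀) (nameᵃ∈ x m₀) (nameᵇ∈ y m₀) m₁

      agreed≤ : ∀ i m → agreed i m ≤ L i m
      agreed≤ (x , y , m₀ , m₁) m = Sim.agreement≤law x y m₀ m₁ m

      accepted≤ : ∀ i m → accepted i m ≤ rate * ab i m
      accepted≤ (x , y , m₀ , m₁) m = Acc.accept≤ (jᵃ x M′) (jᵇ y M′) (0≤a x M′) (0≤b y M′) (proj₂ (magnitudeᵃ x M′)) (proj₂ (magnitudeᵇ y M′)) (acceptᵃ∈ x m₀ m₁ m) (acceptᵇ∈ y m₀ m₁ m)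
        where M′ = m₀ ∷ m₁ ∷ encode m

      -- Each of the three factors has an upper bound valid without exception, so errors can only
      -- remove mass. The shortfall then equals the total error, with no absolute values to
      -- estimate.
      T≤cQ : ∀ i m → T i m ≤ c * Q i m
      T≤cQ i m = begin
        μ₀ i * (both i m * (agreed i m * accepted i m))       ≤⟨ *-monoʳ-≤ (0≤μ₀ i) (*-mono-≤ (both-nonNeg i m) (0≤* (0≤L i m) (0≤* (<⇒≤ 0<rate) (0≤ab i m))) (both≤ i m) (*-mono-≤ (agreed-nonNeg i m) (0≤* (<⇒≤ 0<rate) (0≤ab i m)) (agreed≤ i m) (accepted≤ i m))) ⟩
        μ₀ i * (θ * u i * (L i m * (rate * ab i m)))          ≡⟨ solve 6 (λ μ θ u l r ab → μ :* (θ :* u :* (l :* (r :* ab))) := θ :* r :* (μ :* u :* l :* ab)) refl (μ₀ i) θ (u i) (L i m) rate (ab i m) ⟩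
        c * (μ₀ i * u i * L i m * ab i m)                     ≡⟨ cong (c *_) (WLab≡Q i m) ⟩
        c * Q i m                                             ∎
        where open ≤-Reasoning

      module _ {B′ : ℕ} (0<B : 0ℝ < fromℕ B′) (hashing : K * ½ ^ s ≤ θ)
               (rounds : ¾ ^ r * fromℕ 2 ^ (suc (3 ℕ.* ⌈log₂ suc n ⌉) ℕ.* B′ ℕ.+ 3 ℕ.* ⌈log₂ suc n ⌉) ≤ θ) where

        -- Of the 3 θ, one is for an unfinished search and two are for clashes in the naming. The
        -- mistakes over B′ come from Markov's inequality, and the exceptional cases, a surprising
        -- m₁ or q / p outside the window, are given up entirely.
        loss : Node → Vec Bool n → ℝ
        loss i m = fromℕ 3 * θ * Q i m + Q i m * (mis i m / L i m) / fromℕ B′ + (Q i m * 1[ Surprising K i ] + Q i m * 1[ ¬ Ratio t (Q i m) (P i m) ])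

        name-sums : ∀ x y m₀ → sum (nameᵃ x m₀) + sum (nameᵇ y m₀) * ½ ^ s ≤ fromℕ 2 * θ
        name-sums x y m₀ = ≤-trans (+-mono-≤
            (≤-trans (≤-reflexive (homogeneous (∑-linear k₁) θ (p₁ x m₀))) (≤-trans (*-monoʳ-≤ (<⇒≤ 0<θ) (p₁-total x m₀)) (≤-reflexive (ℝ.*-identityʳ θ))))
            (≤-trans (*-monoˡ-≤ (^-nonNeg s (<⇒≤ 0<½)) (≤-trans (monotone (∑-linear k₁) λ m₁ → cap≤ (K * v₁ y m₀ m₁)) (≤-trans (≤-reflexive (homogeneous (∑-linear k₁) K (v₁ y m₀))) (≤-trans (*-monoʳ-≤ (<⇒≤ 0<K) (v₁-total y m₀)) (≤-reflexive (ℝ.*-identityʳ K)))))) hashing))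
          (≤-reflexive (solve 1 (λ θ → θ :+ θ := :2 :* θ) refl θ))

        0≤mis/L : ∀ i m → 0ℝ < L i m → 0ℝ ≤ mis i m / L i m
        0≤mis/L i@(x , y , m₀ , m₁) m 0<L = 0≤/ (≤-trans (nonNegative (linear (Pⁿ ts n)) λ us → 0≤* (0≤1[] _) (0≤fromℕ (Search.mistakes owners (strategy us (labelsᵃ x m₀ m₁)) (strategy us (labelsᵇ y m₀ m₁))))) (≤-reflexive (truth-mistakes ts owners (realisableᵃ x m₀ m₁) (realisableᵇ y m₀ m₁) m))) (<⇒≤ 0<L)

        typical : ∀ i m → 0ℝ < Q i m → ¬ Surprising K i → Ratio t (Q i m) (P i m) → c * Q i m - T i m ≤ c * (fromℕ 3 * θ * Q i m + Q i m * (mis i m / L i m) / fromℕ B′)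
        typical i@(x , y , m₀ , m₁) m 0<q ¬surp (P≤ , Q≤) = begin
          c * Q i m - T i m                                             ≡⟨ cong (λ z → c * z - T i m) (sym (WLab≡Q i m)) ⟩
          c * (μ₀ i * u i * L i m * ab i m) - T i m                     ≤⟨ +-monoʳ-≤ (c * (μ₀ i * u i * L i m * ab i m)) (neg-mono-≤ (*-monoʳ-≤ (0≤μ₀ i) (*-monoʳ-≤ (both-nonNeg i m) (*-monoʳ-≤ (agreed-nonNeg i m) accepted≥)))) ⟩
          c * (μ₀ i * u i * L i m * ab i m) - μ₀ i * (X′ * (Y′ * (rate * ab i m)))
            -- In a typical case acceptance is exact, so only the naming and the history factor fall
            -- short; their deficits are separated by telescoping the product.
            ≡⟨ solve 8 (λ μ θ u l r ab x y → θ :* r :* (μ :* u :* l :* ab) :- μ :* (x :* (y :* (r :* ab))) := μ :* r :* ab :* (θ :* u :* (l :- y) :+ (θ :* u :- x) :* y)) refl (μ₀ i) θ (u i) (L i m) rate (ab i m) X′ Y′ ⟩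
          μ₀ i * rate * ab i m * (θ * u i * (L i m - Y′) + (θ * u i - X′) * Y′)
            ≤⟨ *-monoʳ-≤ (0≤* (0≤* (0≤μ₀ i) (<⇒≤ 0<rate)) (0≤ab i m)) (+-mono-≤ (*-monoʳ-≤ (0≤* (<⇒≤ 0<θ) (0≤u i)) L-Y) (*-mono-≤ (x≤y⇒0≤y-x (both≤ i m)) (0≤L i m) U-X (agreed≤ i m))) ⟩
          μ₀ i * rate * ab i m * (θ * u i * (θ * L i m + mis i m / fromℕ B′) + θ * u i * (fromℕ 2 * θ) * L i m)
            ≡⟨ solve 8 (λ μ θ u l r ab mi bi → μ :* r :* ab :* (θ :* u :* (θ :* l :+ mi :* bi) :+ θ :* u :* (:2 :* θ) :* l) := θ :* r :* (:3 :* θ :* (μ :* u :* l :* ab) :+ μ :* u :* ab :* mi :* bi)) refl (μ₀ i) θ (u i) (L i m) rate (ab i m) (mis i m) (fromℕ B′ ⁻¹) ⟩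
          c * (fromℕ 3 * θ * (μ₀ i * u i * L i m * ab i m) + μ₀ i * u i * ab i m * mis i m / fromℕ B′)
            ≡⟨ cong₂ (λ z w → c * (fromℕ 3 * θ * z + w / fromℕ B′)) (WLab≡Q i m) mis≡ ⟩
          c * (fromℕ 3 * θ * Q i m + Q i m * (mis i m / L i m) / fromℕ B′) ∎
          where
          open ≤-Reasoning
          M′ = m₀ ∷ m₁ ∷ encode m
          X′ = both i m
          Y′ = agreed i m
          0<P = Q⇒P i m 0<q
          0<L = proj₂ (Q⇒W,L i m 0<q)
          PR≡Q : P i m * ab i m ≡ Q i m
          PR≡Q = ratio-product x y M′ 0<P
          0<ab : 0ℝ < a x M′ × 0ℝ < b y M′
          0<ab = *-pos⁻¹ (0≤a x M′) (0≤b y M′) (proj₂ (*-pos⁻¹ (<⇒≤ 0<P) (0≤ab i m) (subst (0ℝ <_) (sym PR≡Q) 0<q)))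
          accepted≥ : rate * ab i m ≤ accepted i m
          accepted≥ = Acc.accept≥ (jᵃ x M′) (jᵇ y M′) (0≤a x M′) (0≤b y M′) (proj₂ (magnitudeᵃ x M′)) (proj₂ (magnitudeᵇ y M′)) (acceptᵃ∈ x m₀ m₁ m) (acceptᵇ∈ y m₀ m₁ m) (proj₁ 0<ab) (proj₂ 0<ab)
            (*-cancelˡ-≤ 0<P (≤-trans (≤-reflexive (ℝ.*-identityʳ _)) (≤-trans P≤ (≤-reflexive (trans (cong (_* fromℕ 2 ^ t) (sym PR≡Q)) (ℝ.*-assoc _ _ _))))))
            (*-cancelˡ-≤ 0<P (≤-trans (≤-reflexive PR≡Q) Q≤))
          L-Y : L i m - Y′ ≤ θ * L i m + mis i m / fromℕ B′
          L-Y = ≤-cert (x≤y⇒0≤y-x (Sim.agreement≥ x y m₀ m₁ {B′} 0<B (<⇒≤ 0<θ) rounds m)) (solve 3 (λ l y z → z := l :- y :+ (y :- (l :- z))) refl (L i m) Y′ (θ * L i m + mis i m / fromℕ B′))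
          tᴬ≤tᴮ : nameᵃ x m₀ m₁ ≤ nameᵇ y m₀ m₁
          tᴬ≤tᴮ = ≤cap (≤-trans (*-monoˡ-≤ (0≤u i) θ≤1) (≤-trans (≤-reflexive (ℝ.*-identityˡ _)) (≮⇒≥ ¬surp))) (proj₂ (proj₁ (nameᵃ∈ x m₀ m₁)))
          U-X : θ * u i - X′ ≤ θ * u i * (fromℕ 2 * θ)
          U-X = ≤-trans (+-monoʳ-≤ (θ * u i) (neg-mono-≤ (Nam.both≥ (nameᵃ x m₀) (nameᵇ y m₀) (nameᵃ∈ x m₀) (nameᵇ∈ y m₀) m₁ tᴬ≤tᴮ)))
            (≤-trans (≤-reflexive (solve 2 (λ w z → w :- w :* (:1 :- z) := w :* z) refl (θ * u i) (sum (nameᵃ x m₀) + sum (nameᵇ y m₀) * ½ ^ s))) (*-monoʳ-≤ (0≤* (<⇒≤ 0<θ) (0≤u i)) (name-sums x y m₀)))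
          mis≡ : μ₀ i * u i * ab i m * mis i m ≡ Q i m * (mis i m / L i m)
          mis≡ = trans (cong (μ₀ i * u i * ab i m *_) (sym (x/y*y (0<⇒≢ 0<L)))) (trans (solve 5 (λ μ u ab z l → μ :* u :* ab :* (z :* l) := μ :* u :* l :* ab :* z) refl (μ₀ i) (u i) (ab i m) (mis i m / L i m) (L i m)) (cong (_* (mis i m / L i m)) (WLab≡Q i m)))

        cQ-T≤ : ∀ i m → c * Q i m - T i m ≤ c * loss i m
        cQ-T≤ i m = go (0≤⇒≡⊎< (0≤Q i m)) lem lem
          where
          Sp = 1[ Surprising K i ]
          Ra = 1[ ¬ Ratio t (Q i m) (P i m) ]
          0≤T : 0ℝ ≤ T i m
          0≤T = 0≤* (0≤μ₀ i) (0≤* (both-nonNeg i m) (0≤* (agreed-nonNeg i m) (accepted-nonNeg i m)))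
          drop-T : c * Q i m - T i m ≤ c * Q i m
          drop-T = ≤-cert 0≤T (solve 2 (λ x t → x := x :- t :+ t) refl (c * Q i m) (T i m))
          first-two : 0ℝ < Q i m → 0ℝ ≤ fromℕ 3 * θ * Q i m + Q i m * (mis i m / L i m) / fromℕ B′
          first-two 0<q = 0≤+ (0≤* (0≤* (0≤fromℕ 3) (<⇒≤ 0<θ)) (<⇒≤ 0<q)) (0≤/ (0≤* (<⇒≤ 0<q) (0≤mis/L i m (proj₂ (Q⇒W,L i m 0<q)))) (<⇒≤ 0<B))
          go : Q i m ≡ 0ℝ ⊎ 0ℝ < Q i m → Dec (Surprising K i) → Dec (Ratio t (Q i m) (P i m)) → c * Q i m - T i m ≤ c * loss i m
          go (inj₁ q≡0) _ _ = ≤-trans drop-T (≤-reflexive (cong (c *_) (trans q≡0 (sym (trans (cong (λ z → fromℕ 3 * θ * z + z * (mis i m / L i m) / fromℕ B′ + (z * Sp + z * Ra)) q≡0)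
            (solve 5 (λ θ z b s r → :3 :* θ :* :0 :+ :0 :* z :* b :+ (:0 :* s :+ :0 :* r) := :0) refl θ (mis i m / L i m) (fromℕ B′ ⁻¹) Sp Ra))))))
          go (inj₂ 0<q) (yes surp) _ = ≤-trans drop-T (*-monoʳ-≤ (<⇒≤ 0<c) (≤-cert (0≤+ (first-two 0<q) (0≤* (<⇒≤ 0<q) (0≤1[] _)))
            (trans (cong (λ z → F₂ + (Q i m * z + Q i m * Ra)) (1[]-yes surp)) (solve 3 (λ f q r → f :+ (q :* :1 :+ r) := q :+ (f :+ r)) refl F₂ (Q i m) (Q i m * Ra)))))
            where F₂ = fromℕ 3 * θ * Q i m + Q i m * (mis i m / L i m) / fromℕ B′
          go (inj₂ 0<q) (no _) (no ¬ratio) = ≤-trans drop-T (*-monoʳ-≤ (<⇒≤ 0<c) (≤-cert (0≤+ (first-two 0<q) (0≤* (<⇒≤ 0<q) (0≤1[] _)))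
            (trans (cong (λ z → F₂ + (Q i m * Sp + Q i m * z)) (1[]-yes ¬ratio)) (solve 3 (λ f q r → f :+ (r :+ q :* :1) := q :+ (f :+ r)) refl F₂ (Q i m) (Q i m * Sp)))))
            where F₂ = fromℕ 3 * θ * Q i m + Q i m * (mis i m / L i m) / fromℕ B′
          go (inj₂ 0<q) (no ¬surp) (yes ratio) = ≤-trans (typical i m 0<q ¬surp ratio) (*-monoʳ-≤ (<⇒≤ 0<c) (≤-cert (0≤+ (0≤* (<⇒≤ 0<q) (0≤1[] _)) (0≤* (<⇒≤ 0<q) (0≤1[] _))) refl))

        module _ (naming : ∑⁴ (λ i → mass (Q i) * 1[ Surprising K i ]) ≤ θ)
                 (history : ∑⁴ (λ i → mass (λ m → Q i m * (mis i m / L i m))) ≤ θ * fromℕ B′)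
                 (ratio : ∑⁴ (λ i → mass (λ m → Q i m * 1[ ¬ Ratio t (Q i m) (P i m) ])) ≤ θ) where

          private
            F : (Node → Vec Bool n → ℝ) → ℝ
            F g = ∑⁴ λ i → mass (g i)

            lin : IsLinear {A = Node × Vec Bool n} (λ g → F λ i m → g (i , m))
            lin = ∘-linear ∑⁴-linear λ _ → sumBits-linear n

          total-loss : F loss ≤ fromℕ 6 * θ
          total-loss = begin
            F loss ≡⟨ trans (additive lin (λ (i , m) → fromℕ 3 * θ * Q i m + Q i m * (mis i m / L i m) / fromℕ B′) (λ (i , m) → Q i m * 1[ Surprising K i ] + Q i m * 1[ ¬ Ratio t (Q i m) (P i m) ]))
                        (cong₂ _+_ (additive lin (λ (i , m) → fromℕ 3 * θ * Q i m) (λ (i , m) → Q i m * (mis i m / L i m) / fromℕ B′)) (additive lin (λ (i , m) → Q i m * 1[ Surprising K i ]) (λ (i , m) → Q i m * 1[ ¬ Ratio t (Q i m) (P i m) ]))) ⟩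
            (F (λ i m → fromℕ 3 * θ * Q i m) + F (λ i m → Q i m * (mis i m / L i m) / fromℕ B′)) + (F (λ i m → Q i m * 1[ Surprising K i ]) + F (λ i m → Q i m * 1[ ¬ Ratio t (Q i m) (P i m) ]))
              ≤⟨ +-mono-≤ (+-mono-≤ (≤-reflexive (trans (homogeneous lin (fromℕ 3 * θ) (λ (i , m) → Q i m)) (trans (cong (fromℕ 3 * θ *_) ∑⁴Q≡1) (ℝ.*-identityʳ _))))
                   (≤-trans (≤-reflexive (homogeneousʳ lin (fromℕ B′ ⁻¹) (λ (i , m) → Q i m * (mis i m / L i m)))) (x/z≤y 0<B history)))
                   (+-mono-≤ (≤-trans (≤-reflexive (congruent ∑⁴-linear λ i → homogeneousʳ (sumBits-linear n) 1[ Surprising K i ] (Q i))) naming) ratio) ⟩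
            (fromℕ 3 * θ + θ) + (θ + θ)   ≡⟨ solve 1 (λ θ → (:3 :* θ :+ θ) :+ (θ :+ θ) := con (pos 6) :* θ) refl θ ⟩
            fromℕ 6 * θ                   ∎
            where open ≤-Reasoning

          meanBias : ℝ
          meanBias = total³ (λ ((x , y , m) : Point {X} {Y} {ks = k₀ ∷ k₁ ∷ replicate n 2}) → q x y m * ∣ bias q f m ∣)

          -- Since T is at most c Q and σ at most 1, replacing T by c Q in the signed sum costs no
          -- more than the shortfall c Q - T, whatever the signs are. With c Q in place of T the sum
          -- is c times the mean bias.
          payoff≥ : c * (meanBias - fromℕ 6 * θ) ≤ F (λ i m → T i m * σ i m)
          payoff≥ = begin
            c * (meanBias - fromℕ 6 * θ)                 ≤⟨ *-monoʳ-≤ (<⇒≤ 0<c) (+-monoʳ-≤ meanBias (neg-mono-≤ total-loss)) ⟩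
            c * (meanBias - F loss)                      ≡⟨ trans (solve 3 (λ c x y → c :* (x :- y) := c :* x :- c :* y) refl c meanBias (F loss))
                                                            (cong₂ _-_ (trans (cong (c *_) (sym guessed)) (sym (homogeneous lin c (λ (i , m) → Q i m * σ i m)))) (sym (homogeneous lin c (λ (i , m) → loss i m)))) ⟩
            F (λ i m → c * (Q i m * σ i m)) - F (λ i m → c * loss i m) ≡⟨ sym (subtractive lin (λ (i , m) → c * (Q i m * σ i m)) (λ (i , m) → c * loss i m)) ⟩
            F (λ i m → c * (Q i m * σ i m) - c * loss i m) ≤⟨ monotone lin (λ (i , m) → pointwise i m) ⟩
            F (λ i m → T i m * σ i m)                    ∎
            where
            open ≤-Reasoning
            guessed : F (λ i m → Q i m * σ i m) ≡ meanBias
            guessed = trans (sym (total³≡ (λ x y m → q x y m * (sign (guess m) * sign (f x y))))) guess-value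
            σ≤1 : ∀ i m → σ i m ≤ 1ℝ
            σ≤1 (x , y , m₀ , m₁) m = ≤-trans (≤-reflexive (sym (sign-xor (guess (m₀ ∷ m₁ ∷ encode m)) (f x y)))) (sign≤1 (guess (m₀ ∷ m₁ ∷ encode m) xor f x y))
            pointwise : ∀ i m → c * (Q i m * σ i m) - c * loss i m ≤ T i m * σ i m
            pointwise i m = ≤-cert (0≤+ (0≤* (x≤y⇒0≤y-x (T≤cQ i m)) (x≤y⇒0≤y-x (σ≤1 i m))) (x≤y⇒0≤y-x (cQ-T≤ i m)))
              (solve 5 (λ c Q s T l → T :* s := c :* (Q :* s) :- l :+ ((c :* Q :- T) :* (:1 :- s) :+ (l :- (c :* Q :- T)))) refl c (Q i m) (σ i m) (T i m) (c * loss i m))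

          compressed : ∃ λ (tr : Tree (Fin X) (Fin Y)) → depth tr ℕ.≤ (s ℕ.+ (r ℕ.* 4 ℕ.+ 0)) ℕ.+ 2 × c * (meanBias - fromℕ 6 * θ) ≤ value (p[xy] p) f (run tr)
          compressed =
            let (m₀ , ω) , h = attained (finite p₀ p₀-probability ⊗ Pω) (λ (m₀ , ω) → payoff m₀ ω)
                tr , d≤ , v≥ = Signing.signed (p[xy] p) f (D.dialogue m₀ ω) (λ x (v , σ) → D.tagᵃ m₀ ω x (D.selectᵃ m₀ ω x) σ) (λ y (v , σ) → D.tagᵇ m₀ ω y (D.selectᵇ m₀ ω v y) σ) (λ y (v , σ) → D.outᵇ m₀ ω y (D.selectᵇ m₀ ω v y) σ)
            in tr , d≤ , ≤-trans payoff≥ (≤-trans (≤-reflexive (sym mean-payoff)) (≤-trans h v≥))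

  open CompressedAdvantage

  -- Choice of the constants and conclusion

  module Parameters where

    open IsLinear

    module _ {A B A′ B′ : Set} (g : A′ → A) (h : B′ → B) where

      mapTree : Tree A B → Tree A′ B′
      mapTree (output b)  = output b
      mapTree (alice s t) = alice (s ∘ g) (mapTree ∘ t)
      mapTree (bob s t)   = bob (s ∘ h) (mapTree ∘ t)

      run-mapTree : ∀ t a b → run (mapTree t) a b ≡ run t (g a) (h b)
      run-mapTree (output _)  a b = refl
      run-mapTree (alice s t) a b = run-mapTree (t (s (g a))) a b
      run-mapTree (bob s t)   a b = run-mapTree (t (s (h b))) a b

      depth-mapTree : ∀ t → depth (mapTree t) ≡ depth t
      depth-mapTree (output _)  = refl
      depth-mapTree (alice s t) = cong suc (cong₂ ℕ._⊔_ (depth-mapTree (t false)) (depth-mapTree (t true)))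
      depth-mapTree (bob s t)   = cong suc (cong₂ ℕ._⊔_ (depth-mapTree (t false)) (depth-mapTree (t true)))

    deterministic : ∀ {X Y} → Tree (Fin X) (Fin Y) → Protocol X Y
    deterministic t = record
      { publics = 1 ; privatesA = 1 ; privatesB = 1
      ; public-pr = λ _ → 1ℝ ; privateA-pr = λ _ → 1ℝ ; privateB-pr = λ _ → 1ℝ
      ; isProb-public = certain ; isProb-privateA = certain ; isProb-privateB = certain
      ; tree = λ _ → mapTree proj₁ proj₁ t
      }
      where
      certain : IsProbability {1} (λ _ → 1ℝ)
      certain = (λ _ → 0≤1) , ℝ.+-identityʳ 1ℝ

    deterministic-cost : ∀ {X Y} (t : Tree (Fin X) (Fin Y)) → ‖ deterministic t ‖ ≡ depth t
    deterministic-cost t = trans (ℕ.⊔-identityʳ _) (depth-mapTree proj₁ proj₁ t)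

    deterministic-advantage : ∀ {X Y} (t : Tree (Fin X) (Fin Y)) μ f → advantage (deterministic t) μ f ≡ value μ f (run t)
    deterministic-advantage {X} {Y} t μ f = congruent (∑-linear X) λ x → congruent (∑-linear Y) λ y →
      trans (solve 2 (λ m s → m :* :1 :* :1 :* :1 :* s :+ :0 :+ :0 :+ :0 := m :* s) refl (μ x y) _)
        (cong (λ b → μ x y * sign (b xor f x y)) (run-mapTree proj₁ proj₁ t (x , zero) (y , zero)))

    fromℕ-cancel-≤ : ∀ {m n} → fromℕ m ≤ fromℕ n → m ℕ.≤ n
    fromℕ-cancel-≤ {m} {n} h with m ℕ.≤? n
    ... | yes p = p
    ... | no ¬p = contradiction (≤-trans (fromℕ-mono (ℕ.≰⇒> ¬p)) h) (<⇒≱ (subst (fromℕ n <_) (ℝ.+-comm _ _) (x<x+1 (fromℕ n))))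

    fromℕ-^ : ∀ k → fromℕ (2 ℕ.^ k) ≡ fromℕ 2 ^ k
    fromℕ-^ zero    = fromℕ-1
    fromℕ-^ (suc k) = trans (fromℕ-* 2 (2 ℕ.^ k)) (cong (fromℕ 2 *_) (fromℕ-^ k))

    ½^*2^ : ∀ k → ½ ^ k * fromℕ 2 ^ k ≡ 1ℝ
    ½^*2^ k = trans (sym (^-* k ½ (fromℕ 2))) (trans (cong (_^ k) (trans (ℝ.*-comm ½ _) (*-inverseʳ _ (0<⇒≢ 0<2)))) (1^ k))

    ¾³≤½ : ¾ ^ 3 ≤ ½
    ¾³≤½ = ≤-cert (0≤* (0≤fromℕ 5) (0≤* (0≤* (0≤* 0≤h 0≤h) (0≤* 0≤h 0≤h)) (0≤* 0≤h 0≤h)))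
      (begin
        ½                              ≡⟨ sym (solve¹ ½) ⟩
        ½ * 1ℝ                         ≡⟨ cong (½ *_) (sym one) ⟩
        -- 32/64 = 27/64 + 5/64; the powers of ½ + ½ bring all terms to degree 6, where the solver
        -- can compare them.
        ½ * ((½ + ½) ^ 5)              ≡⟨ solve 1 (λ h → h :* (h :+ h) :^ 5 := (:3 :* (h :* h)) :^ 3 :+ con (pos 5) :* (h :* h :* (h :* h) :* (h :* h))) refl ½ ⟩
        ¾ ^ 3 + fromℕ 5 * (½ * ½ * (½ * ½) * (½ * ½)) ∎)
      where
      open ≡-Reasoning
      0≤h = <⇒≤ 0<½
      solve¹ : ∀ h → h * 1ℝ ≡ h
      solve¹ = ℝ.*-identityʳ
      one : (½ + ½) ^ 5 ≡ 1ℝ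
      one = trans (cong (_^ 5) ½+½) (1^ 5)

    ¾^≤½^ : ∀ k → ¾ ^ (3 ℕ.* k) ≤ ½ ^ k
    ¾^≤½^ k = ≤-trans (≤-reflexive (sym (^-^ ¾ 3 k))) (^-monoˡ k (^-nonNeg 3 (<⇒≤ 0<¾)) ¾³≤½)

    all≡2⇒replicate : ∀ {n} (ks : Vec ℕ n) → (∀ i → lookup ks i ≡ 2) → ks ≡ replicate n 2
    all≡2⇒replicate []       h = refl
    all≡2⇒replicate (k ∷ ks) h = cong₂ _∷_ (h zero) (all≡2⇒replicate ks (h ∘ suc))

    module Constants (α : ℝ) (0<α : 0ℝ < α) where

      α₂ : ℝ
      α₂ = α + 1ℝ

      0<α₂ : 0ℝ < α₂
      0<α₂ = 0<+ 0<α 0≤1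

      0≤α₂ = <⇒≤ 0<α₂

      -- As ln 2 is at least ½, k₀ ≥ 2 α₂ makes K = 2 ^ k₀ admissible in `mean-bias`, so the mean
      -- bias is at least 2 ^ -k₀ = 16 θ. The losses consume 6 θ of it, and the gain keeps one θ by
      -- `7θ≤`. With t the right side of `window-error` corresponds to a probability of at most θ.
      k₀ e t : ℕ
      k₀ = proj₁ (archimedean (fromℕ 2 * α₂))
      e = k₀ ℕ.+ 4

      θ E′ : ℝ
      θ = ½ ^ e
      E′ = fromℕ 2 ^ e

      t = proj₁ (archimedean (fromℕ 2 * (α₂ + fromℕ 2) * E′))

      0<θ : 0ℝ < θ
      0<θ = ^-pos e 0<½

      0<E′ : 0ℝ < E′
      0<E′ = ^-pos e 0<2

      -- The acceptance rate depends neither on the list of thresholds nor on the shift N, so dummy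
      -- values fix it, and with it Δ, before the instance is given.
      rate : ℝ
      rate = Acceptance.rate [] 0 t
        where open import Data.List.Base using ([])

      0<rate : 0ℝ < rate
      0<rate = Acceptance.0<rate [] 0 t
        where open import Data.List.Base using ([])

      gain : ℝ
      gain = θ * rate * θ

      0<gain : 0ℝ < gain
      0<gain = 0<* (0<* 0<θ 0<rate) 0<θ

      -- `c₁` covers the hash of m₁ and the fixed part 13 e + 2, that is e hash bits, 3 e tests of 4
      -- bits and 2 bits for the signs. `c₂` bounds (B + 1) / w. Each unit of `pot` costs 12 bits,
      -- which with the 7 of `searching` makes 84. The inverse of `gain` secures the advantage 1 /
      -- Δ.
      c₁ c₂ Δ : ℝ
      c₁ = fromℕ 2 * (α₂ + fromℕ 2) * E′ + 1ℝ + fromℕ (13 ℕ.* e ℕ.+ 2)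
      c₂ = fromℕ 3 * (1ℝ + α₂) * E′ + fromℕ 2
      Δ = c₁ + fromℕ 84 * c₂ + gain ⁻¹

      0≤c₁ : 0ℝ ≤ c₁
      0≤c₁ = 0≤+ (0≤+ (0≤* (0≤* (<⇒≤ 0<2) (0≤+ 0≤α₂ (<⇒≤ 0<2))) (<⇒≤ 0<E′)) 0≤1) (0≤fromℕ (13 ℕ.* e ℕ.+ 2))

      0≤c₂ : 0ℝ ≤ c₂
      0≤c₂ = 0≤+ (0≤* (0≤* (0≤fromℕ 3) (0≤+ 0≤1 0≤α₂)) (<⇒≤ 0<E′)) (<⇒≤ 0<2)

      0<Δ : 0ℝ < Δ
      0<Δ = subst (0ℝ <_) (ℝ.+-comm _ _) (0<+ (0<⁻¹ 0<gain) (0≤+ 0≤c₁ (0≤* (0≤fromℕ 84) 0≤c₂)))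

      1/Δ≤gain : 1ℝ / Δ ≤ gain
      1/Δ≤gain = x/z≤y 0<Δ (≤-trans (≤-reflexive (sym (*-inverseʳ gain (0<⇒≢ 0<gain)))) (*-monoʳ-≤ (<⇒≤ 0<gain) (≤-cert (0≤+ 0≤c₁ (0≤* (0≤fromℕ 84) 0≤c₂)) (ℝ.+-comm _ _))))

      error≤θ : ∀ {S D G} → 0ℝ < D → 0ℝ ≤ S → D * E′ ≤ G → G * S ≤ D → S ≤ θ
      error≤θ {S} {D} {G} 0<D 0≤S h h′ = *-cancelˡ-≤ 0<E′ (≤-trans (*-cancelˡ-≤ 0<D (≤-trans (≤-reflexive (sym (ℝ.*-assoc D E′ S))) (≤-trans (*-monoˡ-≤ 0≤S h) (≤-trans h′ (≤-reflexive (sym (ℝ.*-identityʳ D)))))))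
        (≤-reflexive (trans (sym (½^*2^ e)) (ℝ.*-comm _ _))))

      ln-≥ : ∀ {z} k → fromℕ 2 * z ≤ fromℕ k → z ≤ fromℕ k * ln2
      ln-≥ {z} k h = *-cancelˡ-≤ 0<2 (≤-trans h (≤-trans (≤-trans (≤-reflexive (sym (ℝ.*-identityʳ _))) (*-monoʳ-≤ (0≤fromℕ k) ½≤ln2)) (≤-reflexive (solve 2 (λ k l → k :* (:2 :* l) := :2 :* (k :* l)) refl (fromℕ k) ln2))))

      7θ≤ : fromℕ 7 * θ ≤ ½ ^ k₀
      7θ≤ = ≤-cert (0≤* (0≤fromℕ 9) (<⇒≤ 0<θ)) (begin
        ½ ^ k₀                       ≡⟨ sym (ℝ.*-identityʳ _) ⟩
        ½ ^ k₀ * 1ℝ                  ≡⟨ cong (½ ^ k₀ *_) (sym (trans (cong (_^ 4) ½+½) (1^ 4))) ⟩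
        ½ ^ k₀ * (½ + ½) ^ 4         ≡⟨ solve 2 (λ k h → k :* (h :+ h) :^ 4 := con (pos 7) :* (k :* h :^ 4) :+ con (pos 9) :* (k :* h :^ 4)) refl (½ ^ k₀) ½ ⟩
        fromℕ 7 * (½ ^ k₀ * ½ ^ 4) + fromℕ 9 * (½ ^ k₀ * ½ ^ 4) ≡⟨ cong (λ z → fromℕ 7 * z + fromℕ 9 * z) (sym (^-+ ½ k₀ 4)) ⟩
        fromℕ 7 * θ + fromℕ 9 * θ    ∎)
        where open ≡-Reasoning

      module Instance (I : ℝ) (1≤I : 1ℝ ≤ I) (n : ℕ) where

        C : ℕ
        C = suc n

        0<I : 0ℝ < I
        0<I = <-≤-trans 0<1 1≤I

        0≤I = <⇒≤ 0<I

        1≤C : 1ℝ ≤ fromℕ C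
        1≤C = ≤-cert (0≤fromℕ n) refl

        w : ℝ
        w = √ (fromℕ C * I)

        0<CI : 0ℝ < fromℕ C * I
        0<CI = 0<* (0<fromℕ-suc n) 0<I

        1≤CI : 1ℝ ≤ fromℕ C * I
        1≤CI = ≤-trans (≤-reflexive (sym (ℝ.*-identityˡ 1ℝ))) (*-mono-≤ 0≤1 0≤I 1≤C 1≤I)

        w² : w * w ≡ fromℕ C * I
        w² = √-square (<⇒≤ 0<CI)

        0<w : 0ℝ < w
        0<w = √-pos 0<CI

        1≤w : 1ℝ ≤ w
        1≤w = x²≤y²⇒x≤y (<⇒≤ 0<w) (≤-trans (≤-reflexive (ℝ.*-identityˡ 1ℝ)) (≤-trans 1≤CI (≤-reflexive (sym w²))))

        κ-ceiling : ∃ λ m → fromℕ 2 * (α₂ * I + fromℕ 2) * E′ ≤ fromℕ m × fromℕ m ≤ fromℕ 2 * (α₂ * I + fromℕ 2) * E′ + 1ℝ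
        κ-ceiling = ceiling _ (0≤* (0≤* (<⇒≤ 0<2) (0≤+ (0≤* 0≤α₂ 0≤I) (<⇒≤ 0<2))) (<⇒≤ 0<E′))

        B-ceiling : ∃ λ m → fromℕ 3 * (1ℝ + α₂) * w * E′ ≤ fromℕ m × fromℕ m ≤ fromℕ 3 * (1ℝ + α₂) * w * E′ + 1ℝ
        B-ceiling = ceiling _ (0≤* (0≤* (0≤* (0≤fromℕ 3) (0≤+ 0≤1 0≤α₂)) (<⇒≤ 0<w)) (<⇒≤ 0<E′))

        -- κ makes `naming-error` at most θ, and B does so for the mean number of mistakes divided
        -- by B. Three tests halve the failure bound by `¾³≤½`, so 3 (pot + e) of them outweigh 2 ^
        -- pot and leave θ.
        κ B D pot r s : ℕ
        κ = proj₁ κ-ceiling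
        B = proj₁ B-ceiling
        s = κ ℕ.+ e
        D = ⌈log₂ suc n ⌉
        pot = suc (3 ℕ.* D) ℕ.* B ℕ.+ 3 ℕ.* D
        r = 3 ℕ.* (pot ℕ.+ e)

        0<B : 0ℝ < fromℕ B
        0<B = <-≤-trans (0<* (0<* (0<* (0<fromℕ-suc 2) (0<+ 0<1 0≤α₂)) 0<w) 0<E′) (proj₁ (proj₂ B-ceiling))

        hashing : fromℕ 2 ^ κ * ½ ^ s ≤ θ
        hashing = ≤-reflexive (trans (cong (fromℕ 2 ^ κ *_) (^-+ ½ κ e)) (trans (solve 3 (λ a b c → a :* (b :* c) := b :* a :* c) refl (fromℕ 2 ^ κ) (½ ^ κ) (½ ^ e)) (trans (cong (_* ½ ^ e) (½^*2^ κ)) (ℝ.*-identityˡ _))))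

        rounds : ¾ ^ r * fromℕ 2 ^ pot ≤ θ
        rounds = ≤-trans (*-monoˡ-≤ (^-nonNeg pot (<⇒≤ 0<2)) (¾^≤½^ (pot ℕ.+ e))) (≤-reflexive (trans (cong (_* fromℕ 2 ^ pot) (^-+ ½ pot e))
          (trans (solve 3 (λ a b c → a :* b :* c := a :* c :* b) refl (½ ^ pot) (½ ^ e) (fromℕ 2 ^ pot)) (trans (cong (_* ½ ^ e) (½^*2^ pot)) (ℝ.*-identityˡ _)))))

        ℓ : ℝ
        ℓ = log₂ (fromℕ C * I)

        ℓ≡ : ℓ ≡ ln (fromℕ C * I) / ln2
        ℓ≡ = log₂≡ 0<CI

        0≤ℓ : 0ℝ ≤ ℓ
        0≤ℓ = subst (0ℝ ≤_) (sym ℓ≡) (0≤/ (subst (_≤ ln (fromℕ C * I)) ln-1 (ln-mono-≤ 0<1 1≤CI)) (<⇒≤ 0<ln2))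

        D≤ : fromℕ D ≤ ℓ + 1ℝ
        D≤ = go (ceiling ℓ 0≤ℓ)
          where
          C≤ : ∀ k → ℓ ≤ fromℕ k → fromℕ C ≤ fromℕ 2 ^ k
          C≤ k h = ≤-trans (≤-trans (≤-reflexive (sym (ℝ.*-identityʳ _))) (*-monoʳ-≤ (0≤fromℕ C) 1≤I)) (ln-cancel-≤ (^-pos k 0<2)
            (≤-trans (≤-reflexive (sym (trans (cong (_* ln2) ℓ≡) (x/y*y (0<⇒≢ 0<ln2))))) (≤-trans (*-monoˡ-≤ (<⇒≤ 0<ln2) h) (≤-reflexive (sym (ln-^ k 0<2))))))
          D≤k : ∀ k → fromℕ (suc n) ≤ fromℕ (2 ℕ.^ k) → D ℕ.≤ k
          D≤k k h = ℕ.≤-trans (⌈log₂⌉-mono-≤ {suc n} {2 ℕ.^ k} (fromℕ-cancel-≤ {suc n} {2 ℕ.^ k} h)) (ℕ.≤-reflexive (⌈log₂2^n⌉≡n k))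
          go : (∃ λ k → ℓ ≤ fromℕ k × fromℕ k ≤ ℓ + 1ℝ) → fromℕ D ≤ ℓ + 1ℝ
          go (k , h , h′) = ≤-trans (fromℕ-mono {D} {k} (D≤k k (≤-trans (C≤ k h) (≤-reflexive (sym (fromℕ-^ k)))))) h′

        -- For C = 1 there are no bits to search among; otherwise log₂ (C I) ≥ 1.
        searching : fromℕ (suc (3 ℕ.* D)) * w ≤ I + fromℕ 7 * (w * ℓ)
        searching = go (ℕ.m≤n⇒m<n∨m≡n (z≤n {n}))
          where
          w≤I : √ (fromℕ 1 * I) ≤ I
          w≤I = x²≤y²⇒x≤y 0≤I (≤-trans (≤-reflexive (trans (√-square (0≤* (0≤fromℕ 1) 0≤I)) (trans (cong (_* I) fromℕ-1) (ℝ.*-identityˡ I)))) (≤-trans (≤-reflexive (sym (ℝ.*-identityˡ I))) (*-monoˡ-≤ 0≤I 1≤I)))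
          one≤ℓ : 0 ℕ.< n → 1ℝ ≤ ℓ
          one≤ℓ 0<n = ≤-trans (x≤y/z 0<ln2 (≤-trans (≤-reflexive (ℝ.*-identityˡ _)) (ln-mono-≤ 0<2 (≤-trans (fromℕ-mono (s≤s 0<n)) (≤-trans (≤-reflexive (sym (ℝ.*-identityʳ _))) (*-monoʳ-≤ (0≤fromℕ C) 1≤I)))))) (≤-reflexive (sym ℓ≡))
          go : 0 ℕ.< n ⊎ 0 ≡ n → fromℕ (suc (3 ℕ.* D)) * w ≤ I + fromℕ 7 * (w * ℓ)
          go (inj₂ 0≡n) = ≤-trans (≤-reflexive (trans (cong (λ m → fromℕ (suc (3 ℕ.* ⌈log₂ suc m ⌉)) * w) (sym 0≡n)) (trans (cong (_* w) fromℕ-1) (ℝ.*-identityˡ w))))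
            (≤-trans (subst (λ m → √ (fromℕ (suc m) * I) ≤ I) 0≡n w≤I) (≤-cert (0≤* (0≤fromℕ 7) (0≤* (<⇒≤ 0<w) 0≤ℓ)) refl))
          go (inj₁ 0<n) = ≤-cert (0≤+ 0≤I (0≤* (<⇒≤ 0<w) (0≤+ (0≤* (0≤fromℕ 3) (x≤y⇒0≤y-x D≤)) (0≤* (0≤fromℕ 4) (x≤y⇒0≤y-x (one≤ℓ 0<n))))))
            (trans (solve 4 (λ I w l d → I :+ con (pos 7) :* (w :* l) := (:1 :+ :3 :* d) :* w :+ (I :+ w :* (:3 :* (l :+ :1 :- d) :+ :4 :* (l :- :1)))) refl I w ℓ (fromℕ D))
              (cong (λ z → (1ℝ + z) * w + (I + w * (fromℕ 3 * (ℓ + 1ℝ - fromℕ D) + fromℕ 4 * (ℓ - 1ℝ)))) (sym (fromℕ-* 3 D))))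

        cost : ℕ
        cost = (s ℕ.+ (r ℕ.* 4 ℕ.+ 0)) ℕ.+ 2

        cost≤ : fromℕ cost ≤ Δ * (I + w * ℓ)
        cost≤ = begin
          fromℕ cost                                       ≡⟨ split ⟩
          fromℕ κ + fromℕ (13 ℕ.* e ℕ.+ 2) + fromℕ 12 * fromℕ pot ≤⟨ +-mono-≤ (+-mono-≤ κ≤ (≤-trans (≤-reflexive (sym (ℝ.*-identityʳ _))) (*-monoʳ-≤ (0≤fromℕ (13 ℕ.* e ℕ.+ 2)) 1≤I))) (*-monoʳ-≤ (0≤fromℕ 12) pot≤) ⟩
          (fromℕ 2 * (α₂ + fromℕ 2) * E′ + 1ℝ) * I + fromℕ (13 ℕ.* e ℕ.+ 2) * I + fromℕ 12 * (c₂ * (I + fromℕ 7 * (w * ℓ)))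
            ≤⟨ ≤-cert (0≤+ (0≤+ (0≤* (0≤* (0≤fromℕ 72) 0≤c₂) 0≤I) (0≤* 0≤c₁ 0≤wℓ)) (0≤* (<⇒≤ (0<⁻¹ 0<gain)) (0≤+ 0≤I 0≤wℓ)))
                 (solve 6 (λ c a I wl d g → (c :+ a :+ con (pos 84) :* d :+ g) :* (I :+ wl) := c :* I :+ a :* I :+ con (pos 12) :* (d :* (I :+ con (pos 7) :* wl)) :+ (con (pos 72) :* d :* I :+ (c :+ a) :* wl :+ g :* (I :+ wl))) refl
                   (fromℕ 2 * (α₂ + fromℕ 2) * E′ + 1ℝ) (fromℕ (13 ℕ.* e ℕ.+ 2)) I (w * ℓ) c₂ (gain ⁻¹)) ⟩
          Δ * (I + w * ℓ)                                  ∎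
          where
          open ≤-Reasoning
          0≤wℓ = 0≤* (<⇒≤ 0<w) 0≤ℓ
          natural : cost ≡ κ ℕ.+ (13 ℕ.* e ℕ.+ 2) ℕ.+ 12 ℕ.* pot
          natural = solve-∀′ κ e pot
            where
            open import Data.Nat.Solver using (module +-*-Solver)
            solve-∀′ : ∀ κ e pot → ((κ ℕ.+ e) ℕ.+ ((3 ℕ.* (pot ℕ.+ e)) ℕ.* 4 ℕ.+ 0)) ℕ.+ 2 ≡ κ ℕ.+ (13 ℕ.* e ℕ.+ 2) ℕ.+ 12 ℕ.* pot
            solve-∀′ = +-*-Solver.solve 3 (λ κ e p → ((κ S.:+ e) S.:+ ((S.con 3 S.:* (p S.:+ e)) S.:* S.con 4 S.:+ S.con 0)) S.:+ S.con 2 S.:= κ S.:+ (S.con 13 S.:* e S.:+ S.con 2) S.:+ S.con 12 S.:* p) refl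
              where module S = +-*-Solver
          split : fromℕ cost ≡ fromℕ κ + fromℕ (13 ℕ.* e ℕ.+ 2) + fromℕ 12 * fromℕ pot
          split = trans (cong fromℕ natural) (trans (fromℕ-+ (κ ℕ.+ (13 ℕ.* e ℕ.+ 2)) (12 ℕ.* pot)) (cong₂ _+_ (fromℕ-+ κ (13 ℕ.* e ℕ.+ 2)) (fromℕ-* 12 pot)))
          κ≤ : fromℕ κ ≤ (fromℕ 2 * (α₂ + fromℕ 2) * E′ + 1ℝ) * I
          κ≤ = ≤-trans (proj₂ (proj₂ κ-ceiling)) (≤-cert (0≤* (0≤+ (0≤* (0≤fromℕ 4) (<⇒≤ 0<E′)) 0≤1) (x≤y⇒0≤y-x 1≤I))
            (solve 3 (λ a I E → (:2 :* (a :+ :2) :* E :+ :1) :* I := :2 :* (a :* I :+ :2) :* E :+ :1 :+ (:4 :* E :+ :1) :* (I :- :1)) refl α₂ I E′))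
          pot≤ : fromℕ pot ≤ c₂ * (I + fromℕ 7 * (w * ℓ))
          pot≤ = begin
            fromℕ pot                                      ≤⟨ fromℕ-mono (ℕ.≤-trans (ℕ.+-monoʳ-≤ (suc (3 ℕ.* D) ℕ.* B) (ℕ.n≤1+n (3 ℕ.* D))) (ℕ.≤-reflexive (trans (ℕ.+-comm (suc (3 ℕ.* D) ℕ.* B) _) (sym (ℕ.*-suc (suc (3 ℕ.* D)) B))))) ⟩
            fromℕ (suc (3 ℕ.* D) ℕ.* suc B)                ≡⟨ fromℕ-* (suc (3 ℕ.* D)) (suc B) ⟩
            fromℕ (suc (3 ℕ.* D)) * fromℕ (suc B)          ≤⟨ *-monoʳ-≤ (0≤fromℕ (suc (3 ℕ.* D))) B≤ ⟩
            fromℕ (suc (3 ℕ.* D)) * (c₂ * w)               ≡⟨ solve 3 (λ d c w → d :* (c :* w) := c :* (d :* w)) refl (fromℕ (suc (3 ℕ.* D))) c₂ w ⟩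
            c₂ * (fromℕ (suc (3 ℕ.* D)) * w)               ≤⟨ *-monoʳ-≤ 0≤c₂ searching ⟩
            c₂ * (I + fromℕ 7 * (w * ℓ))                   ∎
            where
            B≤ : fromℕ (suc B) ≤ c₂ * w
            B≤ = ≤-cert (0≤+ (x≤y⇒0≤y-x (proj₂ (proj₂ B-ceiling))) (0≤* (<⇒≤ 0<2) (x≤y⇒0≤y-x 1≤w)))
              (solve 4 (λ a w E b → (:3 :* (:1 :+ a) :* E :+ :2) :* w := :1 :+ b :+ (:3 :* (:1 :+ a) :* w :* E :+ :1 :- b :+ :2 :* (w :- :1))) refl α₂ w E′ (fromℕ B))

        module _ {X Y k₀′ k₁ : ℕ} (f : Fin X → Fin Y → Bool) (p : Joint X Y (k₀′ ∷ k₁ ∷ replicate n 2)) (protocol : IsProtocolDistribution p)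
                 (h : M I p f ≤± [ α * I ]) where

          private
            β : ℝ
            β = α₂ * I

            -- M is measured in bits and the entropies in nats; ln 2 being at most 1 absorbs the
            -- change of unit.
            β≤ : β * ln2 ≤ α₂ * I
            β≤ = ≤-trans (*-monoʳ-≤ (0≤* 0≤α₂ 0≤I) ln2≤1) (≤-reflexive (ℝ.*-identityʳ β))

            αI<β : α * I < β
            αI<β = 0<y-x⇒x<y (subst (0ℝ <_) (solve 2 (λ a I → I := (a :+ :1) :* I :- a :* I) refl α I) 0<I)

            cheap : ∃ (Extraction.Cheap p f (IsProtocolDistribution.isDistribution protocol) I β 1≤I)
            cheap = Extraction.exists-cheap p f (IsProtocolDistribution.isDistribution protocol) I β 1≤I h αI<β

            module Er = Errors p f protocol I β 1≤I (proj₂ cheap) 0≤α₂ β≤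

            1≤K : 1ℝ ≤ fromℕ 2 ^ κ
            1≤K = ^-monoʳ 1≤2 (z≤n {κ})

            0≤Q1 : ∀ (g : Er.Node → Vec Bool n → ℝ) → (∀ i m → 0ℝ ≤ g i m) → 0ℝ ≤ Er.∑⁴ (λ i → mass (g i))
            0≤Q1 g h = nonNegative Er.∑⁴-linear λ i → mass-nonNeg (h i)

            naming : Er.∑⁴ (λ i → mass (Er.Q i) * 1[ Er.Surprising (fromℕ 2 ^ κ) i ]) ≤ θ
            naming = error≤θ (0<+ (0<* 0<α₂ 0<I) (<⇒≤ 0<2)) (nonNegative Er.∑⁴-linear λ i → 0≤* (mass-nonNeg (Er.0≤Q i)) (0≤1[] _))
              (≤-trans (ln-≥ κ (≤-trans (≤-reflexive (sym (ℝ.*-assoc _ _ _))) (proj₁ (proj₂ κ-ceiling)))) (≤-reflexive (sym (ln-^ κ 0<2)))) (Er.naming-error 1≤K)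

            ratio : Er.∑⁴ (λ i → mass (λ m → Er.Q i m * 1[ ¬ Er.Ratio t (Er.Q i m) (Er.P i m) ])) ≤ θ
            ratio = error≤θ (0<+ 0<α₂ (<⇒≤ 0<2)) (0≤Q1 (λ i m → Er.Q i m * 1[ ¬ Er.Ratio t (Er.Q i m) (Er.P i m) ]) λ i m → 0≤* (Er.0≤Q i m) (0≤1[] _))
              (ln-≥ t (≤-trans (≤-reflexive (sym (ℝ.*-assoc _ _ _))) (proj₂ (archimedean (fromℕ 2 * (α₂ + fromℕ 2) * E′))))) (Er.window-error t)

            -- k = √(I / C) balances the two terms of `history-error`: k² C is I, and dividing 3 (1
            -- + α₂) I by k leaves 3 (1 + α₂) √(C I) mistakes.
            k : ℝ
            k = w / fromℕ C

            0<k : 0ℝ < k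
            0<k = 0</ 0<w (0<fromℕ-suc n)

            kC : k * fromℕ C ≡ w
            kC = x/y*y (0<⇒≢ (0<fromℕ-suc n))

            kw : k * w ≡ I
            kw = *-cancelˡ-≡ (0<⇒≢ (0<fromℕ-suc n)) (trans (solve 3 (λ C k w → C :* (k :* w) := k :* C :* w) refl (fromℕ C) k w) (trans (cong (_* w) kC) w²))

            k²n≤I : k * k * fromℕ n ≤ I
            k²n≤I = ≤-trans (*-monoʳ-≤ (0≤x² k) (fromℕ-mono (ℕ.n≤1+n n))) (≤-reflexive (trans (ℝ.*-assoc k k _) (trans (cong (k *_) kC) kw)))

            S : ℝ
            S = Er.∑⁴ (λ i → mass (λ m → Er.Q i m * (Er.mis i m / Er.L i m)))

            history : S ≤ θ * fromℕ B
            history = ≤-trans (*-cancelˡ-≤ 0<k (≤-trans (Er.history-error (<⇒≤ 0<k)) (begin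
                fromℕ 3 * (k * k) * fromℕ n + fromℕ 3 * (α₂ * I)   ≤⟨ ≤-cert (0≤* (0≤fromℕ 3) (x≤y⇒0≤y-x k²n≤I)) (solve 4 (λ k n I a → :3 :* (:1 :+ a) :* I := :3 :* (k :* k) :* n :+ :3 :* (a :* I) :+ :3 :* (I :- k :* k :* n)) refl k (fromℕ n) I α₂) ⟩
                fromℕ 3 * (1ℝ + α₂) * I                            ≡⟨ cong (fromℕ 3 * (1ℝ + α₂) *_) (sym kw) ⟩
                fromℕ 3 * (1ℝ + α₂) * (k * w)                      ≡⟨ solve 3 (λ a k w → a :* (k :* w) := k :* (a :* w)) refl (fromℕ 3 * (1ℝ + α₂)) k w ⟩
                k * (fromℕ 3 * (1ℝ + α₂) * w)                      ∎)))
              (*-cancelˡ-≤ 0<E′ (≤-trans (≤-reflexive (ℝ.*-comm E′ _)) (≤-trans (proj₁ (proj₂ B-ceiling)) (≤-reflexive (sym (trans (solve 3 (λ E θ b → E :* (θ :* b) := θ :* E :* b) refl E′ θ (fromℕ B)) (trans (cong (_* fromℕ B) (½^*2^ e)) (ℝ.*-identityˡ _))))))))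
              where open ≤-Reasoning

            module Bound = CompressionBound p f protocol I β 1≤I (proj₂ cheap) 0≤α₂ β≤ e s κ t r

            compressed : ∃ λ (tr : Tree (Fin X) (Fin Y)) → depth tr ℕ.≤ cost × _ ≤ value (Probabilities.p[xy] p) f (run tr)
            compressed = Bound.compressed {B} 0<B hashing rounds naming history ratio

            meanBias = Bound.meanBias {B} 0<B hashing rounds naming history ratio

            bias≥ : ½ ^ k₀ ≤ meanBias
            bias≥ = *-cancelˡ-≤ (^-pos k₀ 0<2) (≤-trans (≤-reflexive (trans (ℝ.*-comm _ _) (½^*2^ k₀))) (Er.mean-bias (^-pos k₀ 0<2)
              (≤-trans (ln-≥ k₀ (proj₂ (archimedean (fromℕ 2 * α₂)))) (≤-reflexive (sym (ln-^ k₀ 0<2))))))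

            gain≤ : gain ≤ θ * rate * (meanBias - fromℕ 6 * θ)
            gain≤ = *-monoʳ-≤ (<⇒≤ (0<* 0<θ 0<rate)) (≤-cert (x≤y⇒0≤y-x (≤-trans 7θ≤ bias≥)) (solve 2 (λ b θ → b :- con (pos 6) :* θ := θ :+ (b :- con (pos 7) :* θ)) refl meanBias θ))

          advantage≥ : ∀ μ → (∀ x y → μ x y ≡ Probabilities.p[xy] p x y) → [ 1ℝ / Δ ] ≤± adv μ (Δ * (I + w * ℓ)) f
          advantage≥ μ μ≡ = let tr , d≤ , v≥ = compressed in
            ≤-sup± {S = λ v → Σ (Protocol X Y) λ π → fromℕ ‖ π ‖ ≤ Δ * (I + w * ℓ) × v ≡ [ advantage π μ f ]}
              (≤-trans 1/Δ≤gain (≤-trans gain≤ (≤-trans v≥ (≤-reflexive (sym (trans (deterministic-advantage tr μ f) (congruent (∑-linear X) λ x → congruent (∑-linear Y) λ y → cong (_* sign (run tr x y xor f x y)) (μ≡ x y))))))))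
              (deterministic tr , ≤-trans (≤-trans (≤-reflexive (cong fromℕ (deterministic-cost tr))) (fromℕ-mono d≤)) cost≤ , refl)

    module Conclusion (α : ℝ) (0<α : 0ℝ < α) where

      open Constants α 0<α

      main : (I : ℝ) → 1ℝ ≤ I → (C : ℕ) → 1 ℕ.≤ C → (X Y : ℕ) (f : Fin X → Fin Y → Bool) →
             (ks : Vec ℕ (suc C)) (p : Joint X Y ks) → IsProtocolDistribution p →
             (μ : Fin X → Fin Y → ℝ) → (∀ x y → μ x y ≡ Probabilities.p[xy] p x y) →
             (∀ i → 2 ℕ.≤ toℕ i → lookup ks i ≡ 2) → M I p f ≤± [ α * I ] →
             [ 1ℝ / Δ ] ≤± adv μ (Δ * (I + √ (fromℕ C * I) * log₂ (fromℕ C * I))) f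
      main I 1≤I (suc n) _ X Y f (k₀′ ∷ k₁ ∷ ks) p protocol μ μ≡ binary h = go ks (all≡2⇒replicate ks λ i → binary (suc (suc i)) (s≤s (s≤s z≤n))) p protocol μ≡ h
        where
        go : ∀ ks → ks ≡ replicate n 2 → (p : Joint X Y (k₀′ ∷ k₁ ∷ ks)) → IsProtocolDistribution p → (∀ x y → μ x y ≡ Probabilities.p[xy] p x y) → M I p f ≤± [ α * I ] →
             [ 1ℝ / Δ ] ≤± adv μ (Δ * (I + √ (fromℕ (suc n) * I) * log₂ (fromℕ (suc n) * I))) f
        go _ refl p protocol μ≡ h = Instance.advantage≥ I 1≤I n f p protocol h μ μ≡

  open Parameters public

theorem7 : (lem : ExcludedMiddle 0ℓ) (R : RealNumbers) → let open Communication lem R in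
  (α : ℝ) → 0ℝ < α →
  Σ ℝ λ Δ → 0ℝ < Δ ×
    ((I : ℝ) → 1ℝ ≤ I →
     (C : ℕ) → 1 ℕ.≤ C →
     (X Y : ℕ) (f : Fin X → Fin Y → Bool) →
     (ks : Vec ℕ (suc C)) (p : Joint X Y ks) → IsProtocolDistribution p →
     (μ : Fin X → Fin Y → ℝ) → (∀ x y → μ x y ≡ Probabilities.p[xy] p x y) →
     (∀ i → 2 ℕ.≤ toℕ i → lookup ks i ≡ 2) →
     M I p f ≤± [ α * I ] →
     [ 1ℝ / Δ ] ≤± adv μ (Δ * (I + √ (fromℕ C * I) * log₂ (fromℕ C * I))) f)
theorem7 lem R α 0<α = Constants.Δ α 0<α , Constants.0<Δ α 0<α , Conclusion.main α 0<α
  where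
  open Compressing lem R
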